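{- Let $R$ be a set. For every $R$-deco polygon $\pi$, the coproduct of $\mathrm B(\pi)$ in the Hopf algebra $\mathrm B(\mathcal P_\bullet(R))$ is $$\Delta\big(\mathrm B(\pi)\big)=\sum_{D\ \mathrm{admissible}}\mathrm{sgn}(D)\ \mathrm B(R^D)\otimes \prod_i{}^{\!\text{sh}}\ \mathrm B\big(P_i^D\big),$$ where $D$ runs through all admissible dissections of $\pi$ and $\prod^{\text{sh}}$ denotes the shuffle product; the sum includes the two particular terms $\mathrm B(\pi)\otimes1$ (corresponding to $R^D=\pi$) and $1\otimes\mathrm B(\pi)$ (corresponding to $R^D=\emptyset$). Thus the subalgebra generated by the elements $\mathrm B(\pi)$, $\pi$ an $R$-deco polygon, is a Hopf subalgebra of $\mathrm B(\mathcal P_\bullet(R))$.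
   Context: **Polygons.** An $R$-deco polygon is an oriented convex polygon with $N\ge2$ sides decorated by elements of $R$, with a distinguished root side. The orientation gives a linear order of sides with root side last; write $[a_1,\dots,a_{n+1}]$ ($a_{n+1}$ on the root). Weight $\chi=n$ = number of non-root sides. $v_0$ is the vertex between root and first side (first vertex), $v_k$ the vertex between the $k$-th and $(k+1)$-st side. $\mathcal P=\mathcal P_\bullet(R)$ is the exterior $\mathbb Q$-algebra (with unit) on the vector space with basis the $R$-deco polygons. An arrow goes from a vertex $v_k$ to the interior of a side $a_l$ (arrows with same vertex and side are identified); it is trivial if $v_k$ is an endpoint of the side, forward if $l>k$, backward otherwise. For a non-trivial forward arrow $\alpha:v_k\to a_l$ put $\pi_\alpha^{rt}=[a_1,\dots,a_k,a_l,\dots,a_{n+1}]$, $\pi_\alpha^{co}=[a_{k+1},\dots,a_{l-1},a_l]$, $\mathrm{sgn}(\alpha)=1$; for a non-trivial backward arrow ($l<k$) put $\pi_\alpha^{rt}=[a_1,\dots,a_l,a_{k+1},\dots,a_{n+1}]$, $\pi_\alpha^{co}=[a_k,\dots,a_{l+1},a_l]$, $\mathrm{sgn}(\alpha)=(-1)^{k-l}$. Then $\partial\pi=\sum_\alpha\mathrm{sgn}(\alpha)\pi_\alpha^{rt}\wedge\pi_\alpha^{co}$ over non-trivial arrows, extended as a derivation with sign given by exterior degree. **Dissections.** Two arrows do not intersect if (for suitable endpoints on the sides) they have no point in common except possibly the starting point. An $n$-fold dissection $D$ of $\pi$ is the set of $n$ regions cut out by $n-1$ distinct, pairwise non-intersecting,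 non-trivial arrows. The root region is the one containing the first vertex and part of the root side. The dual tree $\tau(D)$ has the regions as vertices, the arrows as edges, and the root region as root; it defines a partial order on the regions (a region precedes those further from the root along the tree). Each region gives an $R$-deco polygon by contracting all arrows in its boundary: for the root region, root side and orientation are those of $\pi$; for any other region, let $\alpha$ be the unique boundary arrow closest to the root; the root side is the one where $\alpha$ ends, and the orientation is that of $\pi$ if $\alpha$ is forward, the opposite one if $\alpha$ is backward. Denote this polygon $\pi^{co}_{D,\alpha}$. $\mathrm{sgn}(D)=\prod_{\alpha\text{ backward arrow of }D}(-1)^{\chi(\pi^{co}_{D,\alpha})}$. $D$ is admissible if every simple path in $\tau(D)$ from the root to a leaf vertex contains at most one of the edges dual to the arrows of $D$ (i.e. every non-root region is adjacent to the root region); $R^D$ denotes then the polygon of the root region and $P_i^D$ the polygons of the remaining regions. The dissection without arrows has $R^D=\pi$ and contributes $\mathrm B(\pi)\otimes 1$; in addition the case $R^D=\emptyset$ with the single remaining polygon $\pi$, sign $+1$ and $\mathrm B(\emptyset)=1$, is counted as admissible. **The element $\mathrm B(\pi)$.** $\mathrm B(\pi)=\sum_{n\ge1}\sum_D\mathrm{sgn}(D)\sum_\lambda[\pi_D^{\lambda(1)}|\cdots|\pi_D^{\lambda(n)}]$, over all $n$-fold dissections $D$ of $\pi$ and all linear orders $\lambda$ of the associated polygons $\pi_D^i$ compatible with the partial order of $\tau(D)$. **Bar construction.** $\mathrm B(\mathcal P)$ is the tensor coalgebra on the augmentation ideal of $\mathcal P$, with words written $[x_1|\cdots|x_N]$,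 with deconcatenation coproduct $\Delta[x_1|\cdots|x_N]=\sum_{j=0}^N[x_1|\cdots|x_j]\otimes[x_{j+1}|\cdots|x_N]$ and (graded) shuffle product, letters $x_i$ having shifted degree (exterior degree minus one), so that no signs occur for words whose letters are polygons. It carries the usual bar differential built from $\partial$ and $\wedge$. -}

module Defs where

open import Level using (Level) renaming (suc to lsuc)
open import Data.Nat using (ℕ; zero; suc; pred; _+_; _*_; _∸_; _⊓_; _⊔_; _≤_; _<_; z≤n; s≤s; s≤s⁻¹; _≤?_; _<?_; _≟_)
open import Data.Nat.Properties
open import Data.Fin using (Fin; zero; suc; toℕ; fromℕ; fromℕ<)
open import Data.Fin.Properties using (toℕ<n; toℕ-fromℕ; toℕ-fromℕ<)
open import Data.Rational using (ℚ; 0ℚ; 1ℚ) renaming (_+_ to _+ℚ_; _*_ to _*ℚ_; -_ to -ℚ_)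
open import Data.List using (List; []; _∷_; [_]; _++_; _∷ʳ_; map; concatMap; cartesianProduct; mapMaybe; filter; foldr; length; lookup; reverse; allFin; upTo; splitAt)
open import Data.Nat.ListAction using (sum)
open import Data.List.Properties using (length-map; length-reverse)
open import Data.List.NonEmpty using (List⁺; _∷_; _++⁺_)
open import Data.List.Membership.Propositional using (_∈_; find)
open import Data.List.Membership.Propositional.Properties using (∈-filter⁺; ∈-allFin)
open import Data.List.Relation.Unary.All as All using (All; []; _∷_; all?)
open import Data.List.Relation.Unary.Any as Any using (Any; here; there; any?)
open import Data.List.Relation.Unary.AllPairs using (AllPairs; []; _∷_; allPairs?)
open import Data.Maybe using (Maybe; just; nothing)
open import Data.Product using (∃; _×_; _,_; proj₁; proj₂)
open import Data.Sum using (_⊎_; inj₁; inj₂)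
open import Data.Empty using (⊥-elim)
open import Data.Empty.Irrelevant renaming (⊥-elim to ⊥-elim-irr)
open import Relation.Nullary using (¬_; Dec; yes; no; recompute)
open import Relation.Nullary.Decidable using (_×-dec_; _⊎-dec_; ¬?)
open import Relation.Binary.Definitions using (tri<; tri≈; tri>)
open import Relation.Binary.PropositionalEquality using (_≡_; _≢_; refl; sym; trans; cong; subst)

private
  variable
    a b : Level
    A : Set a
    B : Set b

------------------------------------------------------------------------
-- ℚ-vector spaces by generators and relations

-- The list (q₁ , g₁) ∷ … ∷ (qₖ , gₖ) ∷ [] stands for q₁g₁ + … + qₖgₖ.
Lin : Set a → Set a
Lin G = List (ℚ × G)

⟦_⟧ : A → Lin A
⟦ g ⟧ = [ 1ℚ , g ]

infixl 6 _⊕_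
_⊕_ : Lin A → Lin A → Lin A
_⊕_ = _++_

infixr 7 _•_
_•_ : ℚ → Lin A → Lin A
c • x = map (λ (q , g) → c *ℚ q , g) x

∑ : List A → (A → Lin B) → Lin B
∑ is f = concatMap f is

infix 5 ∑
syntax ∑ is (λ i → x) = ∑[ i ∈ is ] x

linear : (A → Lin B) → Lin A → Lin B
linear f x = ∑[ t ∈ x ] (proj₁ t • f (proj₂ t))

bilinear : {C : Set a} → (A → B → Lin C) → Lin A → Lin B → Lin C
bilinear f x y = linear (λ g → linear (f g) y) x

mapGen : (A → B) → Lin A → Lin B
mapGen f = linear (λ g → ⟦ f g ⟧)

-- The quotient of the free vector space on Gen by the span of the relators.
record Space (a : Level) : Set (lsuc a) where
  field
    Gen     : Set a
    Relator : Lin Gen → Set a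

open Space public

infix 4 Eq
data Eq (V : Space a) : Lin (Gen V) → Lin (Gen V) → Set a where
  ≈-refl    : ∀ {x} → Eq V x x
  ≈-sym     : ∀ {x y} → Eq V x y → Eq V y x
  ≈-trans   : ∀ {x y z} → Eq V x y → Eq V y z → Eq V x z
  ⊕-cong    : ∀ {x x′ y y′} → Eq V x x′ → Eq V y y′ → Eq V (x ⊕ y) (x′ ⊕ y′)
  ⊕-comm    : ∀ x y → Eq V (x ⊕ y) (y ⊕ x)
  collect   : ∀ p q g → Eq V ((p , g) ∷ (q , g) ∷ []) [ p +ℚ q , g ]
  zero-coef : ∀ g → Eq V [ 0ℚ , g ] []
  relator   : ∀ {r} c → Relator V r → Eq V (c • r) []

syntax Eq V x y = x ≈[ V ] y

data TensorRelator (V W : Space a) : Lin (Gen V × Gen W) → Set a where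
  relatorˡ : ∀ {r} → Relator V r → ∀ w → TensorRelator V W (mapGen (_, w) r)
  relatorʳ : ∀ {r} v → Relator W r → TensorRelator V W (mapGen (v ,_) r)

infixr 6 _⊗ˢ_
_⊗ˢ_ : Space a → Space a → Space a
V ⊗ˢ W = record { Gen = Gen V × Gen W ; Relator = TensorRelator V W }

infixr 6 _⊗_
_⊗_ : {A B : Set a} → Lin A → Lin B → Lin (A × B)
_⊗_ = bilinear (λ v w → ⟦ v , w ⟧)

-- The tensor space ⊕_N V^{⊗N}; the generator g₁ ∷ … ∷ g_N ∷ [] is
-- g₁ ⊗ … ⊗ g_N.
data WordRelator (V : Space a) : Lin (List (Gen V)) → Set a where
  in-letter : ∀ {r} u → Relator V r → ∀ w →
              WordRelator V (mapGen (λ g → u ++ g ∷ w) r)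

Words : Space a → Space a
Words V = record { Gen = List (Gen V) ; Relator = WordRelator V }

-- The augmentation ideal of the exterior algebra on the vector space with
-- basis X; the generator x₀ ∷ x₁ ∷ … ∷ xₖ is x₀ ∧ x₁ ∧ … ∧ xₖ.
data WedgeRelator (X : Set a) : Lin (List⁺ X) → Set a where
  square : ∀ u x v → WedgeRelator X ⟦ u ++⁺ (x ∷ x ∷ v) ⟧
  swap   : ∀ u x y v →
           WedgeRelator X (⟦ u ++⁺ (x ∷ y ∷ v) ⟧ ⊕ ⟦ u ++⁺ (y ∷ x ∷ v) ⟧)

Λ⁺ : Set a → Space a
Λ⁺ X = record { Gen = List⁺ X ; Relator = WedgeRelator X }

------------------------------------------------------------------------
-- The bar construction of the exterior algebra on a set X, as a Hopf algebra

[-1]^_ : ℕ → ℚ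
[-1]^ zero  = 1ℚ
[-1]^ suc k = -ℚ ([-1]^ k)

module _ {X : Set a} where

  Letter : Set a
  Letter = List⁺ X

  Word : Set a
  Word = List Letter

  -- Exterior degree minus one.
  degree : Letter → ℕ
  degree (_ ∷ xs) = length xs

  wordDegree : Word → ℕ
  wordDegree w = sum (map degree w)

  prefix : Letter → Lin Word → Lin Word
  prefix x = mapGen (x ∷_)

  -- The Koszul sign is that of moving y past x ∷ u.
  shuffle : Word → Word → Lin Word
  shuffle []      w       = ⟦ w ⟧
  shuffle (x ∷ u) []      = ⟦ x ∷ u ⟧
  shuffle (x ∷ u) (y ∷ w) =
    prefix x (shuffle u (y ∷ w))
    ⊕ [-1]^ (degree y * wordDegree (x ∷ u)) • prefix y (shuffle (x ∷ u) w)

  infixl 7 _ш_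
  _ш_ : Lin Word → Lin Word → Lin Word
  _ш_ = bilinear shuffle

  𝟏 : Lin Word
  𝟏 = ⟦ [] ⟧

  ∏ш : List (Lin Word) → Lin Word
  ∏ш = foldr _ш_ 𝟏

  Δ : Lin Word → Lin (Word × Word)
  Δ = linear (λ w → ∑[ j ∈ upTo (suc (length w)) ] ⟦ splitAt j w ⟧)

  -- S[x₁|…|x_N] = (-1)^N ε [x_N|…|x₁], where ε is the Koszul sign of the
  -- reversal: the convolution inverse of the identity for Δ and _ш_.
  antipodeWord : Word → Lin Word
  antipodeWord []      = 𝟏
  antipodeWord (x ∷ u) =
    -ℚ ([-1]^ (degree x * wordDegree u)) • mapGen (_∷ʳ x) (antipodeWord u)

  antipode : Lin Word → Lin Word
  antipode = linear antipodeWord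

Bar : Set a → Space a
Bar X = Words (Λ⁺ X)

module _ {X : Set a} where

  -- The subalgebra generated by the elements satisfying P.
  data Generated (P : Lin (Word {X = X}) → Set a) : Lin (Word {X = X}) → Set a where
    generator : ∀ {x} → P x → Generated P x
    one       : Generated P 𝟏
    plus      : ∀ {x y} → Generated P x → Generated P y → Generated P (x ⊕ y)
    scale     : ∀ {x} c → Generated P x → Generated P (c • x)
    times     : ∀ {x y} → Generated P x → Generated P y → Generated P (x ш y)
    resp      : ∀ {x y} → x ≈[ Bar X ] y → Generated P x → Generated P y

  -- The image of H ⊗ H in the tensor square, for H a subspace.
  data TensorSquare (H : Lin (Word {X = X}) → Set a) :
                    Lin (Word {X = X} × Word {X = X}) → Set a where
    pure : ∀ {x y} → H x → H y → TensorSquare H (x ⊗ y)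
    zero : TensorSquare H []
    plus : ∀ {x y} → TensorSquare H x → TensorSquare H y → TensorSquare H (x ⊕ y)
    resp : ∀ {x y} → x ≈[ Bar X ⊗ˢ Bar X ] y → TensorSquare H x → TensorSquare H y

  record IsHopfSubalgebra (H : Lin (Word {X = X}) → Set a) : Set a where
    field
      ≈-closed        : ∀ {x y} → x ≈[ Bar X ] y → H x → H y
      ⊕-closed        : ∀ {x y} → H x → H y → H (x ⊕ y)
      •-closed        : ∀ {x} c → H x → H (c • x)
      𝟏-closed        : H 𝟏
      ш-closed        : ∀ {x y} → H x → H y → H (x ш y)
      Δ-closed        : ∀ {x} → H x → TensorSquare H (Δ x)
      antipode-closed : ∀ {x} → H x → H (antipode x)

------------------------------------------------------------------------
-- Arrows and dissections of a polygon with N sides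

-- Vertices v₀, …, v_{N-1} and sides are numbered from 0 in the order given by
-- the orientation: side j joins v_j to v_{j+1} (indices mod N), it is the side
-- decorated by a_{j+1}, and the root is side N-1.
record Arrow (N : ℕ) : Set

Trivial : ∀ {N} → Fin N → Fin N → Set
Trivial {N} v s =
  toℕ v ≡ toℕ s ⊎ toℕ v ≡ suc (toℕ s) ⊎ (suc (toℕ s) ≡ N × toℕ v ≡ 0)

record Arrow N where
  constructor arrow
  field
    vertex      : Fin N
    side        : Fin N
    .nontrivial : ¬ Trivial vertex side

open Arrow public

nontrivial-elim : ∀ {N} (α : Arrow N) → ¬ Trivial (vertex α) (side α)
nontrivial-elim (arrow _ _ nt) t = ⊥-elim-irr (nt t)

trivial? : ∀ {N} (v s : Fin N) → Dec (Trivial v s)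
trivial? {N} v s =
  (toℕ v ≟ toℕ s) ⊎-dec ((toℕ v ≟ suc (toℕ s)) ⊎-dec ((suc (toℕ s) ≟ N) ×-dec (toℕ v ≟ 0)))

allArrows : ∀ N → List (Arrow N)
allArrows N = mapMaybe (λ (v , s) → nontrivialArrow v s (trivial? v s))
                       (cartesianProduct (allFin N) (allFin N))
  where
  nontrivialArrow : (v s : Fin N) → Dec (Trivial v s) → Maybe (Arrow N)
  nontrivialArrow v s (yes _) = nothing
  nontrivialArrow v s (no ¬t) = just (arrow v s ¬t)

-- An arrow from v_k to a_l is forward if l > k and backward if l < k; l = k is
-- excluded by nontriviality, and l = side + 1.
Backward : ∀ {N} → Arrow N → Set
Backward α = suc (toℕ (side α)) < toℕ (vertex α)

backward? : ∀ {N} (α : Arrow N) → Dec (Backward α)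
backward? α = suc (toℕ (side α)) <? toℕ (vertex α)

-- Walking once around the boundary from v₀, one meets v_k at position 2k and
-- the interior of side j at position 2j+1.
vertexPos sidePos : ∀ {N} → Fin N → ℕ
vertexPos v = 2 * toℕ v
sidePos   s = suc (2 * toℕ s)

-- Each arrow cuts off, on the side away from the root region, the piece of the
-- boundary between its two ends.  So the regions of a dissection are the root
-- region, nothing, and for each arrow α the region just beyond α, just α; in
-- the latter case α is the boundary arrow closest to the root.  The root region
-- gets the whole boundary, from v₀ back to v₀.
Region : ℕ → Set
Region N = Maybe (Arrow N)

lo hi : ∀ {N} → Region N → ℕ
lo nothing      = 0
lo (just α)     = vertexPos (vertex α) ⊓ sidePos (side α)
hi {N} nothing  = 2 * N
hi (just α)     = vertexPos (vertex α) ⊔ sidePos (side α)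

-- Chords of a convex polygon meet in their interiors iff their ends
-- interleave.  Two arrows ending on the same side can be pulled apart there, and
-- a common starting point is allowed, so the inequalities are strict.
Interleaved : ∀ {N} → Arrow N → Arrow N → Set
Interleaved α β =
  lo (just α) < lo (just β) × lo (just β) < hi (just α) × hi (just α) < hi (just β)

NonIntersecting : ∀ {N} → Arrow N → Arrow N → Set
NonIntersecting α β = ¬ Interleaved α β × ¬ Interleaved β α

nonIntersecting? : ∀ {N} (α β : Arrow N) → Dec (NonIntersecting α β)
nonIntersecting? α β = ¬? (interleaved? α β) ×-dec ¬? (interleaved? β α)
  where
  interleaved? : ∀ α β → Dec (Interleaved α β)
  interleaved? α β =
    (lo (just α) <? lo (just β)) ×-dec (lo (just β) <? hi (just α)) ×-dec (hi (just α) <? hi (just β))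

record Dissection (N : ℕ) : Set where
  constructor dissection
  field
    arrows           : List (Arrow N)
    .nonIntersecting : AllPairs NonIntersecting arrows

open Dissection public

sublists : List A → List (List A)
sublists []       = [ [] ]
sublists (x ∷ xs) = sublists xs ++ map (x ∷_) (sublists xs)

-- Every set of pairwise non-intersecting nontrivial arrows occurs exactly once.
dissections : ∀ N → List (Dissection N)
dissections N = mapMaybe (λ as → toDissection as (allPairs? nonIntersecting? as))
                         (sublists (allArrows N))
  where
  toDissection : (as : List (Arrow N)) → Dec (AllPairs NonIntersecting as) → Maybe (Dissection N)
  toDissection as (yes p) = just (dissection as p)
  toDissection as (no _)  = nothing

regions : ∀ {N} → Dissection N → List (Region N)
regions D = nothing ∷ map just (arrows D)

-- The partial order of the dual tree: r ≺ s iff the path from the root region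
-- to s passes through r ≠ s, i.e. iff s lies in the part of the polygon cut off by
-- the arrow of r.
infix 4 _≺_
_≺_ : ∀ {N} → Region N → Region N → Set
r ≺ s = (lo r ≤ lo s × hi s ≤ hi r) × ¬ (lo r ≡ lo s × hi s ≡ hi r)

_≺?_ : ∀ {N} (r s : Region N) → Dec (r ≺ s)
r ≺? s = ((lo r ≤? lo s) ×-dec (hi s ≤? hi r)) ×-dec ¬? ((lo r ≟ lo s) ×-dec (hi s ≟ hi r))

-- s is a child of r in the dual tree.
Child : ∀ {N} → Dissection N → Region N → Region N → Set
Child D r s = r ≺ s × ¬ Any (λ t → r ≺ t × t ≺ s) (regions D)

child? : ∀ {N} (D : Dissection N) (r s : Region N) → Dec (Child D r s)
child? D r s = (r ≺? s) ×-dec ¬? (any? (λ t → (r ≺? t) ×-dec (t ≺? s)) (regions D))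

Admissible : ∀ {N} → Dissection N → Set
Admissible D = All (λ α → Child D nothing (just α)) (arrows D)

admissible? : ∀ {N} (D : Dissection N) → Dec (Admissible D)
admissible? D = all? (λ α → child? D nothing (just α)) (arrows D)

insertions : A → List A → List (List A)
insertions x []       = [ [ x ] ]
insertions x (y ∷ ys) = (x ∷ y ∷ ys) ∷ map (y ∷_) (insertions x ys)

permutations : List A → List (List A)
permutations []       = [ [] ]
permutations (x ∷ xs) = concatMap (insertions x) (permutations xs)

linearOrders : ∀ {N} → Dissection N → List (List (Region N))
linearOrders D = filter (allPairs? (λ r s → ¬? (s ≺? r))) (permutations (regions D))

-- Part of side j lies on the piece of the boundary belonging to r, resp. all of
-- side j does.
Touches Covers : ∀ {N} → Region N → Fin N → Set
Touches r j = lo r ≤ sidePos j × sidePos j ≤ hi r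
Covers  r j = lo r < sidePos j × sidePos j < hi r

covers? : ∀ {N} (r : Region N) (j : Fin N) → Dec (Covers r j)
covers? r j = (lo r <? sidePos j) ×-dec (sidePos j <? hi r)

-- A side at which an arrow ends is divided among the regions meeting there, so
-- it bounds r unless a region beyond r takes the whole of it.
Hides : ∀ {N} → Region N → Fin N → Arrow N → Set
Hides r j β = r ≺ just β × Covers (just β) j

hides? : ∀ {N} (r : Region N) (j : Fin N) (β : Arrow N) → Dec (Hides r j β)
hides? r j β = (r ≺? just β) ×-dec covers? (just β) j

Bounds : ∀ {N} → List (Arrow N) → Region N → Fin N → Set
Bounds as r j = Touches r j × ¬ Any (Hides r j) as

bounds? : ∀ {N} (as : List (Arrow N)) (r : Region N) (j : Fin N) → Dec (Bounds as r j)
bounds? as r j =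
  ((lo r ≤? sidePos j) ×-dec (sidePos j ≤? hi r)) ×-dec ¬? (any? (hides? r j) as)

boundarySides : ∀ {N} → List (Arrow N) → Region N → List (Fin N)
boundarySides {N} as r = filter (bounds? as r) (allFin N)

-- The sides of r in the orientation of its polygon.  This puts the root side
-- last: a forward arrow ends at the last side it cuts off, a backward arrow at
-- the first one.
orient : ∀ {N} → Region N → List (Fin N) → List (Fin N)
orient nothing  js = js
orient (just α) js with backward? α
... | yes _ = reverse js
... | no  _ = js

regionSides : ∀ {N} → Dissection N → Region N → List (Fin N)
regionSides D r = orient r (boundarySides (arrows D) r)

------------------------------------------------------------------------
-- Every region has at least two sides

module TwoSides {N : ℕ} (as : List (Arrow N)) (nonInt : AllPairs NonIntersecting as) where

  pairwise : ∀ {bs : List (Arrow N)} → AllPairs NonIntersecting bs →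
             ∀ {β γ} → β ∈ bs → γ ∈ bs → β ≡ γ ⊎ NonIntersecting β γ
  pairwise (_ ∷ _)  (here refl) (here refl) = inj₁ refl
  pairwise (p ∷ _)  (here refl) (there j)   = inj₂ (All.lookup p j)
  pairwise (p ∷ _)  (there i)   (here refl) = inj₂ (proj₂ q , proj₁ q)
    where q = All.lookup p i
  pairwise (_ ∷ ps) (there i)   (there j)   = pairwise ps i j

  lo≤side : (β : Arrow N) → lo (just β) ≤ sidePos (side β)
  lo≤side β = m⊓n≤n (vertexPos (vertex β)) (sidePos (side β))

  side≤hi : (β : Arrow N) → sidePos (side β) ≤ hi (just β)
  side≤hi β = m≤n⊔m (vertexPos (vertex β)) (sidePos (side β))

  endAtSide : (β : Arrow N) → lo (just β) ≡ sidePos (side β) ⊎ hi (just β) ≡ sidePos (side β)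
  endAtSide β with ≤-total (vertexPos (vertex β)) (sidePos (side β))
  ... | inj₁ v≤s = inj₂ (m≤n⇒m⊔n≡n v≤s)
  ... | inj₂ s≤v = inj₁ (m≥n⇒m⊓n≡n s≤v)

  hi≤2N : (β : Arrow N) → hi (just β) ≤ 2 * N
  hi≤2N β = ⊔-lub (*-monoʳ-≤ 2 (<⇒≤ (toℕ<n (vertex β))))
                  (≤-trans (n≤1+n _) (≤-trans (≤-reflexive (sym (*-suc 2 (toℕ (side β)))))
                                              (*-monoʳ-≤ 2 (toℕ<n (side β)))))

  Contains : Arrow N → Arrow N → Set
  Contains γ β = (lo (just γ) ≤ lo (just β) × hi (just β) ≤ hi (just γ)) ×
                 (lo (just γ) < lo (just β) ⊎ hi (just β) < hi (just γ))

  containsEnd : ∀ {β γ} → β ∈ as → γ ∈ as → Covers (just γ) (side β) → Contains γ β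
  containsEnd {β} {γ} β∈ γ∈ (l , h) with pairwise nonInt β∈ γ∈ | endAtSide β
  ... | inj₁ refl | inj₁ e = ⊥-elim (<-irrefl e l)
  ... | inj₁ refl | inj₂ e = ⊥-elim (<-irrefl (sym e) h)
  ... | inj₂ (¬βγ , ¬γβ) | inj₁ e = (<⇒≤ l′ , ≮⇒≥ (λ h′ → ¬γβ (l′ , subst (_< _) (sym e) h , h′))) , inj₁ l′
    where l′ = subst (_ <_) (sym e) l
  ... | inj₂ (¬βγ , ¬γβ) | inj₂ e = (≮⇒≥ (λ l′ → ¬βγ (l′ , subst (_ <_) (sym e) l , h′)) , <⇒≤ h′) , inj₂ h′
    where h′ = subst (_< _) (sym e) h

  slack : Arrow N → ℕ
  slack β = lo (just β) + (2 * N ∸ hi (just β))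

  slack-decreases : ∀ β γ → Contains γ β → slack γ < slack β
  slack-decreases β γ ((l , h) , inj₁ l<) = +-mono-<-≤ l< (∸-monoʳ-≤ (2 * N) h)
  slack-decreases β γ ((l , h) , inj₂ h<) = +-mono-≤-< l (∸-monoʳ-< h< (hi≤2N γ))

  module _ (r : Region N) (e₀ j₀ : Fin N) (e₀-bounds : Bounds as r e₀)
           (j₀≢e₀ : j₀ ≢ e₀) (j₀-touches : Touches r j₀)
           (avoids : ∀ β → r ≺ just β → Covers (just β) j₀ → side β ≢ e₀) where

    search : ∀ k β → slack β < k → β ∈ as → Hides r j₀ β → ∃ λ j → Bounds as r j × j ≢ e₀
    search (suc k) β s<k β∈ (((rl , rh) , r≢) , cov) with any? (hides? r (side β)) as
    ... | no ¬p = side β ,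
                  ((≤-trans rl (lo≤side β) , ≤-trans (side≤hi β) rh) , ¬p) ,
                  avoids β ((rl , rh) , r≢) cov
    ... | yes p with find p
    ...   | γ , γ∈ , r≺γ , covγ = search k γ (<-≤-trans (slack-decreases β γ c) (s≤s⁻¹ s<k)) γ∈
                                    (r≺γ , ≤-<-trans (proj₁ (proj₁ c)) (proj₁ cov)
                                         , <-≤-trans (proj₂ cov) (proj₂ (proj₁ c)))
      where c = containsEnd {β} {γ} β∈ γ∈ covγ

    another : ∃ λ j → Bounds as r j × j ≢ e₀
    another with any? (hides? r j₀) as
    ... | no ¬p = j₀ , (j₀-touches , ¬p) , j₀≢e₀
    ... | yes p with find p
    ...   | β , β∈ , h = search (suc (slack β)) β ≤-refl β∈ h

    two : 2 ≤ length (boundarySides as r)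
    two with another
    ... | j , bj , j≢ = distinct (∈-filter⁺ (bounds? as r) (∈-allFin j) bj)
                                 (∈-filter⁺ (bounds? as r) (∈-allFin e₀) e₀-bounds) j≢
      where
      distinct : ∀ {xs : List (Fin N)} {i i′} → i ∈ xs → i′ ∈ xs → i ≢ i′ → 2 ≤ length xs
      distinct (here refl) (here refl) ne = ⊥-elim (ne refl)
      distinct {_ ∷ _ ∷ _} (here _)  (there _) _ = s≤s (s≤s z≤n)
      distinct {_ ∷ _ ∷ _} (there _) _         _ = s≤s (s≤s z≤n)

2v<side : ∀ v s → v < s → 2 * v < suc (2 * s)
2v<side v s v<s = s≤s (*-monoʳ-≤ 2 (<⇒≤ v<s))

side<2v : ∀ s v → suc s ≤ v → suc (2 * s) < 2 * v
side<2v s v h = ≤-trans (≤-reflexive (sym (*-suc 2 s))) (*-monoʳ-≤ 2 h)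

root≥2 : ∀ {n} (as : List (Arrow (suc (suc n)))) → AllPairs NonIntersecting as →
         2 ≤ length (boundarySides as nothing)
root≥2 {n} as nonInt = TwoSides.two as nonInt nothing last zero last-bounds (λ ())
                                    (z≤n , s≤s z≤n) avoids
  where
  last : Fin (suc (suc n))
  last = fromℕ (suc n)

  last-pos : sidePos last ≡ suc (2 * suc n)
  last-pos = cong (λ k → suc (2 * k)) (toℕ-fromℕ (suc n))

  hi≤last : (β : Arrow (suc (suc n))) → hi (just β) ≤ suc (2 * suc n)
  hi≤last β = ⊔-lub (≤-trans (*-monoʳ-≤ 2 (s≤s⁻¹ (toℕ<n (vertex β)))) (n≤1+n _))
                    (s≤s (*-monoʳ-≤ 2 (s≤s⁻¹ (toℕ<n (side β)))))

  last-bounds : Bounds as nothing last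
  last-bounds = (z≤n , ≤-trans (≤-reflexive last-pos) (<⇒≤ (side<2v (suc n) (suc (suc n)) ≤-refl)))
              , λ any → let (β , _ , _ , _ , h) = find any in
                        <⇒≱ (≤-<-trans (≤-reflexive (sym last-pos)) h) (hi≤last β)

  avoids : ∀ β → nothing ≺ just β → Covers (just β) zero → side β ≢ last
  avoids (arrow zero s nt) _ _ e =
    ⊥-elim-irr (nt (inj₂ (inj₂ (cong suc (trans (cong toℕ e) (toℕ-fromℕ (suc n))) , refl))))
  avoids (arrow (suc v) s nt) _ (l , _) e = <⇒≱ l (⊓-glb (s≤s z≤n) (s≤s z≤n))

module _ {N : ℕ} (as : List (Arrow N)) (nonInt : AllPairs NonIntersecting as) (α : Arrow N) where

  private
    v s : ℕ
    v = toℕ (vertex α)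
    s = toℕ (side α)

  forward≥2 : v < s → 2 ≤ length (boundarySides as (just α))
  forward≥2 v<s = TwoSides.two as nonInt (just α) (side α) (vertex α)
    ( (TwoSides.lo≤side as nonInt α , TwoSides.side≤hi as nonInt α)
    , λ any → let (β , _ , ((_ , h) , _) , _ , c) = find any in
              <⇒≱ c (≤-trans h (≤-reflexive hi-eq)))
    (λ e → <-irrefl (cong toℕ e) v<s)
    (≤-trans (≤-reflexive lo-eq) (n≤1+n _) , ≤-trans (s≤s (*-monoʳ-≤ 2 (<⇒≤ v<s))) (≤-reflexive (sym hi-eq)))
    avoids
    where
    lo-eq : lo (just α) ≡ 2 * v
    lo-eq = m≤n⇒m⊓n≡m (<⇒≤ (2v<side v s v<s))
    hi-eq : hi (just α) ≡ suc (2 * s)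
    hi-eq = m≤n⇒m⊔n≡n (<⇒≤ (2v<side v s v<s))
    avoids : ∀ β → just α ≺ just β → Covers (just β) (vertex α) → side β ≢ side α
    avoids β ((l , h) , ne) (c , _) refl = ne (trans lo-eq (sym loβ) , trans hiβ (sym hi-eq))
      where
      loβ : lo (just β) ≡ 2 * v
      loβ = ≤-antisym (s≤s⁻¹ c) (≤-trans (≤-reflexive (sym lo-eq)) l)
      hiβ : hi (just β) ≡ suc (2 * s)
      hiβ = ≤-antisym (≤-trans h (≤-reflexive hi-eq)) (TwoSides.side≤hi as nonInt β)

  backward≥2 : ∀ m → v ≡ suc m → s < m → 2 ≤ length (boundarySides as (just α))
  backward≥2 m v≡ s<m = TwoSides.two as nonInt (just α) (side α) before
    ( (TwoSides.lo≤side as nonInt α , TwoSides.side≤hi as nonInt α)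
    , λ any → let (β , _ , ((l , _) , _) , c , _) = find any in
              <⇒≱ c (≤-trans (≤-reflexive (sym lo-eq)) l))
    (λ e → <-irrefl (trans (sym (cong toℕ e)) toℕ-before) s<m)
    ( ≤-trans (≤-reflexive lo-eq) (≤-trans (s≤s (*-monoʳ-≤ 2 (<⇒≤ s<m))) (≤-reflexive (sym before-pos)))
    , ≤-trans (≤-trans (≤-reflexive before-pos) (<⇒≤ (side<2v m v (≤-reflexive (sym v≡))))) (≤-reflexive (sym hi-eq)))
    avoids
    where
    before : Fin N
    before = fromℕ< {m} (<-trans ≤-refl (subst (_< N) v≡ (toℕ<n (vertex α))))
    toℕ-before : toℕ before ≡ m
    toℕ-before = toℕ-fromℕ< _
    before-pos : sidePos before ≡ suc (2 * m)
    before-pos = cong (λ k → suc (2 * k)) toℕ-before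
    s<2v : suc (2 * s) < 2 * v
    s<2v = side<2v s v (≤-trans (<⇒≤ (s≤s s<m)) (≤-reflexive (sym v≡)))
    lo-eq : lo (just α) ≡ suc (2 * s)
    lo-eq = m≥n⇒m⊓n≡n (<⇒≤ s<2v)
    hi-eq : hi (just α) ≡ 2 * v
    hi-eq = m≥n⇒m⊔n≡m (<⇒≤ s<2v)
    avoids : ∀ β → just α ≺ just β → Covers (just β) before → side β ≢ side α
    avoids β ((l , h) , ne) (_ , c) refl = ne (trans lo-eq (sym loβ) , trans hiβ (sym hi-eq))
      where
      loβ : lo (just β) ≡ suc (2 * s)
      loβ = ≤-antisym (TwoSides.lo≤side as nonInt β) (≤-trans (≤-reflexive (sym lo-eq)) l)
      2v≡ : 2 * v ≡ suc (suc (2 * m))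
      2v≡ = trans (cong (2 *_) v≡) (*-suc 2 m)
      hiβ : hi (just β) ≡ 2 * v
      hiβ = ≤-antisym (≤-trans h (≤-reflexive hi-eq))
                      (≤-trans (≤-reflexive (trans 2v≡ (cong suc (sym before-pos)))) c)

  beyond : ∀ k → v ≡ k → s < k → 2 ≤ length (boundarySides as (just α))
  beyond (suc m) v≡ s<k with m≤n⇒m<n∨m≡n (s≤s⁻¹ s<k)
  ... | inj₁ s<m = backward≥2 m v≡ s<m
  ... | inj₂ s≡m = ⊥-elim (nontrivial-elim α (inj₂ (inj₁ (trans v≡ (cong suc (sym s≡m))))))

  arrow≥2 : 2 ≤ length (boundarySides as (just α))
  arrow≥2 with <-cmp v s
  ... | tri< v<s _ _ = forward≥2 v<s
  ... | tri≈ _ v≡s _ = ⊥-elim (nontrivial-elim α (inj₁ v≡s))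
  ... | tri> _ _ s<v = beyond v refl s<v

boundary≥2 : ∀ {N} → 2 ≤ N → (as : List (Arrow N)) → AllPairs NonIntersecting as →
             ∀ r → 2 ≤ length (boundarySides as r)
boundary≥2 (s≤s (s≤s z≤n)) as nonInt nothing  = root≥2 as nonInt
boundary≥2 _               as nonInt (just α) = arrow≥2 as nonInt α

length-orient : ∀ {N} (r : Region N) js → length (orient r js) ≡ length js
length-orient nothing  js = refl
length-orient (just α) js with backward? α
... | yes _ = length-reverse js
... | no  _ = refl

regionSides≥2 : ∀ {N} → 2 ≤ N → (as : List (Arrow N)) → AllPairs NonIntersecting as →
                ∀ r → 2 ≤ length (orient r (boundarySides as r))
regionSides≥2 2≤N as nonInt r =
  subst (2 ≤_) (sym (length-orient r _)) (boundary≥2 2≤N as nonInt r)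

------------------------------------------------------------------------
-- Polygons

-- [a₁, …, a_{n+1}], the decoration of the root side last.
record Polygon (R : Set a) : Set a where
  constructor polygon
  field
    sides     : List R
    .atLeast2 : 2 ≤ length sides

open Polygon public

private
  variable
    R : Set a

size : Polygon R → ℕ
size π = length (sides π)

χ : Polygon R → ℕ
χ π = pred (size π)

regionLabels : (π : Polygon R) → Dissection (size π) → Region (size π) → List R
regionLabels π D r = map (lookup (sides π)) (regionSides D r)

regionLabels≥2 : (π : Polygon R) (D : Dissection (size π)) (r : Region (size π)) →
                 2 ≤ length (regionLabels π D r)
regionLabels≥2 π@(polygon as 2≤N) D@(dissection αs nonInt) r =
  recompute (2 ≤? length (regionLabels π D r))
    (subst (2 ≤_) (sym (length-map (lookup as) (regionSides D r))) (regionSides≥2 2≤N αs nonInt r))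

regionPolygon : (π : Polygon R) → Dissection (size π) → Region (size π) → Polygon R
regionPolygon π D r = polygon (regionLabels π D r) (regionLabels≥2 π D r)

sgn : (π : Polygon R) → Dissection (size π) → ℚ
sgn π D = foldr _*ℚ_ 1ℚ
  (map (λ α → [-1]^ χ (regionPolygon π D (just α))) (filter backward? (arrows D)))

-- A polygon as a letter, of exterior degree 1.
letter : Polygon R → Letter
letter π = π ∷ []

𝐁 : Polygon R → Lin Word
𝐁 π = ∑[ D ∈ dissections (size π) ] sgn π D • (∑[ ℓ ∈ linearOrders D ] ⟦ map (λ r → letter (regionPolygon π D r)) ℓ ⟧)

-- The index set of the coproduct formula: nothing is the additional case in
-- which the root polygon is ∅ and the only remaining polygon is π.
AdmissibleTerm : Polygon R → Set
AdmissibleTerm π = Maybe (Dissection (size π))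

admissibleTerms : (π : Polygon R) → List (AdmissibleTerm π)
admissibleTerms π = nothing ∷ map just (filter admissible? (dissections (size π)))

sgnᵃ : (π : Polygon R) → AdmissibleTerm π → ℚ
sgnᵃ π nothing  = 1ℚ
sgnᵃ π (just D) = sgn π D

rootPolygon : (π : Polygon R) → AdmissibleTerm π → Maybe (Polygon R)
rootPolygon π nothing  = nothing
rootPolygon π (just D) = just (regionPolygon π D nothing)

remainingPolygons : (π : Polygon R) → AdmissibleTerm π → List (Polygon R)
remainingPolygons π nothing  = [ π ]
remainingPolygons π (just D) = map (λ α → regionPolygon π D (just α)) (arrows D)

-- 𝐁 extended by 𝐁 ∅ = 1.
𝐁∅ : Maybe (Polygon R) → Lin Word
𝐁∅ nothing  = 𝟏
𝐁∅ (just π) = 𝐁 π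

PolygonElement : (R : Set a) → Lin (Word {X = Polygon R}) → Set a
PolygonElement R x = ∃ λ π → x ≡ 𝐁 π

-- The last letter of a word of B(π) is a polygon cut off by a single arrow α, so that
--   B(π) = [π] + Σ_α sgn(α) B(π_α^rt) · π_α^co,
-- where · appends a letter.  Since Δ(w · x) = Δ(w) (1 ⊗ x) + (w · x) ⊗ 1, the coproduct
-- formula follows by induction once T(π), the sum of its terms with R^D ≠ ∅, is seen to satisfy
--   T(π) = B(π) ⊗ 1 + Σ_α sgn(α) T(π_α^rt) (1 ⊗ π_α^co).
-- Now the last letter of a word of ∏ш B(P_i) is the last letter of one factor B(P_i): either
-- it is P_i itself, and α is then an arrow of the admissible dissection, or it is cut off from
-- P_i by an arrow, which is an arrow α of π beyond which no region of the dissection lies.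
--
-- All elements B(π) lie in the span of the words of polygons, which have degree zero, and
-- there Δ and S are compatible with the product without signs.  The antipode of B(π) is found
-- from S ⋆ id = ε and the coproduct formula, by induction on the number of sides.


module Submission where

open import Level using (Level)
open import Data.Bool using (Bool; true; false; T; not; _∧_; _xor_; if_then_else_)
open import Data.Bool.ListAction using (all; any)
open import Data.Bool.Properties using (not-involutive; not-distribˡ-xor)
open import Data.Empty using (⊥; ⊥-elim)
open import Data.Empty.Irrelevant renaming (⊥-elim to ⊥-elim-irr)
open import Data.Fin using (Fin; zero; suc; toℕ; fromℕ<)
import Data.Fin.Properties as Fin
open import Data.List using (List; []; _∷_; [_]; _++_; _∷ʳ_; map; concatMap; cartesianProduct; cartesianProductWith; mapMaybe; filter; foldr; length; lookup; reverse; allFin; upTo; splitAt)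
open import Data.List.Membership.Propositional using (_∈_; find; lose)
open import Data.List.Membership.Propositional.Properties using (∈-filter⁺; ∈-filter⁻; ∈-map⁺; ∈-map⁻; ∈-cartesianProduct⁺; ∈-upTo⁺; ∈-allFin)
open import Data.List.Membership.Propositional.Properties.WithK using (unique∧set⇒bag)
open import Data.List.NonEmpty as List⁺ using (List⁺; _++⁺_)
open import Data.List.Properties
open import Data.List.Relation.Binary.BagAndSetEquality using (∼bag⇒↭)
open import Data.List.Relation.Binary.Permutation.Propositional using (_↭_; prep; ↭-sym; ↭-trans; ↭-reflexive) renaming (refl to ↭refl; swap to ↭swap; trans to ↭trans)
import Data.List.Relation.Binary.Permutation.Propositional.Properties as ↭
open import Data.List.Relation.Unary.All as All using (All; []; _∷_; all?)
import Data.List.Relation.Unary.All.Properties as All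
open import Data.List.Relation.Unary.AllPairs as AllPairs using (AllPairs; []; _∷_; allPairs?)
import Data.List.Relation.Unary.AllPairs.Properties as AllPairs
open import Data.List.Relation.Unary.Any as Any using (Any; here; there; any?)
import Data.List.Relation.Unary.Any.Properties as Any
open import Data.List.Relation.Unary.Unique.Propositional using (Unique)
import Data.List.Relation.Unary.Unique.Propositional.Properties as Unique
open import Data.Maybe using (Maybe; just; nothing)
open import Data.Nat using (ℕ; zero; suc; pred; _+_; _*_; _∸_; _≤_; _<_; z≤n; s≤s; s≤s⁻¹; _≤?_; _<?_; _≟_; _≡ᵇ_; _<ᵇ_)
open import Data.Nat.Properties
import Data.Nat.Tactic.RingSolver as NatTactic
open import Data.Product using (∃; _×_; _,_; proj₁; proj₂; map₁; map₂; uncurry)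
open import Data.Rational using (ℚ; 0ℚ; 1ℚ) renaming (_+_ to _+ℚ_; _*_ to _*ℚ_; -_ to -ℚ_)
import Data.Rational.Properties as ℚ
open import Data.Sum using (_⊎_; inj₁; inj₂; [_,_]′)
open import Data.Unit using (⊤; tt)
open import Data.Vec using (Vec; []; _∷_)
open import Data.Vec.N-ary using (N-ary; _$ⁿ_; curryⁿ; ∀ⁿ)
open import Function using (_∘_; id; _⇔_; mk⇔; Equivalence; case_of_)
open import Relation.Binary.Bundles using (Setoid)
open import Relation.Binary.Definitions using (tri<; tri≈; tri>)
open import Relation.Binary.PropositionalEquality using (_≡_; _≢_; refl; sym; trans; cong; cong₂; subst; subst₂; module ≡-Reasoning)
import Relation.Binary.Reasoning.Setoid as SetoidReasoning
open import Relation.Nullary using (¬_; Dec; yes; no; does; contradiction)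
open import Relation.Nullary.Decidable using (_×-dec_; _⊎-dec_; _→-dec_; ¬?; T?; decidable-stable; does-⇔; dec-true; dec-false)
open import Defs

-- Fourier–Motzkin elimination over ℕ

-- A `Dissection` has the number of sides of its polygon in its type, so an arrow of a piece and the
-- same arrow in the whole polygon are objects of different types. The computation is therefore made
-- with arcs, pairs `(l , c)` of numbers that do not mention a polygon, and with plain lists of
-- decorations. Arcs of a piece are carried to the whole polygon by `embed` and `nest`, and what
-- relates their positions is linear arithmetic; hence the decision procedure. Words of lists become
-- words of polygons only at the end, by `realize` and `toBar`.
--
-- The delicate case of the recursion for T(π) is a last letter that is a proper part of some P_i.
-- It can be cut off inside P_i or directly from π, and the two descriptions must agree in labels,
-- orientations and signs; this is the content of `rt-co`, `co-co` and `sign-nest`. The coproduct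
-- formula holds for formal linear combinations of words; the relations of the exterior algebra
-- matter only for the Hopf subalgebra, where the operations must be well defined on the quotient.

-- c₁ ∷ … ∷ cₙ ∷ const k stands for c₁x₁ + … + cₙxₙ + k.
data Affine : ℕ → Set where
  const : ℕ → Affine 0
  _∷_   : ∀ {n} → ℕ → Affine n → Affine (suc n)

infix 9 _at_
_at_ : ∀ {n} → Affine n → Vec ℕ n → ℕ
const k at []       = k
(c ∷ f) at (x ∷ xs) = c * x + f at xs

constant : ∀ {n} → ℕ → Affine n
constant {zero}  k = const k
constant {suc n} k = 0 ∷ constant k

variable-at : ∀ {n} → Fin n → Affine n
variable-at zero    = 1 ∷ constant 0
variable-at (suc i) = 0 ∷ variable-at i

infixl 6 _⊞_
_⊞_ : ∀ {n} → Affine n → Affine n → Affine n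
const k ⊞ const l = const (k + l)
(c ∷ f) ⊞ (d ∷ g) = (c + d) ∷ (f ⊞ g)

infixr 7 _⊠_
_⊠_ : ∀ {n} → ℕ → Affine n → Affine n
k ⊠ const l = const (k * l)
k ⊠ (c ∷ f) = (k * c) ∷ (k ⊠ f)

constant-at : ∀ {n} k (xs : Vec ℕ n) → constant k at xs ≡ k
constant-at k []       = refl
constant-at k (x ∷ xs) = constant-at k xs

variable-at-at : ∀ {n} (i : Fin n) xs → variable-at i at xs ≡ Data.Vec.lookup xs i
variable-at-at zero    (x ∷ xs) = trans (cong (1 * x +_) (constant-at 0 xs)) (solve-∀ x)
  where
  solve-∀ : ∀ x → 1 * x + 0 ≡ x
  solve-∀ = NatTactic.solve-∀
variable-at-at (suc i) (x ∷ xs) = variable-at-at i xs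

⊞-at : ∀ {n} (f g : Affine n) xs → (f ⊞ g) at xs ≡ f at xs + g at xs
⊞-at (const k) (const l) []       = refl
⊞-at (c ∷ f)   (d ∷ g)   (x ∷ xs) rewrite ⊞-at f g xs = regroup c d x (f at xs) (g at xs)
  where
  regroup : ∀ c d x u w → (c + d) * x + (u + w) ≡ c * x + u + (d * x + w)
  regroup = NatTactic.solve-∀

⊠-at : ∀ {n} k (f : Affine n) xs → (k ⊠ f) at xs ≡ k * f at xs
⊠-at k (const l) []       = refl
⊠-at k (c ∷ f)   (x ∷ xs) rewrite ⊠-at k f xs = regroup k c x (f at xs)
  where
  regroup : ∀ k c x u → k * c * x + k * u ≡ k * (c * x + u)
  regroup = NatTactic.solve-∀

Inequality : ℕ → Set
Inequality n = Affine n × Affine n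

Holds : ∀ {n} → Vec ℕ n → Inequality n → Set
Holds xs (f , g) = f at xs ≤ g at xs

-- An inequality in x and the remaining variables, solved for x: f ≤ d x + g, or
-- d x + f ≤ g, or free of x.
data Solved (n : ℕ) : Set where
  lower upper : ℕ → Inequality n → Solved n
  free        : Inequality n → Solved n

SolvedHolds : ∀ {n} → ℕ → Vec ℕ n → Solved n → Set
SolvedHolds x xs (lower d (f , g)) = f at xs ≤ d * x + g at xs
SolvedHolds x xs (upper d (f , g)) = d * x + f at xs ≤ g at xs
SolvedHolds x xs (free i)          = Holds xs i

solveFor : ∀ {n} → Inequality (suc n) → Solved n
solveFor (a ∷ f , b ∷ g) with a <? b | b <? a
... | yes _ | _     = lower (b ∸ a) (f , g)
... | no _  | yes _ = upper (a ∸ b) (f , g)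
... | no _  | no _  = free (f , g)

solveFor-holds : ∀ {n} x (xs : Vec ℕ n) i → Holds (x ∷ xs) i → SolvedHolds x xs (solveFor i)
solveFor-holds x xs (a ∷ f , b ∷ g) h with a <? b | b <? a
... | yes a<b | _ = +-cancelˡ-≤ (a * x) _ _ (≤-trans h (≤-reflexive eq))
  where
  regroup : ∀ a d x u → (a + d) * x + u ≡ a * x + (d * x + u)
  regroup = NatTactic.solve-∀
  eq : b * x + g at xs ≡ a * x + ((b ∸ a) * x + g at xs)
  eq = trans (cong (λ k → k * x + g at xs) (sym (m+[n∸m]≡n (<⇒≤ a<b)))) (regroup a (b ∸ a) x (g at xs))
... | no _ | yes b<a = +-cancelˡ-≤ (b * x) _ _ (≤-trans (≤-reflexive (sym eq)) h)
  where
  regroup : ∀ a d x u → (a + d) * x + u ≡ a * x + (d * x + u)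
  regroup = NatTactic.solve-∀
  eq : a * x + f at xs ≡ b * x + ((a ∸ b) * x + f at xs)
  eq = trans (cong (λ k → k * x + f at xs) (sym (m+[n∸m]≡n (<⇒≤ b<a)))) (regroup b (a ∸ b) x (f at xs))
... | no a≮b | no b≮a with ≤-antisym (≮⇒≥ b≮a) (≮⇒≥ a≮b)
... | refl = +-cancelˡ-≤ (a * x) _ _ h

frees : ∀ {n} → List (Solved n) → List (Inequality n)
frees []             = []
frees (free i ∷ ss)  = i ∷ frees ss
frees (_ ∷ ss)       = frees ss

-- The pairs (1 , i) with i = (0 ≤ x + 0) account for x being a natural number.
lowers uppers : ∀ {n} → List (Solved n) → List (ℕ × Inequality n)
lowers []               = [ 1 , constant 0 , constant 0 ]
lowers (lower d i ∷ ss) = (d , i) ∷ lowers ss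
lowers (_ ∷ ss)         = lowers ss
uppers []               = []
uppers (upper d i ∷ ss) = (d , i) ∷ uppers ss
uppers (_ ∷ ss)         = uppers ss

-- Each inequality is scaled by the coefficient of `x` in the other one, so that `x` occurs equally
-- on both sides and cancels without division.
combine : ∀ {n} → ℕ × Inequality n → ℕ × Inequality n → Inequality n
combine (d , f , g) (e , f′ , g′) = e ⊠ f ⊞ d ⊠ f′ , e ⊠ g ⊞ d ⊠ g′

_≡ᵃ_ : ∀ {n} → Affine n → Affine n → Bool
const k ≡ᵃ const l = k ≡ᵇ l
(c ∷ f) ≡ᵃ (d ∷ g) = (c ≡ᵇ d) ∧ (f ≡ᵃ g)

opposite : ∀ {n} → ℕ × Inequality n → ℕ × Inequality n → Bool
opposite (d , f , g) (e , f′ , g′) = (d ≡ᵇ e) ∧ (f ≡ᵃ g′) ∧ (g ≡ᵃ f′)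

-- A lower and an upper bound that together are an equation allow to substitute for
-- x, so that not all pairs of bounds need to be combined.
equation : ∀ {n} (ls us : List (ℕ × Inequality n)) → Maybe ((∃ λ l → l ∈ ls) × (∃ λ u → u ∈ us))
equation []       us = nothing
equation (l ∷ ls) us with any? (λ u → T? (opposite l u)) us | equation ls us
... | yes p | _ = just ((l , here refl) , (proj₁ (find p) , proj₁ (proj₂ (find p))))
... | no _  | just ((l′ , l′∈) , u) = just ((l′ , there l′∈) , u)
... | no _  | nothing = nothing

combinations : ∀ {n} (ls us : List (ℕ × Inequality n)) → List (Inequality n)
combinations ls us with equation ls us
... | just ((l , _) , (u , _)) = map (combine l) us ++ map (λ l′ → combine l′ u) ls
... | nothing                  = cartesianProductWith combine ls us

eliminate : ∀ {n} → List (Inequality (suc n)) → List (Inequality n)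
eliminate is = frees ss ++ combinations (lowers ss) (uppers ss)
  where ss = map solveFor is

module _ {n} (x : ℕ) (xs : Vec ℕ n) where

  frees-hold : ∀ ss → All (SolvedHolds x xs) ss → All (Holds xs) (frees ss)
  frees-hold []               []       = []
  frees-hold (free i ∷ ss)    (h ∷ hs) = h ∷ frees-hold ss hs
  frees-hold (lower _ _ ∷ ss) (_ ∷ hs) = frees-hold ss hs
  frees-hold (upper _ _ ∷ ss) (_ ∷ hs) = frees-hold ss hs

  lowers-hold : ∀ ss → All (SolvedHolds x xs) ss →
                All (λ (d , i) → SolvedHolds x xs (lower d i)) (lowers ss)
  lowers-hold []               []       = ≤-trans (≤-reflexive (constant-at 0 xs)) z≤n ∷ []
  lowers-hold (free _ ∷ ss)    (_ ∷ hs) = lowers-hold ss hs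
  lowers-hold (lower _ _ ∷ ss) (h ∷ hs) = h ∷ lowers-hold ss hs
  lowers-hold (upper _ _ ∷ ss) (_ ∷ hs) = lowers-hold ss hs

  uppers-hold : ∀ ss → All (SolvedHolds x xs) ss →
                All (λ (d , i) → SolvedHolds x xs (upper d i)) (uppers ss)
  uppers-hold []               []       = []
  uppers-hold (free _ ∷ ss)    (_ ∷ hs) = uppers-hold ss hs
  uppers-hold (lower _ _ ∷ ss) (_ ∷ hs) = uppers-hold ss hs
  uppers-hold (upper _ _ ∷ ss) (h ∷ hs) = h ∷ uppers-hold ss hs

  combine-holds : ∀ l u → SolvedHolds x xs (lower (proj₁ l) (proj₂ l)) →
                  SolvedHolds x xs (upper (proj₁ u) (proj₂ u)) → Holds xs (combine l u)
  combine-holds (d , f , g) (e , f′ , g′) h h′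
    rewrite ⊞-at (e ⊠ f) (d ⊠ f′) xs | ⊞-at (e ⊠ g) (d ⊠ g′) xs
          | ⊠-at e f xs | ⊠-at d f′ xs | ⊠-at e g xs | ⊠-at d g′ xs =
    +-cancelˡ-≤ (d * e * x) _ _ (≤-trans (≤-reflexive (left d e x (f at xs) (f′ at xs)))
      (≤-trans (+-mono-≤ (*-monoʳ-≤ e h) (*-monoʳ-≤ d h′)) (≤-reflexive (right d e x (g at xs) (g′ at xs)))))
    where
    left : ∀ d e x u u′ → d * e * x + (e * u + d * u′) ≡ e * u + d * (e * x + u′)
    left = NatTactic.solve-∀
    right : ∀ d e x w w′ → e * (d * x + w) + d * w′ ≡ d * e * x + (e * w + d * w′)
    right = NatTactic.solve-∀

  products-hold : ∀ ls us → All (λ (d , i) → SolvedHolds x xs (lower d i)) ls →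
                  All (λ (d , i) → SolvedHolds x xs (upper d i)) us →
                  All (Holds xs) (cartesianProductWith combine ls us)
  products-hold []       us []       hus = []
  products-hold (l ∷ ls) us (h ∷ hs) hus =
    All.++⁺ (All.map⁺ (All.map (λ {u} → combine-holds l u h) hus)) (products-hold ls us hs hus)

  -- Every pair of a lower and an upper bound has a valid combination, so soundness does not depend
  -- on which pairs are chosen; the test `opposite` only serves to choose few of them.
  combinations-hold : ∀ ls us → All (λ (d , i) → SolvedHolds x xs (lower d i)) ls →
                      All (λ (d , i) → SolvedHolds x xs (upper d i)) us →
                      All (Holds xs) (combinations ls us)
  combinations-hold ls us hls hus with equation ls us
  ... | just ((l , l∈) , (u , u∈)) =
    All.++⁺ (All.map⁺ (All.map (λ {u′} → combine-holds l u′ (All.lookup hls l∈)) hus))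
            (All.map⁺ (All.map (λ {l′} h → combine-holds l′ u h (All.lookup hus u∈)) hls))
  ... | nothing = products-hold ls us hls hus

  eliminate-holds : ∀ is → All (Holds (x ∷ xs)) is → All (Holds xs) (eliminate is)
  eliminate-holds is his =
    All.++⁺ (frees-hold ss hss)
            (combinations-hold (lowers ss) (uppers ss) (lowers-hold ss hss) (uppers-hold ss hss))
    where
    ss = map solveFor is
    hss : All (SolvedHolds x xs) ss
    hss = All.map⁺ (All.map (λ {i} → solveFor-holds x xs i) his)

infeasible : ∀ {n} → List (Inequality n) → Bool
infeasible {zero}  is = any (λ { (const k , const l) → l <ᵇ k }) is
infeasible {suc n} is = infeasible (eliminate is)

infeasible-sound : ∀ {n} (is : List (Inequality n)) → T (infeasible is) → ∀ xs → ¬ All (Holds xs) is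
infeasible-sound {zero} ((const k , const l) ∷ is) t [] (h ∷ hs) with l <ᵇ k in eq
... | true  = <⇒≱ (<ᵇ⇒< l k (subst T (sym eq) tt)) h
... | false = infeasible-sound is t [] hs
infeasible-sound {suc n} is t (x ∷ xs) hs = infeasible-sound (eliminate is) t xs (eliminate-holds x xs is hs)

-- Formulas of linear arithmetic and their disjunctive normal forms

infixl 8 _:+_
infixr 9 _:*_
infix  6 _:≤_ _:<_ _:≡_
infixr 5 _:∧_
infixr 4 _:∨_
infixr 3 _:⇒_

data Term (n : ℕ) : Set where
  var  : Fin n → Term n
  #_   : ℕ → Term n
  _:+_ : Term n → Term n → Term n
  _:*_ : ℕ → Term n → Term n

data Formula (n : ℕ) : Set where
  _:≤_ _:≡_      : Term n → Term n → Formula n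
  :⊥             : Formula n
  _:∧_ _:∨_ _:⇒_ : Formula n → Formula n → Formula n

pattern :suc t = # 1 :+ t
pattern _:<_ t u = :suc t :≤ u
pattern :¬_ φ = φ :⇒ :⊥

⟦_⟧ᵗ : ∀ {n} → Term n → Vec ℕ n → ℕ
⟦ var i ⟧ᵗ  ρ = Data.Vec.lookup ρ i
⟦ # k ⟧ᵗ    ρ = k
⟦ t :+ u ⟧ᵗ ρ = ⟦ t ⟧ᵗ ρ + ⟦ u ⟧ᵗ ρ
⟦ k :* t ⟧ᵗ ρ = k * ⟦ t ⟧ᵗ ρ

⟦_⟧ᶠ : ∀ {n} → Formula n → Vec ℕ n → Set
⟦ t :≤ u ⟧ᶠ ρ = ⟦ t ⟧ᵗ ρ ≤ ⟦ u ⟧ᵗ ρ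
⟦ t :≡ u ⟧ᶠ ρ = ⟦ t ⟧ᵗ ρ ≡ ⟦ u ⟧ᵗ ρ
⟦ :⊥ ⟧ᶠ     ρ = ⊥
⟦ φ :∧ ψ ⟧ᶠ ρ = ⟦ φ ⟧ᶠ ρ × ⟦ ψ ⟧ᶠ ρ
⟦ φ :∨ ψ ⟧ᶠ ρ = ⟦ φ ⟧ᶠ ρ ⊎ ⟦ ψ ⟧ᶠ ρ
⟦ φ :⇒ ψ ⟧ᶠ ρ = ⟦ φ ⟧ᶠ ρ → ⟦ ψ ⟧ᶠ ρ

-- Decidability of formulas makes the classical laws of negation available in `dnf-sound` and
-- `valid-sound`.
formula? : ∀ {n} (φ : Formula n) ρ → Dec (⟦ φ ⟧ᶠ ρ)
formula? (t :≤ u) ρ = ⟦ t ⟧ᵗ ρ ≤? ⟦ u ⟧ᵗ ρ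
formula? (t :≡ u) ρ = ⟦ t ⟧ᵗ ρ ≟ ⟦ u ⟧ᵗ ρ
formula? :⊥       ρ = no λ ()
formula? (φ :∧ ψ) ρ = formula? φ ρ ×-dec formula? ψ ρ
formula? (φ :∨ ψ) ρ = formula? φ ρ ⊎-dec formula? ψ ρ
formula? (φ :⇒ ψ) ρ = formula? φ ρ →-dec formula? ψ ρ

affine : ∀ {n} → Term n → Affine n
affine (var i)  = variable-at i
affine (# k)    = constant k
affine (t :+ u) = affine t ⊞ affine u
affine (k :* t) = k ⊠ affine t

affine-at : ∀ {n} (t : Term n) ρ → affine t at ρ ≡ ⟦ t ⟧ᵗ ρ
affine-at (var i)  ρ = variable-at-at i ρ
affine-at (# k)    ρ = constant-at k ρ
affine-at (t :+ u) ρ = trans (⊞-at (affine t) (affine u) ρ) (cong₂ _+_ (affine-at t ρ) (affine-at u ρ))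
affine-at (k :* t) ρ = trans (⊠-at k (affine t) ρ) (cong (k *_) (affine-at t ρ))

-- dnf true φ is a disjunctive normal form of φ, dnf false φ one of ¬ φ.
dnf : ∀ {n} → Bool → Formula n → List (List (Inequality n))
dnf true  (t :≤ u) = [ [ affine t , affine u ] ]
dnf false (t :≤ u) = [ [ affine (:suc u) , affine t ] ]
dnf true  (t :≡ u) = [ (affine t , affine u) ∷ [ affine u , affine t ] ]
dnf false (t :≡ u) = [ affine (:suc t) , affine u ] ∷ [ [ affine (:suc u) , affine t ] ]
dnf true  :⊥       = []
dnf false :⊥       = [ [] ]
dnf true  (φ :∧ ψ) = cartesianProductWith _++_ (dnf true φ) (dnf true ψ)
dnf false (φ :∧ ψ) = dnf false φ ++ dnf false ψ
dnf true  (φ :∨ ψ) = dnf true φ ++ dnf true ψ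
dnf false (φ :∨ ψ) = cartesianProductWith _++_ (dnf false φ) (dnf false ψ)
dnf true  (φ :⇒ ψ) = dnf false φ ++ dnf true ψ
dnf false (φ :⇒ ψ) = cartesianProductWith _++_ (dnf true φ) (dnf false ψ)

Signed : Bool → Set → Set
Signed true  P = P
Signed false P = ¬ P

Disjunction : ∀ {n} → Vec ℕ n → List (List (Inequality n)) → Set
Disjunction ρ = Any (All (Holds ρ))

≤-holds : ∀ {n} (t u : Term n) ρ → ⟦ t ⟧ᵗ ρ ≤ ⟦ u ⟧ᵗ ρ → Holds ρ (affine t , affine u)
≤-holds t u ρ = subst₂ _≤_ (sym (affine-at t ρ)) (sym (affine-at u ρ))

conjoin : ∀ {n} (ρ : Vec ℕ n) {c d} → Disjunction ρ c → Disjunction ρ d →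
          Disjunction ρ (cartesianProductWith _++_ c d)
conjoin ρ = Any.cartesianProductWith⁺ _++_ All.++⁺

dnf-sound : ∀ {n} (ρ : Vec ℕ n) b φ → Signed b (⟦ φ ⟧ᶠ ρ) → Disjunction ρ (dnf b φ)
dnf-sound ρ true  (t :≤ u) h = here (≤-holds t u ρ h ∷ [])
dnf-sound ρ false (t :≤ u) h = here (≤-holds (:suc u) t ρ (≰⇒> h) ∷ [])
dnf-sound ρ true  (t :≡ u) h = here (≤-holds t u ρ (≤-reflexive h) ∷ ≤-holds u t ρ (≤-reflexive (sym h)) ∷ [])
dnf-sound ρ false (t :≡ u) h with <-cmp (⟦ t ⟧ᵗ ρ) (⟦ u ⟧ᵗ ρ)
... | tri< l _ _ = here (≤-holds (:suc t) u ρ l ∷ [])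
... | tri≈ _ e _ = ⊥-elim (h e)
... | tri> _ _ g = there (here (≤-holds (:suc u) t ρ g ∷ []))
dnf-sound ρ false :⊥       h = here []
dnf-sound ρ true  (φ :∧ ψ) (h , h′) = conjoin ρ (dnf-sound ρ true φ h) (dnf-sound ρ true ψ h′)
dnf-sound ρ false (φ :∧ ψ) h with formula? φ ρ
... | no ¬p = Any.++⁺ˡ (dnf-sound ρ false φ ¬p)
... | yes p = Any.++⁺ʳ (dnf false φ) (dnf-sound ρ false ψ (λ q → h (p , q)))
dnf-sound ρ true  (φ :∨ ψ) (inj₁ h) = Any.++⁺ˡ (dnf-sound ρ true φ h)
dnf-sound ρ true  (φ :∨ ψ) (inj₂ h) = Any.++⁺ʳ (dnf true φ) (dnf-sound ρ true ψ h)
dnf-sound ρ false (φ :∨ ψ) h = conjoin ρ (dnf-sound ρ false φ (h ∘ inj₁)) (dnf-sound ρ false ψ (h ∘ inj₂))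
dnf-sound ρ true  (φ :⇒ ψ) h with formula? φ ρ
... | no ¬p = Any.++⁺ˡ (dnf-sound ρ false φ ¬p)
... | yes p = Any.++⁺ʳ (dnf false φ) (dnf-sound ρ true ψ (h p))
dnf-sound ρ false (φ :⇒ ψ) h =
  conjoin ρ (dnf-sound ρ true φ (decidable-stable (formula? φ ρ) (λ ¬p → h (λ p → ⊥-elim (¬p p)))))
            (dnf-sound ρ false ψ (λ q → h (λ _ → q)))

valid : ∀ {n} → Formula n → Bool
valid φ = all infeasible (dnf false φ)

valid-sound : ∀ {n} (φ : Formula n) → T (valid φ) → ∀ ρ → ⟦ φ ⟧ᶠ ρ
valid-sound φ t ρ = decidable-stable (formula? φ ρ) λ ¬h → refuted (dnf false φ) t (dnf-sound ρ false φ ¬h)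
  where
  refuted : ∀ ds → T (all infeasible ds) → ¬ Disjunction ρ ds
  refuted (d ∷ ds) t (here h) with infeasible d in eq
  ... | true = infeasible-sound d (subst T (sym eq) tt) ρ h
  refuted (d ∷ ds) t (there h) with infeasible d
  ... | true = refuted ds t h

Statementⁿ : ∀ n → N-ary n (Term n) (Formula n) → Formula n
Statementⁿ n f = f $ⁿ Data.Vec.map var (Data.Vec.allFin n)

-- A proof by reflection: `T (valid …)` evaluates to `⊤` if the formula is found valid, and its
-- inhabitant is then filled in by the type checker. Variables are eliminated in the order in which
-- `f` binds them; the choice of this order in the applications affects only the cost of the
-- evaluation.
lia : ∀ n (f : N-ary n (Term n) (Formula n)) {_ : T (valid (Statementⁿ n f))} →
      ∀ⁿ n (curryⁿ (⟦ Statementⁿ n f ⟧ᶠ))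
lia n f {t} = generalize n (valid-sound (Statementⁿ n f) t)
  where
  generalize : ∀ n {P : Vec ℕ n → Set} → (∀ ρ → P ρ) → ∀ⁿ n (curryⁿ P)
  generalize zero    h = h []
  generalize (suc n) h = λ x → generalize n (λ ρ → h (x ∷ ρ))

-- Linear combinations

variable
  ℓ ℓ′ : Level
  A B C G H X Y : Set ℓ
  P Q : Set ℓ′

-- Without relators, `∼` is equality of formal linear combinations. The coproduct formula is proved
-- for `∼` and then passed to the bar construction by `∼⇒≈`.
Free : Set ℓ → Space ℓ
Free {ℓ} G = record { Gen = G ; Relator = λ _ → Level.Lift ℓ ⊥ }

infix 4 _∼_
_∼_ : {G : Set ℓ} → Lin G → Lin G → Set ℓ
_∼_ {G = G} = Eq (Free G)

≈-setoid : Space ℓ → Setoid ℓ ℓ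
≈-setoid V = record
  { Carrier       = Lin (Gen V)
  ; _≈_           = Eq V
  ; isEquivalence = record { refl = ≈-refl ; sym = ≈-sym ; trans = ≈-trans } }

module ≈-Reasoning {ℓ} (V : Space ℓ) = SetoidReasoning (≈-setoid V)
module ∼-Reasoning {ℓ} (G : Set ℓ) = ≈-Reasoning (Free G)

≡⇒≈ : {V : Space ℓ} {x y : Lin (Gen V)} → x ≡ y → x ≈[ V ] y
≡⇒≈ refl = ≈-refl

•-⊕ : ∀ c (x y : Lin G) → c • (x ⊕ y) ≡ c • x ⊕ c • y
•-⊕ c x y = map-++ _ x y

•-• : ∀ c d (x : Lin G) → c • (d • x) ≡ (c *ℚ d) • x
•-• c d x = trans (sym (map-∘ x)) (map-cong (λ (q , g) → cong (_, g) (sym (ℚ.*-assoc c d q))) x)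

1• : (x : Lin G) → 1ℚ • x ≡ x
1• x = trans (map-cong (λ (q , g) → cong (_, g) (ℚ.*-identityˡ q)) x) (map-id x)

⊕-identityʳ : (x : Lin G) → x ⊕ [] ≡ x
⊕-identityʳ = ++-identityʳ

∑-• : ∀ c (is : List A) (f : A → Lin G) → c • (∑ is f) ≡ (∑[ i ∈ is ] c • f i)
∑-• c is f = map-concatMap _ f is

linear-⊕ : (f : G → Lin H) (x y : Lin G) → linear f (x ⊕ y) ≡ linear f x ⊕ linear f y
linear-⊕ f x y = concatMap-++ _ x y

linear-• : ∀ (f : G → Lin H) c x → linear f (c • x) ≡ c • linear f x
linear-• f c x = trans (concatMap-map _ _ x)
  (trans (concatMap-cong (λ (q , g) → sym (•-• c q (f g))) x) (sym (∑-• c x _)))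

linear-⟦⟧ : (f : G → Lin H) (g : G) → linear f ⟦ g ⟧ ≡ f g
linear-⟦⟧ f g = trans (⊕-identityʳ _) (1• (f g))

linear-id : (x : Lin G) → linear ⟦_⟧ x ≡ x
linear-id []            = refl
linear-id ((q , g) ∷ x) = cong₂ (λ p y → (p , g) ∷ y) (ℚ.*-identityʳ q) (linear-id x)

linear-∑ : (h : G → Lin H) (is : List A) (f : A → Lin G) → linear h (∑ is f) ≡ ∑ is (linear h ∘ f)
linear-∑ h []       f = refl
linear-∑ h (i ∷ is) f = trans (linear-⊕ h (f i) _) (cong (linear h (f i) ⊕_) (linear-∑ h is f))

•-linear-∑ : ∀ c (h : G → Lin H) (is : List A) (f : A → Lin G) →
             c • linear h (∑ is f) ≡ (∑[ i ∈ is ] c • linear h (f i))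
•-linear-∑ c h is f = trans (cong (c •_) (linear-∑ h is f)) (∑-• c is (linear h ∘ f))

linear-linear : (g : H → Lin C) (f : G → Lin H) (x : Lin G) → linear g (linear f x) ≡ linear (linear g ∘ f) x
linear-linear g f x = trans (linear-∑ g x _) (concatMap-cong (λ (q , y) → linear-• g q (f y)) x)

linear-≗ : {f f′ : G → Lin H} → (∀ g → f g ≡ f′ g) → ∀ x → linear f x ≡ linear f′ x
linear-≗ e x = concatMap-cong (λ (q , g) → cong (q •_) (e g)) x

linear-•ʳ : ∀ c (f : G → Lin H) x → linear (λ g → c • f g) x ≡ c • linear f x
linear-•ʳ c f x = trans (concatMap-cong (λ (q , g) →
    trans (•-• q c (f g)) (trans (cong (_• f g) (ℚ.*-comm q c)) (sym (•-• c q (f g))))) x)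
  (sym (∑-• c x _))

mapGen-mapGen : (g : H → C) (f : G → H) (x : Lin G) → mapGen g (mapGen f x) ≡ mapGen (g ∘ f) x
mapGen-mapGen g f x = trans (linear-linear (⟦_⟧ ∘ g) (⟦_⟧ ∘ f) x) (linear-≗ (λ y → linear-⟦⟧ (⟦_⟧ ∘ g) (f y)) x)

linear-mapGen : (g : H → Lin C) (f : G → H) (x : Lin G) → linear g (mapGen f x) ≡ linear (g ∘ f) x
linear-mapGen g f x = trans (linear-linear g (⟦_⟧ ∘ f) x) (linear-≗ (λ y → linear-⟦⟧ g (f y)) x)

mapGen-linear : (g : H → C) (f : G → Lin H) (x : Lin G) → mapGen g (linear f x) ≡ linear (mapGen g ∘ f) x
mapGen-linear g f x = linear-linear (⟦_⟧ ∘ g) f x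

∑-map : (h : A → B) (is : List A) (f : B → Lin G) → ∑ (map h is) f ≡ ∑ is (f ∘ h)
∑-map h is f = concatMap-map f h is

∑-concatMap : (h : A → List B) (is : List A) (f : B → Lin G) → ∑ (concatMap h is) f ≡ (∑[ i ∈ is ] ∑ (h i) f)
∑-concatMap h []       f = refl
∑-concatMap h (i ∷ is) f = trans (concatMap-++ f (h i) _) (cong (∑ (h i) f ⊕_) (∑-concatMap h is f))

∑-≗ : {f f′ : A → Lin G} → (∀ i → f i ≡ f′ i) → ∀ is → ∑ is f ≡ ∑ is f′
∑-≗ = concatMap-cong

module _ {V : Space ℓ} where

  ⊕-congˡ : ∀ {x y y′ : Lin (Gen V)} → y ≈[ V ] y′ → x ⊕ y ≈[ V ] x ⊕ y′
  ⊕-congˡ = ⊕-cong ≈-refl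

  ⊕-congʳ : ∀ {x x′ y : Lin (Gen V)} → x ≈[ V ] x′ → x ⊕ y ≈[ V ] x′ ⊕ y
  ⊕-congʳ e = ⊕-cong e ≈-refl

  ⊕-interchange : ∀ (x y z w : Lin (Gen V)) → (x ⊕ y) ⊕ (z ⊕ w) ≈[ V ] (x ⊕ z) ⊕ (y ⊕ w)
  ⊕-interchange x y z w = begin
    (x ⊕ y) ⊕ (z ⊕ w) ≡⟨ ++-assoc x y (z ⊕ w) ⟩
    x ++ (y ++ (z ⊕ w)) ≡⟨ cong (x ++_) (++-assoc y z w) ⟨
    x ++ ((y ⊕ z) ⊕ w) ≈⟨ ⊕-congˡ {x} (⊕-congʳ {y = w} (⊕-comm y z)) ⟩
    x ++ ((z ⊕ y) ⊕ w) ≡⟨ cong (x ++_) (++-assoc z y w) ⟩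
    x ++ (z ++ (y ⊕ w)) ≡⟨ ++-assoc x z (y ⊕ w) ⟨
    (x ⊕ z) ⊕ (y ⊕ w) ∎
    where open ≈-Reasoning V

  ⊕-swapˡ : ∀ (x y z : Lin (Gen V)) → x ⊕ (y ⊕ z) ≈[ V ] y ⊕ (x ⊕ z)
  ⊕-swapˡ x y z = ≈-trans (≡⇒≈ (sym (++-assoc x y z)))
    (≈-trans (⊕-congʳ {y = z} (⊕-comm x y)) (≡⇒≈ (++-assoc y x z)))

  •-cong : ∀ c {x y : Lin (Gen V)} → x ≈[ V ] y → c • x ≈[ V ] c • y
  •-cong c ≈-refl = ≈-refl
  •-cong c (≈-sym e) = ≈-sym (•-cong c e)
  •-cong c (≈-trans e e′) = ≈-trans (•-cong c e) (•-cong c e′)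
  •-cong c (⊕-cong {x} {x′} {y} {y′} e e′) =
    ≈-trans (≡⇒≈ (•-⊕ c x y)) (≈-trans (⊕-cong (•-cong c e) (•-cong c e′)) (≡⇒≈ (sym (•-⊕ c x′ y′))))
  •-cong c (⊕-comm x y) = ≈-trans (≡⇒≈ (•-⊕ c x y)) (≈-trans (⊕-comm (c • x) (c • y)) (≡⇒≈ (sym (•-⊕ c y x))))
  •-cong c (collect p q g) = ≈-trans (collect (c *ℚ p) (c *ℚ q) g) (≡⇒≈ (cong (λ r → [ r , g ]) (sym (ℚ.*-distribˡ-+ c p q))))
  •-cong c (zero-coef g) = ≈-trans (≡⇒≈ (cong (λ r → [ r , g ]) (ℚ.*-zeroʳ c))) (zero-coef g)
  •-cong c (relator {r} d ρ) = ≈-trans (≡⇒≈ (•-• c d r)) (relator (c *ℚ d) ρ)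

  +-• : ∀ p q (x : Lin (Gen V)) → (p +ℚ q) • x ≈[ V ] p • x ⊕ q • x
  +-• p q []            = ≈-refl
  +-• p q ((t , g) ∷ x) = begin
    [ (p +ℚ q) *ℚ t , g ] ⊕ (p +ℚ q) • x
      ≈⟨ ⊕-cong (≈-trans (≡⇒≈ (cong (λ r → [ r , g ]) (ℚ.*-distribʳ-+ t p q))) (≈-sym (collect _ _ g))) (+-• p q x) ⟩
    ([ p *ℚ t , g ] ⊕ [ q *ℚ t , g ]) ⊕ (p • x ⊕ q • x)
      ≈⟨ ⊕-interchange [ p *ℚ t , g ] [ q *ℚ t , g ] (p • x) (q • x) ⟩
    ([ p *ℚ t , g ] ⊕ p • x) ⊕ ([ q *ℚ t , g ] ⊕ q • x) ∎
    where open ≈-Reasoning V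

  0• : ∀ (x : Lin (Gen V)) → 0ℚ • x ≈[ V ] []
  0• []            = ≈-refl
  0• ((t , g) ∷ x) = ⊕-cong (≈-trans (≡⇒≈ (cong (λ r → [ r , g ]) (ℚ.*-zeroˡ t))) (zero-coef g)) (0• x)

  ∑-cong-∈ : ∀ (is : List A) {f f′ : A → Lin (Gen V)} → (∀ i → i ∈ is → f i ≈[ V ] f′ i) → ∑ is f ≈[ V ] ∑ is f′
  ∑-cong-∈ []       e = ≈-refl
  ∑-cong-∈ (i ∷ is) e = ⊕-cong (e i (here refl)) (∑-cong-∈ is (λ j j∈ → e j (there j∈)))

  ∑-cong : ∀ (is : List A) {f f′ : A → Lin (Gen V)} → (∀ i → f i ≈[ V ] f′ i) → ∑ is f ≈[ V ] ∑ is f′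
  ∑-cong is e = ∑-cong-∈ is (λ i _ → e i)

  ∑-0 : ∀ (is : List A) {f : A → Lin (Gen V)} → (∀ i → f i ≈[ V ] []) → ∑ is f ≈[ V ] []
  ∑-0 []       e = ≈-refl
  ∑-0 (i ∷ is) e = ⊕-cong (e i) (∑-0 is e)

  ∑-⊕ : ∀ (is : List A) (f g : A → Lin (Gen V)) → (∑[ i ∈ is ] f i ⊕ g i) ≈[ V ] ∑ is f ⊕ ∑ is g
  ∑-⊕ []       f g = ≈-refl
  ∑-⊕ (i ∷ is) f g = ≈-trans (⊕-congˡ {f i ⊕ g i} (∑-⊕ is f g)) (⊕-interchange (f i) (g i) _ _)

  ∑-swap : ∀ (is : List A) (js : List B) (f : A → B → Lin (Gen V)) →
           (∑[ i ∈ is ] ∑[ j ∈ js ] f i j) ≈[ V ] (∑[ j ∈ js ] ∑[ i ∈ is ] f i j)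
  ∑-swap []       js f = ≈-sym (∑-0 js (λ _ → ≈-refl))
  ∑-swap (i ∷ is) js f = ≈-trans (⊕-congˡ {∑ js (f i)} (∑-swap is js f)) (≈-sym (∑-⊕ js (f i) _))

  ∑-↭ : ∀ {is js : List A} (f : A → Lin (Gen V)) → is ↭ js → ∑ is f ≈[ V ] ∑ js f
  ∑-↭ f ↭refl          = ≈-refl
  ∑-↭ f (prep i p)     = ⊕-congˡ {f i} (∑-↭ f p)
  ∑-↭ f (↭swap i j p)  = ≈-trans (⊕-congˡ {f i} (⊕-congˡ {f j} (∑-↭ f p))) (⊕-swapˡ (f i) (f j) _)
  ∑-↭ f (↭trans p q)   = ≈-trans (∑-↭ f p) (∑-↭ f q)

  linear-cong : {f f′ : G → Lin (Gen V)} → (∀ g → f g ≈[ V ] f′ g) → ∀ x → linear f x ≈[ V ] linear f′ x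
  linear-cong e x = ∑-cong x (λ (q , g) → •-cong q (e g))

  linear-⊕ʳ : ∀ (f h : G → Lin (Gen V)) x → linear (λ g → f g ⊕ h g) x ≈[ V ] linear f x ⊕ linear h x
  linear-⊕ʳ f h x = ≈-trans (≡⇒≈ (∑-≗ (λ (q , g) → •-⊕ q (f g) (h g)) x)) (∑-⊕ x _ _)

  linear-∑ʳ : ∀ (is : List A) (f : G → A → Lin (Gen V)) x →
              linear (λ g → ∑ is (f g)) x ≈[ V ] (∑[ i ∈ is ] linear (λ g → f g i) x)
  linear-∑ʳ is f x = ≈-trans (≡⇒≈ (∑-≗ (λ (q , g) → ∑-• q is (f g)) x)) (∑-swap x is _)

  linear-swap : ∀ (f : G → H → Lin (Gen V)) x y →
                linear (λ g → linear (f g) y) x ≈[ V ] linear (λ h → linear (λ g → f g h) x) y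
  linear-swap f x y = ≈-trans (linear-∑ʳ y (λ g (q , h) → q • f g h) x)
    (≡⇒≈ (∑-≗ (λ (q , h) → linear-•ʳ q (λ g → f g h) x) y))

  linear-0ʳ : {f : G → Lin (Gen V)} → (∀ g → f g ≈[ V ] []) → ∀ x → linear f x ≈[ V ] []
  linear-0ʳ e x = ∑-0 x (λ (q , g) → •-cong q (e g))

linear-resp : {V W : Space ℓ} (f : Gen V → Lin (Gen W)) →
              (∀ {r} → Relator V r → linear f r ≈[ W ] []) →
              ∀ {x y} → x ≈[ V ] y → linear f x ≈[ W ] linear f y
linear-resp f k ≈-refl = ≈-refl
linear-resp f k (≈-sym e) = ≈-sym (linear-resp f k e)
linear-resp f k (≈-trans e e′) = ≈-trans (linear-resp f k e) (linear-resp f k e′)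
linear-resp f k (⊕-cong {x} {x′} {y} {y′} e e′) =
  ≈-trans (≡⇒≈ (linear-⊕ f x y)) (≈-trans (⊕-cong (linear-resp f k e) (linear-resp f k e′)) (≡⇒≈ (sym (linear-⊕ f x′ y′))))
linear-resp f k (⊕-comm x y) =
  ≈-trans (≡⇒≈ (linear-⊕ f x y)) (≈-trans (⊕-comm (linear f x) (linear f y)) (≡⇒≈ (sym (linear-⊕ f y x))))
linear-resp f k (collect p q g) =
  ≈-trans (≡⇒≈ (cong (p • f g ++_) (⊕-identityʳ _))) (≈-trans (≈-sym (+-• p q (f g))) (≡⇒≈ (sym (⊕-identityʳ _))))
linear-resp f k (zero-coef g) = ≈-trans (≡⇒≈ (⊕-identityʳ _)) (0• (f g))
linear-resp f k (relator {r} c ρ) = ≈-trans (≡⇒≈ (linear-• f c r)) (•-cong c (k ρ))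

linear-resp-∼ : {G : Set ℓ} {W : Space ℓ} (f : G → Lin (Gen W)) →
                ∀ {x y} → x ∼ y → linear f x ≈[ W ] linear f y
linear-resp-∼ {G = G} f = linear-resp {V = Free G} f (λ ())

-- The identity on generators extends to a well defined linear map from the free space to `V`, and
-- by `linear-id` this extension leaves every combination as it is.
∼⇒≈ : {V : Space ℓ} {x y : Lin (Gen V)} → x ∼ y → x ≈[ V ] y
∼⇒≈ {V = V} {x} {y} e = subst₂ (Eq V) (linear-id x) (linear-id y) (linear-resp-∼ ⟦_⟧ e)

mapGen-cong : {G H : Set ℓ} (f : G → H) {x y : Lin G} → x ∼ y → mapGen f x ∼ mapGen f y
mapGen-cong f = linear-resp-∼ (⟦_⟧ ∘ f)

-- A sum over part of a list is written as a sum over the whole list with guarded terms. Conditions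
-- on the indices can then be moved between nested sums without changing the ranges.
guard : Dec P → Lin G → Lin G
guard (yes _) x = x
guard (no _)  x = []

linear-guard : (f : G → Lin H) (d : Dec P) (x : Lin G) → linear f (guard d x) ≡ guard d (linear f x)
linear-guard f (yes _) x = refl
linear-guard f (no _)  x = refl

•-guard : ∀ c (d : Dec P) (x : Lin G) → c • guard d x ≡ guard d (c • x)
•-guard c (yes _) x = refl
•-guard c (no _)  x = refl

guard-⊕ : ∀ (d : Dec P) (x y : Lin G) → guard d (x ⊕ y) ≡ guard d x ⊕ guard d y
guard-⊕ (yes _) x y = refl
guard-⊕ (no _)  x y = refl

guard-no : ∀ {x : Lin G} (d : Dec P) → ¬ P → guard d x ≡ []
guard-no (yes p) ¬p = contradiction p ¬p
guard-no (no _)  ¬p = refl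

guard-yes : ∀ {x : Lin G} (d : Dec P) → P → guard d x ≡ x
guard-yes (yes _) p = refl
guard-yes (no ¬p) p = contradiction p ¬p

guard-× : ∀ (d : Dec P) (e : Dec Q) (x : Lin G) → guard d (guard e x) ≡ guard (d ×-dec e) x
guard-× (yes _) (yes _) x = refl
guard-× (yes _) (no _)  x = refl
guard-× (no _)  (yes _) x = refl
guard-× (no _)  (no _)  x = refl

∑-filter : {P : A → Set ℓ′} (P? : ∀ i → Dec (P i)) (is : List A) (f : A → Lin G) →
           ∑ (filter P? is) f ≡ (∑[ i ∈ is ] guard (P? i) (f i))
∑-filter P? []       f = refl
∑-filter P? (i ∷ is) f with P? i
... | yes _ = cong (f i ⊕_) (∑-filter P? is f)
... | no _  = ∑-filter P? is f

module _ {V : Space ℓ} where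

  guard-cong : ∀ {x y : Lin (Gen V)} (d : Dec P) (e : Dec Q) → (P → Q) → (Q → P) → (P → x ≈[ V ] y) →
               guard d x ≈[ V ] guard e y
  guard-cong (yes p) (yes q) to from eq = eq p
  guard-cong (yes p) (no ¬q) to from eq = contradiction (to p) ¬q
  guard-cong (no ¬p) (yes q) to from eq = contradiction (from q) ¬p
  guard-cong (no ¬p) (no ¬q) to from eq = ≈-refl

  guard-∑ : ∀ (d : Dec P) (is : List A) (f : A → Lin (Gen V)) → guard d (∑ is f) ≈[ V ] (∑[ i ∈ is ] guard d (f i))
  guard-∑ (yes _) is f = ≈-refl
  guard-∑ (no _)  is f = ≈-sym (∑-0 is (λ _ → ≈-refl))

module _ {V : Space ℓ} {G H : Set ℓ} (f : G → H → Lin (Gen V)) where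

  bilinear-cong : ∀ {x x′ y y′} → x ∼ x′ → y ∼ y′ → bilinear f x y ≈[ V ] bilinear f x′ y′
  bilinear-cong {x} {x′} {y} {y′} e e′ =
    ≈-trans (linear-resp-∼ (λ u → linear (f u) y) e) (linear-cong (λ u → linear-resp-∼ (f u) e′) x′)

  bilinear-∑ʳ : ∀ (is : List A) x (h : A → Lin H) → bilinear f x (∑ is h) ≈[ V ] (∑[ i ∈ is ] bilinear f x (h i))
  bilinear-∑ʳ is x h = ≈-trans (≡⇒≈ (linear-≗ (λ u → linear-∑ (f u) is h) x)) (linear-∑ʳ is (λ u i → linear (f u) (h i)) x)

  bilinear-⊕ʳ : ∀ x y y′ → bilinear f x (y ⊕ y′) ≈[ V ] bilinear f x y ⊕ bilinear f x y′
  bilinear-⊕ʳ x y y′ = ≈-trans (≡⇒≈ (linear-≗ (λ u → linear-⊕ (f u) y y′) x)) (linear-⊕ʳ (λ u → linear (f u) y) (λ u → linear (f u) y′) x)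

module _ {G H C : Set ℓ} (f : G → H → Lin C) where

  bilinear-⊕ˡ : ∀ x x′ y → bilinear f (x ⊕ x′) y ≡ bilinear f x y ⊕ bilinear f x′ y
  bilinear-⊕ˡ x x′ y = linear-⊕ (λ u → linear (f u) y) x x′

  bilinear-∑ˡ : ∀ (is : List A) (h : A → Lin G) y → bilinear f (∑ is h) y ≡ (∑[ i ∈ is ] bilinear f (h i) y)
  bilinear-∑ˡ is h y = linear-∑ (λ u → linear (f u) y) is h

  bilinear-•ˡ : ∀ c x y → bilinear f (c • x) y ≡ c • bilinear f x y
  bilinear-•ˡ c x y = linear-• (λ u → linear (f u) y) c x

  bilinear-•ʳ : ∀ c x y → bilinear f x (c • y) ≡ c • bilinear f x y
  bilinear-•ʳ c x y = trans (linear-≗ (λ u → linear-• (f u) c y) x) (linear-•ʳ c (λ u → linear (f u) y) x)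

module _ {V : Space ℓ} {G H : Set ℓ} (f : G → H → Lin (Gen V)) where

  bilinear-linearʳ : ∀ {H′ : Set ℓ} (h : H′ → Lin H) x y →
                     bilinear f x (linear h y) ≈[ V ] linear (λ w → bilinear f x (h w)) y
  bilinear-linearʳ h x y = ≈-trans (≡⇒≈ (linear-≗ (λ u → linear-linear (f u) h y) x)) (linear-swap (λ u w → linear (f u) (h w)) x y)

  bilinear-linear : ∀ {G′ H′ : Set ℓ} (g : G′ → Lin G) (h : H′ → Lin H) x y →
                    bilinear f (linear g x) (linear h y) ≈[ V ] bilinear (λ u w → bilinear f (g u) (h w)) x y
  bilinear-linear g h x y = ≈-trans (≡⇒≈ (linear-linear (λ u → linear (f u) (linear h y)) g x))
    (linear-cong (λ u → bilinear-linearʳ h (g u) y) x)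

linear-bilinear : {G H C D : Set ℓ} (h : C → Lin D) (f : G → H → Lin C) → ∀ x y →
                  linear h (bilinear f x y) ≡ bilinear (λ u w → linear h (f u w)) x y
linear-bilinear h f x y = trans (linear-linear h (λ u → linear (f u) y) x) (linear-≗ (λ u → linear-linear h (f u) y) x)

bilinear-cong-≗ : {V : Space ℓ} {G H : Set ℓ} {f f′ : G → H → Lin (Gen V)} → (∀ u w → f u w ≈[ V ] f′ u w) → ∀ x y →
                  bilinear f x y ≈[ V ] bilinear f′ x y
bilinear-cong-≗ e x y = linear-cong (λ u → linear-cong (e u) y) x

-- Arcs

odd : ℕ → Bool
odd zero    = false
odd (suc n) = not (odd n)

-- The arrow with ends at the boundary positions l and l + 2c + 1.  It is backward
-- iff l is odd, and c is the weight of the region it cuts off.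
Arc : Set
Arc = ℕ × ℕ

-- `1 ≤ c` and `2 + c ≤ N` exclude the trivial arrows: those to the side just before or just after
-- the vertex, and the one from v₀ to the root side. The last condition keeps the upper end
-- `l + 2c + 1` at or before the position `2N - 1` of the root side.
Valid : ℕ → Arc → Set
Valid N (l , c) = 1 ≤ c × 2 + c ≤ N × 2 + l + 2 * c ≤ 2 * N

valid? : ∀ N α → Dec (Valid N α)
valid? N (l , c) = (1 ≤? c) ×-dec (2 + c ≤? N) ×-dec (2 + l + 2 * c ≤? 2 * N)

arcs : ℕ → List Arc
arcs N = filter (valid? N) (cartesianProduct (upTo (2 * N)) (upTo N))

infix 4 _⊃_
-- In `⊃` the upper ends are compared without their common summand 1, and `c′ < c` says that the
-- nested arcs differ. Arcs with a common end may be disjoint or nested.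
_⊃_ Disjoint Before : Arc → Arc → Set
(l , c) ⊃ (l′ , c′) = l ≤ l′ × l′ + 2 * c′ ≤ l + 2 * c × c′ < c
Disjoint (l , c) (l′ , c′) = 1 + l + 2 * c ≤ l′ ⊎ 1 + l′ + 2 * c′ ≤ l
-- For arrows of one dissection: α may come after γ in a linear order of the regions.
Before γ α = Disjoint γ α ⊎ γ ⊃ α

_⊃?_ : ∀ α β → Dec (α ⊃ β)
(l , c) ⊃? (l′ , c′) = (l ≤? l′) ×-dec (l′ + 2 * c′ ≤? l + 2 * c) ×-dec (c′ <? c)

disjoint? : ∀ α β → Dec (Disjoint α β)
disjoint? (l , c) (l′ , c′) = (1 + l + 2 * c ≤? l′) ⊎-dec (1 + l′ + 2 * c′ ≤? l)

before? : ∀ γ α → Dec (Before γ α)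
before? γ α = disjoint? γ α ⊎-dec (γ ⊃? α)

Over Meets : Arc → ℕ → Set
Over  (l , c) j = l < 1 + 2 * j × 1 + 2 * j < 1 + l + 2 * c
Meets (l , c) j = l ≤ 1 + 2 * j × 1 + 2 * j ≤ 1 + l + 2 * c

Below : Maybe Arc → Arc → Set
Below nothing  β = ⊤
Below (just α) β = α ⊃ β

MeetsRegion : Maybe Arc → ℕ → Set
MeetsRegion nothing  j = ⊤
MeetsRegion (just α) j = Meets α j

Conceals : Maybe Arc → ℕ → Arc → Set
Conceals r j β = Below r β × Over β j

Visible : List Arc → Maybe Arc → ℕ → Set
Visible as r j = MeetsRegion r j × ¬ Any (Conceals r j) as

over? : ∀ α j → Dec (Over α j)
over? (l , c) j = (l <? 1 + 2 * j) ×-dec (1 + 2 * j <? 1 + l + 2 * c)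

below? : ∀ r β → Dec (Below r β)
below? nothing  β = yes tt
below? (just α) β = α ⊃? β

meets? : ∀ r j → Dec (MeetsRegion r j)
meets? nothing        j = yes tt
meets? (just (l , c)) j = (l ≤? 1 + 2 * j) ×-dec (1 + 2 * j ≤? 1 + l + 2 * c)

visible? : ∀ as r j → Dec (Visible as r j)
visible? as r j = meets? r j ×-dec ¬? (any? (λ β → below? r β ×-dec over? β j) as)

-- Decorations of the regions, selected by position

select : {P : ℕ → Set} → (∀ j → Dec (P j)) → ℕ → List X → List X
select P? k []       = []
select P? k (x ∷ xs) = if does (P? k) then x ∷ select P? (suc k) xs else select P? (suc k) xs

turn : Maybe Arc → List X → List X
turn nothing        xs = xs
turn (just (l , _)) xs = if odd l then reverse xs else xs

-- The counterpart of `regionLabels` without a polygon: `xs` may be any list, in particular the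
-- result of an earlier cut.
labels : List Arc → Maybe Arc → List X → List X
labels as r xs = turn r (select (visible? as r) 0 xs)

-- π_α^rt and π_α^co.
rt co : Arc → List X → List X
rt α = labels [ α ] nothing
co α = labels [ α ] (just α)

module _ {P Q : ℕ → Set} (P? : ∀ j → Dec (P j)) (Q? : ∀ j → Dec (Q j)) where

  select-cong : ∀ k m (xs : List X) → (∀ i → i < length xs → P (k + i) ⇔ Q (m + i)) →
                select P? k xs ≡ select Q? m xs
  select-cong k m []       e = refl
  select-cong k m (x ∷ xs) e
    rewrite does-⇔ (subst₂ (λ i j → P i ⇔ Q j) (+-identityʳ k) (+-identityʳ m) (e 0 (s≤s z≤n))) (P? k) (Q? m)
          | select-cong (suc k) (suc m) xs
              (λ i i< → subst₂ (λ i j → P i ⇔ Q j) (+-suc k i) (+-suc m i) (e (suc i) (s≤s i<)))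
    = refl

module _ {P : ℕ → Set} (P? : ∀ j → Dec (P j)) where

  select-++ : ∀ k (xs ys : List X) → select P? k (xs ++ ys) ≡ select P? k xs ++ select P? (k + length xs) ys
  select-++ k []       ys = cong (λ i → select P? i ys) (sym (+-identityʳ k))
  select-++ k (x ∷ xs) ys with does (P? k)
  ... | true  = cong (x ∷_) (trans (select-++ (suc k) xs ys)
                  (cong (λ i → select P? (suc k) xs ++ select P? i ys) (sym (+-suc k (length xs)))))
  ... | false = trans (select-++ (suc k) xs ys)
                  (cong (λ i → select P? (suc k) xs ++ select P? i ys) (sym (+-suc k (length xs))))

  select-none : ∀ k (xs : List X) → (∀ i → i < length xs → ¬ P (k + i)) → select P? k xs ≡ []
  select-none k []       e = refl
  select-none k (x ∷ xs) e with P? k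
  ... | yes p = ⊥-elim (e 0 (s≤s z≤n) (subst P (sym (+-identityʳ k)) p))
  ... | no _  = select-none (suc k) xs (λ i i< → e (suc i) (s≤s i<) ∘ subst P (sym (+-suc k i)))

  select-every : ∀ k (xs : List X) → (∀ i → i < length xs → P (k + i)) → select P? k xs ≡ xs
  select-every k []       e = refl
  select-every k (x ∷ xs) e with P? k
  ... | yes _ = cong (x ∷_) (select-every (suc k) xs (λ i i< → subst P (+-suc k i) (e (suc i) (s≤s i<))))
  ... | no ¬p = ⊥-elim (¬p (subst P (+-identityʳ k) (e 0 (s≤s z≤n))))

module _ {P Q : ℕ → Set} (P? : ∀ j → Dec (P j)) (Q? : ∀ j → Dec (Q j)) where

  select-reverse : ∀ k m (xs : List X) → (∀ i j → suc (i + j) ≡ length xs → P (k + i) ⇔ Q (m + j)) →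
                   select P? k (reverse xs) ≡ reverse (select Q? m xs)
  select-reverse k m []       e = refl
  select-reverse k m (x ∷ xs) e = begin
    select P? k (reverse (x ∷ xs))
      ≡⟨ cong (select P? k) (unfold-reverse x xs) ⟩
    select P? k (reverse xs ++ [ x ])
      ≡⟨ select-++ P? k (reverse xs) [ x ] ⟩
    select P? k (reverse xs) ++ select P? (k + length (reverse xs)) [ x ]
      ≡⟨ cong₂ (λ u n → u ++ select P? (k + n) [ x ])
               (select-reverse k (suc m) xs (λ i j s → subst (λ n → P (k + i) ⇔ Q n) (+-suc m j)
                  (e i (suc j) (cong suc (trans (+-suc i j) s)))))
               (length-reverse xs) ⟩
    reverse (select Q? (suc m) xs) ++ select P? (k + length xs) [ x ]
      ≡⟨ last ⟩
    reverse (select Q? m (x ∷ xs)) ∎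
    where
    open ≡-Reasoning
    last : reverse (select Q? (suc m) xs) ++ select P? (k + length xs) [ x ] ≡ reverse (select Q? m (x ∷ xs))
    last rewrite does-⇔ (subst (λ n → P (k + length xs) ⇔ Q n) (+-identityʳ m)
                           (e (length xs) 0 (cong suc (+-identityʳ _)))) (P? (k + length xs)) (Q? m)
      with does (Q? m)
    ... | true  = sym (unfold-reverse x (select Q? (suc m) xs))
    ... | false = ++-identityʳ _

Visible-cong : ∀ {as as′ r r′ j j′} → MeetsRegion r j ⇔ MeetsRegion r′ j′ →
               Any (Conceals r j) as ⇔ Any (Conceals r′ j′) as′ → Visible as r j ⇔ Visible as′ r′ j′
Visible-cong m h = mk⇔ (λ (t , ¬p) → Equivalence.to m t , ¬p ∘ Equivalence.from h)
                       (λ (t , ¬p) → Equivalence.from m t , ¬p ∘ Equivalence.to h)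

labels-↭ : ∀ {as as′} → as ↭ as′ → ∀ r (xs : List X) → labels as r xs ≡ labels as′ r xs
labels-↭ {as = as} {as′} p r xs = cong (turn r) (select-cong (visible? as r) (visible? as′ r) 0 0 xs
  (λ i _ → Visible-cong {as} {as′} {r} {r} {i} {i} (mk⇔ id id) (mk⇔ (↭.Any-resp-↭ p) (↭.Any-resp-↭ (↭-sym p)))))

halve : ∀ n → ∃ λ b → n ≡ (if odd n then 1 else 0) + 2 * b
halve zero    = 0 , refl
halve (suc n) with odd n | halve n
... | true  | b , e = suc b , trans (cong suc e) (sym (*-suc 2 b))
... | false | b , e = b , cong suc e

odd-+2* : ∀ m k → odd (m + 2 * k) ≡ odd m
odd-+2* m zero    = cong odd (+-identityʳ m)
odd-+2* m (suc k) = trans (cong odd (trans (cong (m +_) (*-suc 2 k)) (trans (+-suc m _) (cong suc (+-suc m _)))))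
  (trans (not-involutive _) (odd-+2* m k))

odd-+ : ∀ m n → odd (m + n) ≡ odd m xor odd n
odd-+ zero    n = refl
odd-+ (suc m) n = trans (cong not (odd-+ m n)) (not-distribˡ-xor (odd m) (odd n))

-- The root piece of an arc

-- Position `p` of the root piece is position `q` of the whole polygon. In the root piece the arc
-- has shrunk to the step from `l` to `l + 1`, so that all later positions differ by the `2c`
-- positions cut away.
Moved : ℕ → ℕ → ℕ → ℕ → Set
Moved l c p q = (p ≤ l × q ≡ p) ⊎ (l < p × q ≡ p + 2 * c)

-- The graph of `embed`, expressed by the two ends of the arc. As a formula of linear arithmetic it
-- can be handed to `lia`, unlike `embed` with its case distinction.
Embeds : Arc → Arc → Arc → Set
Embeds (l , c) (l′ , c′) (m , d) = Moved l c l′ m × Moved l c (1 + l′ + 2 * c′) (1 + m + 2 * d)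

-- An arc of rt α, seen in the undissected polygon.
embed : Arc → Arc → Arc
embed (l , c) (l′ , c′) with 1 + l′ + 2 * c′ ≤? l | l′ ≤? l
... | yes _ | _     = l′ , c′
... | no _  | yes _ = l′ , c′ + c
... | no _  | no _  = l′ + 2 * c , c′

variable
  n : ℕ

-- A formula with a leading colon evaluates to the predicate of the same name, so that `lia` applies
-- directly to facts about arcs.
:Moved : Term n → Term n → Term n → Term n → Formula n
:Moved l c p q = (p :≤ l :∧ q :≡ p) :∨ (l :< p :∧ q :≡ p :+ 2 :* c)

:Embeds : Term n → Term n → Term n → Term n → Term n → Term n → Formula n
:Embeds l c l′ c′ m d = :Moved l c l′ m :∧ :Moved l c (# 1 :+ l′ :+ 2 :* c′) (# 1 :+ m :+ 2 :* d)

:⊃ :Disjoint :Before : Term n → Term n → Term n → Term n → Formula n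
:⊃ l c l′ c′ = l :≤ l′ :∧ l′ :+ 2 :* c′ :≤ l :+ 2 :* c :∧ c′ :< c
:Disjoint l c l′ c′ = # 1 :+ l :+ 2 :* c :≤ l′ :∨ # 1 :+ l′ :+ 2 :* c′ :≤ l
:Before l c l′ c′ = :Disjoint l c l′ c′ :∨ :⊃ l c l′ c′

:Over :Meets : Term n → Term n → Term n → Formula n
:Over l c j = l :< # 1 :+ 2 :* j :∧ # 1 :+ 2 :* j :< # 1 :+ l :+ 2 :* c
:Meets l c j = l :≤ # 1 :+ 2 :* j :∧ # 1 :+ 2 :* j :≤ # 1 :+ l :+ 2 :* c

:Valid : Term n → Term n → Term n → Formula n
:Valid N l c = # 1 :≤ c :∧ # 2 :+ c :≤ N :∧ # 2 :+ l :+ 2 :* c :≤ 2 :* N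

embeds : ∀ α γ → Embeds α γ (embed α γ)
embeds (l , c) (l′ , c′) with 1 + l′ + 2 * c′ ≤? l | l′ ≤? l
... | yes h | _ = inj₁ (lia 3 (λ l l′ c′ → # 1 :+ l′ :+ 2 :* c′ :≤ l :⇒ l′ :≤ l) l l′ c′ h , refl) , inj₁ (h , refl)
... | no h  | yes h′ = inj₁ (h′ , refl) ,
  inj₂ (≰⇒> h , lia 3 (λ l′ c′ c → # 1 :+ l′ :+ 2 :* (c′ :+ c) :≡ # 1 :+ l′ :+ 2 :* c′ :+ 2 :* c) l′ c′ c)
... | no h  | no h′ = inj₂ (≰⇒> h′ , refl) ,
  inj₂ (≰⇒> h , lia 3 (λ l′ c′ c → # 1 :+ (l′ :+ 2 :* c) :+ 2 :* c′ :≡ # 1 :+ l′ :+ 2 :* c′ :+ 2 :* c) l′ c′ c)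

Embeds-functional : ∀ α γ β β′ → Embeds α γ β → Embeds α γ β′ → β ≡ β′
Embeds-functional (l , c) (l′ , c′) (m , d) (m′ , d′) e e′ = uncurry (cong₂ _,_)
  (lia 8 (λ l c l′ c′ m d m′ d′ → :Embeds l c l′ c′ m d :⇒ :Embeds l c l′ c′ m′ d′ :⇒ m :≡ m′ :∧ d :≡ d′)
    l c l′ c′ m d m′ d′ e e′)

Embeds-injective : ∀ α β γ γ′ → Embeds α γ β → Embeds α γ′ β → γ ≡ γ′
Embeds-injective (l , c) (m , d) (l′ , c′) (l″ , c″) e e′ = uncurry (cong₂ _,_)
  (lia 8 (λ m d l c l′ c′ l″ c″ → :Embeds l c l′ c′ m d :⇒ :Embeds l c l″ c″ m d :⇒ l′ :≡ l″ :∧ c′ :≡ c″)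
    m d l c l′ c′ l″ c″ e e′)

embed-injective : ∀ α {γ γ′} → embed α γ ≡ embed α γ′ → γ ≡ γ′
embed-injective α {γ} {γ′} eq =
  Embeds-injective α (embed α γ) γ γ′ (embeds α γ) (subst (Embeds α γ′) (sym eq) (embeds α γ′))

Embeds-⊃ : ∀ α γ β γ′ β′ → Embeds α γ γ′ → Embeds α β β′ → (γ ⊃ β) ⇔ (γ′ ⊃ β′)
Embeds-⊃ (l , c) (l′ , c′) (l″ , c″) (m , d) (m′ , d′) e e′ = mk⇔
  (lia 10 (λ l c l′ c′ l″ c″ m d m′ d′ → :Embeds l c l′ c′ m d :⇒ :Embeds l c l″ c″ m′ d′ :⇒ :⊃ l′ c′ l″ c″ :⇒ :⊃ m d m′ d′)
    l c l′ c′ l″ c″ m d m′ d′ e e′)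
  (lia 10 (λ m d m′ d′ l′ c′ l″ c″ l c → :Embeds l c l′ c′ m d :⇒ :Embeds l c l″ c″ m′ d′ :⇒ :⊃ m d m′ d′ :⇒ :⊃ l′ c′ l″ c″)
    m d m′ d′ l′ c′ l″ c″ l c e e′)

embed-⊃ : ∀ α γ β → (γ ⊃ β) ⇔ (embed α γ ⊃ embed α β)
embed-⊃ α γ β = Embeds-⊃ α γ β (embed α γ) (embed α β) (embeds α γ) (embeds α β)

Embeds-Disjoint : ∀ α γ β γ′ β′ → Embeds α γ γ′ → Embeds α β β′ → Disjoint γ β ⇔ Disjoint γ′ β′
Embeds-Disjoint (l , c) (l′ , c′) (l″ , c″) (m , d) (m′ , d′) e e′ = mk⇔
  (lia 10 (λ l c l′ c′ l″ c″ m d m′ d′ → :Embeds l c l′ c′ m d :⇒ :Embeds l c l″ c″ m′ d′ :⇒ :Disjoint l′ c′ l″ c″ :⇒ :Disjoint m d m′ d′)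
    l c l′ c′ l″ c″ m d m′ d′ e e′)
  (lia 10 (λ m d m′ d′ l′ c′ l″ c″ l c → :Embeds l c l′ c′ m d :⇒ :Embeds l c l″ c″ m′ d′ :⇒ :Disjoint m d m′ d′ :⇒ :Disjoint l′ c′ l″ c″)
    m d m′ d′ l′ c′ l″ c″ l c e e′)

embed-Disjoint : ∀ α γ β → Disjoint γ β ⇔ Disjoint (embed α γ) (embed α β)
embed-Disjoint α γ β = Embeds-Disjoint α γ β (embed α γ) (embed α β) (embeds α γ) (embeds α β)

embed-Before : ∀ α γ β → Before γ β ⇔ Before (embed α γ) (embed α β)
embed-Before α γ β = mk⇔
  (λ { (inj₁ h) → inj₁ (Equivalence.to (embed-Disjoint α γ β) h) ; (inj₂ h) → inj₂ (Equivalence.to (embed-⊃ α γ β) h) })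
  (λ { (inj₁ h) → inj₁ (Equivalence.from (embed-Disjoint α γ β) h) ; (inj₂ h) → inj₂ (Equivalence.from (embed-⊃ α γ β) h) })

-- No end of an embedded arc lies strictly between the ends of `α`, because these are the images of
-- two neighbouring positions. So the arc lies beside `α` or around it; that it is `α` itself is
-- ruled out by `1 ≤ proj₂ γ`.
Embeds-before : ∀ α γ γ′ → Embeds α γ γ′ → 1 ≤ proj₂ α → 1 ≤ proj₂ γ → Before γ′ α
Embeds-before (l , c) (l′ , c′) (m , d) =
  lia 6 (λ m d l′ c′ l c → :Embeds l c l′ c′ m d :⇒ # 1 :≤ c :⇒ # 1 :≤ c′ :⇒ :Before m d l c) m d l′ c′ l c

embed-before : ∀ α γ → 1 ≤ proj₂ α → 1 ≤ proj₂ γ → Before (embed α γ) α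
embed-before α γ = Embeds-before α γ (embed α γ) (embeds α γ)

Embeds-valid : ∀ N′ α γ γ′ → Embeds α γ γ′ → 1 ≤ proj₂ α → Valid N′ γ → Valid (N′ + proj₂ α) γ′
Embeds-valid N′ (l , c) (l′ , c′) (m , d) =
  lia 7 (λ m d l′ c′ l c N′ → :Embeds l c l′ c′ m d :⇒ # 1 :≤ c :⇒ :Valid N′ l′ c′ :⇒ :Valid (N′ :+ c) m d) m d l′ c′ l c N′

embed-valid : ∀ N′ α γ → 1 ≤ proj₂ α → Valid N′ γ → Valid (N′ + proj₂ α) (embed α γ)
embed-valid N′ α γ = Embeds-valid N′ α γ (embed α γ) (embeds α γ)

-- An arc in front of `α` is its own preimage, one behind `α` is moved back by `2c`, and one around
-- `α` loses `c` of its weight.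
embed-surjective : ∀ N′ α γ → Valid (N′ + proj₂ α) α → Valid (N′ + proj₂ α) γ → Before γ α →
                   ∃ λ γ′ → Valid N′ γ′ × embed α γ′ ≡ γ
embed-surjective N′ α@(l , c) γ@(m , d) vα vγ h with preimage h
  where
  Preimage : Set
  Preimage = ∃ λ γ′ → Valid N′ γ′ × Embeds α γ′ γ
  preimage : Before γ α → Preimage
  preimage (inj₁ (inj₁ h)) = (m , d) ,
    lia 5 (λ m d l c N → :Valid (N :+ c) l c :⇒ :Valid (N :+ c) m d :⇒ # 1 :+ m :+ 2 :* d :≤ l :⇒ :Valid N m d :∧ :Embeds l c m d m d) m d l c N′ vα vγ h
  -- Terms of `lia` have no subtraction, so the difference `m ∸ 2c` enters as a new variable `k`.
  preimage (inj₁ (inj₂ h)) with m≤n⇒∃[o]m+o≡n {2 * c} {m} (lia 3 (λ m l c → # 1 :+ l :+ 2 :* c :≤ m :⇒ 2 :* c :≤ m) m l c h)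
  ... | k , refl = (k , d) ,
    lia 5 (λ k d l c N → :Valid (N :+ c) l c :⇒ :Valid (N :+ c) (2 :* c :+ k) d :⇒ # 1 :+ l :+ 2 :* c :≤ 2 :* c :+ k :⇒ :Valid N k d :∧ :Embeds l c k d (2 :* c :+ k) d) k d l c N′ vα vγ h
  preimage (inj₂ h) with m≤n⇒∃[o]m+o≡n (<⇒≤ (proj₂ (proj₂ h)))
  ... | k , refl = (m , k) ,
    lia 5 (λ m k l c N → :Valid (N :+ c) l c :⇒ :Valid (N :+ c) m (c :+ k) :⇒ :⊃ m (c :+ k) l c :⇒ :Valid N m k :∧ :Embeds l c m k m (c :+ k)) m k l c N′ vα vγ h
... | γ′ , v , e = γ′ , v , Embeds-functional α γ′ _ _ (embeds α γ′) e

:Shifted : Term n → Term n → Term n → Term n → Formula n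
:Shifted a c i j = (i :< a :∧ j :≡ i) :∨ (a :≤ i :∧ j :≡ i :+ c)

Shifted : ℕ → ℕ → ℕ → ℕ → Set
Shifted a c i j = (i < a × j ≡ i) ⊎ (a ≤ i × j ≡ i + c)

:Ceil : Term n → Term n → Formula n
:Ceil a l = 2 :* a :≡ l :∨ 2 :* a :≡ # 1 :+ l

-- For an arc of either direction with lower end `l`, the sides wholly beyond it are `a`, ...,
-- `a + c - 1`, where `a` is half of `l` rounded up. An alternative of two equations replaces the
-- division.
Ceil : ℕ → ℕ → Set
Ceil a l = 2 * a ≡ l ⊎ 2 * a ≡ 1 + l

ceil : ∀ l → ∃ λ a → Ceil a l
ceil l with odd l | halve l
... | true  | b , e = suc b , inj₂ (trans (*-suc 2 b) (cong suc (sym e)))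
... | false | b , e = b , inj₁ (sym e)

Embeds-Over : ∀ α γ γ′ → Embeds α γ γ′ → ∀ {a i j} → Ceil a (proj₁ α) → Shifted a (proj₂ α) i j → Over γ i ⇔ Over γ′ j
Embeds-Over (l , c) (l′ , c′) (m , d) e {a} {i} {j} k s = mk⇔
  (lia 9 (λ j m d a i l′ c′ l c → :Embeds l c l′ c′ m d :⇒ :Ceil a l :⇒ :Shifted a c i j :⇒ :Over l′ c′ i :⇒ :Over m d j)
    j m d a i l′ c′ l c e k s)
  (lia 9 (λ j m d a i l′ c′ l c → :Embeds l c l′ c′ m d :⇒ :Ceil a l :⇒ :Shifted a c i j :⇒ :Over m d j :⇒ :Over l′ c′ i)
    j m d a i l′ c′ l c e k s)

Embeds-Meets : ∀ α γ γ′ → Embeds α γ γ′ → ∀ {a i j} → Ceil a (proj₁ α) → Shifted a (proj₂ α) i j → Meets γ i ⇔ Meets γ′ j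
Embeds-Meets (l , c) (l′ , c′) (m , d) e {a} {i} {j} k s = mk⇔
  (lia 9 (λ j m d a i l′ c′ l c → :Embeds l c l′ c′ m d :⇒ :Ceil a l :⇒ :Shifted a c i j :⇒ :Meets l′ c′ i :⇒ :Meets m d j)
    j m d a i l′ c′ l c e k s)
  (lia 9 (λ j m d a i l′ c′ l c → :Embeds l c l′ c′ m d :⇒ :Ceil a l :⇒ :Shifted a c i j :⇒ :Meets m d j :⇒ :Meets l′ c′ i)
    j m d a i l′ c′ l c e k s)

Shifted-¬Over : ∀ α {a i j} → Ceil a (proj₁ α) → Shifted a (proj₂ α) i j → ¬ Over α j
Shifted-¬Over (l , c) {a} {i} {j} =
  lia 5 (λ j a i l c → :Ceil a l :⇒ :Shifted a c i j :⇒ :¬ (:Over l c j)) j a i l c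

-- A region of the root piece that reaches a side beyond `α` extends over the whole of `α`, so that
-- `α` hides this side from it.
Embeds-conceals : ∀ α γ γ′ → Embeds α γ γ′ → 1 ≤ proj₂ α → 1 ≤ proj₂ γ → ∀ {j} → Over α j → Meets γ′ j → γ′ ⊃ α
Embeds-conceals (l , c) (l′ , c′) (m , d) e h h′ {j} =
  lia 7 (λ m d j l′ c′ l c → :Embeds l c l′ c′ m d :⇒ # 1 :≤ c :⇒ # 1 :≤ c′ :⇒ :Over l c j :⇒ :Meets m d j :⇒ :⊃ m d l c)
    m d j l′ c′ l c e h h′

split₃ : ∀ a c (xs : List X) → a + c ≤ length xs →
         ∃ λ ys → ∃ λ zs → ∃ λ ws → xs ≡ ys ++ zs ++ ws × length ys ≡ a × length zs ≡ c
split₃ zero    zero    xs       h       = [] , [] , xs , refl , refl , refl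
split₃ zero    (suc c) (x ∷ xs) (s≤s h) with split₃ zero c xs h
... | [] , zs , ws , e , e′ , e″ = [] , x ∷ zs , ws , cong (x ∷_) e , refl , cong suc e″
split₃ (suc a) c (x ∷ xs) (s≤s h) with split₃ a c xs h
... | ys , zs , ws , e , e′ , e″ = x ∷ ys , zs , ws , cong (x ∷_) e , cong suc e′ , e″

module _ {P Q : ℕ → Set} (P? : ∀ j → Dec (P j)) (Q? : ∀ j → Dec (Q j)) where

  select-cut : ∀ a c (ys zs ws : List X) → length ys ≡ a → length zs ≡ c →
               (∀ i j → Shifted a c i j → P i ⇔ Q j) → (∀ j → a ≤ j → j < a + c → ¬ Q j) →
               select P? 0 (ys ++ ws) ≡ select Q? 0 (ys ++ zs ++ ws)
  select-cut a c ys zs ws refl refl e ¬q = begin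
    select P? 0 (ys ++ ws)
      ≡⟨ select-++ P? 0 ys ws ⟩
    select P? 0 ys ++ select P? a ws
      ≡⟨ cong₂ _++_ (select-cong P? Q? 0 0 ys (λ i i< → e i i (inj₁ (i< , refl))))
           (select-cong P? Q? a (a + c) ws (λ i _ → e (a + i) (a + c + i) (inj₂ (m≤m+n a i , shift i)))) ⟩
    select Q? 0 ys ++ select Q? (a + c) ws
      ≡⟨ cong (λ u → select Q? 0 ys ++ (u ++ select Q? (a + c) ws))
           (select-none Q? a zs (λ i i< → ¬q (a + i) (m≤m+n a i) (+-monoʳ-< a i<))) ⟨
    select Q? 0 ys ++ (select Q? a zs ++ select Q? (a + c) ws)
      ≡⟨ cong (select Q? 0 ys ++_) (select-++ Q? a zs ws) ⟨
    select Q? 0 ys ++ select Q? a (zs ++ ws)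
      ≡⟨ select-++ Q? 0 ys (zs ++ ws) ⟨
    select Q? 0 (ys ++ zs ++ ws) ∎
    where
    open ≡-Reasoning
    shift : ∀ i → a + c + i ≡ a + i + c
    shift i = trans (+-assoc a c i) (trans (cong (a +_) (+-comm c i)) (sym (+-assoc a i c)))

module _ (α : Arc) (xs : List X) (vα : Valid (length xs) α) where

  private
    l c m : ℕ
    l = proj₁ α
    c = proj₂ α
    m = proj₁ (ceil l)
    isCeil : Ceil m l
    isCeil = proj₂ (ceil l)

    m+c≤N : m + c ≤ length xs
    m+c≤N = lia 4 (λ m l c N → :Ceil m l :⇒ :Valid N l c :⇒ m :+ c :≤ N) m l c (length xs) isCeil vα

    parts = split₃ m c xs m+c≤N
    ys zs ws : List X
    ys = proj₁ parts
    zs = proj₁ (proj₂ parts)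
    ws = proj₁ (proj₂ (proj₂ parts))
    xs≡ : xs ≡ ys ++ zs ++ ws
    xs≡ = proj₁ (proj₂ (proj₂ (proj₂ parts)))
    ys≡ : length ys ≡ m
    ys≡ = proj₁ (proj₂ (proj₂ (proj₂ (proj₂ parts))))
    zs≡ : length zs ≡ c
    zs≡ = proj₂ (proj₂ (proj₂ (proj₂ (proj₂ parts))))

    between⇒Over : ∀ j → m ≤ j → j < m + c → Over α j
    between⇒Over j = lia 4 (λ j m l c → :Ceil m l :⇒ m :≤ j :⇒ j :< m :+ c :⇒ :Over l c j) j m l c isCeil

  rt-cut : rt α xs ≡ ys ++ ws
  rt-cut = trans (cong (select (visible? [ α ] nothing) 0) xs≡)
    (trans (sym (select-cut (λ _ → yes tt) (visible? [ α ] nothing) m c ys zs ws ys≡ zs≡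
              (λ i j s → mk⇔ (λ _ → tt , λ { (here (_ , o)) → Shifted-¬Over α {m} {i} {j} isCeil s o }) (λ _ → tt))
              (λ j h h′ (_ , ¬v) → ¬v (here (tt , between⇒Over j h h′)))))
           (select-every (λ _ → yes tt) 0 (ys ++ ws) (λ _ _ → tt)))

  length-rt : length (rt α xs) + c ≡ length xs
  length-rt = begin
    length (rt α xs) + c              ≡⟨ cong (λ u → length u + c) rt-cut ⟩
    length (ys ++ ws) + c             ≡⟨ cong (_+ c) (length-++ ys) ⟩
    length ys + length ws + c         ≡⟨ +-assoc (length ys) (length ws) c ⟩
    length ys + (length ws + c)       ≡⟨ cong (length ys +_) (+-comm (length ws) c) ⟩
    length ys + (c + length ws)       ≡⟨ cong (λ k → length ys + (k + length ws)) zs≡ ⟨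
    length ys + (length zs + length ws) ≡⟨ cong (length ys +_) (length-++ zs) ⟨
    length ys + length (zs ++ ws)     ≡⟨ length-++ ys ⟨
    length (ys ++ zs ++ ws)           ≡⟨ cong length xs≡ ⟨
    length xs ∎
    where open ≡-Reasoning

  private
    visible-rt : ∀ as r → All (λ γ → 1 ≤ proj₂ γ) (Data.List.fromMaybe r) → ∀ i j → Shifted m c i j →
                 Visible as r i ⇔ Visible (α ∷ map (embed α) as) (Data.Maybe.map (embed α) r) j
    visible-rt as r 1≤ i j s = Visible-cong {as} {_} {r} {Data.Maybe.map (embed α) r} (meets r) (mk⇔
        (λ p → there (Any.map⁺ (Any.map (λ {β} (b , o) → Equivalence.to (below r β) b ,
                                        Equivalence.to (Embeds-Over α β (embed α β) (embeds α β) {m} {i} {j} isCeil s) o) p)))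
        (λ { (here (_ , o)) → ⊥-elim (Shifted-¬Over α {m} {i} {j} isCeil s o)
           ; (there p) → Any.map (λ {β} (b , o) → Equivalence.from (below r β) b ,
                                        Equivalence.from (Embeds-Over α β (embed α β) (embeds α β) {m} {i} {j} isCeil s) o) (Any.map⁻ p) }))
      where
      meets : ∀ r → MeetsRegion r i ⇔ MeetsRegion (Data.Maybe.map (embed α) r) j
      meets nothing  = mk⇔ id id
      meets (just γ) = Embeds-Meets α γ (embed α γ) (embeds α γ) {m} {i} {j} isCeil s
      below : ∀ r β → Below r β ⇔ Below (Data.Maybe.map (embed α) r) (embed α β)
      below nothing  β = mk⇔ id id
      below (just γ) β = embed-⊃ α γ β

    concealed : ∀ as r → All (λ γ → 1 ≤ proj₂ γ) (Data.List.fromMaybe r) → ∀ j → Over α j →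
                ¬ Visible (α ∷ map (embed α) as) (Data.Maybe.map (embed α) r) j
    concealed as nothing  _        j o (_ , ¬v) = ¬v (here (tt , o))
    concealed as (just γ) (1≤ ∷ _) j o (mt , ¬v) =
      ¬v (here (Embeds-conceals α γ (embed α γ) (embeds α γ) (proj₁ vα) 1≤ {j} o mt , o))

  odd-embed : ∀ γ → odd (proj₁ (embed α γ)) ≡ odd (proj₁ γ)
  odd-embed γ@(l′ , _) with proj₁ (embeds α γ)
  ... | inj₁ (_ , e) = cong odd e
  ... | inj₂ (_ , e) = trans (cong odd e) (odd-+2* l′ c)

  -- The sides kept by `rt α` have the same position relative to an arc as to its embedding, and the
  -- sides removed are hidden by `α` from every region of the root piece. Orientations agree because
  -- the ends of arcs move by even amounts.
  labels-rt : ∀ as r → All (λ γ → 1 ≤ proj₂ γ) (Data.List.fromMaybe r) →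
              labels as r (rt α xs) ≡ labels (α ∷ map (embed α) as) (Data.Maybe.map (embed α) r) xs
  labels-rt as r 1≤ = trans (cong (turn r) selected) (turned r _)
    where
    as′ = α ∷ map (embed α) as
    r′ = Data.Maybe.map (embed α) r
    selected : select (visible? as r) 0 (rt α xs) ≡ select (visible? as′ r′) 0 xs
    selected = trans (cong (select (visible? as r) 0) rt-cut)
      (trans (select-cut (visible? as r) (visible? as′ r′) m c ys zs ws ys≡ zs≡ (visible-rt as r 1≤)
               (λ j h h′ → concealed as r 1≤ j (between⇒Over j h h′)))
             (cong (select (visible? as′ r′) 0) (sym xs≡)))
    turned : ∀ r (us : List X) → turn r us ≡ turn (Data.Maybe.map (embed α) r) us
    turned nothing  us = refl
    turned (just γ) us rewrite odd-embed γ = refl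

-- The piece cut off by an arc

-- An arc of co α, seen in the undissected polygon.
nest : Arc → Arc → Arc
nest (l , c) (l′ , c′) = (if odd l then l + 2 * c ∸ (l′ + 2 * c′) else l + l′) , c′

-- γ = nest α β, and side i of co α is side j of the undissected polygon.
:Nests : Term n → Term n → Term n → Term n → Term n → Term n → Term n → Term n → Term n → Formula n
:Nests l c l′ c′ m d b i j =
  (l :≡ 2 :* b :∧ m :≡ l :+ l′ :∧ d :≡ c′ :∧ j :≡ b :+ i) :∨
  (l :≡ # 1 :+ 2 :* b :∧ m :+ l′ :+ 2 :* c′ :≡ l :+ 2 :* c :∧ d :≡ c′ :∧ j :+ i :≡ b :+ c)

Nests : Arc → Arc → Arc → ℕ → ℕ → ℕ → Set
Nests (l , c) (l′ , c′) (m , d) b i j =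
  (l ≡ 2 * b × m ≡ l + l′ × d ≡ c′ × j ≡ b + i) ⊎
  (l ≡ 1 + 2 * b × m + l′ + 2 * c′ ≡ l + 2 * c × d ≡ c′ × j + i ≡ b + c)

nests : ∀ α β → Valid (suc (proj₂ α)) β → ∀ b i j → proj₁ α ≡ (if odd (proj₁ α) then 1 else 0) + 2 * b →
        (odd (proj₁ α) ≡ false → j ≡ b + i) → (odd (proj₁ α) ≡ true → j + i ≡ b + proj₂ α) →
        Nests α β (nest α β) b i j
nests (l , c) (l′ , c′) v b i j e ef et with odd l
... | false = inj₁ (e , refl , refl , ef refl)
... | true  = inj₂ (e , trans (+-assoc (l + 2 * c ∸ (l′ + 2 * c′)) l′ (2 * c′)) (m∸n+n≡m
  (lia 4 (λ l c l′ c′ → :Valid (# 1 :+ c) l′ c′ :⇒ l′ :+ 2 :* c′ :≤ l :+ 2 :* c) l c l′ c′ v)) , refl , et refl)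

Nests-Over : ∀ α β γ b i j → Nests α β γ b i j → Over β i ⇔ Over γ j
Nests-Over (l , c) (l′ , c′) (m , d) b i j s = mk⇔
  (lia 9 (λ m d j i l c l′ c′ b → :Nests l c l′ c′ m d b i j :⇒ :Over l′ c′ i :⇒ :Over m d j) m d j i l c l′ c′ b s)
  (lia 9 (λ m d j i l c l′ c′ b → :Nests l c l′ c′ m d b i j :⇒ :Over m d j :⇒ :Over l′ c′ i) m d j i l c l′ c′ b s)

Nests-Meets : ∀ α β γ b i j → Nests α β γ b i j → Meets β i ⇔ Meets γ j
Nests-Meets (l , c) (l′ , c′) (m , d) b i j s = mk⇔
  (lia 9 (λ m d j i l c l′ c′ b → :Nests l c l′ c′ m d b i j :⇒ :Meets l′ c′ i :⇒ :Meets m d j) m d j i l c l′ c′ b s)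
  (lia 9 (λ m d j i l c l′ c′ b → :Nests l c l′ c′ m d b i j :⇒ :Meets m d j :⇒ :Meets l′ c′ i) m d j i l c l′ c′ b s)

Nests-⊃ : ∀ α β γ b i j → Valid (suc (proj₂ α)) β → Nests α β γ b i j → α ⊃ γ
Nests-⊃ (l , c) (l′ , c′) (m , d) b i j =
  lia 9 (λ m d j i l c l′ c′ b → :Valid (# 1 :+ c) l′ c′ :⇒ :Nests l c l′ c′ m d b i j :⇒ :⊃ l c m d) m d j i l c l′ c′ b

nest-⊃ : ∀ α β → Valid (suc (proj₂ α)) β → α ⊃ nest α β
nest-⊃ α@(l , c) β v = by (odd l) refl
  where
  b = proj₁ (halve l)
  by : ∀ o → odd l ≡ o → α ⊃ nest α β
  by false o = Nests-⊃ α β (nest α β) b 0 (b + 0) v (nests α β v b 0 (b + 0) (proj₂ (halve l))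
                 (λ _ → refl) (λ t → case trans (sym o) t of λ ()))
  by true o  = Nests-⊃ α β (nest α β) b 0 (b + c) v (nests α β v b 0 (b + c) (proj₂ (halve l))
                 (λ t → case trans (sym o) t of λ ()) (λ _ → +-identityʳ (b + c)))

⊃-irrefl : ∀ α → ¬ (α ⊃ α)
⊃-irrefl (l , c) (_ , _ , h) = <-irrefl refl h

⊃-asym : ∀ α β → α ⊃ β → ¬ (β ⊃ α)
⊃-asym (l , c) (l′ , c′) (_ , _ , h) (_ , _ , h′) = <-asym h h′

⊃-Meets : ∀ α β j → α ⊃ β → Meets β j → Meets α j
⊃-Meets (l , c) (l′ , c′) j =
  lia 5 (λ l c l′ c′ j → :⊃ l c l′ c′ :⇒ :Meets l′ c′ j :⇒ :Meets l c j) l c l′ c′ j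

-- The piece of a backward `α` has the opposite orientation, in which forward and backward arrows
-- are exchanged.
odd-nest : ∀ α β → Valid (suc (proj₂ α)) β → odd (proj₁ (nest α β)) ≡ odd (proj₁ α) xor odd (proj₁ β)
odd-nest (l , c) (l′ , c′) v with odd l in o
... | false = trans (odd-+ l l′) (cong (_xor odd l′) o)
... | true  = xor-cancel (trans (sym (odd-+ m l′)) (trans (sym (odd-+2* (m + l′) c′)) (trans (cong odd sum) (trans (odd-+2* l c) o))))
  where
  m = l + 2 * c ∸ (l′ + 2 * c′)
  sum : m + l′ + 2 * c′ ≡ l + 2 * c
  sum = trans (+-assoc m l′ (2 * c′)) (m∸n+n≡m
    (lia 4 (λ l c l′ c′ → :Valid (# 1 :+ c) l′ c′ :⇒ l′ :+ 2 :* c′ :≤ l :+ 2 :* c) l c l′ c′ v))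
  xor-cancel : ∀ {x y} → x xor y ≡ true → x ≡ not y
  xor-cancel {true}  {false} e = refl
  xor-cancel {false} {true}  e = refl

module _ {Q : ℕ → Set} (Q? : ∀ j → Dec (Q j)) where

  select-window : ∀ (ys zs ws : List X) → (∀ j → Q j → length ys ≤ j × j < length ys + length zs) →
                  select Q? 0 (ys ++ zs ++ ws) ≡ select Q? (length ys) zs
  select-window ys zs ws h = begin
    select Q? 0 (ys ++ zs ++ ws)
      ≡⟨ select-++ Q? 0 ys (zs ++ ws) ⟩
    select Q? 0 ys ++ select Q? (length ys) (zs ++ ws)
      ≡⟨ cong₂ _++_ (select-none Q? 0 ys (λ i i< q → <⇒≱ i< (proj₁ (h i q)))) (select-++ Q? (length ys) zs ws) ⟩
    select Q? (length ys) zs ++ select Q? (length ys + length zs) ws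
      ≡⟨ cong (select Q? (length ys) zs ++_)
           (select-none Q? _ ws (λ i i< q → <⇒≱ (proj₂ (h _ q)) (m≤m+n _ i))) ⟩
    select Q? (length ys) zs ++ []
      ≡⟨ ++-identityʳ _ ⟩
    select Q? (length ys) zs ∎
    where open ≡-Reasoning

module _ (α : Arc) (xs : List X) (vα : Valid (length xs) α) where

  private
    l c b : ℕ
    l = proj₁ α
    c = proj₂ α
    b = proj₁ (halve l)
    l≡ : l ≡ (if odd l then 1 else 0) + 2 * b
    l≡ = proj₂ (halve l)

    l≡′ : l ≡ 2 * b ⊎ l ≡ 1 + 2 * b
    l≡′ with odd l | l≡
    ... | true  | e = inj₂ e
    ... | false | e = inj₁ e

    b+c<N : b + suc c ≤ length xs
    b+c<N = lia 4 (λ b l c N → (l :≡ 2 :* b :∨ l :≡ # 1 :+ 2 :* b) :⇒ :Valid N l c :⇒ b :+ (# 1 :+ c) :≤ N)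
                b l c (length xs) l≡′ vα

    parts = split₃ b (suc c) xs b+c<N
    ys zs ws : List X
    ys = proj₁ parts
    zs = proj₁ (proj₂ parts)
    ws = proj₁ (proj₂ (proj₂ parts))
    xs≡ : xs ≡ ys ++ zs ++ ws
    xs≡ = proj₁ (proj₂ (proj₂ (proj₂ parts)))
    ys≡ : length ys ≡ b
    ys≡ = proj₁ (proj₂ (proj₂ (proj₂ (proj₂ parts))))
    zs≡ : length zs ≡ suc c
    zs≡ = proj₂ (proj₂ (proj₂ (proj₂ (proj₂ parts))))

    meets⇔ : ∀ j → Meets α j ⇔ (b ≤ j × j < b + suc c)
    meets⇔ j = mk⇔
      (lia 4 (λ j b l c → (l :≡ 2 :* b :∨ l :≡ # 1 :+ 2 :* b) :⇒ :Meets l c j :⇒ b :≤ j :∧ j :< b :+ (# 1 :+ c)) j b l c l≡′)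
      (lia 4 (λ j b l c → (l :≡ 2 :* b :∨ l :≡ # 1 :+ 2 :* b) :⇒ b :≤ j :∧ j :< b :+ (# 1 :+ c) :⇒ :Meets l c j) j b l c l≡′)

    window : ∀ {Q : ℕ → Set} (Q? : ∀ j → Dec (Q j)) → (∀ j → Q j → Meets α j) → select Q? 0 xs ≡ select Q? b zs
    window {Q} Q? h = trans (cong (select Q? 0) xs≡) (trans
      (select-window Q? ys zs ws (λ j q → subst₂ (λ p k → p ≤ j × j < p + k) (sym ys≡) (sym zs≡) (Equivalence.to (meets⇔ j) (h j q))))
      (cong (λ p → select Q? p zs) ys≡))

  co-cut : co α xs ≡ turn (just α) zs
  co-cut = cong (turn (just α)) (trans (window (visible? [ α ] (just α)) (λ j → proj₁)) (select-every (visible? [ α ] (just α)) b zs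
    (λ i i< → Equivalence.from (meets⇔ (b + i)) (m≤m+n b i , +-monoʳ-< b (subst (i <_) zs≡ i<)) ,
              λ { (here (h , _)) → ⊃-irrefl α h })))

  length-co : length (co α xs) ≡ suc c
  length-co = trans (cong length co-cut) (turned (odd l))
    where
    turned : ∀ o → length (if o then reverse zs else zs) ≡ suc c
    turned true  = trans (length-reverse zs) zs≡
    turned false = zs≡

  module _ (β : Arc) (vβ : Valid (suc c) β) where

    private
      γ : Arc
      γ = nest α β

      region : Maybe Arc → Arc
      region nothing  = α
      region (just _) = γ

      -- The two regions of `co α` dissected by the single arc `β`. Their counterparts in the
      -- polygon dissected by `α` and `γ` are the regions just beyond `α` and just beyond `γ`.
      data RegionOfCo : Maybe Arc → Set where
        isRoot : RegionOfCo nothing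
        isArc  : RegionOfCo (just β)

      visible-co : ∀ {r} → RegionOfCo r → ∀ i j → i ≤ c → (odd l ≡ false → j ≡ b + i) → (odd l ≡ true → j + i ≡ b + c) →
                   Visible [ β ] r i ⇔ Visible (α ∷ γ ∷ []) (just (region r)) j
      visible-co {r} k i j i≤c ef et with nests α β vβ b i j l≡ ef et
      ... | s = Visible-cong {[ β ]} {α ∷ γ ∷ []} {r} {just (region r)} {i} {j} (meets k) (conceals k)
        where
        j-range : b ≤ j × j < b + suc c
        j-range = lia 5 (λ j b i l c → i :≤ c :⇒ (j :≡ b :+ i :∨ j :+ i :≡ b :+ c) :⇒ b :≤ j :∧ j :< b :+ (# 1 :+ c))
                      j b i l c i≤c (either (odd l) refl)
          where
          either : ∀ o → odd l ≡ o → j ≡ b + i ⊎ j + i ≡ b + c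
          either false o = inj₁ (ef o)
          either true  o = inj₂ (et o)
        meets : ∀ {r} → RegionOfCo r → MeetsRegion r i ⇔ MeetsRegion (just (region r)) j
        meets isRoot = mk⇔ (λ _ → Equivalence.from (meets⇔ j) j-range) (λ _ → tt)
        meets isArc  = Nests-Meets α β γ b i j s
        conceals : ∀ {r} → RegionOfCo r →
                   Any (Conceals r i) [ β ] ⇔ Any (Conceals (just (region r)) j) (α ∷ γ ∷ [])
        conceals isRoot = mk⇔
          (λ { (here (_ , o)) → there (here (nest-⊃ α β vβ , Equivalence.to (Nests-Over α β γ b i j s) o)) })
          (λ { (here (h , _)) → ⊥-elim (⊃-irrefl α h)
             ; (there (here (_ , o))) → here (tt , Equivalence.from (Nests-Over α β γ b i j s) o) })
        conceals isArc = mk⇔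
          (λ { (here (h , _)) → ⊥-elim (⊃-irrefl β h) })
          (λ { (here (h , _)) → ⊥-elim (⊃-asym α γ (nest-⊃ α β vβ) h)
             ; (there (here (h , _))) → ⊥-elim (⊃-irrefl γ h) })

      visible⇒meets : ∀ {r} → RegionOfCo r → ∀ j → Visible (α ∷ γ ∷ []) (just (region r)) j → Meets α j
      visible⇒meets isRoot j (m , _) = m
      visible⇒meets isArc  j (m , _) = ⊃-Meets α γ j (nest-⊃ α β vβ) m

      -- For a backward `α` the sides of `co α` come in reverse order, and selecting from a reversed
      -- list reverses the selection. This reversal is absorbed by the orientation of the
      -- counterpart, whose parity is known from `odd-nest`.
      labels-co : ∀ {r} → RegionOfCo r → labels [ β ] r (co α xs) ≡ labels (α ∷ γ ∷ []) (just (region r)) xs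
      labels-co {r} k = trans (cong (labels [ β ] r) co-cut)
        (trans (by (odd l) refl) (cong (turn (just (region r))) (sym (window Q? (visible⇒meets k)))))
        where
        P? = visible? [ β ] r
        Q? = visible? (α ∷ γ ∷ []) (just (region r))
        turned : ∀ {r} → RegionOfCo r → ∀ o → odd l ≡ o → (us : List X) →
                 turn r (if o then reverse us else us) ≡ turn (just (region r)) us
        turned isRoot o e us rewrite e = refl
        turned isArc o e us rewrite trans (odd-nest α β vβ) (cong (_xor odd (proj₁ β)) e) with o | odd (proj₁ β)
        ... | true  | true  = reverse-involutive us
        ... | true  | false = refl
        ... | false | true  = refl
        ... | false | false = refl
        i≤c : ∀ {i} → i < length zs → i ≤ c
        i≤c i< = s≤s⁻¹ (subst (_ <_) zs≡ i<)
        by : ∀ o → odd l ≡ o → labels [ β ] r (if odd l then reverse zs else zs) ≡ turn (just (region r)) (select Q? b zs)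
        by true  e = trans (cong (λ o → labels [ β ] r (if o then reverse zs else zs)) e)
          (trans (cong (turn r) (select-reverse P? Q? 0 b zs (λ i j s →
            visible-co k i (b + j) (s≤s⁻¹ (subst (suc i ≤_) (trans s zs≡) (s≤s (m≤m+n i j))))
              (λ e′ → case trans (sym e) e′ of λ ())
              (λ _ → trans (+-assoc b j i) (cong (b +_) (trans (+-comm j i) (suc-injective (trans s zs≡))))))))
          (turned k true e (select Q? b zs)))
        by false e = trans (cong (λ o → labels [ β ] r (if o then reverse zs else zs)) e)
          (trans (cong (turn r) (select-cong P? Q? 0 b zs (λ i i< →
            visible-co k i (b + i) (i≤c i<) (λ _ → refl) (λ e′ → case trans (sym e) e′ of λ ()))))
          (turned k false e (select Q? b zs)))

    rt-co : rt β (co α xs) ≡ labels (α ∷ nest α β ∷ []) (just α) xs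
    rt-co = labels-co isRoot

    co-co : co β (co α xs) ≡ co (nest α β) xs
    co-co = trans (labels-co isArc) (cong (turn (just γ)) (select-cong (visible? (α ∷ γ ∷ []) (just γ)) (visible? [ γ ] (just γ)) 0 0 xs (λ j _ →
      Visible-cong {α ∷ γ ∷ []} {[ γ ]} {just γ} {just γ} {j} {j} (mk⇔ id id) (mk⇔
        (λ { (here (h , _)) → ⊥-elim (⊃-asym α γ (nest-⊃ α β vβ) h) ; (there p) → p }) there))))

-- Arcs of the pieces as arcs of the polygon

↭-unique : {xs ys : List A} → Unique xs → Unique ys → (∀ {x} → x ∈ xs → x ∈ ys) → (∀ {x} → x ∈ ys → x ∈ xs) → xs ↭ ys
↭-unique u u′ h h′ = ∼bag⇒↭ (unique∧set⇒bag u u′ (mk⇔ h h′))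

arcs-valid : ∀ N {α} → α ∈ arcs N → Valid N α
arcs-valid N α∈ = proj₂ (∈-filter⁻ (valid? N) {xs = cartesianProduct (upTo (2 * N)) (upTo N)} α∈)

valid-∈ : ∀ N {α} → Valid N α → α ∈ arcs N
valid-∈ N {l , c} v = ∈-filter⁺ (valid? N) (∈-cartesianProduct⁺
  (∈-upTo⁺ (lia 3 (λ l c N → :Valid N l c :⇒ l :< 2 :* N) l c N v))
  (∈-upTo⁺ (lia 3 (λ l c N → :Valid N l c :⇒ c :< N) l c N v))) v

arcs-unique : ∀ N → Unique (arcs N)
arcs-unique N = Unique.filter⁺ (valid? N) (Unique.cartesianProduct⁺ (Unique.upTo⁺ (2 * N)) (Unique.upTo⁺ N))

-- `embed α` is a bijection from the arcs of the root piece onto the arcs that may come before `α`.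
-- Sums over dissections of `rt α` are re-indexed along it.
arcs-before : ∀ {N} α N′ → Valid N α → N′ + proj₂ α ≡ N →
              filter (λ γ → before? γ α) (arcs N) ↭ map (embed α) (arcs N′)
arcs-before α N′ vα refl = ↭-unique (Unique.filter⁺ (λ γ → before? γ α) (arcs-unique (N′ + proj₂ α))) (Unique.map⁺ (embed-injective α) (arcs-unique N′))
  (λ {γ} γ∈ →
          let (γ∈′ , h) = ∈-filter⁻ (λ γ → before? γ α) {xs = arcs M} γ∈
              (γ′ , v , e) = embed-surjective N′ α γ vα (arcs-valid M γ∈′) h
          in subst (_∈ map (embed α) (arcs N′)) e (∈-map⁺ (embed α) (valid-∈ N′ v)))
  (λ γ∈ →
          let (γ′ , γ′∈ , e) = ∈-map⁻ (embed α) γ∈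
              v = arcs-valid N′ γ′∈
          in subst (_∈ filter (λ γ → before? γ α) (arcs M)) (sym e) (∈-filter⁺ (λ γ → before? γ α)
               (valid-∈ M (embed-valid N′ α γ′ (proj₁ vα) v)) (embed-before α γ′ (proj₁ vα) (proj₁ v))))
  where M = N′ + proj₂ α

nest-injective : ∀ α {β β′} → Valid (suc (proj₂ α)) β → Valid (suc (proj₂ α)) β′ → nest α β ≡ nest α β′ → β ≡ β′
nest-injective (l , c) {l′ , c′} {l″ , c″} v v′ e with cong proj₂ e | cong proj₁ e
... | refl | e′ with odd l
... | false = cong (_, c′) (+-cancelˡ-≡ l l′ l″ e′)
... | true  = cong (_, c′) (+-cancelʳ-≡ (2 * c′) l′ l″ (∸-cancelˡ-≡ (below l′ v) (below l″ v′) e′))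
  where
  below : ∀ k → Valid (suc c) (k , c′) → k + 2 * c′ ≤ l + 2 * c
  below k = lia 4 (λ l c l′ c′ → :Valid (# 1 :+ c) l′ c′ :⇒ l′ :+ 2 :* c′ :≤ l :+ 2 :* c) l c k c′

nest-surjective : ∀ N α γ → Valid N γ → α ⊃ γ → ∃ λ β → Valid (suc (proj₂ α)) β × nest α β ≡ γ
nest-surjective N (l , c) (m , d) v h with odd l
... | false with m≤n⇒∃[o]m+o≡n (proj₁ h)
...   | k , refl = (k , d) ,
        lia 5 (λ l c k d N → :Valid N (l :+ k) d :⇒ :⊃ l c (l :+ k) d :⇒ :Valid (# 1 :+ c) k d) l c k d N v h , refl
nest-surjective N (l , c) (m , d) v h | true with m≤n⇒∃[o]m+o≡n (proj₁ (proj₂ h))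
...   | k , e = (k , d) ,
        lia 6 (λ l c k m d N → m :+ 2 :* d :+ k :≡ l :+ 2 :* c :⇒ :Valid N m d :⇒ :⊃ l c m d :⇒ :Valid (# 1 :+ c) k d) l c k m d N e v h ,
        cong (_, d) (trans (cong (_∸ (k + 2 * d)) (trans (sym e) (regroup m (2 * d) k))) (m+n∸n≡m m (k + 2 * d)))
  where
  regroup : ∀ m x k → m + x + k ≡ m + (k + x)
  regroup = NatTactic.solve-∀

nest-valid : ∀ N α β → Valid N α → Valid (suc (proj₂ α)) β → Valid N (nest α β)
nest-valid N (l , c) (l′ , c′) vα vβ with nest-⊃ (l , c) (l′ , c′) vβ
... | h = lia 6 (λ l c m l′ c′ N → :Valid N l c :⇒ :Valid (# 1 :+ c) l′ c′ :⇒ :⊃ l c m c′ :⇒ :Valid N m c′)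
              l c (proj₁ (nest (l , c) (l′ , c′))) l′ c′ N vα vβ h

map-unique : (f : A → B) {xs : List A} → (∀ {x y} → x ∈ xs → y ∈ xs → f x ≡ f y → x ≡ y) → Unique xs → Unique (map f xs)
map-unique f inj []       = []
map-unique f inj (p ∷ ps) =
  All.map⁺ (All.tabulate (λ y∈ e → All.lookup p y∈ (inj (here refl) (there y∈) e))) ∷
  map-unique f (λ x∈ y∈ → inj (there x∈) (there y∈)) ps

-- Re-indexes the arcs that cut something off inside the piece `co α` as arcs of the whole polygon.
arcs-below : ∀ {N} α → Valid N α → filter (α ⊃?_) (arcs N) ↭ map (nest α) (arcs (suc (proj₂ α)))
arcs-below {N} α vα = ↭-unique (Unique.filter⁺ (α ⊃?_) (arcs-unique N))
  (map-unique (nest α) (λ x∈ y∈ → nest-injective α (arcs-valid (suc (proj₂ α)) x∈) (arcs-valid (suc (proj₂ α)) y∈)) (arcs-unique (suc (proj₂ α))))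
  (λ {γ} γ∈ →
          let (γ∈′ , h) = ∈-filter⁻ (α ⊃?_) {xs = arcs N} γ∈
              (β , v , e) = nest-surjective N α γ (arcs-valid N γ∈′) h
          in subst (_∈ map (nest α) (arcs (suc (proj₂ α)))) e (∈-map⁺ (nest α) (valid-∈ (suc (proj₂ α)) v)))
  (λ γ∈ →
          let (β , β∈ , e) = ∈-map⁻ (nest α) γ∈
              v = arcs-valid (suc (proj₂ α)) β∈
          in subst (_∈ filter (α ⊃?_) (arcs N)) (sym e) (∈-filter⁺ (α ⊃?_)
               (valid-∈ N (nest-valid N α β vα v)) (nest-⊃ α β v)))

-- Sums over sublists and permutations

picks : List A → List (A × List A)
picks []       = []
picks (x ∷ xs) = (x , xs) ∷ map (map₂ (x ∷_)) (picks xs)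

picks-proj₁ : (xs : List A) → map proj₁ (picks xs) ≡ xs
picks-proj₁ []       = refl
picks-proj₁ (x ∷ xs) = cong (x ∷_) (trans (sym (map-∘ (picks xs))) (picks-proj₁ xs))

picks-↭ : (xs : List A) → All (λ (x , r) → xs ↭ x ∷ r) (picks xs)
picks-↭ []       = []
picks-↭ (x ∷ xs) = ↭refl ∷ All.map⁺ (All.map (λ p → ↭trans (prep x p) (↭swap x _ ↭refl)) (picks-↭ xs))

sublists-All : {P : A → Set ℓ′} {xs : List A} → All P xs → All (All P) (sublists xs)
sublists-All []       = [] ∷ []
sublists-All (p ∷ ps) = All.++⁺ (sublists-All ps) (All.map⁺ (All.map (p ∷_) (sublists-All ps)))

insertions-↭ : ∀ (x : A) ys → All (x ∷ ys ↭_) (insertions x ys)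
insertions-↭ x []       = ↭refl ∷ []
insertions-↭ x (y ∷ ys) = ↭refl ∷ All.map⁺ (All.map (λ p → ↭trans (↭swap x y ↭refl) (prep y p)) (insertions-↭ x ys))

permutations-↭ : (xs : List A) → All (xs ↭_) (permutations xs)
permutations-↭ []       = ↭refl ∷ []
permutations-↭ (x ∷ xs) = All.concat⁺ (All.map⁺ (All.map
  (λ {ys} p → All.map (↭trans (prep x p)) (insertions-↭ x ys)) (permutations-↭ xs)))

atNil : List A → Lin G → Lin G
atNil []      x = x
atNil (_ ∷ _) x = []

∑-++ : ∀ (is js : List A) (f : A → Lin G) → ∑ (is ++ js) f ≡ ∑ is f ⊕ ∑ js f
∑-++ is js f = concatMap-++ f is js

∑-picks : ∀ (is : List A) (f : A → Lin G) → ∑ (picks is) (λ (x , _) → f x) ≡ ∑ is f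
∑-picks is f = trans (sym (∑-map proj₁ (picks is) f)) (cong (λ js → ∑ js f) (picks-proj₁ is))

∑-sublists-∷ : ∀ x (xs : List A) (f : List A → Lin G) →
               ∑ (sublists (x ∷ xs)) f ≡ ∑ (sublists xs) f ⊕ ∑ (sublists xs) (f ∘ (x ∷_))
∑-sublists-∷ x xs f = trans (∑-++ (sublists xs) _ f) (cong (∑ (sublists xs) f ⊕_) (∑-map (x ∷_) (sublists xs) f))

∑-sublists-map : ∀ (h : A → B) (xs : List A) (f : List B → Lin G) →
                 ∑ (sublists (map h xs)) f ≡ ∑ (sublists xs) (f ∘ map h)
∑-sublists-map h []       f = refl
∑-sublists-map h (x ∷ xs) f = trans (∑-sublists-∷ (h x) (map h xs) f)
  (trans (cong₂ _⊕_ (∑-sublists-map h xs f) (∑-sublists-map h xs (f ∘ (h x ∷_)))) (sym (∑-sublists-∷ x xs (f ∘ map h))))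

∑-insertions-∷ : ∀ (x y : A) ys (f : List A → Lin G) →
                 ∑ (insertions x (y ∷ ys)) f ≡ f (x ∷ y ∷ ys) ⊕ ∑ (insertions x ys) (f ∘ (y ∷_))
∑-insertions-∷ x y ys f = cong (f (x ∷ y ∷ ys) ⊕_) (∑-map (y ∷_) (insertions x ys) f)

∑-permutations-∷ : ∀ x (xs : List A) (f : List A → Lin G) →
                   ∑ (permutations (x ∷ xs)) f ≡ (∑[ m ∈ permutations xs ] ∑ (insertions x m) f)
∑-permutations-∷ x xs f = ∑-concatMap (insertions x) (permutations xs) f

∑-insertions-map : ∀ (h : A → B) x ys (f : List B → Lin G) →
                   ∑ (insertions (h x) (map h ys)) f ≡ ∑ (insertions x ys) (f ∘ map h)
∑-insertions-map h x []       f = refl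
∑-insertions-map h x (y ∷ ys) f = trans (∑-insertions-∷ (h x) (h y) (map h ys) f)
  (trans (cong (f (h x ∷ h y ∷ map h ys) ⊕_) (∑-insertions-map h x ys (f ∘ (h y ∷_)))) (sym (∑-insertions-∷ x y ys (f ∘ map h))))

∑-permutations-map : ∀ (h : A → B) xs (f : List B → Lin G) →
                     ∑ (permutations (map h xs)) f ≡ ∑ (permutations xs) (f ∘ map h)
∑-permutations-map h []       f = refl
∑-permutations-map h (x ∷ xs) f = trans (∑-permutations-∷ (h x) (map h xs) f)
  (trans (∑-permutations-map h xs (λ m → ∑ (insertions (h x) m) f))
    (trans (∑-≗ (λ m → ∑-insertions-map h x m f) (permutations xs)) (sym (∑-permutations-∷ x xs (f ∘ map h)))))

-- An arrangement is a sublist together with an order of its entries; for arcs, a candidate for a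
-- dissection with a linear order of its non-root regions.
∑-arrangements : List A → (List A → Lin G) → Lin G
∑-arrangements xs f = ∑[ as ∈ sublists xs ] ∑ (permutations as) f

∑-arrangements-map : ∀ (h : A → B) (xs : List A) (f : List B → Lin G) →
                     ∑-arrangements (map h xs) f ≡ ∑-arrangements xs (f ∘ map h)
∑-arrangements-map h xs f = trans (∑-sublists-map h xs _) (∑-≗ (λ as → ∑-permutations-map h as f) (sublists xs))

module _ {V : Space ℓ} where

  -- Both sides sum over a sublist with a marked entry; on the right the mark is chosen first.
  ∑-sublists-picks : ∀ (xs : List A) (g : A → List A → Lin (Gen V)) →
                     (∑[ as ∈ sublists xs ] ∑ (picks as) (λ (x , r) → g x r)) ≈[ V ]
                     ∑ (picks xs) (λ (x , xs′) → ∑[ r ∈ sublists xs′ ] g x r)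
  ∑-sublists-picks []       g = ≈-refl
  ∑-sublists-picks (y ∷ xs) g = begin
    ∑ (sublists (y ∷ xs)) pick
      ≡⟨ ∑-sublists-∷ y xs pick ⟩
    ∑ (sublists xs) pick ⊕ (∑[ as ∈ sublists xs ] g y as ⊕ ∑ (map (map₂ (y ∷_)) (picks as)) (λ (x , r) → g x r))
      ≈⟨ ⊕-cong (∑-sublists-picks xs g) (≈-trans (∑-⊕ (sublists xs) (g y) _)
           (⊕-congˡ {x = ∑ (sublists xs) (g y)} (≈-trans (≡⇒≈ (∑-≗ (λ as → ∑-map (map₂ (y ∷_)) (picks as) _) (sublists xs)))
             (∑-sublists-picks xs (λ x r → g x (y ∷ r)))))) ⟩
    ∑ (picks xs) (λ (x , xs′) → ∑ (sublists xs′) (g x)) ⊕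
      (∑ (sublists xs) (g y) ⊕ ∑ (picks xs) (λ (x , xs′) → ∑ (sublists xs′) (g x ∘ (y ∷_))))
      ≈⟨ ⊕-swapˡ (∑ (picks xs) (λ (x , xs′) → ∑ (sublists xs′) (g x))) (∑ (sublists xs) (g y)) _ ⟩
    ∑ (sublists xs) (g y) ⊕ (∑ (picks xs) (λ (x , xs′) → ∑ (sublists xs′) (g x)) ⊕
      ∑ (picks xs) (λ (x , xs′) → ∑ (sublists xs′) (g x ∘ (y ∷_))))
      ≈⟨ ⊕-congˡ {x = ∑ (sublists xs) (g y)} (≈-sym (∑-⊕ (picks xs) (λ (x , xs′) → ∑ (sublists xs′) (g x)) _)) ⟩
    ∑ (sublists xs) (g y) ⊕ ∑ (picks xs) (λ (x , xs′) → ∑ (sublists xs′) (g x) ⊕ ∑ (sublists xs′) (g x ∘ (y ∷_)))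
      ≡⟨ cong (∑ (sublists xs) (g y) ⊕_) (∑-≗ (λ (x , xs′) → sym (∑-sublists-∷ y xs′ (g x))) (picks xs)) ⟩
    ∑ (sublists xs) (g y) ⊕ ∑ (picks xs) (λ (x , xs′) → ∑ (sublists (y ∷ xs′)) (g x))
      ≡⟨ cong (∑ (sublists xs) (g y) ⊕_) (∑-map (map₂ (y ∷_)) (picks xs) (λ (x , xs′) → ∑ (sublists xs′) (g x))) ⟨
    ∑ (picks (y ∷ xs)) (λ (x , xs′) → ∑ (sublists xs′) (g x)) ∎
    where
    open ≈-Reasoning V
    pick : List _ → Lin (Gen V)
    pick as = ∑ (picks as) (λ (x , r) → g x r)

  ∑-sublists-atNil : ∀ (xs : List A) (u : Lin (Gen V)) → (∑[ as ∈ sublists xs ] atNil as u) ≈[ V ] u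
  ∑-sublists-atNil []       u = ≡⇒≈ (⊕-identityʳ u)
  ∑-sublists-atNil (x ∷ xs) u = ≈-trans (≡⇒≈ (∑-sublists-∷ x xs (λ as → atNil as u)))
    (≈-trans (⊕-cong (∑-sublists-atNil xs u) (∑-0 (sublists xs) (λ _ → ≈-refl))) (≡⇒≈ (⊕-identityʳ u)))

  -- Permuting a list also permutes the entries inside its sublists, hence the invariance asked of
  -- `f`.
  ∑-sublists-↭ : ∀ {xs ys : List A} (f : List A → Lin (Gen V)) → (∀ {as bs} → as ↭ bs → f as ≈[ V ] f bs) →
                 xs ↭ ys → ∑ (sublists xs) f ≈[ V ] ∑ (sublists ys) f
  ∑-sublists-↭ f r ↭refl = ≈-refl
  ∑-sublists-↭ f r (prep {xs} {ys} x p) = ≈-trans (≡⇒≈ (∑-sublists-∷ x xs f))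
    (≈-trans (⊕-cong (∑-sublists-↭ f r p) (∑-sublists-↭ (f ∘ (x ∷_)) (r ∘ prep x) p)) (≡⇒≈ (sym (∑-sublists-∷ x ys f))))
  ∑-sublists-↭ f r (↭trans p q) = ≈-trans (∑-sublists-↭ f r p) (∑-sublists-↭ f r q)
  ∑-sublists-↭ f r (↭swap {xs} {ys} x y p) = begin
    ∑ (sublists (x ∷ y ∷ xs)) f
      ≡⟨ four x y xs ⟩
    (s xs f ⊕ s xs (f ∘ (y ∷_))) ⊕ (s xs (f ∘ (x ∷_)) ⊕ s xs (f ∘ (x ∷_) ∘ (y ∷_)))
      ≈⟨ ⊕-interchange (s xs f) (s xs (f ∘ (y ∷_))) (s xs (f ∘ (x ∷_))) _ ⟩
    (s xs f ⊕ s xs (f ∘ (x ∷_))) ⊕ (s xs (f ∘ (y ∷_)) ⊕ s xs (f ∘ (x ∷_) ∘ (y ∷_)))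
      ≈⟨ ⊕-cong (⊕-cong (∑-sublists-↭ f r p) (∑-sublists-↭ (f ∘ (x ∷_)) (r ∘ prep x) p))
           (⊕-cong (∑-sublists-↭ (f ∘ (y ∷_)) (r ∘ prep y) p)
             (≈-trans (∑-cong (sublists xs) (λ as → r (↭swap x y (↭refl {xs = as}))))
                      (∑-sublists-↭ (f ∘ (y ∷_) ∘ (x ∷_)) (r ∘ prep y ∘ prep x) p))) ⟩
    (s ys f ⊕ s ys (f ∘ (x ∷_))) ⊕ (s ys (f ∘ (y ∷_)) ⊕ s ys (f ∘ (y ∷_) ∘ (x ∷_)))
      ≡⟨ four y x ys ⟨
    ∑ (sublists (y ∷ x ∷ ys)) f ∎
    where
    open ≈-Reasoning V
    s : List _ → (List _ → Lin (Gen V)) → Lin (Gen V)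
    s zs g = ∑ (sublists zs) g
    four : ∀ x y xs → s (x ∷ y ∷ xs) f ≡ (s xs f ⊕ s xs (f ∘ (y ∷_))) ⊕ (s xs (f ∘ (x ∷_)) ⊕ s xs (f ∘ (x ∷_) ∘ (y ∷_)))
    four x y xs = trans (∑-sublists-∷ x (y ∷ xs) f) (cong₂ _⊕_ (∑-sublists-∷ y xs f) (∑-sublists-∷ y xs (f ∘ (x ∷_))))

  ∑-sublists-filter : ∀ {P : A → Set ℓ′} (P? : ∀ x → Dec (P x)) (xs : List A) (f : List A → Lin (Gen V)) →
                      (∀ as → ¬ All P as → f as ≈[ V ] []) →
                      ∑ (sublists xs) f ≈[ V ] ∑ (sublists (filter P? xs)) f
  ∑-sublists-filter P? []       f z = ≈-refl
  ∑-sublists-filter P? (x ∷ xs) f z with P? x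
  ... | yes p = ≈-trans (≡⇒≈ (∑-sublists-∷ x xs f))
    (≈-trans (⊕-cong (∑-sublists-filter P? xs f z)
                     (∑-sublists-filter P? xs (f ∘ (x ∷_)) (λ as ¬ps → z (x ∷ as) (λ { (_ ∷ ps) → ¬ps ps }))))
             (≡⇒≈ (sym (∑-sublists-∷ x (filter P? xs) f))))
  ... | no ¬p = ≈-trans (≡⇒≈ (∑-sublists-∷ x xs f))
    (≈-trans (⊕-cong (∑-sublists-filter P? xs f z) (∑-0 (sublists xs) (λ as → z (x ∷ as) (λ { (p ∷ _) → ¬p p }))))
             (≡⇒≈ (⊕-identityʳ _)))

  ∑-insertions-∷ʳ : ∀ (x z : A) ys (f : List A → Lin (Gen V)) →
                    ∑ (insertions x (ys ∷ʳ z)) f ≈[ V ] ∑ (insertions x ys) (f ∘ (_∷ʳ z)) ⊕ f (ys ∷ʳ z ∷ʳ x)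
  ∑-insertions-∷ʳ x z []       f = ≡⇒≈ (cong₂ _⊕_ (sym (⊕-identityʳ (f (x ∷ z ∷ [])))) (⊕-identityʳ (f (z ∷ x ∷ []))))
  ∑-insertions-∷ʳ x z (y ∷ ys) f = begin
    ∑ (insertions x (y ∷ ys ∷ʳ z)) f
      ≡⟨ ∑-insertions-∷ x y (ys ∷ʳ z) f ⟩
    f (x ∷ y ∷ ys ∷ʳ z) ⊕ ∑ (insertions x (ys ∷ʳ z)) (f ∘ (y ∷_))
      ≈⟨ ⊕-congˡ {x = f (x ∷ y ∷ ys ∷ʳ z)} (∑-insertions-∷ʳ x z ys (f ∘ (y ∷_))) ⟩
    f (x ∷ y ∷ ys ∷ʳ z) ⊕ (∑ (insertions x ys) (f ∘ (y ∷_) ∘ (_∷ʳ z)) ⊕ f (y ∷ ys ∷ʳ z ∷ʳ x))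
      ≡⟨ ++-assoc (f (x ∷ y ∷ ys ∷ʳ z)) _ _ ⟨
    (f (x ∷ y ∷ ys ∷ʳ z) ⊕ ∑ (insertions x ys) (f ∘ (y ∷_) ∘ (_∷ʳ z))) ⊕ f (y ∷ ys ∷ʳ z ∷ʳ x)
      ≡⟨ cong (_⊕ f (y ∷ ys ∷ʳ z ∷ʳ x)) (∑-insertions-∷ x y ys (f ∘ (_∷ʳ z))) ⟨
    ∑ (insertions x (y ∷ ys)) (f ∘ (_∷ʳ z)) ⊕ f (y ∷ ys ∷ʳ z ∷ʳ x) ∎
    where open ≈-Reasoning V

  ∑-insertions-comm : ∀ (x y : A) zs (f : List A → Lin (Gen V)) →
                      (∑[ m ∈ insertions y zs ] ∑ (insertions x m) f) ≈[ V ] (∑[ m ∈ insertions x zs ] ∑ (insertions y m) f)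
  ∑-insertions-comm x y [] f = ≈-trans (≡⇒≈ (⊕-identityʳ _)) (≈-trans
    (⊕-swapˡ (f (x ∷ y ∷ [])) (f (y ∷ x ∷ [])) []) (≡⇒≈ (sym (⊕-identityʳ _))))
  ∑-insertions-comm x y (z ∷ zs) f = begin
    (∑[ m ∈ insertions y (z ∷ zs) ] ∑ (insertions x m) f)
      ≈⟨ expand x y ⟩
    (f (x ∷ y ∷ z ∷ zs) ⊕ f (y ∷ x ∷ z ∷ zs)) ⊕ ((S x y ⊕ S y x) ⊕ D x y)
      ≈⟨ ⊕-cong (⊕-comm (f (x ∷ y ∷ z ∷ zs)) (f (y ∷ x ∷ z ∷ zs)))
                (⊕-cong (⊕-comm (S x y) (S y x)) (∑-insertions-comm x y zs (f ∘ (z ∷_)))) ⟩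
    (f (y ∷ x ∷ z ∷ zs) ⊕ f (x ∷ y ∷ z ∷ zs)) ⊕ ((S y x ⊕ S x y) ⊕ D y x)
      ≈⟨ expand y x ⟨
    (∑[ m ∈ insertions x (z ∷ zs) ] ∑ (insertions y m) f) ∎
    where
    open ≈-Reasoning V
    S D : _ → _ → Lin (Gen V)
    S x y = ∑ (insertions x zs) (f ∘ (y ∷_) ∘ (z ∷_))
    D x y = ∑[ m ∈ insertions y zs ] ∑ (insertions x m) (f ∘ (z ∷_))
    expand : ∀ x y → (∑[ m ∈ insertions y (z ∷ zs) ] ∑ (insertions x m) f) ≈[ V ]
                     (f (x ∷ y ∷ z ∷ zs) ⊕ f (y ∷ x ∷ z ∷ zs)) ⊕ ((S x y ⊕ S y x) ⊕ D x y)
    expand x y = begin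
      (∑[ m ∈ insertions y (z ∷ zs) ] ∑ (insertions x m) f)
        ≡⟨ ∑-insertions-∷ y z zs (λ m → ∑ (insertions x m) f) ⟩
      ∑ (insertions x (y ∷ z ∷ zs)) f ⊕ (∑[ m ∈ insertions y zs ] ∑ (insertions x (z ∷ m)) f)
        ≡⟨ cong₂ _⊕_ (trans (∑-insertions-∷ x y (z ∷ zs) f) (trans
             (cong (f (x ∷ y ∷ z ∷ zs) ⊕_) (∑-insertions-∷ x z zs (f ∘ (y ∷_))))
             (sym (++-assoc (f (x ∷ y ∷ z ∷ zs)) _ _))))
             (∑-≗ (λ m → ∑-insertions-∷ x z m f) (insertions y zs)) ⟩
      ((f (x ∷ y ∷ z ∷ zs) ⊕ f (y ∷ x ∷ z ∷ zs)) ⊕ S x y) ⊕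
        (∑[ m ∈ insertions y zs ] f (x ∷ z ∷ m) ⊕ ∑ (insertions x m) (f ∘ (z ∷_)))
        ≈⟨ ⊕-congˡ {x = (f (x ∷ y ∷ z ∷ zs) ⊕ f (y ∷ x ∷ z ∷ zs)) ⊕ S x y} (∑-⊕ (insertions y zs) _ _) ⟩
      ((f (x ∷ y ∷ z ∷ zs) ⊕ f (y ∷ x ∷ z ∷ zs)) ⊕ S x y) ⊕ (S y x ⊕ D x y)
        ≡⟨ ++-assoc (f (x ∷ y ∷ z ∷ zs) ⊕ f (y ∷ x ∷ z ∷ zs)) (S x y) _ ⟩
      (f (x ∷ y ∷ z ∷ zs) ⊕ f (y ∷ x ∷ z ∷ zs)) ⊕ (S x y ⊕ (S y x ⊕ D x y))
        ≡⟨ cong ((f (x ∷ y ∷ z ∷ zs) ⊕ f (y ∷ x ∷ z ∷ zs)) ⊕_) (++-assoc (S x y) (S y x) (D x y)) ⟨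
      (f (x ∷ y ∷ z ∷ zs) ⊕ f (y ∷ x ∷ z ∷ zs)) ⊕ ((S x y ⊕ S y x) ⊕ D x y) ∎

  ∑-permutations-↭ : ∀ {xs ys : List A} (f : List A → Lin (Gen V)) → xs ↭ ys →
                     ∑ (permutations xs) f ≈[ V ] ∑ (permutations ys) f
  ∑-permutations-↭ f ↭refl = ≈-refl
  ∑-permutations-↭ f (↭trans p q) = ≈-trans (∑-permutations-↭ f p) (∑-permutations-↭ f q)
  ∑-permutations-↭ f (prep {xs} {ys} x p) = ≈-trans (≡⇒≈ (∑-permutations-∷ x xs f))
    (≈-trans (∑-permutations-↭ (λ m → ∑ (insertions x m) f) p) (≡⇒≈ (sym (∑-permutations-∷ x ys f))))
  ∑-permutations-↭ f (↭swap {xs} {ys} x y p) = begin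
    ∑ (permutations (x ∷ y ∷ xs)) f
      ≡⟨ two x y xs ⟩
    (∑[ m ∈ permutations xs ] ∑[ m′ ∈ insertions y m ] ∑ (insertions x m′) f)
      ≈⟨ ∑-permutations-↭ _ p ⟩
    (∑[ m ∈ permutations ys ] ∑[ m′ ∈ insertions y m ] ∑ (insertions x m′) f)
      ≈⟨ ∑-cong (permutations ys) (λ m → ∑-insertions-comm x y m f) ⟩
    (∑[ m ∈ permutations ys ] ∑[ m′ ∈ insertions x m ] ∑ (insertions y m′) f)
      ≡⟨ two y x ys ⟨
    ∑ (permutations (y ∷ x ∷ ys)) f ∎
    where
    open ≈-Reasoning V
    two : ∀ x y xs → ∑ (permutations (x ∷ y ∷ xs)) f ≡
                     (∑[ m ∈ permutations xs ] ∑[ m′ ∈ insertions y m ] ∑ (insertions x m′) f)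
    two x y xs = trans (∑-permutations-∷ x (y ∷ xs) f) (∑-permutations-∷ y xs (λ m → ∑ (insertions x m) f))

  -- `permutations` proceeds by inserting the first entry of the list, whereas the recursion for
  -- B(π) singles out the last entry of the permutation. The two groups of terms come from inserting
  -- `x` somewhere before the last entry `z` or behind it.
  ∑-permutations-last : ∀ (xs : List A) (f : List A → Lin (Gen V)) →
                        ∑ (permutations xs) f ≈[ V ]
                        atNil xs (f []) ⊕ ∑ (picks xs) (λ (x , r) → ∑[ m ∈ permutations r ] f (m ∷ʳ x))
  ∑-permutations-last []       f = ≈-refl
  ∑-permutations-last (x ∷ xs) f = begin
    ∑ (permutations (x ∷ xs)) f
      ≡⟨ ∑-permutations-∷ x xs f ⟩
    (∑[ m ∈ permutations xs ] ∑ (insertions x m) f)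
      ≈⟨ ∑-permutations-last xs (λ m → ∑ (insertions x m) f) ⟩
    atNil xs (f [ x ] ⊕ []) ⊕ ∑ (picks xs) (λ (z , r) → ∑[ m ∈ permutations r ] ∑ (insertions x (m ∷ʳ z)) f)
      ≈⟨ ⊕-cong (≡⇒≈ (cong (atNil xs) (⊕-identityʳ (f [ x ])))) (∑-cong (picks xs) (λ (z , r) →
           ≈-trans (∑-cong (permutations r) (λ m → ∑-insertions-∷ʳ x z m f)) (∑-⊕ (permutations r) _ _))) ⟩
    atNil xs (f [ x ]) ⊕ ∑ (picks xs) (λ (z , r) →
      (∑[ m ∈ permutations r ] ∑ (insertions x m) (f ∘ (_∷ʳ z))) ⊕ (∑[ m ∈ permutations r ] f (m ∷ʳ z ∷ʳ x)))
      ≈⟨ ⊕-congˡ {x = atNil xs (f [ x ])} (∑-⊕ (picks xs) _ _) ⟩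
    atNil xs (f [ x ]) ⊕ (∑ (picks xs) (λ (z , r) → ∑[ m ∈ permutations r ] ∑ (insertions x m) (f ∘ (_∷ʳ z))) ⊕
      ∑ (picks xs) (λ (z , r) → ∑[ m ∈ permutations r ] f (m ∷ʳ z ∷ʳ x)))
      ≈⟨ ≈-trans (⊕-swapˡ (atNil xs (f [ x ])) (∑ (picks xs) (λ (z , r) → ∑[ m ∈ permutations r ] ∑ (insertions x m) (f ∘ (_∷ʳ z)))) _)
                 (⊕-comm (∑ (picks xs) (λ (z , r) → ∑[ m ∈ permutations r ] ∑ (insertions x m) (f ∘ (_∷ʳ z)))) _) ⟩
    (atNil xs (f [ x ]) ⊕ ∑ (picks xs) (λ (z , r) → ∑[ m ∈ permutations r ] f (m ∷ʳ z ∷ʳ x))) ⊕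
      ∑ (picks xs) (λ (z , r) → ∑[ m ∈ permutations r ] ∑ (insertions x m) (f ∘ (_∷ʳ z)))
      ≈⟨ ⊕-cong (≈-sym (∑-permutations-last xs (f ∘ (_∷ʳ x))))
           (≡⇒≈ (∑-≗ (λ (z , r) → sym (∑-permutations-∷ x r (f ∘ (_∷ʳ z)))) (picks xs))) ⟩
    (∑[ m ∈ permutations xs ] f (m ∷ʳ x)) ⊕ ∑ (picks xs) (λ (z , r) → ∑[ m ∈ permutations (x ∷ r) ] f (m ∷ʳ z))
      ≡⟨ cong ((∑[ m ∈ permutations xs ] f (m ∷ʳ x)) ⊕_) (∑-map (map₂ (x ∷_)) (picks xs) _) ⟨
    ∑ (picks (x ∷ xs)) (λ (z , r) → ∑[ m ∈ permutations r ] f (m ∷ʳ z)) ∎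
    where open ≈-Reasoning V

  ∑-arrangements-last : ∀ (xs : List A) (f : List A → Lin (Gen V)) →
                        ∑-arrangements xs f ≈[ V ]
                        f [] ⊕ ∑ (picks xs) (λ (x , xs′) → ∑-arrangements xs′ (f ∘ (_∷ʳ x)))
  ∑-arrangements-last xs f = ≈-trans (∑-cong (sublists xs) (λ as → ∑-permutations-last as f))
    (≈-trans (∑-⊕ (sublists xs) _ _)
      (⊕-cong (∑-sublists-atNil xs (f [])) (∑-sublists-picks xs (λ x r → ∑[ m ∈ permutations r ] f (m ∷ʳ x)))))

  ∑-arrangements-cong : ∀ {P : A → Set ℓ′} {xs : List A} → All P xs → {f g : List A → Lin (Gen V)} →
                        (∀ m → All P m → f m ≈[ V ] g m) → ∑-arrangements xs f ≈[ V ] ∑-arrangements xs g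
  ∑-arrangements-cong {xs = xs} ps e = ∑-cong-∈ (sublists xs) (λ as as∈ → ∑-cong-∈ (permutations as) (λ m m∈ →
    e m (↭.All-resp-↭ (All.lookup (permutations-↭ as) m∈) (All.lookup (sublists-All ps) as∈))))

  ∑-arrangements-↭ : ∀ {xs ys : List A} (f : List A → Lin (Gen V)) → xs ↭ ys →
                     ∑-arrangements xs f ≈[ V ] ∑-arrangements ys f
  ∑-arrangements-↭ f p = ∑-sublists-↭ _ (∑-permutations-↭ f) p

  ∑-arrangements-filter : ∀ {P : A → Set ℓ′} (P? : ∀ x → Dec (P x)) (xs : List A) (f : List A → Lin (Gen V)) →
                          (∀ m → ¬ All P m → f m ≈[ V ] []) →
                          ∑-arrangements xs f ≈[ V ] ∑-arrangements (filter P? xs) f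
  ∑-arrangements-filter P? xs f z = ∑-sublists-filter P? xs _ (λ as ¬p →
    ≈-trans (∑-cong-∈ (permutations as) (λ m m∈ →
      z m (¬p ∘ ↭.All-resp-↭ (↭-sym (All.lookup (permutations-↭ as) m∈))))) (∑-0 (permutations as) (λ _ → ≈-refl)))

-- The element B(π) of a list of decorations

product : List ℚ → ℚ
product = foldr _*ℚ_ 1ℚ

-- The factor of sgn D at the region beyond α, for a dissection D with arcs as.
signIn : List Arc → List X → Arc → ℚ
signIn as xs α = if odd (proj₁ α) then [-1]^ pred (length (labels as (just α) xs)) else 1ℚ

sign : Arc → ℚ
sign (l , c) = if odd l then [-1]^ c else 1ℚ

-- Words whose letters are polygons, given as lists of decorations.
dissectionWord : List Arc → List X → List (List X)
dissectionWord ms xs = labels ms nothing xs ∷ map (λ α → labels ms (just α) xs) ms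

orderedTerm : List X → List Arc → Lin (List (List X))
orderedTerm xs ms = guard (allPairs? before? ms) (product (map (signIn ms xs) ms) • ⟦ dissectionWord ms xs ⟧)

-- The dissections with a linear order of their regions, the root region excepted, are
-- the lists ms of distinct arcs with AllPairs Before ms.
𝔹 : List X → Lin (List (List X))
𝔹 xs = ∑-arrangements (arcs (length xs)) (orderedTerm xs)

product-∷ʳ : ∀ qs q → product (qs ∷ʳ q) ≡ q *ℚ product qs
product-∷ʳ []       q = refl
product-∷ʳ (p ∷ qs) q = trans (cong (p *ℚ_) (product-∷ʳ qs q))
  (trans (sym (ℚ.*-assoc p q _)) (trans (cong (_*ℚ product qs) (ℚ.*-comm p q)) (ℚ.*-assoc q p _)))

map-cong-All : {P : A → Set} {f g : A → B} → (∀ {x} → P x → f x ≡ g x) → ∀ {xs} → All P xs → map f xs ≡ map g xs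
map-cong-All e []       = refl
map-cong-All e (p ∷ ps) = cong₂ _∷_ (e p) (map-cong-All e ps)

AllPairs-∷ʳ⁻ : {R : A → A → Set ℓ′} → ∀ xs {x} → AllPairs R (xs ∷ʳ x) → AllPairs R xs × All (λ y → R y x) xs
AllPairs-∷ʳ⁻ []       ps       = [] , []
AllPairs-∷ʳ⁻ (y ∷ ys) (p ∷ ps) with AllPairs-∷ʳ⁻ ys ps | All.∷ʳ⁻ p
... | qs , rs | p′ , r = p′ ∷ qs , r ∷ rs

AllPairs-∷ʳ⁺ : {R : A → A → Set ℓ′} → ∀ {xs x} → AllPairs R xs → All (λ y → R y x) xs → AllPairs R (xs ∷ʳ x)
AllPairs-∷ʳ⁺ ps rs = AllPairs.++⁺ ps ([] ∷ []) (All.map (λ r → r ∷ []) rs)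

Before-irrefl : ∀ α → 1 ≤ proj₂ α → ¬ Before α α
Before-irrefl (l , c) = lia 2 (λ l c → # 1 :≤ c :⇒ :¬ (:Before l c l c)) l c

Before⇒⊅ : ∀ γ α → Before γ α → ¬ (α ⊃ γ)
Before⇒⊅ (l′ , c′) (l , c) = lia 4 (λ l′ c′ l c → :Before l′ c′ l c :⇒ :¬ (:⊃ l c l′ c′)) l′ c′ l c

-- Only an arc beyond `α` can hide a side from the region of `α`.
labels-outermost : ∀ as α (xs : List X) → All (λ γ → ¬ (α ⊃ γ)) as → labels as (just α) xs ≡ co α xs
labels-outermost as α xs h = cong (turn (just α)) (select-cong (visible? as (just α)) (visible? [ α ] (just α)) 0 0 xs (λ j _ →
  Visible-cong {as} {[ α ]} {just α} {just α} {j} {j} (mk⇔ id id) (mk⇔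
    (λ p → let (γ , γ∈ , k , _) = find {P = Conceals (just α) j} p in ⊥-elim (All.lookup h γ∈ k))
    (λ { (here (k , _)) → ⊥-elim (⊃-irrefl α k) }))))

labels-[] : (xs : List X) → labels [] nothing xs ≡ xs
labels-[] xs = select-every (visible? [] nothing) 0 xs (λ _ _ → tt , λ ())

module _ (α : Arc) (xs : List X) (vα : Valid (length xs) α) where

  private
    N′ : ℕ
    N′ = length (rt α xs)

  module _ (ms : List Arc) (vms : All (Valid N′) ms) where

    private
      ms′ : List Arc
      ms′ = map (embed α) ms

      before-α : All (λ γ → Before γ α) ms′
      before-α = All.map⁺ (All.map (λ {γ} v → embed-before α γ (proj₁ vα) (proj₁ v)) vms)

      pairs⇔ : AllPairs Before ms ⇔ AllPairs Before (ms′ ∷ʳ α)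
      pairs⇔ = mk⇔
        (λ ps → AllPairs-∷ʳ⁺ (AllPairs.map⁺ (AllPairs.map (λ {γ} {β} → Equivalence.to (embed-Before α γ β)) ps)) before-α)
        (λ ps → AllPairs.map (λ {γ} {β} → Equivalence.from (embed-Before α γ β)) (AllPairs.map⁻ (proj₁ (AllPairs-∷ʳ⁻ ms′ ps))))

      labels-rt′ : ∀ r → All (λ γ → 1 ≤ proj₂ γ) (Data.List.fromMaybe r) →
                   labels (ms′ ∷ʳ α) (Data.Maybe.map (embed α) r) xs ≡ labels ms r (rt α xs)
      labels-rt′ r 1≤ = trans (labels-↭ (↭.++-comm ms′ [ α ]) (Data.Maybe.map (embed α) r) xs) (sym (labels-rt α xs vα ms r 1≤))

      labels-co′ : labels (ms′ ∷ʳ α) (just α) xs ≡ co α xs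
      labels-co′ = labels-outermost (ms′ ∷ʳ α) α xs
        (All.++⁺ (All.map (λ {γ} → Before⇒⊅ γ α) before-α) (⊃-irrefl α ∷ []))

      word≡ : dissectionWord (ms′ ∷ʳ α) xs ≡ dissectionWord ms (rt α xs) ∷ʳ co α xs
      word≡ = cong₂ _∷_ (labels-rt′ nothing []) (trans (map-++ _ ms′ [ α ]) (cong₂ _++_
        (trans (sym (map-∘ ms)) (map-cong-All (λ {γ} v → labels-rt′ (just γ) (proj₁ v ∷ [])) vms))
        (cong [_] labels-co′)))

      sign≡ : product (map (signIn (ms′ ∷ʳ α) xs) (ms′ ∷ʳ α)) ≡ sign α *ℚ product (map (signIn ms (rt α xs)) ms)
      sign≡ = trans (cong product (map-++ sg ms′ [ α ])) (trans (product-∷ʳ (map sg ms′) (sg α)) (cong₂ _*ℚ_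
        (cong (λ n → if odd (proj₁ α) then [-1]^ pred n else 1ℚ) (trans (cong length labels-co′) (length-co α xs vα)))
        (cong product (trans (sym (map-∘ {g = sg} {f = embed α} ms)) (map-cong-All {f = sg ∘ embed α} {g = signIn ms (rt α xs)} (λ {γ} v →
          cong₂ (λ o n → if o then [-1]^ pred n else 1ℚ) (odd-embed α xs vα γ) (cong length (labels-rt′ (just γ) (proj₁ v ∷ [])))) vms)))))
        where
        sg : Arc → ℚ
        sg = signIn (ms′ ∷ʳ α) xs

    -- In an order that ends with `α` no region lies beyond `α`, so its letter is `co α xs`, of
    -- weight `c`. By `labels-rt` the other letters and signs are those of the dissection of
    -- `rt α xs`, and the order conditions that involve `α` hold by `embed-before`.
    orderedTerm-embed : orderedTerm xs (map (embed α) ms ∷ʳ α) ∼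
                        sign α • mapGen (_∷ʳ co α xs) (orderedTerm (rt α xs) ms)
    orderedTerm-embed = begin
      guard (allPairs? before? (ms′ ∷ʳ α)) (product (map (signIn (ms′ ∷ʳ α) xs) (ms′ ∷ʳ α)) • ⟦ dissectionWord (ms′ ∷ʳ α) xs ⟧)
        ≈⟨ guard-cong (allPairs? before? (ms′ ∷ʳ α)) (allPairs? before? ms) (Equivalence.from pairs⇔) (Equivalence.to pairs⇔) (λ _ → ≈-refl) ⟩
      guard (allPairs? before? ms) (product (map (signIn (ms′ ∷ʳ α) xs) (ms′ ∷ʳ α)) • ⟦ dissectionWord (ms′ ∷ʳ α) xs ⟧)
        ≡⟨ cong (guard (allPairs? before? ms)) (trans (cong₂ (λ q w → q • ⟦ w ⟧) sign≡ word≡) (sym (•-• (sign α) q ⟦ w ∷ʳ co α xs ⟧))) ⟩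
      guard (allPairs? before? ms) (sign α • (q • ⟦ w ∷ʳ co α xs ⟧))
        ≡⟨ cong (λ u → guard (allPairs? before? ms) (sign α • u))
             (trans (linear-• (λ w → ⟦ w ∷ʳ co α xs ⟧) q ⟦ w ⟧) (cong (q •_) (linear-⟦⟧ (λ w → ⟦ w ∷ʳ co α xs ⟧) w))) ⟨
      guard (allPairs? before? ms) (sign α • mapGen (_∷ʳ co α xs) (q • ⟦ w ⟧))
        ≡⟨ •-guard (sign α) (allPairs? before? ms) (mapGen (_∷ʳ co α xs) (q • ⟦ w ⟧)) ⟨
      sign α • guard (allPairs? before? ms) (mapGen (_∷ʳ co α xs) (q • ⟦ w ⟧))
        ≡⟨ cong (sign α •_) (linear-guard (λ w → ⟦ w ∷ʳ co α xs ⟧) (allPairs? before? ms) (q • ⟦ w ⟧)) ⟨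
      sign α • mapGen (_∷ʳ co α xs) (orderedTerm (rt α xs) ms) ∎
      where
      open ∼-Reasoning (List (List X))
      q = product (map (signIn ms (rt α xs)) ms)
      w = dissectionWord ms (rt α xs)

  arrangements-before : ∀ {L′} → arcs (length xs) ↭ α ∷ L′ →
                        ∑-arrangements L′ (λ ms → orderedTerm xs (ms ∷ʳ α)) ∼
                        sign α • mapGen (_∷ʳ co α xs) (𝔹 (rt α xs))
  arrangements-before {L′} p = begin
    ∑-arrangements L′ f
      ≈⟨ ∑-arrangements-filter b? L′ f (λ ms ¬b → ≡⇒≈ (guard-no (allPairs? before? (ms ∷ʳ α)) (λ ps → ¬b (proj₂ (AllPairs-∷ʳ⁻ ms ps))))) ⟩
    ∑-arrangements (filter b? L′) f
      ≈⟨ ∑-arrangements-↭ f filtered ⟩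
    ∑-arrangements (map (embed α) (arcs N′)) f
      ≡⟨ ∑-arrangements-map (embed α) (arcs N′) f ⟩
    ∑-arrangements (arcs N′) (f ∘ map (embed α))
      ≈⟨ ∑-arrangements-cong (All.tabulate (arcs-valid N′)) (λ ms vms → orderedTerm-embed ms vms) ⟩
    ∑-arrangements (arcs N′) (λ ms → sign α • mapGen (_∷ʳ co α xs) (orderedTerm (rt α xs) ms))
      ≡⟨ ∑-≗ (λ as → •-linear-∑ (sign α) h (permutations as) (orderedTerm (rt α xs))) (sublists (arcs N′)) ⟨
    (∑[ as ∈ sublists (arcs N′) ] sign α • mapGen (_∷ʳ co α xs) (∑[ ms ∈ permutations as ] orderedTerm (rt α xs) ms))
      ≡⟨ •-linear-∑ (sign α) h (sublists (arcs N′)) (λ as → ∑ (permutations as) (orderedTerm (rt α xs))) ⟨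
    sign α • mapGen (_∷ʳ co α xs) (𝔹 (rt α xs)) ∎
    where
    open ∼-Reasoning (List (List X))
    b? = λ γ → before? γ α
    f : List Arc → Lin (List (List X))
    f = λ ms → orderedTerm xs (ms ∷ʳ α)
    h : List (List X) → Lin (List (List X))
    h = λ w → ⟦ w ∷ʳ co α xs ⟧
    filtered : filter b? L′ ↭ map (embed α) (arcs N′)
    -- `Before α α` fails, so `α` can be put back in front of `L′` without changing the filtered
    -- list.
    filtered = ↭-trans (subst (λ L → filter b? L′ ↭ L) (sym (filter-reject b? (Before-irrefl α (proj₁ vα)))) ↭refl)
      (↭-trans (↭.filter-↭ b? (↭-sym p)) (arcs-before α N′ vα (length-rt α xs vα)))

𝔹-last : (xs : List X) → 𝔹 xs ∼ ⟦ [ xs ] ⟧ ⊕ (∑[ α ∈ arcs (length xs) ] sign α • mapGen (_∷ʳ co α xs) (𝔹 (rt α xs)))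
𝔹-last {X = X} xs = begin
  𝔹 xs
    ≈⟨ ∑-arrangements-last (arcs (length xs)) (orderedTerm xs) ⟩
  orderedTerm xs [] ⊕ ∑ (picks L) (λ (α , L′) → ∑-arrangements L′ (λ ms → orderedTerm xs (ms ∷ʳ α)))
    ≈⟨ ⊕-cong (≡⇒≈ (trans (1• ⟦ [ labels [] nothing xs ] ⟧) (cong (λ u → ⟦ [ u ] ⟧) (labels-[] xs))))
         (∑-cong-∈ (picks L) (λ (α , L′) αL′∈ → let p = All.lookup (picks-↭ L) αL′∈ in
            arrangements-before α xs (arcs-valid (length xs) (↭.∈-resp-↭ (↭-sym p) (here refl))) p)) ⟩
  ⟦ [ xs ] ⟧ ⊕ ∑ (picks L) (λ (α , _) → sign α • mapGen (_∷ʳ co α xs) (𝔹 (rt α xs)))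
    ≡⟨ cong (⟦ [ xs ] ⟧ ⊕_) (∑-picks L (λ α → sign α • mapGen (_∷ʳ co α xs) (𝔹 (rt α xs)))) ⟩
  ⟦ [ xs ] ⟧ ⊕ (∑[ α ∈ L ] sign α • mapGen (_∷ʳ co α xs) (𝔹 (rt α xs))) ∎
  where
  open ∼-Reasoning (List (List X))
  L = arcs (length xs)

-- Shuffles of letters of degree zero

module _ {X : Set ℓ} where

  cons : X → Lin (List X) → Lin (List X)
  cons x = mapGen (x ∷_)

  infixl 8 _▷_
  _▷_ : Lin (List X) → X → Lin (List X)
  p ▷ x = mapGen (_∷ʳ x) p

  -- The shuffle product of letters of degree zero, for arbitrary letters and before any relations.
  -- On words of polygons `shuffle-embedWord` identifies it with `shuffle`.
  shuf : List X → List X → Lin (List X)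
  shuf []      w       = ⟦ w ⟧
  shuf (x ∷ u) []      = ⟦ x ∷ u ⟧
  shuf (x ∷ u) (y ∷ w) = cons x (shuf u (y ∷ w)) ⊕ cons y (shuf (x ∷ u) w)

  infixl 7 _⧢_
  _⧢_ : Lin (List X) → Lin (List X) → Lin (List X)
  _⧢_ = bilinear shuf

  ∏⧢ : List (Lin (List X)) → Lin (List X)
  ∏⧢ = foldr _⧢_ ⟦ [] ⟧

  private
    W : Set ℓ
    W = List X

  cons-⊕ : ∀ x p q → cons x (p ⊕ q) ≡ cons x p ⊕ cons x q
  cons-⊕ x p q = linear-⊕ (λ u → ⟦ x ∷ u ⟧) p q

  ▷-⊕ : ∀ p q x → (p ⊕ q) ▷ x ≡ p ▷ x ⊕ q ▷ x
  ▷-⊕ p q x = linear-⊕ (λ u → ⟦ u ∷ʳ x ⟧) p q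

  ⧢-cong : ∀ {p p′ q q′} → p ∼ p′ → q ∼ q′ → p ⧢ q ∼ p′ ⧢ q′
  ⧢-cong = bilinear-cong shuf

  ⧢-congˡ : ∀ {p q q′} → q ∼ q′ → p ⧢ q ∼ p ⧢ q′
  ⧢-congˡ {p} e = ⧢-cong (≈-refl {x = p}) e

  ⧢-congʳ : ∀ {p p′ q} → p ∼ p′ → p ⧢ q ∼ p′ ⧢ q
  ⧢-congʳ {q = q} e = ⧢-cong e (≈-refl {x = q})

  shuf-[]ʳ : ∀ u → shuf u [] ≡ ⟦ u ⟧
  shuf-[]ʳ []      = refl
  shuf-[]ʳ (x ∷ u) = refl

  ⧢-identityˡ : ∀ p → ⟦ [] ⟧ ⧢ p ≡ p
  ⧢-identityˡ p = trans (linear-⟦⟧ (λ u → linear (shuf u) p) []) (linear-id p)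

  ⧢-identityʳ : ∀ p → p ⧢ ⟦ [] ⟧ ≡ p
  ⧢-identityʳ p = trans (linear-≗ (λ u → trans (linear-⟦⟧ (shuf u) []) (shuf-[]ʳ u)) p) (linear-id p)

  shuf-comm : ∀ u w → shuf u w ∼ shuf w u
  shuf-comm []      w       = ≡⇒≈ (sym (shuf-[]ʳ w))
  shuf-comm (x ∷ u) []      = ≈-refl
  shuf-comm (x ∷ u) (y ∷ w) = ≈-trans
    (⊕-cong (mapGen-cong (x ∷_) (shuf-comm u (y ∷ w))) (mapGen-cong (y ∷_) (shuf-comm (x ∷ u) w)))
    (⊕-comm (cons x (shuf (y ∷ w) u)) (cons y (shuf w (x ∷ u))))

  ⧢-comm : ∀ p q → p ⧢ q ∼ q ⧢ p
  ⧢-comm p q = ≈-trans (linear-swap shuf p q) (linear-cong (λ w → linear-cong (λ u → shuf-comm u w) p) q)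

  private
    infixl 7 _⧢ˡ_ _⧢ʳ_
    _⧢ˡ_ : W → Lin W → Lin W
    u ⧢ˡ p = linear (shuf u) p
    _⧢ʳ_ : Lin W → W → Lin W
    p ⧢ʳ w = linear (λ u → shuf u w) p

    cons-⧢ʳ : ∀ x p z t → cons x p ⧢ʳ (z ∷ t) ∼ cons x (p ⧢ʳ (z ∷ t)) ⊕ cons z (cons x p ⧢ʳ t)
    cons-⧢ʳ x p z t = begin
      cons x p ⧢ʳ (z ∷ t)
        ≡⟨ linear-mapGen (λ u → shuf u (z ∷ t)) (x ∷_) p ⟩
      linear (λ u → cons x (shuf u (z ∷ t)) ⊕ cons z (shuf (x ∷ u) t)) p
        ≈⟨ linear-⊕ʳ (λ u → cons x (shuf u (z ∷ t))) (λ u → cons z (shuf (x ∷ u) t)) p ⟩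
      linear (λ u → cons x (shuf u (z ∷ t))) p ⊕ linear (λ u → cons z (shuf (x ∷ u) t)) p
        ≡⟨ cong₂ _⊕_ (sym (mapGen-linear (x ∷_) (λ u → shuf u (z ∷ t)) p))
             (trans (sym (mapGen-linear (z ∷_) (λ u → shuf (x ∷ u) t) p))
                    (cong (cons z) (sym (linear-mapGen (λ u → shuf u t) (x ∷_) p)))) ⟩
      cons x (p ⧢ʳ (z ∷ t)) ⊕ cons z (cons x p ⧢ʳ t) ∎
      where open ∼-Reasoning W

    ⧢ˡ-cons : ∀ x u y p → (x ∷ u) ⧢ˡ cons y p ∼ cons x (u ⧢ˡ cons y p) ⊕ cons y ((x ∷ u) ⧢ˡ p)
    ⧢ˡ-cons x u y p = begin
      (x ∷ u) ⧢ˡ cons y p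
        ≡⟨ linear-mapGen (shuf (x ∷ u)) (y ∷_) p ⟩
      linear (λ w → cons x (shuf u (y ∷ w)) ⊕ cons y (shuf (x ∷ u) w)) p
        ≈⟨ linear-⊕ʳ (λ w → cons x (shuf u (y ∷ w))) (λ w → cons y (shuf (x ∷ u) w)) p ⟩
      linear (λ w → cons x (shuf u (y ∷ w))) p ⊕ linear (λ w → cons y (shuf (x ∷ u) w)) p
        ≡⟨ cong₂ _⊕_ (trans (sym (mapGen-linear (x ∷_) (λ w → shuf u (y ∷ w)) p))
                       (cong (cons x) (sym (linear-mapGen (shuf u) (y ∷_) p))))
             (sym (mapGen-linear (y ∷_) (shuf (x ∷ u)) p)) ⟩
      cons x (u ⧢ˡ cons y p) ⊕ cons y ((x ∷ u) ⧢ˡ p) ∎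
      where open ∼-Reasoning W

  -- Sorted by first letters, both sides are sums of three parts, beginning with `x`, `y` and `z`,
  -- and each part falls under an induction hypothesis.
  shuf-assoc : ∀ u w t → linear (λ v → shuf v t) (shuf u w) ∼ linear (shuf u) (shuf w t)
  shuf-assoc []      w       t  = ≡⇒≈ (trans (linear-⟦⟧ (λ v → shuf v t) w) (sym (linear-id (shuf w t))))
  shuf-assoc (x ∷ u) []      t  = ≡⇒≈ (trans (linear-⟦⟧ (λ v → shuf v t) (x ∷ u)) (sym (linear-⟦⟧ (shuf (x ∷ u)) t)))
  shuf-assoc (x ∷ u) (y ∷ w) [] = ≡⇒≈ (trans (linear-≗ shuf-[]ʳ (shuf (x ∷ u) (y ∷ w)))
    (trans (linear-id _) (sym (linear-⟦⟧ (shuf (x ∷ u)) (y ∷ w)))))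
  shuf-assoc (x ∷ u) (y ∷ w) (z ∷ t) = begin
    (cons x p ⊕ cons y q) ⧢ʳ c
      ≡⟨ linear-⊕ (λ v → shuf v c) (cons x p) (cons y q) ⟩
    cons x p ⧢ʳ c ⊕ cons y q ⧢ʳ c
      ≈⟨ ⊕-cong (cons-⧢ʳ x p z t) (cons-⧢ʳ y q z t) ⟩
    (cons x (p ⧢ʳ c) ⊕ cons z (cons x p ⧢ʳ t)) ⊕ (cons y (q ⧢ʳ c) ⊕ cons z (cons y q ⧢ʳ t))
      ≈⟨ ⊕-interchange (cons x (p ⧢ʳ c)) (cons z (cons x p ⧢ʳ t)) (cons y (q ⧢ʳ c)) _ ⟩
    (cons x (p ⧢ʳ c) ⊕ cons y (q ⧢ʳ c)) ⊕ (cons z (cons x p ⧢ʳ t) ⊕ cons z (cons y q ⧢ʳ t))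
      ≡⟨ cong (cons x (p ⧢ʳ c) ⊕ cons y (q ⧢ʳ c) ⊕_)
           (trans (sym (cons-⊕ z (cons x p ⧢ʳ t) (cons y q ⧢ʳ t)))
                  (cong (cons z) (sym (linear-⊕ (λ v → shuf v t) (cons x p) (cons y q))))) ⟩
    (cons x (p ⧢ʳ c) ⊕ cons y (q ⧢ʳ c)) ⊕ cons z (shuf (x ∷ u) (y ∷ w) ⧢ʳ t)
      ≈⟨ ⊕-cong (⊕-cong (mapGen-cong (x ∷_) (shuf-assoc u (y ∷ w) (z ∷ t))) (mapGen-cong (y ∷_) (shuf-assoc (x ∷ u) w (z ∷ t))))
                (mapGen-cong (z ∷_) (shuf-assoc (x ∷ u) (y ∷ w) t)) ⟩
    (cons x (u ⧢ˡ (cons y r ⊕ cons z s)) ⊕ cons y (a ⧢ˡ r)) ⊕ cons z (a ⧢ˡ s)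
      ≡⟨ cong (λ v → (v ⊕ cons y (a ⧢ˡ r)) ⊕ cons z (a ⧢ˡ s))
           (trans (cong (cons x) (linear-⊕ (shuf u) (cons y r) (cons z s))) (cons-⊕ x (u ⧢ˡ cons y r) (u ⧢ˡ cons z s))) ⟩
    ((cons x (u ⧢ˡ cons y r) ⊕ cons x (u ⧢ˡ cons z s)) ⊕ cons y (a ⧢ˡ r)) ⊕ cons z (a ⧢ˡ s)
      ≡⟨ ++-assoc (cons x (u ⧢ˡ cons y r) ⊕ cons x (u ⧢ˡ cons z s)) (cons y (a ⧢ˡ r)) (cons z (a ⧢ˡ s)) ⟩
    (cons x (u ⧢ˡ cons y r) ⊕ cons x (u ⧢ˡ cons z s)) ⊕ (cons y (a ⧢ˡ r) ⊕ cons z (a ⧢ˡ s))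
      ≈⟨ ⊕-interchange (cons x (u ⧢ˡ cons y r)) (cons x (u ⧢ˡ cons z s)) (cons y (a ⧢ˡ r)) _ ⟩
    (cons x (u ⧢ˡ cons y r) ⊕ cons y (a ⧢ˡ r)) ⊕ (cons x (u ⧢ˡ cons z s) ⊕ cons z (a ⧢ˡ s))
      ≈⟨ ⊕-cong (⧢ˡ-cons x u y r) (⧢ˡ-cons x u z s) ⟨
    a ⧢ˡ cons y r ⊕ a ⧢ˡ cons z s
      ≡⟨ linear-⊕ (shuf a) (cons y r) (cons z s) ⟨
    a ⧢ˡ (cons y r ⊕ cons z s) ∎
    where
    open ∼-Reasoning W
    c = z ∷ t
    a = x ∷ u
    p = shuf u (y ∷ w)
    q = shuf (x ∷ u) w
    r = shuf w (z ∷ t)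
    s = shuf (y ∷ w) t

  ⧢-assoc : ∀ p q r → (p ⧢ q) ⧢ r ∼ p ⧢ (q ⧢ r)
  ⧢-assoc p q r = begin
    (p ⧢ q) ⧢ r
      ≡⟨ linear-linear (λ v → linear (shuf v) r) (λ u → linear (shuf u) q) p ⟩
    linear (λ u → linear (λ v → linear (shuf v) r) (linear (shuf u) q)) p
      ≡⟨ linear-≗ (λ u → linear-linear (λ v → linear (shuf v) r) (shuf u) q) p ⟩
    linear (λ u → linear (λ w → linear (λ v → linear (shuf v) r) (shuf u w)) q) p
      ≈⟨ linear-cong (λ u → linear-cong (λ w → ≈-trans (linear-swap shuf (shuf u w) r)
           (≈-trans (linear-cong (shuf-assoc u w) r) (≡⇒≈ (sym (linear-linear (shuf u) (shuf w) r))))) q) p ⟩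
    linear (λ u → linear (λ w → linear (shuf u) (linear (shuf w) r)) q) p
      ≡⟨ linear-≗ (λ u → linear-linear (shuf u) (λ w → linear (shuf w) r) q) p ⟨
    p ⧢ (q ⧢ r) ∎
    where open ∼-Reasoning W

  ⧢-swapˡ : ∀ p q r → p ⧢ (q ⧢ r) ∼ q ⧢ (p ⧢ r)
  ⧢-swapˡ p q r = ≈-trans (≈-sym (⧢-assoc p q r)) (≈-trans (⧢-congʳ {q = r} (⧢-comm p q)) (⧢-assoc q p r))

  private
    cons-▷ : ∀ y p x → cons y p ▷ x ≡ cons y (p ▷ x)
    cons-▷ y p x = trans (mapGen-mapGen (_∷ʳ x) (y ∷_) p) (sym (mapGen-mapGen (y ∷_) (_∷ʳ x) p))

  -- `shuf` is defined by recursion on first letters; this is the mirror image of that recursion, as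
  -- needed for an induction on last letters.
  shuf-last : ∀ u x w y → shuf (u ∷ʳ x) (w ∷ʳ y) ∼ shuf u (w ∷ʳ y) ▷ x ⊕ shuf (u ∷ʳ x) w ▷ y
  shuf-last []      x []      y = ⊕-comm ⟦ x ∷ y ∷ [] ⟧ ⟦ y ∷ x ∷ [] ⟧
  shuf-last []      x (b ∷ w) y = begin
    ⟦ x ∷ b ∷ w ∷ʳ y ⟧ ⊕ cons b (shuf [ x ] (w ∷ʳ y))
      ≈⟨ ⊕-congˡ {x = ⟦ x ∷ b ∷ w ∷ʳ y ⟧} (mapGen-cong (b ∷_) (shuf-last [] x w y)) ⟩
    ⟦ x ∷ b ∷ w ∷ʳ y ⟧ ⊕ (⟦ b ∷ w ∷ʳ y ∷ʳ x ⟧ ⊕ cons b (shuf [ x ] w ▷ y))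
      ≈⟨ ⊕-swapˡ ⟦ x ∷ b ∷ w ∷ʳ y ⟧ ⟦ b ∷ w ∷ʳ y ∷ʳ x ⟧ _ ⟩
    ⟦ b ∷ w ∷ʳ y ∷ʳ x ⟧ ⊕ (⟦ x ∷ b ∷ w ∷ʳ y ⟧ ⊕ cons b (shuf [ x ] w ▷ y))
      ≡⟨ cong (λ v → ⟦ b ∷ w ∷ʳ y ∷ʳ x ⟧ ⊕ (⟦ x ∷ b ∷ w ∷ʳ y ⟧ ⊕ v)) (cons-▷ b (shuf [ x ] w) y) ⟨
    ⟦ b ∷ w ∷ʳ y ∷ʳ x ⟧ ⊕ (⟦ x ∷ b ∷ w ∷ʳ y ⟧ ⊕ cons b (shuf [ x ] w) ▷ y)
      ≡⟨ cong (⟦ b ∷ w ∷ʳ y ∷ʳ x ⟧ ⊕_) (▷-⊕ ⟦ x ∷ b ∷ w ⟧ (cons b (shuf [ x ] w)) y) ⟨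
    ⟦ b ∷ w ∷ʳ y ∷ʳ x ⟧ ⊕ shuf [ x ] (b ∷ w) ▷ y ∎
    where open ∼-Reasoning W
  shuf-last (a ∷ u) x [] y = begin
    shuf (a ∷ u ∷ʳ x) [ y ]
      ≈⟨ ⊕-congʳ {y = ⟦ y ∷ a ∷ u ∷ʳ x ⟧} (mapGen-cong (a ∷_) (shuf-last u x [] y)) ⟩
    cons a (shuf u [ y ] ▷ x ⊕ shuf (u ∷ʳ x) [] ▷ y) ⊕ ⟦ y ∷ a ∷ u ∷ʳ x ⟧
      ≡⟨ cong (_⊕ ⟦ y ∷ a ∷ u ∷ʳ x ⟧) (trans (cons-⊕ a (shuf u [ y ] ▷ x) (shuf (u ∷ʳ x) [] ▷ y)) (cong₂ _⊕_ (sym (cons-▷ a (shuf u [ y ]) x))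
           (cong (λ v → cons a (v ▷ y)) (shuf-[]ʳ (u ∷ʳ x))))) ⟩
    (cons a (shuf u [ y ]) ▷ x ⊕ ⟦ a ∷ u ∷ʳ x ∷ʳ y ⟧) ⊕ ⟦ y ∷ a ∷ u ∷ʳ x ⟧
      ≡⟨ ++-assoc (cons a (shuf u [ y ]) ▷ x) ⟦ a ∷ u ∷ʳ x ∷ʳ y ⟧ ⟦ y ∷ a ∷ u ∷ʳ x ⟧ ⟩
    cons a (shuf u [ y ]) ▷ x ⊕ (⟦ a ∷ u ∷ʳ x ∷ʳ y ⟧ ⊕ ⟦ y ∷ a ∷ u ∷ʳ x ⟧)
      ≈⟨ ⊕-congˡ {x = cons a (shuf u [ y ]) ▷ x} (⊕-comm ⟦ a ∷ u ∷ʳ x ∷ʳ y ⟧ ⟦ y ∷ a ∷ u ∷ʳ x ⟧) ⟩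
    cons a (shuf u [ y ]) ▷ x ⊕ (⟦ y ∷ a ∷ u ∷ʳ x ⟧ ⊕ ⟦ a ∷ u ∷ʳ x ∷ʳ y ⟧)
      ≡⟨ ++-assoc (cons a (shuf u [ y ]) ▷ x) ⟦ y ∷ a ∷ u ∷ʳ x ⟧ ⟦ a ∷ u ∷ʳ x ∷ʳ y ⟧ ⟨
    (cons a (shuf u [ y ]) ▷ x ⊕ ⟦ y ∷ a ∷ u ∷ʳ x ⟧) ⊕ ⟦ a ∷ u ∷ʳ x ∷ʳ y ⟧
      ≡⟨ cong (_⊕ ⟦ a ∷ u ∷ʳ x ∷ʳ y ⟧) (▷-⊕ (cons a (shuf u [ y ])) ⟦ y ∷ a ∷ u ⟧ x) ⟨
    shuf (a ∷ u) [ y ] ▷ x ⊕ ⟦ a ∷ u ∷ʳ x ∷ʳ y ⟧ ∎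
    where open ∼-Reasoning W
  shuf-last (a ∷ u) x (b ∷ w) y = begin
    cons a (shuf (u ∷ʳ x) (b ∷ w ∷ʳ y)) ⊕ cons b (shuf (a ∷ u ∷ʳ x) (w ∷ʳ y))
      ≈⟨ ⊕-cong (mapGen-cong (a ∷_) (shuf-last u x (b ∷ w) y)) (mapGen-cong (b ∷_) (shuf-last (a ∷ u) x w y)) ⟩
    cons a (p ▷ x ⊕ q ▷ y) ⊕ cons b (r ▷ x ⊕ s ▷ y)
      ≡⟨ cong₂ _⊕_ (split a p q) (split b r s) ⟩
    (cons a p ▷ x ⊕ cons a q ▷ y) ⊕ (cons b r ▷ x ⊕ cons b s ▷ y)
      ≈⟨ ⊕-interchange (cons a p ▷ x) (cons a q ▷ y) (cons b r ▷ x) _ ⟩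
    (cons a p ▷ x ⊕ cons b r ▷ x) ⊕ (cons a q ▷ y ⊕ cons b s ▷ y)
      ≡⟨ cong₂ _⊕_ (▷-⊕ (cons a p) (cons b r) x) (▷-⊕ (cons a q) (cons b s) y) ⟨
    (cons a p ⊕ cons b r) ▷ x ⊕ (cons a q ⊕ cons b s) ▷ y ∎
    where
    open ∼-Reasoning W
    p = shuf u (b ∷ w ∷ʳ y)
    q = shuf (u ∷ʳ x) (b ∷ w)
    r = shuf (a ∷ u) (w ∷ʳ y)
    s = shuf (a ∷ u ∷ʳ x) w
    split : ∀ c p q → cons c (p ▷ x ⊕ q ▷ y) ≡ cons c p ▷ x ⊕ cons c q ▷ y
    split c p q = trans (cons-⊕ c (p ▷ x) (q ▷ y)) (cong₂ _⊕_ (sym (cons-▷ c p x)) (sym (cons-▷ c q y)))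

  ⧢-last : ∀ p x q y → (p ▷ x) ⧢ (q ▷ y) ∼ (p ⧢ (q ▷ y)) ▷ x ⊕ ((p ▷ x) ⧢ q) ▷ y
  ⧢-last p x q y = begin
    (p ▷ x) ⧢ (q ▷ y)
      ≡⟨ trans (linear-mapGen (λ u → linear (shuf u) (q ▷ y)) (_∷ʳ x) p) (linear-≗ (λ u → linear-mapGen (shuf (u ∷ʳ x)) (_∷ʳ y) q) p) ⟩
    linear (λ u → linear (λ w → shuf (u ∷ʳ x) (w ∷ʳ y)) q) p
      ≈⟨ linear-cong (λ u → ≈-trans (linear-cong (λ w → shuf-last u x w y) q)
           (linear-⊕ʳ (λ w → shuf u (w ∷ʳ y) ▷ x) (λ w → shuf (u ∷ʳ x) w ▷ y) q)) p ⟩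
    linear (λ u → linear (λ w → shuf u (w ∷ʳ y) ▷ x) q ⊕ linear (λ w → shuf (u ∷ʳ x) w ▷ y) q) p
      ≈⟨ linear-⊕ʳ (λ u → linear (λ w → shuf u (w ∷ʳ y) ▷ x) q) (λ u → linear (λ w → shuf (u ∷ʳ x) w ▷ y) q) p ⟩
    linear (λ u → linear (λ w → shuf u (w ∷ʳ y) ▷ x) q) p ⊕ linear (λ u → linear (λ w → shuf (u ∷ʳ x) w ▷ y) q) p
      ≡⟨ cong₂ _⊕_
           (trans (linear-≗ (λ u → trans (sym (mapGen-linear (_∷ʳ x) (λ w → shuf u (w ∷ʳ y)) q))
                (cong (_▷ x) (sym (linear-mapGen (shuf u) (_∷ʳ y) q)))) p)
              (sym (mapGen-linear (_∷ʳ x) (λ u → linear (shuf u) (q ▷ y)) p)))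
           (trans (linear-≗ (λ u → sym (mapGen-linear (_∷ʳ y) (shuf (u ∷ʳ x)) q)) p)
              (trans (sym (mapGen-linear (_∷ʳ y) (λ u → linear (shuf (u ∷ʳ x)) q) p))
                (cong (_▷ y) (sym (linear-mapGen (λ u → linear (shuf u) q) (_∷ʳ x) p))))) ⟩
    (p ⧢ (q ▷ y)) ▷ x ⊕ ((p ▷ x) ⧢ q) ▷ y ∎
    where open ∼-Reasoning W

  -- A combination without the empty word, sorted by last letters: an entry `(p , x)` stands for the
  -- words of `p` followed by `x`.
  lastSum : List (Lin (List X) × X) → Lin (List X)
  lastSum K = ∑ K (λ (p , x) → p ▷ x)

  lastSum-⧢ : ∀ K K′ → lastSum K ⧢ lastSum K′ ∼
              ∑ K (λ (p , x) → (p ⧢ lastSum K′) ▷ x) ⊕ ∑ K′ (λ (q , y) → (lastSum K ⧢ q) ▷ y)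
  lastSum-⧢ K K′ = begin
    lastSum K ⧢ lastSum K′
      ≡⟨ bilinear-∑ˡ shuf K _ (lastSum K′) ⟩
    ∑ K (λ (p , x) → (p ▷ x) ⧢ lastSum K′)
      ≈⟨ ∑-cong K (λ (p , x) → ≈-trans (bilinear-∑ʳ shuf K′ (p ▷ x) (λ (q , y) → q ▷ y))
           (≈-trans (∑-cong K′ (λ (q , y) → ⧢-last p x q y)) (∑-⊕ K′ (λ (q , y) → (p ⧢ (q ▷ y)) ▷ x) (λ (q , y) → ((p ▷ x) ⧢ q) ▷ y)))) ⟩
    ∑ K (λ (p , x) → ∑ K′ (λ (q , y) → (p ⧢ (q ▷ y)) ▷ x) ⊕ ∑ K′ (λ (q , y) → ((p ▷ x) ⧢ q) ▷ y))
      ≈⟨ ∑-⊕ K (λ (p , x) → ∑ K′ (λ (q , y) → (p ⧢ (q ▷ y)) ▷ x)) (λ (p , x) → ∑ K′ (λ (q , y) → ((p ▷ x) ⧢ q) ▷ y)) ⟩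
    ∑ K (λ (p , x) → ∑ K′ (λ (q , y) → (p ⧢ (q ▷ y)) ▷ x)) ⊕ ∑ K (λ (p , x) → ∑ K′ (λ (q , y) → ((p ▷ x) ⧢ q) ▷ y))
      ≈⟨ ⊕-cong
           (∑-cong K (λ (p , x) → ≈-trans (≡⇒≈ (sym (linear-∑ (λ w → ⟦ w ∷ʳ x ⟧) K′ (λ (q , y) → p ⧢ (q ▷ y)))))
             (mapGen-cong (_∷ʳ x) (≈-sym (bilinear-∑ʳ shuf K′ p (λ (q , y) → q ▷ y))))))
           (≈-trans (∑-swap K K′ (λ (p , x) (q , y) → ((p ▷ x) ⧢ q) ▷ y)) (≡⇒≈ (∑-≗ (λ (q , y) →
             trans (sym (linear-∑ (λ w → ⟦ w ∷ʳ y ⟧) K (λ (p , x) → (p ▷ x) ⧢ q)))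
                   (cong (_▷ y) (sym (bilinear-∑ˡ shuf K (λ (p , x) → p ▷ x) q)))) K′))) ⟩
    ∑ K (λ (p , x) → (p ⧢ lastSum K′) ▷ x) ⊕ ∑ K′ (λ (q , y) → (lastSum K ⧢ q) ▷ y) ∎
    where open ∼-Reasoning W

  module _ {A : Set ℓ′} (f : A → Lin (List X)) (K : A → List (Lin (List X) × X)) (e : ∀ i → f i ∼ lastSum (K i)) where

    private
      lasts : List A → Lin W
      lasts is = ∑ (picks is) (λ (i , r) → ∑ (K i) (λ (p , x) → (p ⧢ ∏⧢ (map f r)) ▷ x))

    ∏⧢-last-∷ : ∀ i is → ∏⧢ (map f is) ∼ lasts is → ∏⧢ (map f (i ∷ is)) ∼ lasts (i ∷ is)
    ∏⧢-last-∷ i is e′ = begin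
      f i ⧢ ∏⧢ (map f is)
        ≈⟨ ⧢-cong (e i) rest ⟩
      lastSum (K i) ⧢ lastSum K′
        ≈⟨ lastSum-⧢ (K i) K′ ⟩
      ∑ (K i) (λ (p , x) → (p ⧢ lastSum K′) ▷ x) ⊕ ∑ K′ (λ (q , y) → (lastSum (K i) ⧢ q) ▷ y)
        ≈⟨ ⊕-cong (∑-cong (K i) (λ (p , x) → mapGen-cong (_∷ʳ x) (⧢-congˡ {p} (≈-sym rest))))
             (≈-trans (∑-cong K′ (λ (q , y) → mapGen-cong (_∷ʳ y) (⧢-congʳ {q = q} (≈-sym (e i)))))
               (≈-trans (≡⇒≈ (flatten (λ (q , y) → (f i ⧢ q) ▷ y)))
                 (∑-cong (picks is) (λ (j , r) → ∑-cong (K j) (λ (p , x) →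
                   mapGen-cong (_∷ʳ x) (⧢-swapˡ (f i) p (∏⧢ (map f r)))))))) ⟩
      ∑ (K i) (λ (p , x) → (p ⧢ ∏⧢ (map f is)) ▷ x) ⊕
        ∑ (picks is) (λ (j , r) → ∑ (K j) (λ (p , x) → (p ⧢ ∏⧢ (map f (i ∷ r))) ▷ x))
        ≡⟨ cong (∑ (K i) (λ (p , x) → (p ⧢ ∏⧢ (map f is)) ▷ x) ⊕_) (∑-map (map₂ (i ∷_)) (picks is) (λ (j , r) → ∑ (K j) (λ (p , x) → (p ⧢ ∏⧢ (map f r)) ▷ x))) ⟨
      ∑ (picks (i ∷ is)) (λ (j , r) → ∑ (K j) (λ (p , x) → (p ⧢ ∏⧢ (map f r)) ▷ x)) ∎
      where
      open ∼-Reasoning W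
      factor : List A → Lin W × X → Lin W × X
      factor r (p , x) = p ⧢ ∏⧢ (map f r) , x
      K′ : List (Lin W × X)
      K′ = concatMap (λ (j , r) → map (factor r) (K j)) (picks is)
      flatten : (g : Lin W × X → Lin W) → ∑ K′ g ≡ ∑ (picks is) (λ (j , r) → ∑ (K j) (g ∘ factor r))
      flatten g = trans (∑-concatMap (λ (j , r) → map (factor r) (K j)) (picks is) g)
        (∑-≗ (λ (j , r) → ∑-map (factor r) (K j) g) (picks is))
      rest : ∏⧢ (map f is) ∼ lastSum K′
      rest = ≈-trans e′ (≡⇒≈ (sym (flatten (λ (p , x) → p ▷ x))))

    -- The last letter of a shuffle product is the last letter of one of the factors.
    ∏⧢-last : ∀ is → ∏⧢ (map f is) ∼
              atNil is ⟦ [] ⟧ ⊕ ∑ (picks is) (λ (i , r) → ∑ (K i) (λ (p , x) → (p ⧢ ∏⧢ (map f r)) ▷ x))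
    ∏⧢-last []       = ≈-refl
    -- The empty product is the empty word, which has no last letter, so the case of a single factor
    -- cannot be obtained from `∏⧢-last-∷`.
    ∏⧢-last (i ∷ []) = begin
      f i ⧢ ⟦ [] ⟧
        ≡⟨ ⧢-identityʳ (f i) ⟩
      f i
        ≈⟨ e i ⟩
      lastSum (K i)
        ≡⟨ ∑-≗ (λ (p , x) → cong (_▷ x) (⧢-identityʳ p)) (K i) ⟨
      ∑ (K i) (λ (p , x) → (p ⧢ ⟦ [] ⟧) ▷ x)
        ≡⟨ ⊕-identityʳ _ ⟨
      ∑ (K i) (λ (p , x) → (p ⧢ ⟦ [] ⟧) ▷ x) ⊕ [] ∎
      where open ∼-Reasoning W
    ∏⧢-last (i ∷ j ∷ is) = ∏⧢-last-∷ i (j ∷ is) (∏⧢-last (j ∷ is))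

-- Deconcatenation

module _ {X : Set ℓ} where

  private
    W : Set ℓ
    W = List X

  -- A structurally recursive form of the list of all `splitAt j` in `Δ`; the two are compared in
  -- `splits-upTo`.
  splits : W → List (W × W)
  splits []      = [ [] , [] ]
  splits (x ∷ w) = ([] , x ∷ w) ∷ map (map₁ (x ∷_)) (splits w)

  δ : W → Lin (W × W)
  δ w = ∑[ s ∈ splits w ] ⟦ s ⟧

  deconcatenate : Lin W → Lin (W × W)
  deconcatenate = linear δ

  append : X → Lin (W × W) → Lin (W × W)
  append x = mapGen (map₂ (_∷ʳ x))

  δ-∷ : ∀ x w → δ (x ∷ w) ≡ ⟦ [] , x ∷ w ⟧ ⊕ mapGen (map₁ (x ∷_)) (δ w)
  δ-∷ x w = cong (⟦ [] , x ∷ w ⟧ ⊕_) (trans (∑-map (map₁ (x ∷_)) (splits w) ⟦_⟧)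
    (sym (trans (linear-∑ (⟦_⟧ ∘ map₁ (x ∷_)) (splits w) ⟦_⟧) (∑-≗ (linear-⟦⟧ (⟦_⟧ ∘ map₁ (x ∷_))) (splits w)))))

  δ-∷ʳ : ∀ w x → δ (w ∷ʳ x) ≡ append x (δ w) ⊕ ⟦ w ∷ʳ x , [] ⟧
  δ-∷ʳ []      x = refl
  δ-∷ʳ (y ∷ w) x = begin
    δ (y ∷ w ∷ʳ x)
      ≡⟨ δ-∷ y (w ∷ʳ x) ⟩
    ⟦ [] , y ∷ w ∷ʳ x ⟧ ⊕ mapGen (map₁ (y ∷_)) (δ (w ∷ʳ x))
      ≡⟨ cong (λ v → ⟦ [] , y ∷ w ∷ʳ x ⟧ ⊕ mapGen (map₁ (y ∷_)) v) (δ-∷ʳ w x) ⟩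
    ⟦ [] , y ∷ w ∷ʳ x ⟧ ⊕ mapGen (map₁ (y ∷_)) (append x (δ w) ⊕ ⟦ w ∷ʳ x , [] ⟧)
      ≡⟨ cong (⟦ [] , y ∷ w ∷ʳ x ⟧ ⊕_) (linear-⊕ (⟦_⟧ ∘ map₁ (y ∷_)) (append x (δ w)) ⟦ w ∷ʳ x , [] ⟧) ⟩
    ⟦ [] , y ∷ w ∷ʳ x ⟧ ⊕ (mapGen (map₁ (y ∷_)) (append x (δ w)) ⊕ ⟦ y ∷ w ∷ʳ x , [] ⟧)
      ≡⟨ ++-assoc ⟦ [] , y ∷ w ∷ʳ x ⟧ (mapGen (map₁ (y ∷_)) (append x (δ w))) ⟦ y ∷ w ∷ʳ x , [] ⟧ ⟨
    (⟦ [] , y ∷ w ∷ʳ x ⟧ ⊕ mapGen (map₁ (y ∷_)) (append x (δ w))) ⊕ ⟦ y ∷ w ∷ʳ x , [] ⟧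
      ≡⟨ cong (λ v → (⟦ [] , y ∷ w ∷ʳ x ⟧ ⊕ v) ⊕ ⟦ y ∷ w ∷ʳ x , [] ⟧)
           (trans (mapGen-mapGen (map₁ (y ∷_)) (map₂ (_∷ʳ x)) (δ w)) (sym (mapGen-mapGen (map₂ (_∷ʳ x)) (map₁ (y ∷_)) (δ w)))) ⟩
    (append x ⟦ [] , y ∷ w ⟧ ⊕ append x (mapGen (map₁ (y ∷_)) (δ w))) ⊕ ⟦ y ∷ w ∷ʳ x , [] ⟧
      ≡⟨ cong (_⊕ ⟦ y ∷ w ∷ʳ x , [] ⟧) (trans (cong (append x) (δ-∷ y w))
           (linear-⊕ (⟦_⟧ ∘ map₂ (_∷ʳ x)) ⟦ [] , y ∷ w ⟧ (mapGen (map₁ (y ∷_)) (δ w)))) ⟨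
    append x (δ (y ∷ w)) ⊕ ⟦ y ∷ w ∷ʳ x , [] ⟧ ∎
    where open ≡-Reasoning

  ⊗-[]ʳ : ∀ (p : Lin W) → p ⊗ ⟦ [] ⟧ ≡ mapGen {B = W × W} (_, []) p
  ⊗-[]ʳ p = linear-≗ (λ v → linear-⟦⟧ (λ w → ⟦ v , w ⟧) []) p

  ⊗-[]ˡ : ∀ (q : Lin W) → ⟦ [] ⟧ ⊗ q ≡ mapGen {B = W × W} ([] ,_) q
  ⊗-[]ˡ q = linear-⟦⟧ (λ v → linear (λ w → ⟦ v , w ⟧) q) []

  append-⊗ : ∀ x (p q : Lin W) → append x (p ⊗ q) ≡ p ⊗ (q ▷ x)
  append-⊗ x p q = trans (mapGen-linear (map₂ (_∷ʳ x)) (λ v → linear (λ w → ⟦ v , w ⟧) q) p) (linear-≗ (λ v →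
    trans (mapGen-mapGen (map₂ (_∷ʳ x)) (v ,_) q) (sym (mapGen-mapGen (v ,_) (_∷ʳ x) q))) p)

  ⊗-cong : ∀ {p p′ q q′ : Lin W} → p ∼ p′ → q ∼ q′ → p ⊗ q ∼ p′ ⊗ q′
  ⊗-cong = bilinear-cong (λ v w → ⟦ v , w ⟧)

  deconcatenate-▷ : ∀ p x → deconcatenate (p ▷ x) ∼ append x (deconcatenate p) ⊕ ((p ▷ x) ⊗ ⟦ [] ⟧)
  deconcatenate-▷ p x = begin
    deconcatenate (p ▷ x)
      ≡⟨ linear-mapGen δ (_∷ʳ x) p ⟩
    linear (λ w → δ (w ∷ʳ x)) p
      ≡⟨ linear-≗ (λ w → δ-∷ʳ w x) p ⟩
    linear (λ w → append x (δ w) ⊕ ⟦ w ∷ʳ x , [] ⟧) p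
      ≈⟨ linear-⊕ʳ (λ w → append x (δ w)) (λ w → ⟦ w ∷ʳ x , [] ⟧) p ⟩
    linear (λ w → append x (δ w)) p ⊕ linear (λ w → ⟦ w ∷ʳ x , [] ⟧) p
      ≡⟨ cong₂ _⊕_ (mapGen-linear (map₂ (_∷ʳ x)) δ p) (trans (⊗-[]ʳ (p ▷ x)) (mapGen-mapGen (_, []) (_∷ʳ x) p)) ⟨
    append x (deconcatenate p) ⊕ ((p ▷ x) ⊗ ⟦ [] ⟧) ∎
    where open ∼-Reasoning (W × W)

-- The coproduct of 𝔹

AllPairs-↭ : {R : A → A → Set ℓ′} → (∀ {x y} → R x y → R y x) → ∀ {xs ys} → xs ↭ ys → AllPairs R xs → AllPairs R ys
AllPairs-↭ s ↭refl         ps                     = ps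
AllPairs-↭ s (prep x p)    (r ∷ ps)               = ↭.All-resp-↭ p r ∷ AllPairs-↭ s p ps
AllPairs-↭ s (↭swap x y p) ((r ∷ rx) ∷ (ry ∷ ps)) = (s r ∷ ↭.All-resp-↭ p ry) ∷ ↭.All-resp-↭ p rx ∷ AllPairs-↭ s p ps
AllPairs-↭ s (↭trans p q)  ps                     = AllPairs-↭ s q (AllPairs-↭ s p ps)

product-↭ : ∀ {ps qs} → ps ↭ qs → product ps ≡ product qs
product-↭ ↭refl         = refl
product-↭ (prep x p)    = cong (x *ℚ_) (product-↭ p)
product-↭ (↭swap x y p) = trans (cong (λ q → x *ℚ (y *ℚ q)) (product-↭ p))
  (trans (sym (ℚ.*-assoc x y _)) (trans (cong (_*ℚ _) (ℚ.*-comm x y)) (ℚ.*-assoc y x _)))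
product-↭ (↭trans p q)  = trans (product-↭ p) (product-↭ q)

∏⧢-↭ : {ps qs : List (Lin (List X))} → ps ↭ qs → ∏⧢ ps ∼ ∏⧢ qs
∏⧢-↭ ↭refl                     = ≈-refl
∏⧢-↭ (prep x p)                = ⧢-congˡ {p = x} (∏⧢-↭ p)
∏⧢-↭ (↭swap {xs} {ys} x y p)   = ≈-trans (⧢-congˡ {p = x} (⧢-congˡ {p = y} (∏⧢-↭ p))) (⧢-swapˡ x y (∏⧢ ys))
∏⧢-↭ (↭trans p q)              = ≈-trans (∏⧢-↭ p) (∏⧢-↭ q)

guard-[] : (d : Dec P) → guard {G = G} d [] ≡ []
guard-[] (yes _) = refl
guard-[] (no _)  = refl

module _ {V : Space ℓ} where

  guard-0 : ∀ {u : Lin (Gen V)} (d : Dec P) → (P → u ≈[ V ] []) → guard d u ≈[ V ] []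
  guard-0 (yes p) e = e p
  guard-0 (no _)  e = ≈-refl

  -- A term `g x r` that does not vanish has `Q x` on all of `r`, and `Q x x` fails, so `x` does not
  -- occur in `r`. Hence it makes no difference whether `x` is first taken out of `L`.
  ∑-picks-sublists : {Q : A → A → Set ℓ′} (Q? : ∀ x y → Dec (Q x y)) (L : List A) (g : A → List A → Lin (Gen V)) →
                     (∀ x → x ∈ L → ¬ Q x x) → (∀ x r → ¬ All (Q x) r → g x r ≈[ V ] []) →
                     (∀ x {r r′} → r ↭ r′ → g x r ≈[ V ] g x r′) →
                     ∑ (picks L) (λ (x , L′) → ∑ (sublists L′) (g x)) ≈[ V ] (∑[ x ∈ L ] ∑ (sublists L) (g x))
  ∑-picks-sublists Q? L g irr van inv = ≈-trans
    (∑-cong-∈ (picks L) (λ (x , L′) xL′∈ → let p = All.lookup (picks-↭ L) xL′∈ in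
      ≈-trans (∑-sublists-filter (Q? x) L′ (g x) (van x))
        (≈-trans (∑-sublists-↭ (g x) (inv x)
            (↭-trans (↭-reflexive (sym (filter-reject (Q? x) (irr x (↭.∈-resp-↭ (↭-sym p) (here refl))))))
                     (↭.filter-↭ (Q? x) (↭-sym p))))
          (≈-sym (∑-sublists-filter (Q? x) L (g x) (van x))))))
    (≡⇒≈ (∑-picks L (λ x → ∑ (sublists L) (g x))))

disjoint-sym : ∀ {α β} → Disjoint α β → Disjoint β α
disjoint-sym (inj₁ h) = inj₂ h
disjoint-sym (inj₂ h) = inj₁ h

disjoint-below : ∀ α β γ → Disjoint α β → α ⊃ γ → Disjoint β γ
disjoint-below (l , c) (l′ , c′) (m , d) =
  lia 6 (λ l c l′ c′ m d → :Disjoint l c l′ c′ :⇒ :⊃ l c m d :⇒ :Disjoint l′ c′ m d) l c l′ c′ m d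

Disjoint⇒⊅ : ∀ {α γ} → Disjoint α γ → ¬ (α ⊃ γ)
Disjoint⇒⊅ {α} {γ} h = Before⇒⊅ γ α (inj₁ (disjoint-sym {α} {γ} h))

⊃-Over : ∀ α γ j → α ⊃ γ → Over γ j → Over α j
⊃-Over (l , c) (m , d) j = lia 5 (λ l c m d j → :⊃ l c m d :⇒ :Over m d j :⇒ :Over l c j) l c m d j

[-1]^-+ : ∀ m n → [-1]^ (m + n) ≡ [-1]^ m *ℚ [-1]^ n
[-1]^-+ zero    n = sym (ℚ.*-identityˡ _)
[-1]^-+ (suc m) n = trans (cong -ℚ_ ([-1]^-+ m n)) (ℚ.neg-distribˡ-* ([-1]^ m) ([-1]^ n))

[-1]^-± : ∀ n → [-1]^ n ≡ 1ℚ ⊎ [-1]^ n ≡ -ℚ 1ℚ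
[-1]^-± zero    = inj₁ refl
[-1]^-± (suc n) with [-1]^-± n
... | inj₁ e = inj₂ (cong -ℚ_ e)
... | inj₂ e = inj₁ (cong -ℚ_ e)

[-1]^-square : ∀ n → [-1]^ n *ℚ [-1]^ n ≡ 1ℚ
[-1]^-square n with [-1]^-± n
... | inj₁ e = cong₂ _*ℚ_ e e
... | inj₂ e = cong₂ _*ℚ_ e e

signs : List Arc → ℚ
signs as = product (map sign as)

rootFactor partsFactor : List X → List Arc → Lin (List (List X))
rootFactor  xs as = 𝔹 (labels as nothing xs)
partsFactor xs as = ∏⧢ (map (λ α → 𝔹 (co α xs)) as)

admissibleTerm : List X → List Arc → Lin (List (List X) × List (List X))
admissibleTerm xs as = guard (allPairs? disjoint? as) (signs as • (rootFactor xs as ⊗ partsFactor xs as))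

-- The terms with nonempty root polygon on the right hand side of the coproduct formula.
𝕋 : List X → Lin (List (List X) × List (List X))
𝕋 xs = ∑[ as ∈ sublists (arcs (length xs)) ] admissibleTerm xs as

-- The recursion of `𝕋` in the last letter of the second factor

module _ {X : Set ℓ} (xs : List X) where

  private
    W : Set ℓ
    W = List (List X)

    L : List Arc
    L = arcs (length xs)

    rootPart parts : List Arc → Lin W
    rootPart = rootFactor xs
    parts    = partsFactor xs

  private
    -- The part of the term of as in which the words of the second factor end with t.
    ending : List Arc → Lin W → List X → Lin (W × W)
    ending as q t = guard (allPairs? disjoint? as) (signs as • (rootPart as ⊗ (q ▷ t)))

    signs-↭ : ∀ {as bs} → as ↭ bs → signs as ≡ signs bs
    signs-↭ p = product-↭ (↭.map⁺ sign p)

    disjoint-↭ : ∀ {as bs} → as ↭ bs → AllPairs Disjoint as → AllPairs Disjoint bs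
    disjoint-↭ = AllPairs-↭ (λ {α} {β} → disjoint-sym {α} {β})

    ending-↭ : ∀ {as bs} q t → as ↭ bs → ending as q t ∼ ending bs q t
    ending-↭ {as} {bs} q t p = guard-cong (allPairs? disjoint? as) (allPairs? disjoint? bs) (disjoint-↭ p) (disjoint-↭ (↭-sym p))
      (λ _ → ≡⇒≈ (cong₂ (λ s u → s • (𝔹 u ⊗ (q ▷ t))) (signs-↭ p) (labels-↭ p nothing xs)))

    ending-cong : ∀ as {q q′} t → q ∼ q′ → ending as q t ∼ ending as q′ t
    ending-cong as t e = guard-cong (allPairs? disjoint? as) (allPairs? disjoint? as) id id
      (λ _ → •-cong (signs as) (⊗-cong (≈-refl {x = rootPart as}) (mapGen-cong (_∷ʳ t) e)))

    -- The last letters of `𝔹 (co α xs)` with the words in front of them; the piece as a whole is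
    -- preceded by the empty word.
    lasts : Arc → List (Lin W × List X)
    lasts α = (⟦ [] ⟧ , co α xs) ∷
      map (λ β → sign β • 𝔹 (rt β (co α xs)) , co β (co α xs)) (arcs (length (co α xs)))

    𝔹-lastSum : ∀ α → 𝔹 (co α xs) ∼ lastSum (lasts α)
    𝔹-lastSum α = ≈-trans (𝔹-last (co α xs)) (⊕-congˡ {x = ⟦ [ co α xs ] ⟧} (≡⇒≈ (trans
      (∑-≗ (λ β → sym (linear-• (λ w → ⟦ w ∷ʳ co β (co α xs) ⟧) (sign β) (𝔹 (rt β (co α xs))))) (arcs (length (co α xs))))
      (sym (∑-map (λ β → sign β • 𝔹 (rt β (co α xs)) , co β (co α xs)) (arcs (length (co α xs))) (λ (p , t) → p ▷ t))))))

    whole : Arc → List Arc → Lin (W × W)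
    whole α r = ending (α ∷ r) (⟦ [] ⟧ ⧢ parts r) (co α xs)

    inner : Arc → List Arc → Arc → Lin (W × W)
    inner α r β = ending (α ∷ r) ((sign β • 𝔹 (rt β (co α xs))) ⧢ parts r) (co β (co α xs))

    picked : Arc → List Arc → Lin (W × W)
    picked α r = whole α r ⊕ (∑[ β ∈ arcs (length (co α xs)) ] inner α r β)

    picked-≡ : ∀ α r → ∑ (lasts α) (λ (p , t) → ending (α ∷ r) (p ⧢ parts r) t) ≡ picked α r
    picked-≡ α r = cong (whole α r ⊕_) (∑-map (λ β → sign β • 𝔹 (rt β (co α xs)) , co β (co α xs)) (arcs (length (co α xs)))
      (λ (p , t) → ending (α ∷ r) (p ⧢ parts r) t))

    picked-↭ : ∀ α {r r′} → r ↭ r′ → picked α r ∼ picked α r′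
    picked-↭ α {r} {r′} p = ⊕-cong (step ⟦ [] ⟧ (co α xs))
      (∑-cong (arcs (length (co α xs))) (λ β → step (sign β • 𝔹 (rt β (co α xs))) (co β (co α xs))))
      where
      step : ∀ q t → ending (α ∷ r) (q ⧢ parts r) t ∼ ending (α ∷ r′) (q ⧢ parts r′) t
      step q t = ≈-trans (ending-↭ (q ⧢ parts r) t (prep α p)) (ending-cong (α ∷ r′) t (⧢-congˡ {p = q} (∏⧢-↭ (↭.map⁺ _ p))))

    picked-0 : ∀ α r → ¬ All (Disjoint α) r → picked α r ∼ []
    picked-0 α r ¬d = ⊕-cong (≡⇒≈ (guard-no (allPairs? disjoint? (α ∷ r)) λ { (d ∷ _) → ¬d d }))
      (∑-0 (arcs (length (co α xs))) (λ β → ≡⇒≈ (guard-no (allPairs? disjoint? (α ∷ r)) λ { (d ∷ _) → ¬d d })))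

    -- The dissection without arcs gives B(π) ⊗ 1. In every other term one factor of the shuffle
    -- product supplies the last letter, and its arc is moved to the front of the list, on whose
    -- order nothing depends.
    admissibleTerm-last : ∀ as → admissibleTerm xs as ∼
      atNil as (𝔹 xs ⊗ ⟦ [] ⟧) ⊕ ∑ (picks as) (λ (α , r) → picked α r)
    admissibleTerm-last as = begin
      admissibleTerm xs as
        ≈⟨ guard-cong (allPairs? disjoint? as) (allPairs? disjoint? as) id id (λ _ → •-cong (signs as)
             (⊗-cong (≈-refl {x = rootPart as}) (∏⧢-last (λ α → 𝔹 (co α xs)) lasts 𝔹-lastSum as))) ⟩
      within (signs as • (rootPart as ⊗ (atNil as ⟦ [] ⟧ ⊕ ∑ (picks as) (λ (α , r) → ∑ (lasts α) (λ (p , t) → (p ⧢ parts r) ▷ t)))))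
        ≈⟨ guard-cong (allPairs? disjoint? as) (allPairs? disjoint? as) id id (λ _ → distribute) ⟩
      within (atNil as (𝔹 xs ⊗ ⟦ [] ⟧) ⊕
        ∑ (picks as) (λ (α , r) → ∑ (lasts α) (λ (p , t) → signs as • (rootPart as ⊗ ((p ⧢ parts r) ▷ t)))))
        ≡⟨ guard-⊕ (allPairs? disjoint? as) (atNil as (𝔹 xs ⊗ ⟦ [] ⟧)) _ ⟩
      within (atNil as (𝔹 xs ⊗ ⟦ [] ⟧)) ⊕
        within (∑ (picks as) (λ (α , r) → ∑ (lasts α) (λ (p , t) → signs as • (rootPart as ⊗ ((p ⧢ parts r) ▷ t)))))
        ≈⟨ ⊕-cong (atRoot as) (≈-trans (guard-∑ (allPairs? disjoint? as) (picks as) _) (∑-cong-∈ (picks as) (λ (α , r) αr∈ →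
             ≈-trans (guard-∑ (allPairs? disjoint? as) (lasts α) _)
               (≈-trans (∑-cong (lasts α) (λ (p , t) → ending-↭ (p ⧢ parts r) t (All.lookup (picks-↭ as) αr∈)))
                        (≡⇒≈ (picked-≡ α r)))))) ⟩
      atNil as (𝔹 xs ⊗ ⟦ [] ⟧) ⊕ ∑ (picks as) (λ (α , r) → picked α r) ∎
      where
      open ∼-Reasoning (W × W)
      within : Lin (W × W) → Lin (W × W)
      within = guard (allPairs? disjoint? as)
      tensor : W → W → Lin (W × W)
      tensor v w = ⟦ v , w ⟧
      atRoot : ∀ as → guard (allPairs? disjoint? as) (atNil as (𝔹 xs ⊗ ⟦ [] ⟧)) ∼ atNil as (𝔹 xs ⊗ ⟦ [] ⟧)
      atRoot []       = ≈-refl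
      atRoot (α ∷ as) = ≡⇒≈ (guard-[] (allPairs? disjoint? (α ∷ as)))
      nil : ∀ as → signs as • (rootPart as ⊗ atNil as ⟦ [] ⟧) ∼ atNil as (𝔹 xs ⊗ ⟦ [] ⟧)
      nil []       = ≡⇒≈ (trans (1• _) (cong (λ u → 𝔹 u ⊗ ⟦ [] ⟧) (labels-[] xs)))
      nil (α ∷ as) = •-cong (signs (α ∷ as)) (linear-0ʳ {f = λ u → linear (tensor u) []} (λ _ → ≈-refl) (rootPart (α ∷ as)))
      distribute : signs as • (rootPart as ⊗ (atNil as ⟦ [] ⟧ ⊕ ∑ (picks as) (λ (α , r) → ∑ (lasts α) (λ (p , t) → (p ⧢ parts r) ▷ t)))) ∼
        atNil as (𝔹 xs ⊗ ⟦ [] ⟧) ⊕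
          ∑ (picks as) (λ (α , r) → ∑ (lasts α) (λ (p , t) → signs as • (rootPart as ⊗ ((p ⧢ parts r) ▷ t))))
      distribute = begin
        signs as • (rootPart as ⊗ (atNil as ⟦ [] ⟧ ⊕ Z))
          ≈⟨ •-cong (signs as) (bilinear-⊕ʳ tensor (rootPart as) (atNil as ⟦ [] ⟧) Z) ⟩
        signs as • ((rootPart as ⊗ atNil as ⟦ [] ⟧) ⊕ (rootPart as ⊗ Z))
          ≡⟨ •-⊕ (signs as) (rootPart as ⊗ atNil as ⟦ [] ⟧) (rootPart as ⊗ Z) ⟩
        (signs as • (rootPart as ⊗ atNil as ⟦ [] ⟧)) ⊕ (signs as • (rootPart as ⊗ Z))
          ≈⟨ ⊕-cong (nil as) (≈-trans (•-cong (signs as) (≈-trans (bilinear-∑ʳ tensor (picks as) (rootPart as) _)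
               (∑-cong (picks as) (λ (α , r) → bilinear-∑ʳ tensor (lasts α) (rootPart as) (λ (p , t) → (p ⧢ parts r) ▷ t)))))
               (≡⇒≈ (trans (∑-• (signs as) (picks as) _) (∑-≗ (λ (α , r) → ∑-• (signs as) (lasts α) _) (picks as))))) ⟩
        atNil as (𝔹 xs ⊗ ⟦ [] ⟧) ⊕
          ∑ (picks as) (λ (α , r) → ∑ (lasts α) (λ (p , t) → signs as • (rootPart as ⊗ ((p ⧢ parts r) ▷ t)))) ∎
        where
        Z : Lin W
        Z = ∑ (picks as) (λ (α , r) → ∑ (lasts α) (λ (p , t) → (p ⧢ parts r) ▷ t))

    arc-valid : ∀ {α} → α ∈ L → Valid (length xs) α
    arc-valid = arcs-valid (length xs)

    𝕋-picked : 𝕋 xs ∼ (𝔹 xs ⊗ ⟦ [] ⟧) ⊕ (∑[ α ∈ L ] ∑ (sublists L) (picked α))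
    𝕋-picked = ≈-trans (∑-cong (sublists L) admissibleTerm-last) (≈-trans (∑-⊕ (sublists L) _ _)
      (⊕-cong (∑-sublists-atNil L (𝔹 xs ⊗ ⟦ [] ⟧)) (≈-trans (∑-sublists-picks L picked)
        (∑-picks-sublists disjoint? L picked (λ α α∈ d → Before-irrefl α (proj₁ (arc-valid α∈)) (inj₁ d)) picked-0 picked-↭))))

    -- Here γ has been cut off already, so that the piece of an arc α ⊃ γ is smaller.
    pieceAfter : Arc → Arc → List X
    pieceAfter γ α = labels (γ ∷ α ∷ []) (just α) xs

    signAfter : Arc → Arc → ℚ
    signAfter γ = λ α → signIn (γ ∷ α ∷ []) xs α

    productAfter : Arc → List Arc → Lin W
    productAfter γ as = ∏⧢ (map (λ α → 𝔹 (pieceAfter γ α)) as)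

    -- A term of `sign γ • append (co γ xs) (𝕋 (rt γ xs))`, with the arcs of `rt γ xs` replaced by
    -- their embeddings.
    after : Arc → List Arc → Lin (W × W)
    after γ as = sign γ • guard (allPairs? disjoint? as)
      (product (map (signAfter γ) as) • (rootPart (γ ∷ as) ⊗ (productAfter γ as ▷ co γ xs)))

    after-↭ : ∀ γ {as bs} → as ↭ bs → after γ as ∼ after γ bs
    after-↭ γ {as} {bs} p = •-cong (sign γ) (guard-cong (allPairs? disjoint? as) (allPairs? disjoint? bs)
      (disjoint-↭ p) (disjoint-↭ (↭-sym p)) (λ _ →
        ≈-trans (≡⇒≈ (cong₂ (λ s u → s • (𝔹 u ⊗ (productAfter γ as ▷ co γ xs)))
                  (product-↭ (↭.map⁺ (signAfter γ) p)) (labels-↭ (prep γ p) nothing xs)))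
          (•-cong (product (map (signAfter γ) bs)) (⊗-cong (≈-refl {x = rootPart (γ ∷ bs)})
            (mapGen-cong (_∷ʳ co γ xs) (∏⧢-↭ (↭.map⁺ (λ α → 𝔹 (pieceAfter γ α)) p)))))))

    after-0 : ∀ γ as → ¬ AllPairs Disjoint as → after γ as ≡ []
    after-0 γ as ¬d = cong (sign γ •_) (guard-no (allPairs? disjoint? as) ¬d)

    -- By `labels-rt` the labels of a dissection of `rt γ xs` can be read off in `xs`. The signs
    -- follow, as they depend only on the parity of an arc and on the number of labels of its piece.
    cut-first : ∀ γ → Valid (length xs) γ → ∀ as → All (Valid (length (rt γ xs))) as →
                sign γ • append (co γ xs) (admissibleTerm (rt γ xs) as) ∼ after γ (map (embed γ) as)
    cut-first γ vγ as vas = •-cong (sign γ) (≈-trans (≡⇒≈ (linear-guard (⟦_⟧ ∘ map₂ (_∷ʳ co γ xs)) (allPairs? disjoint? as) unguarded))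
      (guard-cong (allPairs? disjoint? as) (allPairs? disjoint? (map (embed γ) as))
        (λ ps → AllPairs.map⁺ (AllPairs.map (λ {α} {β} → Equivalence.to (embed-Disjoint γ α β)) ps))
        (λ ps → AllPairs.map (λ {α} {β} → Equivalence.from (embed-Disjoint γ α β)) (AllPairs.map⁻ ps))
        (λ _ → ≡⇒≈ body)))
      where
      open ≡-Reasoning
      s : ℚ
      s = product (map sign as)
      piece : ∀ {α} → Valid (length (rt γ xs)) α → co α (rt γ xs) ≡ pieceAfter γ (embed γ α)
      piece {α} vα = labels-rt γ xs vγ [ α ] (just α) (proj₁ vα ∷ [])
      signs≡ : map sign as ≡ map (signAfter γ) (map (embed γ) as)
      signs≡ = trans (map-cong-All {f = sign} {g = signAfter γ ∘ embed γ} (λ {α} vα →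
        cong₂ (λ o n → if o then [-1]^ n else 1ℚ) (sym (odd-embed γ xs vγ α))
          (trans (cong pred (sym (length-co α (rt γ xs) vα))) (cong (pred ∘ length) (piece vα)))) vas) (map-∘ as)
      pieces≡ : map (λ α → 𝔹 (co α (rt γ xs))) as ≡ map (λ α → 𝔹 (pieceAfter γ α)) (map (embed γ) as)
      pieces≡ = trans (map-cong-All {f = λ α → 𝔹 (co α (rt γ xs))} {g = λ α → 𝔹 (pieceAfter γ (embed γ α))}
        (λ vα → cong 𝔹 (piece vα)) vas) (map-∘ as)
      unguarded : Lin (W × W)
      unguarded = s • (rootFactor (rt γ xs) as ⊗ partsFactor (rt γ xs) as)
      body : append (co γ xs) unguarded ≡
             product (map (signAfter γ) (map (embed γ) as)) •
               (rootPart (γ ∷ map (embed γ) as) ⊗ (productAfter γ (map (embed γ) as) ▷ co γ xs))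
      body = begin
        append (co γ xs) unguarded
          ≡⟨ linear-• (⟦_⟧ ∘ map₂ (_∷ʳ co γ xs)) s (rootFactor (rt γ xs) as ⊗ partsFactor (rt γ xs) as) ⟩
        s • append (co γ xs) (rootFactor (rt γ xs) as ⊗ partsFactor (rt γ xs) as)
          ≡⟨ cong (s •_) (append-⊗ (co γ xs) (rootFactor (rt γ xs) as) (partsFactor (rt γ xs) as)) ⟩
        s • (rootFactor (rt γ xs) as ⊗ (partsFactor (rt γ xs) as ▷ co γ xs))
          ≡⟨ cong₂ (λ u v → u • v) (cong product signs≡) (cong₂ (λ u ps → 𝔹 u ⊗ (∏⧢ ps ▷ co γ xs))
               (labels-rt γ xs vγ as nothing []) pieces≡) ⟩
        product (map (signAfter γ) (map (embed γ) as)) •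
          (rootPart (γ ∷ map (embed γ) as) ⊗ (productAfter γ (map (embed γ) as) ▷ co γ xs)) ∎

    before-γ : Arc → List Arc
    before-γ γ = filter (λ α → before? α γ) L

    cut-first-sum : ∀ γ → Valid (length xs) γ →
                    sign γ • append (co γ xs) (𝕋 (rt γ xs)) ∼ ∑ (sublists (before-γ γ)) (after γ)
    cut-first-sum γ vγ = begin
      sign γ • append (co γ xs) (𝕋 (rt γ xs))
        ≡⟨ •-linear-∑ (sign γ) (⟦_⟧ ∘ map₂ (_∷ʳ co γ xs)) (sublists (arcs N′)) (admissibleTerm (rt γ xs)) ⟩
      (∑[ as ∈ sublists (arcs N′) ] sign γ • append (co γ xs) (admissibleTerm (rt γ xs) as))
        ≈⟨ ∑-cong-∈ (sublists (arcs N′)) (λ as as∈ → cut-first γ vγ as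
             (All.lookup (sublists-All (All.tabulate (arcs-valid N′))) as∈)) ⟩
      (∑[ as ∈ sublists (arcs N′) ] after γ (map (embed γ) as))
        ≡⟨ ∑-sublists-map (embed γ) (arcs N′) (after γ) ⟨
      ∑ (sublists (map (embed γ) (arcs N′))) (after γ)
        ≈⟨ ∑-sublists-↭ (after γ) (after-↭ γ) (arcs-before γ N′ vγ (length-rt γ xs vγ)) ⟨
      ∑ (sublists (before-γ γ)) (after γ) ∎
      where
      open ∼-Reasoning (W × W)
      N′ : ℕ
      N′ = length (rt γ xs)

    pieceAfter-disjoint : ∀ {γ α} → Disjoint α γ → pieceAfter γ α ≡ co α xs
    pieceAfter-disjoint {γ} {α} d = labels-outermost (γ ∷ α ∷ []) α xs (Disjoint⇒⊅ {α} {γ} d ∷ ⊃-irrefl α ∷ [])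

    signAfter-disjoint : ∀ {γ α} → Valid (length xs) α → Disjoint α γ → signAfter γ α ≡ sign α
    signAfter-disjoint {γ} {α} vα d = cong (λ n → if odd (proj₁ α) then [-1]^ pred n else 1ℚ)
      (trans (cong length (pieceAfter-disjoint {γ} {α} d)) (length-co α xs vα))

    module _ (γ : Arc) (as : List Arc) (vas : All (Valid (length xs)) as) (ds : All (λ α → Disjoint α γ) as) where

      signsAfter-disjoint : product (map (signAfter γ) as) ≡ signs as
      signsAfter-disjoint = cong product (map-cong-All {P = λ α → Valid (length xs) α × Disjoint α γ} {f = signAfter γ} {g = sign}
        (λ {α} (v , d) → signAfter-disjoint {γ} {α} v d) (All.zip (vas , ds)))

      productAfter-disjoint : productAfter γ as ≡ parts as
      productAfter-disjoint = cong ∏⧢ (map-cong-All {f = λ α → 𝔹 (pieceAfter γ α)} {g = λ α → 𝔹 (co α xs)}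
        (λ {α} d → cong 𝔹 (pieceAfter-disjoint {γ} {α} d)) ds)

    allDisjoint? : ∀ γ as → Dec (All (λ α → Disjoint α γ) as)
    allDisjoint? γ as = all? (λ α → disjoint? α γ) as

    -- An antichain of arcs that may precede γ contains at most one arc beyond which γ lies.
    exactly-one : ∀ γ as → All (λ α → Before α γ) as → AllPairs Disjoint as → (u : Lin (W × W)) →
                  u ∼ guard (allDisjoint? γ as) u ⊕ (∑[ α ∈ as ] guard (α ⊃? γ) u)
    exactly-one γ []       []            []       u = ≡⇒≈ (sym (⊕-identityʳ u))
    exactly-one γ (α ∷ as) (inj₂ h ∷ bs) (d ∷ ds) u = ≈-sym (begin
      guard (allDisjoint? γ (α ∷ as)) u ⊕ (guard (α ⊃? γ) u ⊕ (∑[ β ∈ as ] guard (β ⊃? γ) u))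
        ≡⟨ cong₂ (λ v w → v ⊕ (w ⊕ (∑[ β ∈ as ] guard (β ⊃? γ) u)))
             (guard-no (allDisjoint? γ (α ∷ as)) (λ { (d ∷ _) → Disjoint⇒⊅ {α} {γ} d h })) (guard-yes (α ⊃? γ) h) ⟩
      u ⊕ (∑[ β ∈ as ] guard (β ⊃? γ) u)
        ≈⟨ ⊕-congˡ {x = u} (≈-trans (∑-cong-∈ as (λ β β∈ → ≡⇒≈ (guard-no (β ⊃? γ)
             (Disjoint⇒⊅ {β} {γ} (disjoint-below α β γ (All.lookup d β∈) h))))) (∑-0 as (λ _ → ≈-refl))) ⟩
      u ⊕ []
        ≡⟨ ⊕-identityʳ u ⟩
      u ∎)
      where open ∼-Reasoning (W × W)
    exactly-one γ (α ∷ as) (inj₁ h ∷ bs) (d ∷ ds) u = begin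
      u
        ≈⟨ exactly-one γ as bs ds u ⟩
      guard (allDisjoint? γ as) u ⊕ (∑[ β ∈ as ] guard (β ⊃? γ) u)
        ≈⟨ ⊕-cong (guard-cong (allDisjoint? γ as) (allDisjoint? γ (α ∷ as)) (h ∷_) (λ { (_ ∷ hs) → hs }) (λ _ → ≈-refl))
             (≡⇒≈ (cong (_⊕ (∑[ β ∈ as ] guard (β ⊃? γ) u)) (sym (guard-no (α ⊃? γ) (Disjoint⇒⊅ {α} {γ} h))))) ⟩
      guard (allDisjoint? γ (α ∷ as)) u ⊕ (guard (α ⊃? γ) u ⊕ (∑[ β ∈ as ] guard (β ⊃? γ) u)) ∎
      where open ∼-Reasoning (W × W)

    after-split : ∀ γ as → All (λ α → Before α γ) as →
                  after γ as ∼ guard (allDisjoint? γ as) (after γ as) ⊕ ∑ (picks as) (λ (α , r) → guard (α ⊃? γ) (after γ (α ∷ r)))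
    after-split γ as bs = ≈-trans (split (allPairs? disjoint? as)) (⊕-congˡ {x = guard (allDisjoint? γ as) (after γ as)}
      (≈-trans (≡⇒≈ (sym (∑-picks as (λ α → guard (α ⊃? γ) (after γ as)))))
        (∑-cong-∈ (picks as) (λ (α , r) αr∈ → guard-cong (α ⊃? γ) (α ⊃? γ) id id
          (λ _ → after-↭ γ (All.lookup (picks-↭ as) αr∈))))))
      where
      split : Dec (AllPairs Disjoint as) →
              after γ as ∼ guard (allDisjoint? γ as) (after γ as) ⊕ (∑[ α ∈ as ] guard (α ⊃? γ) (after γ as))
      split (yes ds) = exactly-one γ as bs ds (after γ as)
      split (no ¬ds) rewrite after-0 γ as ¬ds = ≈-sym (⊕-cong (≡⇒≈ (guard-[] (allDisjoint? γ as)))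
        (∑-0 as (λ α → ≡⇒≈ (guard-[] (α ⊃? γ)))))

    -- If all arcs are disjoint from `γ`, then `γ` joins them to an admissible dissection in which
    -- its piece occurs as a whole and the other pieces are not affected.
    after-whole : ∀ γ as → Valid (length xs) γ → All (Valid (length xs)) as →
                  guard (allDisjoint? γ as) (after γ as) ∼ whole γ as
    after-whole γ as vγ vas = begin
      guard (allDisjoint? γ as) (after γ as)
        ≡⟨ cong (guard (allDisjoint? γ as)) (•-guard (sign γ) (allPairs? disjoint? as) _) ⟩
      guard (allDisjoint? γ as) (guard (allPairs? disjoint? as) (sign γ • _))
        ≡⟨ guard-× (allDisjoint? γ as) (allPairs? disjoint? as) _ ⟩
      guard (allDisjoint? γ as ×-dec allPairs? disjoint? as) (sign γ • _)
        ≈⟨ guard-cong (allDisjoint? γ as ×-dec allPairs? disjoint? as) (allPairs? disjoint? (γ ∷ as))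
             (λ (d , ds) → All.map (λ {α} → disjoint-sym {α} {γ}) d ∷ ds)
             (λ { (d ∷ ds) → All.map (λ {α} → disjoint-sym {γ} {α}) d , ds })
             (λ (d , _) → ≡⇒≈ (trans (•-• (sign γ) (product (map (signAfter γ) as)) _)
               (cong₂ (λ s p → (sign γ *ℚ s) • (rootPart (γ ∷ as) ⊗ (p ▷ co γ xs)))
                 (signsAfter-disjoint γ as vas d) (trans (productAfter-disjoint γ as vas d) (sym (⧢-identityˡ (parts as))))))) ⟩
      whole γ as ∎
      where open ∼-Reasoning (W × W)

    Within : Arc → Arc → List Arc → Lin (W × W)
    Within γ α r = guard (α ⊃? γ) (after γ (α ∷ r))

    Within-0 : ∀ γ α r → ¬ All (Disjoint α) r → Within γ α r ∼ []
    Within-0 γ α r ¬d = ≡⇒≈ (trans (cong (guard (α ⊃? γ)) (after-0 γ (α ∷ r) (λ { (d ∷ _) → ¬d d }))) (guard-[] (α ⊃? γ)))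

    -- Arcs disjoint from `α` are disjoint from everything beyond `α`, so a term that does not
    -- vanish has all of `r` before `γ`.
    Within-before : ∀ γ α r → ¬ All (λ β → Before β γ) r → Within γ α r ∼ []
    Within-before γ α r ¬b = guard-0 (α ⊃? γ) (λ h → ≡⇒≈ (after-0 γ (α ∷ r) (λ { (d ∷ _) →
      ¬b (All.map (λ {β} k → inj₁ (disjoint-below α β γ k h)) d) })))

    -- The terms are sorted by whether `γ` lies beyond one of the arcs. The restriction to arcs
    -- before `γ` can then be lifted, because the additional terms vanish.
    after-sum : ∀ γ → Valid (length xs) γ → ∑ (sublists (before-γ γ)) (after γ) ∼
                ∑ (sublists L) (whole γ) ⊕ (∑[ α ∈ L ] ∑ (sublists L) (Within γ α))
    after-sum γ vγ = begin
      ∑ (sublists F) (after γ)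
        ≈⟨ ∑-cong-∈ (sublists F) (λ as as∈ → after-split γ as (All.lookup (sublists-All (All.all-filter b? L)) as∈)) ⟩
      (∑[ as ∈ sublists F ] guard (allDisjoint? γ as) (after γ as) ⊕ ∑ (picks as) (λ (α , r) → Within γ α r))
        ≈⟨ ∑-⊕ (sublists F) (λ as → guard (allDisjoint? γ as) (after γ as)) _ ⟩
      (∑[ as ∈ sublists F ] guard (allDisjoint? γ as) (after γ as)) ⊕
        (∑[ as ∈ sublists F ] ∑ (picks as) (λ (α , r) → Within γ α r))
        ≈⟨ ⊕-cong first second ⟩
      ∑ (sublists L) (whole γ) ⊕ (∑[ α ∈ L ] ∑ (sublists L) (Within γ α)) ∎
      where
      open ∼-Reasoning (W × W)
      F : List Arc
      F = before-γ γ
      b? : ∀ α → Dec (Before α γ)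
      b? α = before? α γ
      first : (∑[ as ∈ sublists F ] guard (allDisjoint? γ as) (after γ as)) ∼ ∑ (sublists L) (whole γ)
      first = ≈-trans (≈-sym (∑-sublists-filter b? L (λ as → guard (allDisjoint? γ as) (after γ as))
                (λ as ¬b → ≡⇒≈ (guard-no (allDisjoint? γ as) (λ d → ¬b (All.map inj₁ d))))))
              (∑-cong-∈ (sublists L) (λ as as∈ → after-whole γ as vγ (All.lookup (sublists-All (All.tabulate arc-valid)) as∈)))
      second : (∑[ as ∈ sublists F ] ∑ (picks as) (λ (α , r) → Within γ α r)) ∼ (∑[ α ∈ L ] ∑ (sublists L) (Within γ α))
      second = begin
        (∑[ as ∈ sublists F ] ∑ (picks as) (λ (α , r) → Within γ α r))
          ≈⟨ ∑-sublists-picks F (Within γ) ⟩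
        ∑ (picks F) (λ (α , F′) → ∑ (sublists F′) (Within γ α))
          ≈⟨ ∑-picks-sublists disjoint? F (Within γ)
               (λ α α∈ d → Before-irrefl α (proj₁ (arc-valid (proj₁ (∈-filter⁻ b? {xs = L} α∈)))) (inj₁ d))
               (Within-0 γ) (λ α p → guard-cong (α ⊃? γ) (α ⊃? γ) id id (λ _ → after-↭ γ (prep α p))) ⟩
        (∑[ α ∈ F ] ∑ (sublists F) (Within γ α))
          ≈⟨ ∑-cong F (λ α → ≈-sym (∑-sublists-filter b? L (Within γ α) (Within-before γ α))) ⟩
        (∑[ α ∈ F ] ∑ (sublists L) (Within γ α))
          ≡⟨ ∑-filter b? L (λ α → ∑ (sublists L) (Within γ α)) ⟩
        (∑[ α ∈ L ] guard (b? α) (∑ (sublists L) (Within γ α)))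
          ≈⟨ ∑-cong L drop-guard ⟩
        (∑[ α ∈ L ] ∑ (sublists L) (Within γ α)) ∎
        where
        -- `α ⊃ γ`, required by `Within`, already implies `Before α γ`.
        drop-guard : ∀ α → guard (b? α) (∑ (sublists L) (Within γ α)) ∼ ∑ (sublists L) (Within γ α)
        drop-guard α = ≈-trans (guard-∑ (b? α) (sublists L) (Within γ α)) (∑-cong (sublists L) (λ r →
          ≈-trans (≡⇒≈ (guard-× (b? α) (α ⊃? γ) (after γ (α ∷ r))))
            (guard-cong (b? α ×-dec (α ⊃? γ)) (α ⊃? γ) proj₂ (λ h → inj₂ h , h) (λ _ → ≈-refl))))

    pieceAfter-nest : ∀ α β → Valid (length xs) α → Valid (suc (proj₂ α)) β → rt β (co α xs) ≡ pieceAfter (nest α β) α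
    pieceAfter-nest α β vα vβ = trans (rt-co α xs vα β vβ) (labels-↭ (↭swap α (nest α β) ↭refl) (just α) xs)

    length-pieceAfter : ∀ α β → Valid (length xs) α → Valid (suc (proj₂ α)) β →
                        pred (length (pieceAfter (nest α β) α)) + proj₂ β ≡ proj₂ α
    length-pieceAfter α β vα vβ = pred-+ (length (pieceAfter (nest α β) α))
      (trans (cong (λ u → length u + proj₂ β) (sym (pieceAfter-nest α β vα vβ)))
        (trans (length-rt β (co α xs) (subst (λ k → Valid k β) (sym (length-co α xs vα)) vβ)) (length-co α xs vα)))
      (proj₁ (proj₂ vβ))
      where
      pred-+ : ∀ k → k + proj₂ β ≡ suc (proj₂ α) → 2 + proj₂ β ≤ suc (proj₂ α) → pred k + proj₂ β ≡ proj₂ α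
      pred-+ zero    e h = ⊥-elim (<⇒≱ h (≤-trans (≤-reflexive (sym e)) (n≤1+n _)))
      pred-+ (suc k) e h = suc-injective e

    -- Let `n` be the weight of `β` and `y` the weight of what remains of `co α` after cutting `β`
    -- off. On the left `α` carries the weight `y + n`, on the right only `y`. If `α` is backward,
    -- nesting exchanges the direction of `β`, which accounts for the factor `(-1)^n`.
    sign-nest : ∀ α β → Valid (length xs) α → Valid (suc (proj₂ α)) β →
                sign α *ℚ sign β ≡ sign (nest α β) *ℚ signAfter (nest α β) α
    sign-nest α β vα vβ = trans
      (cong (λ k → (if odd (proj₁ α) then [-1]^ k else 1ℚ) *ℚ sign β) (sym (length-pieceAfter α β vα vβ)))
      (trans (signs≡ (odd (proj₁ α)) (odd (proj₁ β)) (pred (length (pieceAfter (nest α β) α))) (proj₂ β))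
        (cong (λ o → (if o then [-1]^ proj₂ β else 1ℚ) *ℚ signAfter (nest α β) α) (sym (odd-nest α β vβ))))
      where
      signs≡ : ∀ o o′ y n → (if o then [-1]^ (y + n) else 1ℚ) *ℚ (if o′ then [-1]^ n else 1ℚ) ≡
                            (if o xor o′ then [-1]^ n else 1ℚ) *ℚ (if o then [-1]^ y else 1ℚ)
      signs≡ false false y n = refl
      signs≡ false true  y n = ℚ.*-comm 1ℚ ([-1]^ n)
      signs≡ true  false y n = trans (ℚ.*-identityʳ _) (trans ([-1]^-+ y n) (ℚ.*-comm ([-1]^ y) ([-1]^ n)))
      signs≡ true  true  y n = trans (cong (_*ℚ [-1]^ n) ([-1]^-+ y n)) (trans (ℚ.*-assoc ([-1]^ y) ([-1]^ n) ([-1]^ n))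
        (trans (cong ([-1]^ y *ℚ_) ([-1]^-square n)) (ℚ.*-comm ([-1]^ y) 1ℚ)))

    -- Cutting `β` off the piece `co α xs` and cutting `nest α β` off the whole polygon give the
    -- same parts, by `rt-co` and `co-co`. The arcs of `r` are disjoint from `α`, hence from
    -- `nest α β`, so their pieces stay as they are.
    inner-after : ∀ α r β → Valid (length xs) α → All (Valid (length xs)) r → Valid (suc (proj₂ α)) β →
                  inner α r β ∼ after (nest α β) (α ∷ r)
    inner-after α r β vα vr vβ = begin
      guard D (signs (α ∷ r) • (rootPart (α ∷ r) ⊗ (((sign β • p) ⧢ parts r) ▷ co β (co α xs))))
        ≈⟨ guard-cong D D id id (λ { (d ∷ _) → ≡⇒≈ (body (All.map (λ {δ} k → disjoint-below α δ γ k (nest-⊃ α β vβ)) d)) }) ⟩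
      guard D (sign γ • (product (map (signAfter γ) (α ∷ r)) • (rootPart (γ ∷ α ∷ r) ⊗ (productAfter γ (α ∷ r) ▷ co γ xs))))
        ≡⟨ •-guard (sign γ) D (product (map (signAfter γ) (α ∷ r)) • (rootPart (γ ∷ α ∷ r) ⊗ (productAfter γ (α ∷ r) ▷ co γ xs))) ⟨
      after γ (α ∷ r) ∎
      where
      open ∼-Reasoning (W × W)
      γ : Arc
      γ = nest α β
      D : Dec (AllPairs Disjoint (α ∷ r))
      D = allPairs? disjoint? (α ∷ r)
      p : Lin W
      p = 𝔹 (rt β (co α xs))
      coefficient : All (λ δ → Disjoint δ γ) r →
                    signs (α ∷ r) *ℚ sign β ≡ sign γ *ℚ product (map (signAfter γ) (α ∷ r))
      coefficient ds = trans (ℚ.*-assoc (sign α) (signs r) (sign β)) (trans (cong (sign α *ℚ_) (ℚ.*-comm (signs r) (sign β)))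
        (trans (sym (ℚ.*-assoc (sign α) (sign β) (signs r))) (trans (cong (_*ℚ signs r) (sign-nest α β vα vβ))
          (trans (ℚ.*-assoc (sign γ) (signAfter γ α) (signs r))
            (cong (λ s → sign γ *ℚ (signAfter γ α *ℚ s)) (sym (signsAfter-disjoint γ r vr ds)))))))
      -- `γ` lies beyond `α` and hides no further side from the root region.
      root : labels (α ∷ r) nothing xs ≡ labels (γ ∷ α ∷ r) nothing xs
      root = select-cong (visible? (α ∷ r) nothing) (visible? (γ ∷ α ∷ r) nothing) 0 0 xs (λ j _ →
        Visible-cong {α ∷ r} {γ ∷ α ∷ r} {nothing} {nothing} {j} {j} (mk⇔ id id) (mk⇔ there
          (λ { (here (_ , o)) → here (tt , ⊃-Over α γ j (nest-⊃ α β vβ) o) ; (there v) → v })))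
      scalar : ∀ q t → ((sign β • p) ⧢ q) ▷ t ≡ sign β • ((p ⧢ q) ▷ t)
      scalar q t = trans (cong (_▷ t) (bilinear-•ˡ shuf (sign β) p q)) (linear-• (λ w → ⟦ w ∷ʳ t ⟧) (sign β) (p ⧢ q))
      body : All (λ δ → Disjoint δ γ) r →
             signs (α ∷ r) • (rootPart (α ∷ r) ⊗ (((sign β • p) ⧢ parts r) ▷ co β (co α xs))) ≡
             sign γ • (product (map (signAfter γ) (α ∷ r)) • (rootPart (γ ∷ α ∷ r) ⊗ (productAfter γ (α ∷ r) ▷ co γ xs)))
      body ds = E.begin
        signs (α ∷ r) • (rootPart (α ∷ r) ⊗ (((sign β • p) ⧢ parts r) ▷ co β (co α xs)))
          E.≡⟨ cong (λ u → signs (α ∷ r) • (rootPart (α ∷ r) ⊗ u)) (scalar (parts r) (co β (co α xs))) ⟩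
        signs (α ∷ r) • (rootPart (α ∷ r) ⊗ (sign β • ((p ⧢ parts r) ▷ co β (co α xs))))
          E.≡⟨ cong (signs (α ∷ r) •_) (bilinear-•ʳ (λ v w → ⟦ v , w ⟧) (sign β) (rootPart (α ∷ r)) ((p ⧢ parts r) ▷ co β (co α xs))) ⟩
        signs (α ∷ r) • (sign β • (rootPart (α ∷ r) ⊗ ((p ⧢ parts r) ▷ co β (co α xs))))
          E.≡⟨ •-• (signs (α ∷ r)) (sign β) _ ⟩
        (signs (α ∷ r) *ℚ sign β) • (rootPart (α ∷ r) ⊗ ((p ⧢ parts r) ▷ co β (co α xs)))
          E.≡⟨ cong₂ (λ s u → s • u) (coefficient ds) (cong₂ (λ u v → 𝔹 u ⊗ v) root
               (cong₂ (λ v t → v ▷ t) (cong₂ (λ u v → 𝔹 u ⧢ v) (pieceAfter-nest α β vα vβ) (sym (productAfter-disjoint γ r vr ds)))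
                 (co-co α xs vα β vβ))) ⟩
        (sign γ *ℚ product (map (signAfter γ) (α ∷ r))) • (rootPart (γ ∷ α ∷ r) ⊗ (productAfter γ (α ∷ r) ▷ co γ xs))
          E.≡⟨ •-• (sign γ) (product (map (signAfter γ) (α ∷ r))) _ ⟨
        sign γ • (product (map (signAfter γ) (α ∷ r)) • (rootPart (γ ∷ α ∷ r) ⊗ (productAfter γ (α ∷ r) ▷ co γ xs))) E.∎
        where module E = ≡-Reasoning

    inner-sum : ∀ α r → Valid (length xs) α → All (Valid (length xs)) r →
                (∑[ β ∈ arcs (length (co α xs)) ] inner α r β) ∼ (∑[ γ ∈ L ] Within γ α r)
    inner-sum α r vα vr = begin
      (∑[ β ∈ arcs (length (co α xs)) ] inner α r β)
        ≡⟨ cong (λ k → ∑ (arcs k) (inner α r)) (length-co α xs vα) ⟩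
      (∑[ β ∈ arcs (suc (proj₂ α)) ] inner α r β)
        ≈⟨ ∑-cong-∈ (arcs (suc (proj₂ α))) (λ β β∈ → inner-after α r β vα vr (arcs-valid (suc (proj₂ α)) β∈)) ⟩
      (∑[ β ∈ arcs (suc (proj₂ α)) ] after (nest α β) (α ∷ r))
        ≡⟨ ∑-map (nest α) (arcs (suc (proj₂ α))) (λ γ → after γ (α ∷ r)) ⟨
      (∑[ γ ∈ map (nest α) (arcs (suc (proj₂ α))) ] after γ (α ∷ r))
        ≈⟨ ∑-↭ (λ γ → after γ (α ∷ r)) (arcs-below α vα) ⟨
      (∑[ γ ∈ filter (α ⊃?_) L ] after γ (α ∷ r))
        ≡⟨ ∑-filter (α ⊃?_) L (λ γ → after γ (α ∷ r)) ⟩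
      (∑[ γ ∈ L ] Within γ α r) ∎
      where open ∼-Reasoning (W × W)

  -- The words of the second factor end with a whole piece P_i or, if they end in a
  -- proper piece of P_i, that piece is cut off by an arc γ of the polygon itself.
  𝕋-last : 𝕋 xs ∼ (𝔹 xs ⊗ ⟦ [] ⟧) ⊕ (∑[ γ ∈ arcs (length xs) ] sign γ • append (co γ xs) (𝕋 (rt γ xs)))
  𝕋-last = ≈-trans 𝕋-picked (⊕-congˡ {x = 𝔹 xs ⊗ ⟦ [] ⟧} (begin
    (∑[ α ∈ L ] ∑ (sublists L) (picked α))
      ≈⟨ ∑-cong-∈ L (λ α α∈ → ∑-cong-∈ (sublists L) (λ r r∈ → ⊕-congˡ {x = whole α r}
           (inner-sum α r (arc-valid α∈) (All.lookup (sublists-All (All.tabulate arc-valid)) r∈)))) ⟩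
    (∑[ α ∈ L ] ∑[ r ∈ sublists L ] whole α r ⊕ (∑[ γ ∈ L ] Within γ α r))
      ≈⟨ ≈-trans (∑-cong L (λ α → ∑-⊕ (sublists L) (whole α) _)) (∑-⊕ L (λ α → ∑ (sublists L) (whole α)) _) ⟩
    (∑[ α ∈ L ] ∑ (sublists L) (whole α)) ⊕ (∑[ α ∈ L ] ∑[ r ∈ sublists L ] ∑[ γ ∈ L ] Within γ α r)
      ≈⟨ ⊕-congˡ {x = ∑[ α ∈ L ] ∑ (sublists L) (whole α)}
           (≈-trans (∑-cong L (λ α → ∑-swap (sublists L) L (λ r γ → Within γ α r))) (∑-swap L L (λ α γ → ∑ (sublists L) (Within γ α)))) ⟩
    (∑[ γ ∈ L ] ∑ (sublists L) (whole γ)) ⊕ (∑[ γ ∈ L ] ∑[ α ∈ L ] ∑ (sublists L) (Within γ α))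
      ≈⟨ ∑-⊕ L (λ γ → ∑ (sublists L) (whole γ)) _ ⟨
    (∑[ γ ∈ L ] ∑ (sublists L) (whole γ) ⊕ (∑[ α ∈ L ] ∑ (sublists L) (Within γ α)))
      ≈⟨ ∑-cong-∈ L (λ γ γ∈ → ≈-trans (cut-first-sum γ (arc-valid γ∈)) (after-sum γ (arc-valid γ∈))) ⟨
    (∑[ γ ∈ L ] sign γ • append (co γ xs) (𝕋 (rt γ xs))) ∎))
    where open ∼-Reasoning (W × W)

-- Both sides obey the same recursion. By `𝔹-last` the summands with an empty first or second factor
-- add up to 1 ⊗ B(π) and B(π) ⊗ 1, and the remaining ones are those of `𝕋-last`. The induction runs
-- over the bound `n`, since `rt γ xs` is shorter than `xs` but not structurally smaller.
deconcatenate-𝔹 : ∀ n (xs : List X) → length xs < n → deconcatenate (𝔹 xs) ∼ (⟦ [] ⟧ ⊗ 𝔹 xs) ⊕ 𝕋 xs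
deconcatenate-𝔹 {X = X} (suc n) xs h = begin
  deconcatenate (𝔹 xs)
    ≈⟨ linear-resp-∼ δ (𝔹-last xs) ⟩
  deconcatenate (⟦ [ xs ] ⟧ ⊕ ∑ L cut)
    ≡⟨ trans (linear-⊕ δ ⟦ [ xs ] ⟧ (∑ L cut)) (cong₂ _⊕_ (linear-⟦⟧ δ [ xs ]) (linear-∑ δ L cut)) ⟩
  (⟦ [] , [ xs ] ⟧ ⊕ ⟦ [ xs ] , [] ⟧) ⊕ (∑[ γ ∈ L ] deconcatenate (cut γ))
    ≈⟨ ⊕-congˡ {x = ⟦ [] , [ xs ] ⟧ ⊕ ⟦ [ xs ] , [] ⟧} (≈-trans (∑-cong-∈ L step)
         (≈-trans (∑-⊕ L (λ γ → ⟦ [] ⟧ ⊗ cut γ) _) (⊕-congˡ {x = ∑ L (λ γ → ⟦ [] ⟧ ⊗ cut γ)} (∑-⊕ L (λ γ → cut γ ⊗ ⟦ [] ⟧) rest)))) ⟩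
  (⟦ [] , [ xs ] ⟧ ⊕ ⟦ [ xs ] , [] ⟧) ⊕ (∑ L (λ γ → ⟦ [] ⟧ ⊗ cut γ) ⊕ (∑ L (λ γ → cut γ ⊗ ⟦ [] ⟧) ⊕ ∑ L rest))
    ≈⟨ ⊕-interchange ⟦ [] , [ xs ] ⟧ ⟦ [ xs ] , [] ⟧ (∑ L (λ γ → ⟦ [] ⟧ ⊗ cut γ)) _ ⟩
  (⟦ [] , [ xs ] ⟧ ⊕ ∑ L (λ γ → ⟦ [] ⟧ ⊗ cut γ)) ⊕ (⟦ [ xs ] , [] ⟧ ⊕ (∑ L (λ γ → cut γ ⊗ ⟦ [] ⟧) ⊕ ∑ L rest))
    ≈⟨ ⊕-cong left (≈-trans (≡⇒≈ (sym (++-assoc ⟦ [ xs ] , [] ⟧ (∑ L (λ γ → cut γ ⊗ ⟦ [] ⟧)) (∑ L rest))))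
         (≈-trans (⊕-congʳ {y = ∑ L rest} right) (≈-sym (𝕋-last xs)))) ⟩
  (⟦ [] ⟧ ⊗ 𝔹 xs) ⊕ 𝕋 xs ∎
  where
  open ∼-Reasoning (List (List X) × List (List X))
  L = arcs (length xs)
  tensor : List (List X) → List (List X) → Lin (List (List X) × List (List X))
  tensor v w = ⟦ v , w ⟧
  cut : Arc → Lin (List (List X))
  cut γ = sign γ • (𝔹 (rt γ xs) ▷ co γ xs)
  rest : Arc → Lin (List (List X) × List (List X))
  rest γ = sign γ • append (co γ xs) (𝕋 (rt γ xs))
  left : ⟦ [] , [ xs ] ⟧ ⊕ ∑ L (λ γ → ⟦ [] ⟧ ⊗ cut γ) ∼ ⟦ [] ⟧ ⊗ 𝔹 xs
  left = ≈-sym (≈-trans (⊗-cong (≈-refl {x = ⟦ [] ⟧}) (𝔹-last xs)) (≈-trans (bilinear-⊕ʳ tensor ⟦ [] ⟧ ⟦ [ xs ] ⟧ (∑ L cut))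
    (⊕-congˡ {x = ⟦ [] , [ xs ] ⟧} (bilinear-∑ʳ tensor L ⟦ [] ⟧ cut))))
  right : ⟦ [ xs ] , [] ⟧ ⊕ ∑ L (λ γ → cut γ ⊗ ⟦ [] ⟧) ∼ 𝔹 xs ⊗ ⟦ [] ⟧
  right = ≈-sym (≈-trans (⊗-cong (𝔹-last xs) (≈-refl {x = ⟦ [] ⟧})) (≡⇒≈ (trans (bilinear-⊕ˡ tensor ⟦ [ xs ] ⟧ (∑ L cut) ⟦ [] ⟧)
    (cong (⟦ [ xs ] , [] ⟧ ⊕_) (bilinear-∑ˡ tensor L cut ⟦ [] ⟧)))))
  shorter : ∀ γ → Valid (length xs) γ → length (rt γ xs) < n
  shorter γ@(l , c) v = lia 4 (λ k N n c → # 1 :≤ c :⇒ k :+ c :≡ N :⇒ N :< # 1 :+ n :⇒ k :< n)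
    (length (rt γ xs)) (length xs) n c (proj₁ v) (length-rt γ xs v) h
  step : ∀ γ → γ ∈ L → deconcatenate (cut γ) ∼ (⟦ [] ⟧ ⊗ cut γ) ⊕ ((cut γ ⊗ ⟦ [] ⟧) ⊕ rest γ)
  step γ γ∈ = begin
    deconcatenate (cut γ)
      ≡⟨ linear-• δ (sign γ) (p ▷ t) ⟩
    sign γ • deconcatenate (p ▷ t)
      ≈⟨ •-cong (sign γ) (≈-trans (deconcatenate-▷ p t) (⊕-congʳ {y = (p ▷ t) ⊗ ⟦ [] ⟧} (≈-trans
           (mapGen-cong (map₂ (_∷ʳ t)) (deconcatenate-𝔹 n (rt γ xs) (shorter γ (arcs-valid (length xs) γ∈))))
           (≡⇒≈ (trans (linear-⊕ (⟦_⟧ ∘ map₂ (_∷ʳ t)) (⟦ [] ⟧ ⊗ p) (𝕋 (rt γ xs)))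
                  (cong (_⊕ append t (𝕋 (rt γ xs))) (append-⊗ t ⟦ [] ⟧ p))))))) ⟩
    sign γ • (((⟦ [] ⟧ ⊗ (p ▷ t)) ⊕ append t (𝕋 (rt γ xs))) ⊕ ((p ▷ t) ⊗ ⟦ [] ⟧))
      ≡⟨ trans (•-⊕ (sign γ) ((⟦ [] ⟧ ⊗ (p ▷ t)) ⊕ append t (𝕋 (rt γ xs))) ((p ▷ t) ⊗ ⟦ [] ⟧))
           (cong (_⊕ (sign γ • ((p ▷ t) ⊗ ⟦ [] ⟧))) (•-⊕ (sign γ) (⟦ [] ⟧ ⊗ (p ▷ t)) (append t (𝕋 (rt γ xs))))) ⟩
    ((sign γ • (⟦ [] ⟧ ⊗ (p ▷ t))) ⊕ rest γ) ⊕ (sign γ • ((p ▷ t) ⊗ ⟦ [] ⟧))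
      ≡⟨ cong₂ (λ u v → (u ⊕ rest γ) ⊕ v) (bilinear-•ʳ tensor (sign γ) ⟦ [] ⟧ (p ▷ t)) (bilinear-•ˡ tensor (sign γ) (p ▷ t) ⟦ [] ⟧) ⟨
    ((⟦ [] ⟧ ⊗ cut γ) ⊕ rest γ) ⊕ (cut γ ⊗ ⟦ [] ⟧)
      ≡⟨ ++-assoc (⟦ [] ⟧ ⊗ cut γ) (rest γ) (cut γ ⊗ ⟦ [] ⟧) ⟩
    (⟦ [] ⟧ ⊗ cut γ) ⊕ (rest γ ⊕ (cut γ ⊗ ⟦ [] ⟧))
      ≈⟨ ⊕-congˡ {x = ⟦ [] ⟧ ⊗ cut γ} (⊕-comm (rest γ) (cut γ ⊗ ⟦ [] ⟧)) ⟩
    (⟦ [] ⟧ ⊗ cut γ) ⊕ ((cut γ ⊗ ⟦ [] ⟧) ⊕ rest γ) ∎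
    where
    p = 𝔹 (rt γ xs)
    t = co γ xs

-- Arrows as arcs

arcOf : ∀ {N} → Arrow N → Arc
arcOf α with toℕ (vertex α) <? toℕ (side α)
... | yes _ = 2 * toℕ (vertex α) , toℕ (side α) ∸ toℕ (vertex α)
... | no _  = 1 + 2 * toℕ (side α) , toℕ (vertex α) ∸ suc (toℕ (side α))

-- The two directions of an arrow from vertex v to side s with arc (l , c).
:IsArc : Term n → Term n → Term n → Term n → Formula n
:IsArc v s l c = (v :< s :∧ l :≡ 2 :* v :∧ s :≡ v :+ c) :∨ (s :< v :∧ l :≡ # 1 :+ 2 :* s :∧ v :≡ # 1 :+ s :+ c)

IsArc : ℕ → ℕ → Arc → Set
IsArc v s (l , c) = (v < s × l ≡ 2 * v × s ≡ v + c) ⊎ (s < v × l ≡ 1 + 2 * s × v ≡ 1 + s + c)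

isArc : ∀ {N} (α : Arrow N) → IsArc (toℕ (vertex α)) (toℕ (side α)) (arcOf α)
isArc α with toℕ (vertex α) <? toℕ (side α)
... | yes v<s = inj₁ (v<s , refl , sym (m+[n∸m]≡n (<⇒≤ v<s)))
... | no v≮s  = inj₂ (s<v , refl , sym (m+[n∸m]≡n s<v))
  where
  s<v : toℕ (side α) < toℕ (vertex α)
  s<v = ≤∧≢⇒< (≮⇒≥ v≮s) (λ e → nontrivial-elim α (inj₁ (sym e)))

lo-arcOf : ∀ {N} (α : Arrow N) → lo (just α) ≡ proj₁ (arcOf α)
lo-arcOf α with isArc α
... | inj₁ (v<s , e , _) = trans (m≤n⇒m⊓n≡m (<⇒≤ (2v<side _ _ v<s))) (sym e)
... | inj₂ (s<v , e , _) = trans (m≥n⇒m⊓n≡n (<⇒≤ (side<2v (toℕ (side α)) _ s<v))) (sym e)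

hi-arcOf : ∀ {N} (α : Arrow N) → hi (just α) ≡ 1 + proj₁ (arcOf α) + 2 * proj₂ (arcOf α)
hi-arcOf α with isArc α
... | inj₁ (v<s , e , e′) = trans (m≤n⇒m⊔n≡n (<⇒≤ (2v<side _ _ v<s)))
  (lia 4 (λ v s l c → l :≡ 2 :* v :⇒ s :≡ v :+ c :⇒ # 1 :+ 2 :* s :≡ # 1 :+ l :+ 2 :* c) _ _ _ (proj₂ (arcOf α)) e e′)
... | inj₂ (s<v , e , e′) = trans (m≥n⇒m⊔n≡m (<⇒≤ (side<2v (toℕ (side α)) _ s<v)))
  (lia 4 (λ v s l c → l :≡ # 1 :+ 2 :* s :⇒ v :≡ # 1 :+ s :+ c :⇒ 2 :* v :≡ # 1 :+ l :+ 2 :* c) _ (toℕ (side α)) _ (proj₂ (arcOf α)) e e′)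

:NonTrivial : Term n → Term n → Term n → Formula n
:NonTrivial N v s = :¬ (v :≡ s :∨ (v :≡ # 1 :+ s :∨ (# 1 :+ s :≡ N :∧ v :≡ # 0)))

arcOf-valid : ∀ {N} (α : Arrow N) → Valid N (arcOf α)
arcOf-valid {N} α = lia 5 (λ v s l c N → :IsArc v s l c :⇒ v :< N :⇒ s :< N :⇒ :NonTrivial N v s :⇒ :Valid N l c)
  (toℕ (vertex α)) (toℕ (side α)) (proj₁ (arcOf α)) (proj₂ (arcOf α)) N (isArc α) (Fin.toℕ<n (vertex α)) (Fin.toℕ<n (side α)) (nontrivial-elim α)

arrow≡ : ∀ {N} {α β : Arrow N} → toℕ (vertex α) ≡ toℕ (vertex β) → toℕ (side α) ≡ toℕ (side β) → α ≡ β
arrow≡ {α = arrow v s _} {arrow v′ s′ _} e e′ with Fin.toℕ-injective e | Fin.toℕ-injective e′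
... | refl | refl = refl

odd-2* : ∀ k → odd (2 * k) ≡ false
odd-2* k = odd-+2* 0 k

odd-arcOf : ∀ {N} (α : Arrow N) (d : Dec (Backward α)) → odd (proj₁ (arcOf α)) ≡ does d
odd-arcOf α d with isArc α
... | inj₁ (v<s , e , _) = trans (cong odd e) (trans (odd-2* (toℕ (vertex α))) (sym (dec-false d (λ h →
  <-asym v<s (<-trans (n<1+n _) h)))))
... | inj₂ (s<v , e , _) = trans (cong odd e) (trans (cong not (odd-2* (toℕ (side α)))) (sym (dec-true d
  (≤∧≢⇒< s<v (λ e → nontrivial-elim α (inj₂ (inj₁ (sym e))))))))

-- A forward arrow has even `l`, a backward one odd `l`. The elimination behind `lia` does not see
-- parity, so the mixed cases use `even≢odd`.
IsArc-injective : ∀ v s v′ s′ γ → IsArc v s γ → IsArc v′ s′ γ → v ≡ v′ × s ≡ s′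
IsArc-injective v s v′ s′ (l , c) (inj₁ (_ , e , e₂)) (inj₁ (_ , e′ , e₂′)) =
  lia 6 (λ v s v′ s′ l c → l :≡ 2 :* v :⇒ s :≡ v :+ c :⇒ l :≡ 2 :* v′ :⇒ s′ :≡ v′ :+ c :⇒ v :≡ v′ :∧ s :≡ s′)
    v s v′ s′ l c e e₂ e′ e₂′
IsArc-injective v s v′ s′ (l , c) (inj₂ (_ , e , e₂)) (inj₂ (_ , e′ , e₂′)) =
  lia 6 (λ v s v′ s′ l c → l :≡ # 1 :+ 2 :* s :⇒ v :≡ # 1 :+ s :+ c :⇒ l :≡ # 1 :+ 2 :* s′ :⇒ v′ :≡ # 1 :+ s′ :+ c :⇒ v :≡ v′ :∧ s :≡ s′)
    v s v′ s′ l c e e₂ e′ e₂′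
IsArc-injective v s v′ s′ γ (inj₁ (_ , e , _)) (inj₂ (_ , e′ , _)) = ⊥-elim (even≢odd v s′ (trans (sym e) e′))
IsArc-injective v s v′ s′ γ (inj₂ (_ , e , _)) (inj₁ (_ , e′ , _)) = ⊥-elim (even≢odd v′ s (trans (sym e′) e))

arcOf-injective : ∀ {N} {α β : Arrow N} → arcOf α ≡ arcOf β → α ≡ β
arcOf-injective {α = α} {β} e = uncurry arrow≡ (IsArc-injective (toℕ (vertex α)) (toℕ (side α)) (toℕ (vertex β)) (toℕ (side β))
  (arcOf α) (isArc α) (subst (IsArc (toℕ (vertex β)) (toℕ (side β))) (sym e) (isArc β)))

IsArc-functional : ∀ v s γ γ′ → IsArc v s γ → IsArc v s γ′ → γ ≡ γ′
IsArc-functional v s (l , c) (l′ , c′) a b = uncurry (cong₂ _,_)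
  (lia 6 (λ v s l c l′ c′ → :IsArc v s l c :⇒ :IsArc v s l′ c′ :⇒ l :≡ l′ :∧ c :≡ c′) v s l c l′ c′ a b)

arcOf-surjective : ∀ {N} γ → Valid N γ → ∃ λ (α : Arrow N) → arcOf α ≡ γ
arcOf-surjective {N} (l , c) vγ with ends
  where
  ends : ∃ λ v → ∃ λ s → IsArc v s (l , c)
  ends with odd l | halve l
  ... | false | b , e = b , b + c , lia 3 (λ b l c → l :≡ 2 :* b :⇒ # 1 :≤ c :⇒ :IsArc b (b :+ c) l c) b l c e (proj₁ vγ)
  ... | true  | b , e = 1 + b + c , b , lia 3 (λ b l c → l :≡ # 1 :+ 2 :* b :⇒ # 1 :≤ c :⇒ :IsArc (# 1 :+ b :+ c) b l c) b l c e (proj₁ vγ)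
... | v , s , a = α , IsArc-functional v s (arcOf α) (l , c)
    (subst₂ (λ i j → IsArc i j (arcOf α)) (Fin.toℕ-fromℕ< v<N) (Fin.toℕ-fromℕ< s<N) (isArc α)) a
  where
  facts : v < N × s < N × ¬ (v ≡ s ⊎ (v ≡ 1 + s ⊎ (1 + s ≡ N × v ≡ 0)))
  facts = lia 5 (λ v s l c N → :IsArc v s l c :⇒ :Valid N l c :⇒ v :< N :∧ s :< N :∧ :NonTrivial N v s) v s l c N a vγ
  v<N : v < N
  v<N = proj₁ facts
  s<N : s < N
  s<N = proj₁ (proj₂ facts)
  α : Arrow N
  α = arrow (fromℕ< v<N) (fromℕ< s<N) (subst₂ (λ i j → ¬ (i ≡ j ⊎ (i ≡ 1 + j ⊎ (1 + j ≡ N × i ≡ 0))))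
    (sym (Fin.toℕ-fromℕ< v<N)) (sym (Fin.toℕ-fromℕ< s<N)) (proj₂ (proj₂ facts)))

-- The enumeration of all arrows

-- Stated for an arbitrary `f`, because the function that `allArrows` passes to `mapMaybe` is local
-- to its definition and can only be supplied by unification.
mapMaybe-unique : (f : A → Maybe B) → (∀ {x y z} → f x ≡ just z → f y ≡ just z → x ≡ y) →
                  ∀ {xs} → Unique xs → Unique (mapMaybe f xs)
mapMaybe-unique f inj []                 = []
mapMaybe-unique f inj (_∷_ {x} {xs} p ps) with f x in e
... | nothing = mapMaybe-unique f inj ps
... | just z  = All.tabulate (λ w∈ z≡w → distinct xs p (subst (_∈ mapMaybe f xs) (sym z≡w) w∈)) ∷ mapMaybe-unique f inj ps
  where
  distinct : ∀ ys → All (x ≢_) ys → ¬ (z ∈ mapMaybe f ys)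
  distinct (y ∷ ys) (q ∷ qs) z∈ with f y in e′
  distinct (y ∷ ys) (q ∷ qs) z∈         | nothing = distinct ys qs z∈
  distinct (y ∷ ys) (q ∷ qs) (here refl) | just _ = q (inj e e′)
  distinct (y ∷ ys) (q ∷ qs) (there z∈) | just _ = distinct ys qs z∈

∈-mapMaybe : (f : A → Maybe B) (g : B → A) (Q : A → Set) → (∀ {x} → Q x → f x ≢ nothing) →
             (∀ {x y} → f x ≡ just y → g y ≡ x) → (∀ {y z} → g y ≡ g z → y ≡ z) →
             ∀ {xs z} → Q (g z) → g z ∈ xs → z ∈ mapMaybe f xs
∈-mapMaybe f g Q n j inj {x ∷ xs} q z∈ with f x in e
∈-mapMaybe f g Q n j inj {x ∷ xs} q (here refl) | nothing = ⊥-elim (n q e)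
∈-mapMaybe f g Q n j inj {x ∷ xs} q (there z∈)  | nothing = ∈-mapMaybe f g Q n j inj q z∈
∈-mapMaybe f g Q n j inj {x ∷ xs} q (here refl) | just y  = here (sym (inj (j e)))
∈-mapMaybe f g Q n j inj {x ∷ xs} q (there z∈)  | just y  = there (∈-mapMaybe f g Q n j inj q z∈)

allArrows-unique : ∀ N → Unique (allArrows N)
allArrows-unique N = mapMaybe-unique _ ends (Unique.cartesianProduct⁺ (Unique.allFin⁺ N) (Unique.allFin⁺ N))
  where
  ends : ∀ {p q : Fin N × Fin N} {α} → _ ≡ just α → _ ≡ just α → p ≡ q
  ends {v , s} {v′ , s′} e e′ with trivial? v s | trivial? v′ s′
  ends {v , s} {v′ , s′} refl refl | no _ | no _ = refl

∈-allArrows : ∀ {N} (α : Arrow N) → α ∈ allArrows N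
∈-allArrows {N} α = ∈-mapMaybe _ (λ β → vertex β , side β) (λ (v , s) → ¬ Trivial v s) listed ends
  (λ e → arrow≡ (cong (toℕ ∘ proj₁) e) (cong (toℕ ∘ proj₂) e)) (nontrivial-elim α)
  (∈-cartesianProduct⁺ (∈-allFin (vertex α)) (∈-allFin (side α)))
  where
  listed : ∀ {p : Fin N × Fin N} → ¬ Trivial (proj₁ p) (proj₂ p) → _ ≢ nothing
  listed {v , s} nt e with trivial? v s
  listed {v , s} nt refl | yes t = nt t
  ends : ∀ {p : Fin N × Fin N} {β : Arrow N} → _ ≡ just β → (vertex β , side β) ≡ p
  ends {v , s} e with trivial? v s
  ends {v , s} refl | no _ = refl

arcs-↭ : ∀ N → map arcOf (allArrows N) ↭ arcs N
arcs-↭ N = ↭-unique (map-unique arcOf (λ _ _ → arcOf-injective) (allArrows-unique N)) (arcs-unique N)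
  (λ γ∈ → let (α , _ , e) = ∈-map⁻ arcOf γ∈ in subst (_∈ arcs N) (sym e) (valid-∈ N (arcOf-valid α)))
  (λ {γ} γ∈ → let (α , e) = arcOf-surjective γ (arcs-valid N γ∈) in
              subst (_∈ map arcOf (allArrows N)) e (∈-map⁺ arcOf (∈-allArrows α)))

-- Dissections in terms of arcs

module _ {N : ℕ} where

  Ends : Arrow N → Set
  Ends α = lo (just α) ≡ proj₁ (arcOf α) × hi (just α) ≡ 1 + proj₁ (arcOf α) + 2 * proj₂ (arcOf α)

  arrowEnds : ∀ α → Ends α
  arrowEnds α = lo-arcOf α , hi-arcOf α

  private
    :Ends : Term n → Term n → Term n → Term n → Formula n
    :Ends x y l c = x :≡ l :∧ y :≡ # 1 :+ l :+ 2 :* c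

    :≺ : Term n → Term n → Term n → Term n → Formula n
    :≺ x y x′ y′ = (x :≤ x′ :∧ y′ :≤ y) :∧ :¬ (x :≡ x′ :∧ y′ :≡ y)

    :Interleaved : Term n → Term n → Term n → Term n → Formula n
    :Interleaved x y x′ y′ = x :< x′ :∧ x′ :< y :∧ y :< y′

    :NonIntersecting : Term n → Term n → Term n → Term n → Formula n
    :NonIntersecting x y x′ y′ = :¬ (:Interleaved x y x′ y′) :∧ :¬ (:Interleaved x′ y′ x y)

    l c : Arrow N → ℕ
    l α = proj₁ (arcOf α)
    c α = proj₂ (arcOf α)

  ≺⇔⊃ : ∀ α β → (just α ≺ just β) ⇔ (arcOf α ⊃ arcOf β)
  ≺⇔⊃ α β = mk⇔
    (lia 8 (λ x y x′ y′ l c l′ c′ → :Ends x y l c :⇒ :Ends x′ y′ l′ c′ :⇒ :≺ x y x′ y′ :⇒ :⊃ l c l′ c′)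
      (lo (just α)) (hi (just α)) (lo (just β)) (hi (just β)) (l α) (c α) (l β) (c β) (arrowEnds α) (arrowEnds β))
    (lia 8 (λ x y x′ y′ l c l′ c′ → :Ends x y l c :⇒ :Ends x′ y′ l′ c′ :⇒ :⊃ l c l′ c′ :⇒ :≺ x y x′ y′)
      (lo (just α)) (hi (just α)) (lo (just β)) (hi (just β)) (l α) (c α) (l β) (c β) (arrowEnds α) (arrowEnds β))

  -- Two intervals that do not cross are disjoint or nested. Equal arrows would satisfy the left
  -- side but not the right.
  Before⇔ : ∀ α β → α ≢ β → (NonIntersecting α β × ¬ (just β ≺ just α)) ⇔ Before (arcOf α) (arcOf β)
  Before⇔ α β α≢β = mk⇔
    (λ (ni , ¬h) → lia 8 (λ x y x′ y′ l c l′ c′ → :Ends x y l c :⇒ :Ends x′ y′ l′ c′ :⇒ # 1 :≤ c :⇒ # 1 :≤ c′ :⇒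
            :¬ (l′ :≤ l :∧ l :+ 2 :* c :≤ l′ :+ 2 :* c′) :⇒ :NonIntersecting x y x′ y′ :⇒ :Before l c l′ c′)
      (lo (just α)) (hi (just α)) (lo (just β)) (hi (just β)) (l α) (c α) (l β) (c β) (arrowEnds α) (arrowEnds β)
      (proj₁ (arcOf-valid α)) (proj₁ (arcOf-valid β)) (outside (¬h ∘ Equivalence.from (≺⇔⊃ β α))) ni)
    (lia 8 (λ x y x′ y′ l c l′ c′ → :Ends x y l c :⇒ :Ends x′ y′ l′ c′ :⇒
            :Before l c l′ c′ :⇒ :NonIntersecting x y x′ y′ :∧ :¬ (:≺ x′ y′ x y))
      (lo (just α)) (hi (just α)) (lo (just β)) (hi (just β)) (l α) (c α) (l β) (c β) (arrowEnds α) (arrowEnds β))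

    where
    -- The failure of `⊃` leaves open that the arcs coincide, which is excluded by `α≢β`.
    outside : ¬ (arcOf β ⊃ arcOf α) → ¬ (l β ≤ l α × l α + 2 * c α ≤ l β + 2 * c β)
    outside ¬h h = lia 4 (λ l c l′ c′ → :¬ (:⊃ l′ c′ l c) :⇒ :¬ (l :≡ l′ :∧ c :≡ c′) :⇒ :¬ (l′ :≤ l :∧ l :+ 2 :* c :≤ l′ :+ 2 :* c′))
      (l α) (c α) (l β) (c β) ¬h (λ (e , e′) → α≢β (arcOf-injective (cong₂ _,_ e e′))) h

  Disjoint⇔ : ∀ α β → α ≢ β → (NonIntersecting α β × ¬ (just α ≺ just β) × ¬ (just β ≺ just α)) ⇔ Disjoint (arcOf α) (arcOf β)
  Disjoint⇔ α β α≢β = mk⇔ to from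
    where
    to : NonIntersecting α β × ¬ (just α ≺ just β) × ¬ (just β ≺ just α) → Disjoint (arcOf α) (arcOf β)
    to (n , ¬h , ¬h′) = [ id , (λ h → ⊥-elim (¬h (Equivalence.from (≺⇔⊃ α β) h))) ]′
      (Equivalence.to (Before⇔ α β α≢β) (n , ¬h′))
    from : Disjoint (arcOf α) (arcOf β) → NonIntersecting α β × ¬ (just α ≺ just β) × ¬ (just β ≺ just α)
    from d = proj₁ both , (λ h → Disjoint⇒⊅ {arcOf α} {arcOf β} d (Equivalence.to (≺⇔⊃ α β) h)) , proj₂ both
      where
      both : NonIntersecting α β × ¬ (just β ≺ just α)
      both = Equivalence.from (Before⇔ α β α≢β) (inj₁ d)

  arrow-hi : ∀ (α : Arrow N) → hi (just α) < 2 * N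
  arrow-hi α = lia 5 (λ x y l c N → :Ends x y l c :⇒ :Valid N l c :⇒ y :< 2 :* N)
    (lo (just α)) (hi (just α)) (l α) (c α) N (arrowEnds α) (arcOf-valid α)

  root≺ : ∀ (α : Arrow N) → nothing ≺ just α
  root≺ α = (z≤n , <⇒≤ (arrow-hi α)) , λ (_ , e) → <⇒≢ (arrow-hi α) e

  ⊀root : ∀ (r : Region N) → ¬ (r ≺ nothing)
  ⊀root nothing  (_ , ≢) = ≢ (refl , refl)
  ⊀root (just α) ((_ , h) , _) = <⇒≱ (arrow-hi α) h

  private
    arcRegion : Region N → Maybe Arc
    arcRegion = Data.Maybe.map arcOf

  Covers⇔ : ∀ (β : Arrow N) j → Covers (just β) j ⇔ Over (arcOf β) (toℕ j)
  Covers⇔ β j = mk⇔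
    (lia 5 (λ x y l c j → :Ends x y l c :⇒ x :< # 1 :+ 2 :* j :∧ # 1 :+ 2 :* j :< y :⇒ :Over l c j)
      (lo (just β)) (hi (just β)) (l β) (c β) (toℕ j) (arrowEnds β))
    (lia 5 (λ x y l c j → :Ends x y l c :⇒ :Over l c j :⇒ x :< # 1 :+ 2 :* j :∧ # 1 :+ 2 :* j :< y)
      (lo (just β)) (hi (just β)) (l β) (c β) (toℕ j) (arrowEnds β))

  Touches⇔ : ∀ (r : Region N) j → Touches r j ⇔ MeetsRegion (arcRegion r) (toℕ j)
  Touches⇔ nothing j = mk⇔ (λ _ → tt) (λ _ → z≤n , <⇒≤ (side<2v (toℕ j) N (Fin.toℕ<n j)))
  Touches⇔ (just α) j = mk⇔
    (lia 5 (λ x y l c j → :Ends x y l c :⇒ x :≤ # 1 :+ 2 :* j :∧ # 1 :+ 2 :* j :≤ y :⇒ :Meets l c j)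
      (lo (just α)) (hi (just α)) (l α) (c α) (toℕ j) (arrowEnds α))
    (lia 5 (λ x y l c j → :Ends x y l c :⇒ :Meets l c j :⇒ x :≤ # 1 :+ 2 :* j :∧ # 1 :+ 2 :* j :≤ y)
      (lo (just α)) (hi (just α)) (l α) (c α) (toℕ j) (arrowEnds α))

  Hides⇔ : ∀ (r : Region N) j β → Hides r j β ⇔ Conceals (arcRegion r) (toℕ j) (arcOf β)
  Hides⇔ r j β = mk⇔ (λ (h , o) → to r h , Equivalence.to (Covers⇔ β j) o) (λ (h , o) → from r h , Equivalence.from (Covers⇔ β j) o)
    where
    to : ∀ r → r ≺ just β → Below (arcRegion r) (arcOf β)
    to nothing  _ = tt
    to (just α) h = Equivalence.to (≺⇔⊃ α β) h
    from : ∀ r → Below (arcRegion r) (arcOf β) → r ≺ just β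
    from nothing  _ = root≺ β
    from (just α) h = Equivalence.from (≺⇔⊃ α β) h

  Bounds⇔ : ∀ as (r : Region N) j → Bounds as r j ⇔ Visible (map arcOf as) (arcRegion r) (toℕ j)
  Bounds⇔ as r j = mk⇔
    (λ (t , ¬h) → Equivalence.to (Touches⇔ r j) t , λ p → ¬h (Any.map (λ {β} → Equivalence.from (Hides⇔ r j β)) (Any.map⁻ p)))
    (λ (t , ¬h) → Equivalence.from (Touches⇔ r j) t , λ p → ¬h (Any.map⁺ (Any.map (λ {β} → Equivalence.to (Hides⇔ r j β)) p)))

select-tabulate : ∀ {P : B → Set} {Q : ℕ → Set} (P? : ∀ x → Dec (P x)) (Q? : ∀ j → Dec (Q j)) (h : B → X) k (xs : List X)
                  (g : Fin (length xs) → B) → (∀ i → h (g i) ≡ lookup xs i) → (∀ i → P (g i) ⇔ Q (k + toℕ i)) →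
                  map h (filter P? (Data.List.tabulate g)) ≡ select Q? k xs
select-tabulate P? Q? h k []       g e eq = refl
select-tabulate {P = P} {Q} P? Q? h k (x ∷ xs) g e eq
  with P? (g zero) | Q? k | select-tabulate P? Q? h (suc k) xs (g ∘ suc) (e ∘ suc)
                              (λ i → subst (λ n → P (g (suc i)) ⇔ Q n) (+-suc k (toℕ i)) (eq (suc i)))
... | yes _ | yes _ | ih = cong₂ _∷_ (e zero) ih
... | no _  | no _  | ih = ih
... | yes p | no ¬q | _  = ⊥-elim (¬q (subst Q (+-identityʳ k) (Equivalence.to (eq zero) p)))
... | no ¬p | yes q | _  = ⊥-elim (¬p (Equivalence.from (eq zero) (subst Q (sym (+-identityʳ k)) q)))

map-orient : ∀ {N} (f : Fin N → X) (r : Region N) js → map f (orient r js) ≡ turn (Data.Maybe.map arcOf r) (map f js)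
map-orient f nothing  js = refl
map-orient f (just α) js with backward? α
... | yes h rewrite odd-arcOf α (yes h) = reverse-map f js
... | no h  rewrite odd-arcOf α (no h)  = refl

regionLabels≡ : ∀ (π : Polygon X) D r →
                regionLabels π D r ≡ labels (map arcOf (arrows D)) (Data.Maybe.map arcOf r) (sides π)
regionLabels≡ π D r = trans (map-orient (lookup (sides π)) r _) (cong (turn (Data.Maybe.map arcOf r))
  (select-tabulate (bounds? (arrows D) r) (visible? (map arcOf (arrows D)) (Data.Maybe.map arcOf r)) (lookup (sides π)) 0
    (sides π) id (λ _ → refl) (Bounds⇔ (arrows D) r)))

-- Stated separately, since converting one side of regionLabels≡ to these forms makes
-- the type checker unfold labels.
regionLabels-root : ∀ (π : Polygon X) D → regionLabels π D nothing ≡ labels (map arcOf (arrows D)) nothing (sides π)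
regionLabels-root π D = regionLabels≡ π D nothing

regionLabels-arrow : ∀ (π : Polygon X) D α →
                     regionLabels π D (just α) ≡ labels (map arcOf (arrows D)) (just (arcOf α)) (sides π)
regionLabels-arrow π D α = regionLabels≡ π D (just α)

-- Changing the letters of words

module _ {X : Set ℓ} where

  bilinear-mapGen : {Y Z : Set ℓ} (f : Y → Z → Lin X) {G H : Set ℓ} (g : G → Y) (h : H → Z) → ∀ p q →
                    bilinear f (mapGen g p) (mapGen h q) ≡ bilinear (λ u w → f (g u) (h w)) p q
  bilinear-mapGen f g h p q = trans (linear-mapGen (λ u → linear (f u) (mapGen h q)) g p)
    (linear-≗ (λ u → linear-mapGen (f (g u)) h q) p)

⧢-cons : ∀ (x : X) p y q → cons x p ⧢ cons y q ∼ cons x (p ⧢ cons y q) ⊕ cons y (cons x p ⧢ q)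
⧢-cons {X = X} x p y q = begin
  cons x p ⧢ cons y q
    ≡⟨ bilinear-mapGen shuf (x ∷_) (y ∷_) p q ⟩
  bilinear (λ u w → cons x (shuf u (y ∷ w)) ⊕ cons y (shuf (x ∷ u) w)) p q
    ≈⟨ ≈-trans (linear-cong (λ u → linear-⊕ʳ (λ w → cons x (shuf u (y ∷ w))) (λ w → cons y (shuf (x ∷ u) w)) q) p)
         (linear-⊕ʳ (λ u → linear (λ w → cons x (shuf u (y ∷ w))) q) (λ u → linear (λ w → cons y (shuf (x ∷ u) w)) q) p) ⟩
  bilinear (λ u w → cons x (shuf u (y ∷ w))) p q ⊕ bilinear (λ u w → cons y (shuf (x ∷ u) w)) p q
    ≡⟨ cong₂ _⊕_ (trans (sym (linear-bilinear (⟦_⟧ ∘ (x ∷_)) (λ u w → shuf u (y ∷ w)) p q))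
                   (cong (cons x) (linear-≗ (λ u → sym (linear-mapGen (shuf u) (y ∷_) q)) p)))
                 (trans (sym (linear-bilinear (⟦_⟧ ∘ (y ∷_)) (λ u w → shuf (x ∷ u) w) p q))
                   (cong (cons y) (sym (linear-mapGen (λ u → linear (shuf u) q) (x ∷_) p)))) ⟩
  cons x (p ⧢ cons y q) ⊕ cons y (cons x p ⧢ q) ∎
  where open ∼-Reasoning (List X)

deconcatenate-cons : ∀ (y : X) p → deconcatenate (cons y p) ∼ (⟦ [] ⟧ ⊗ cons y p) ⊕ mapGen (map₁ (y ∷_)) (deconcatenate p)
deconcatenate-cons {X = X} y p = begin
  deconcatenate (cons y p)
    ≡⟨ trans (linear-mapGen δ (y ∷_) p) (linear-≗ (δ-∷ y) p) ⟩
  linear (λ w → ⟦ [] , y ∷ w ⟧ ⊕ mapGen (map₁ (y ∷_)) (δ w)) p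
    ≈⟨ linear-⊕ʳ (λ w → ⟦ [] , y ∷ w ⟧) (λ w → mapGen (map₁ (y ∷_)) (δ w)) p ⟩
  linear (λ w → ⟦ [] , y ∷ w ⟧) p ⊕ linear (λ w → mapGen (map₁ (y ∷_)) (δ w)) p
    ≡⟨ cong₂ _⊕_ (trans (⊗-[]ˡ (cons y p)) (mapGen-mapGen ([] ,_) (y ∷_) p)) (mapGen-linear (map₁ (y ∷_)) δ p) ⟨
  (⟦ [] ⟧ ⊗ cons y p) ⊕ mapGen (map₁ (y ∷_)) (deconcatenate p) ∎
  where open ∼-Reasoning (List X × List X)

⊗-0ʳ : (p : Lin (List X)) → p ⊗ [] ∼ ([] {A = ℚ × (List X × List X)})
⊗-0ʳ p = linear-0ʳ (λ _ → ≈-refl) p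

-- Words with a letter outside the domain of f are sent to 0.
module Realize {X Y : Set ℓ} (f : X → Maybe Y) where

  private
    consᵐ : Maybe Y → Lin (List Y) → Lin (List Y)
    consᵐ nothing  p = []
    consᵐ (just y) p = cons y p

  realizeWord : List X → Lin (List Y)
  realizeWord []      = ⟦ [] ⟧
  realizeWord (x ∷ w) = consᵐ (f x) (realizeWord w)

  realize : Lin (List X) → Lin (List Y)
  realize = linear realizeWord

  private
    linear-consᵐ : ∀ m (p : Lin (List X)) → linear (consᵐ m ∘ realizeWord) p ∼ consᵐ m (realize p)
    linear-consᵐ nothing  p = linear-0ʳ (λ _ → ≈-refl) p
    linear-consᵐ (just y) p = ≡⇒≈ (sym (mapGen-linear (y ∷_) realizeWord p))

    realize-cons : ∀ x p → realize (cons x p) ∼ consᵐ (f x) (realize p)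
    realize-cons x p = ≈-trans (≡⇒≈ (linear-mapGen realizeWord (x ∷_) p)) (linear-consᵐ (f x) p)

    consᵐ-cong : ∀ m {p q} → p ∼ q → consᵐ m p ∼ consᵐ m q
    consᵐ-cong nothing  e = ≈-refl
    consᵐ-cong (just y) e = mapGen-cong (y ∷_) e

    consᵐ-0 : ∀ m {p} → p ∼ [] → consᵐ m p ∼ []
    consᵐ-0 nothing  e = ≈-refl
    consᵐ-0 (just y) e = mapGen-cong (y ∷_) e

    ⧢-consᵐ : ∀ m p m′ q → consᵐ m p ⧢ consᵐ m′ q ∼ consᵐ m (p ⧢ consᵐ m′ q) ⊕ consᵐ m′ (consᵐ m p ⧢ q)
    ⧢-consᵐ (just x) p (just y) q = ⧢-cons x p y q
    ⧢-consᵐ nothing  p m′       q = ≈-sym (consᵐ-0 m′ ≈-refl)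
    ⧢-consᵐ (just x) p nothing  q = ≈-trans (zeroʳ (cons x p)) (≈-sym (≈-trans (≡⇒≈ (⊕-identityʳ _)) (consᵐ-0 (just x) (zeroʳ p))))
      where
      zeroʳ : ∀ p → p ⧢ [] ∼ []
      zeroʳ p = linear-0ʳ (λ _ → ≈-refl) p

  -- A shuffle keeps all letters, so the words with a letter outside the domain span an ideal, and
  -- sending them to 0 is multiplicative.
  realize-shuf : ∀ u w → realize (shuf u w) ∼ realizeWord u ⧢ realizeWord w
  realize-shuf []      w       = ≡⇒≈ (trans (linear-⟦⟧ realizeWord w) (sym (⧢-identityˡ (realizeWord w))))
  realize-shuf (x ∷ u) []      = ≡⇒≈ (trans (linear-⟦⟧ realizeWord (x ∷ u)) (sym (⧢-identityʳ (realizeWord (x ∷ u)))))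
  realize-shuf (x ∷ u) (y ∷ w) = begin
    realize (cons x (shuf u (y ∷ w)) ⊕ cons y (shuf (x ∷ u) w))
      ≡⟨ linear-⊕ realizeWord (cons x (shuf u (y ∷ w))) (cons y (shuf (x ∷ u) w)) ⟩
    realize (cons x (shuf u (y ∷ w))) ⊕ realize (cons y (shuf (x ∷ u) w))
      ≈⟨ ⊕-cong (≈-trans (realize-cons x (shuf u (y ∷ w))) (consᵐ-cong (f x) (realize-shuf u (y ∷ w))))
                (≈-trans (realize-cons y (shuf (x ∷ u) w)) (consᵐ-cong (f y) (realize-shuf (x ∷ u) w))) ⟩
    consᵐ (f x) (realizeWord u ⧢ realizeWord (y ∷ w)) ⊕ consᵐ (f y) (realizeWord (x ∷ u) ⧢ realizeWord w)
      ≈⟨ ⧢-consᵐ (f x) (realizeWord u) (f y) (realizeWord w) ⟨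
    realizeWord (x ∷ u) ⧢ realizeWord (y ∷ w) ∎
    where open ∼-Reasoning (List Y)

  realize-⧢ : ∀ p q → realize (p ⧢ q) ∼ realize p ⧢ realize q
  realize-⧢ p q = ≈-trans (≡⇒≈ (linear-bilinear realizeWord shuf p q)) (≈-trans (bilinear-cong-≗ realize-shuf p q)
    (≈-sym (bilinear-linear shuf realizeWord realizeWord p q)))

  realize-∏⧢ : ∀ ps → realize (∏⧢ ps) ∼ ∏⧢ (map realize ps)
  realize-∏⧢ []       = ≈-refl
  realize-∏⧢ (p ∷ ps) = ≈-trans (realize-⧢ p (∏⧢ ps)) (⧢-congˡ {p = realize p} (realize-∏⧢ ps))

  realizePair : List X × List X → Lin (List Y × List Y)
  realizePair (u , w) = realizeWord u ⊗ realizeWord w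

  realize² : Lin (List X × List X) → Lin (List Y × List Y)
  realize² = linear realizePair

  realize-⊗ : ∀ p q → realize² (p ⊗ q) ∼ realize p ⊗ realize q
  realize-⊗ p q = ≈-trans (≡⇒≈ (trans (linear-bilinear realizePair (λ v w → ⟦ v , w ⟧) p q)
      (linear-≗ (λ u → linear-≗ (λ w → linear-⟦⟧ realizePair (u , w)) q) p)))
    (≈-sym (bilinear-linear (λ v w → ⟦ v , w ⟧) realizeWord realizeWord p q))

  -- Each cut of a word with a letter outside the domain leaves this letter in one of the two parts,
  -- so both sides vanish on such a word.
  realize-δ : ∀ w → deconcatenate (realizeWord w) ∼ realize² (δ w)
  realize-δ []      = ≈-refl
  realize-δ (x ∷ w) = begin
    deconcatenate (consᵐ (f x) (realizeWord w))
      ≈⟨ step (f x) ⟩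
    (⟦ [] ⟧ ⊗ consᵐ (f x) (realizeWord w)) ⊕ linear (λ (u , v) → consᵐ (f x) (realizeWord u) ⊗ realizeWord v) (δ w)
      ≡⟨ cong₂ _⊕_ (linear-⟦⟧ realizePair ([] , x ∷ w)) (linear-mapGen realizePair (map₁ (x ∷_)) (δ w)) ⟨
    realize² ⟦ [] , x ∷ w ⟧ ⊕ realize² (mapGen (map₁ (x ∷_)) (δ w))
      ≡⟨ trans (cong realize² (δ-∷ x w)) (linear-⊕ realizePair ⟦ [] , x ∷ w ⟧ (mapGen (map₁ (x ∷_)) (δ w))) ⟨
    realize² (δ (x ∷ w)) ∎
    where
    open ∼-Reasoning (List Y × List Y)
    step : ∀ m → deconcatenate (consᵐ m (realizeWord w)) ∼
           (⟦ [] ⟧ ⊗ consᵐ m (realizeWord w)) ⊕ linear (λ (u , v) → consᵐ m (realizeWord u) ⊗ realizeWord v) (δ w)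
    step nothing  = ≈-sym (⊕-cong (⊗-0ʳ ⟦ [] ⟧) (linear-0ʳ (λ _ → ≈-refl) (δ w)))
    step (just y) = ≈-trans (deconcatenate-cons y (realizeWord w)) (⊕-congˡ {x = ⟦ [] ⟧ ⊗ cons y (realizeWord w)}
      (≈-trans (mapGen-cong (map₁ (y ∷_)) (realize-δ w)) (≡⇒≈ (trans (mapGen-linear (map₁ (y ∷_)) realizePair (δ w))
        (linear-≗ (λ (u , v) → trans (linear-bilinear (⟦_⟧ ∘ map₁ (y ∷_)) (λ v w → ⟦ v , w ⟧) (realizeWord u) (realizeWord v))
          (sym (linear-mapGen (λ u → linear (λ w → ⟦ u , w ⟧) (realizeWord v)) (y ∷_) (realizeWord u)))) (δ w))))))

  deconcatenate-realize : ∀ p → deconcatenate (realize p) ∼ realize² (deconcatenate p)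
  deconcatenate-realize p = ≈-trans (≡⇒≈ (linear-linear δ realizeWord p))
    (≈-trans (linear-cong realize-δ p) (≡⇒≈ (sym (linear-linear realizePair δ p))))

-- Polygons as letters of degree zero of the bar construction

module _ {Y : Set ℓ} where

  embedWord : List Y → Word {X = Y}
  embedWord = map (List⁺._∷ [])

  toBar : Lin (List Y) → Lin (Word {X = Y})
  toBar = mapGen embedWord

  toBar² : Lin (List Y × List Y) → Lin (Word {X = Y} × Word {X = Y})
  toBar² = mapGen (λ (u , w) → embedWord u , embedWord w)

  -- A single polygon has shifted degree zero, so every Koszul sign is `[-1]^ 0`.
  shuffle-embedWord : ∀ u w → shuffle (embedWord u) (embedWord w) ≡ toBar (shuf u w)
  shuffle-embedWord []      w       = sym (linear-⟦⟧ (⟦_⟧ ∘ embedWord) w)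
  shuffle-embedWord (x ∷ u) []      = sym (linear-⟦⟧ (⟦_⟧ ∘ embedWord) (x ∷ u))
  shuffle-embedWord (x ∷ u) (y ∷ w) = begin
    prefix (x List⁺.∷ []) (shuffle (embedWord u) (embedWord (y ∷ w))) ⊕ 1ℚ • prefix (y List⁺.∷ []) (shuffle (embedWord (x ∷ u)) (embedWord w))
      ≡⟨ cong₂ (λ p q → prefix (x List⁺.∷ []) p ⊕ q) (shuffle-embedWord u (y ∷ w))
           (trans (1• _) (cong (prefix (y List⁺.∷ [])) (shuffle-embedWord (x ∷ u) w))) ⟩
    prefix (x List⁺.∷ []) (toBar (shuf u (y ∷ w))) ⊕ prefix (y List⁺.∷ []) (toBar (shuf (x ∷ u) w))
      ≡⟨ cong₂ _⊕_ (prefix-toBar x (shuf u (y ∷ w))) (prefix-toBar y (shuf (x ∷ u) w)) ⟩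
    toBar (cons x (shuf u (y ∷ w))) ⊕ toBar (cons y (shuf (x ∷ u) w))
      ≡⟨ linear-⊕ (⟦_⟧ ∘ embedWord) (cons x (shuf u (y ∷ w))) (cons y (shuf (x ∷ u) w)) ⟨
    toBar (shuf (x ∷ u) (y ∷ w)) ∎
    where
    open ≡-Reasoning
    prefix-toBar : ∀ x p → prefix (x List⁺.∷ []) (toBar p) ≡ toBar (cons x p)
    prefix-toBar x p = trans (mapGen-mapGen ((x List⁺.∷ []) ∷_) embedWord p) (sym (mapGen-mapGen embedWord (x ∷_) p))

  toBar-⧢ : ∀ p q → toBar p ш toBar q ≡ toBar (p ⧢ q)
  toBar-⧢ p q = trans (bilinear-mapGen shuffle embedWord embedWord p q)
    (trans (linear-≗ (λ u → linear-≗ (λ w → shuffle-embedWord u w) q) p) (sym (linear-bilinear (⟦_⟧ ∘ embedWord) shuf p q)))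

  toBar-∏⧢ : ∀ ps → ∏ш (map toBar ps) ≡ toBar (∏⧢ ps)
  toBar-∏⧢ []       = refl
  toBar-∏⧢ (p ∷ ps) = trans (cong (toBar p ш_) (toBar-∏⧢ ps)) (toBar-⧢ p (∏⧢ ps))

  toBar-⊗ : ∀ p q → toBar p ⊗ toBar q ≡ toBar² (p ⊗ q)
  toBar-⊗ p q = trans (bilinear-mapGen (λ v w → ⟦ v , w ⟧) embedWord embedWord p q)
    (sym (trans (linear-bilinear (λ (u , w) → ⟦ embedWord u , embedWord w ⟧) (λ v w → ⟦ v , w ⟧) p q)
      (linear-≗ (λ u → linear-≗ (λ w → linear-⟦⟧ (λ (u , w) → ⟦ embedWord u , embedWord w ⟧) (u , w)) q) p)))

splits-upTo : (w : List A) → map (λ j → splitAt j w) (upTo (suc (length w))) ≡ splits w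
splits-upTo []      = refl
splits-upTo (x ∷ w) = cong (([] , x ∷ w) ∷_) (trans (cong (map (λ j → splitAt j (x ∷ w))) (sym (map-applyUpTo id suc (suc (length w)))))
  (trans (sym (map-∘ (upTo (suc (length w))))) (trans (map-∘ (upTo (suc (length w)))) (cong (map (map₁ (x ∷_))) (splits-upTo w)))))

splits-map : (g : A → B) (w : List A) → splits (map g w) ≡ map (λ (u , v) → map g u , map g v) (splits w)
splits-map g []      = refl
splits-map g (x ∷ w) = cong (([] , g x ∷ map g w) ∷_) (trans (cong (map (map₁ (g x ∷_))) (splits-map g w))
  (trans (sym (map-∘ (splits w))) (map-∘ (splits w))))

Δ-deconcatenate : {Y : Set ℓ} (p : Lin (Word {X = Y})) → Δ p ≡ deconcatenate p
Δ-deconcatenate p = linear-≗ (λ w → trans (sym (∑-map (λ j → splitAt j w) (upTo (suc (length w))) ⟦_⟧))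
  (cong (λ is → ∑ is ⟦_⟧) (splits-upTo w))) p

Δ-toBar : {Y : Set ℓ} (p : Lin (List Y)) → Δ (toBar p) ≡ toBar² (deconcatenate p)
Δ-toBar p = trans (Δ-deconcatenate (toBar p)) (trans (linear-mapGen δ embedWord p) (trans
  (linear-≗ (λ w → trans (cong (λ is → ∑ is ⟦_⟧) (splits-map (List⁺._∷ []) w))
    (trans (∑-map (λ (u , v) → embedWord u , embedWord v) (splits w) ⟦_⟧)
      (sym (trans (linear-∑ (λ (u , v) → ⟦ embedWord u , embedWord v ⟧) (splits w) ⟦_⟧)
        (∑-≗ (λ s → linear-⟦⟧ (λ (u , v) → ⟦ embedWord u , embedWord v ⟧) s) (splits w)))))) p)
  (sym (mapGen-linear (λ (u , v) → embedWord u , embedWord v) δ p))))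

-- The elements B(π) as sums over arcs

toPolygon : {R : Set ℓ} → List R → Maybe (Polygon R)
toPolygon ys with 2 ≤? length ys
... | yes p = just (polygon ys p)
... | no _  = nothing

toPolygon-sides : (π : Polygon X) → toPolygon (sides π) ≡ just π
toPolygon-sides (polygon ys p) with 2 ≤? length ys
... | yes _ = refl
... | no ¬p = ⊥-elim-irr (¬p p)

open module RealizePolygon {ℓ} {R : Set ℓ} = Realize {X = List R} {Y = Polygon R} toPolygon

realizeWord-sides : (πs : List (Polygon X)) → realizeWord (map sides πs) ≡ ⟦ πs ⟧
realizeWord-sides []       = refl
realizeWord-sides (π ∷ πs) rewrite toPolygon-sides π | realizeWord-sides πs = refl

product-filter : {P : A → Set ℓ′} (P? : ∀ x → Dec (P x)) (f : A → ℚ) (xs : List A) →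
                 product (map f (filter P? xs)) ≡ product (map (λ x → if does (P? x) then f x else 1ℚ) xs)
product-filter P? f []       = refl
product-filter P? f (x ∷ xs) with P? x
... | yes _ = cong (f x *ℚ_) (product-filter P? f xs)
... | no _  = trans (product-filter P? f xs) (sym (ℚ.*-identityˡ _))

sublists-unique : {xs : List A} → Unique xs → All Unique (sublists xs)
sublists-unique []                    = [] ∷ []
sublists-unique {xs = x ∷ xs} (p ∷ u) = All.++⁺ (sublists-unique u)
  (All.map⁺ (All.zipWith (λ (q , v) → q ∷ v) (sublists-All p , sublists-unique u)))

AllPairs-zip : {P Q S : A → A → Set ℓ′} → (∀ {x y} → P x y → Q x y → S x y) →
               ∀ {xs} → AllPairs P xs → AllPairs Q xs → AllPairs S xs
AllPairs-zip f []       []       = []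
AllPairs-zip f (p ∷ ps) (q ∷ qs) = All.zipWith (uncurry f) (p , q) ∷ AllPairs-zip f ps qs

AllPairs-∈ : {S : A → A → Set ℓ′} → ∀ {xs} → (∀ {x y} → x ∈ xs → y ∈ xs → S x y) → AllPairs S xs
AllPairs-∈ {xs = []}     f = []
AllPairs-∈ {xs = x ∷ xs} f = All.tabulate (λ y∈ → f (here refl) (there y∈)) ∷ AllPairs-∈ (λ x∈ y∈ → f (there x∈) (there y∈))

AllPairs-lookup : {S : A → A → Set ℓ′} → (∀ {x y} → S x y → S y x) → ∀ {xs} → AllPairs S xs →
                  ∀ {x y} → x ∈ xs → y ∈ xs → x ≡ y ⊎ S x y
AllPairs-lookup s (p ∷ ps) (here refl) (here refl) = inj₁ refl
AllPairs-lookup s (p ∷ ps) (here refl) (there y∈)  = inj₂ (All.lookup p y∈)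
AllPairs-lookup s (p ∷ ps) (there x∈)  (here refl) = inj₂ (s (All.lookup p x∈))
AllPairs-lookup s (p ∷ ps) (there x∈)  (there y∈)  = AllPairs-lookup s ps x∈ y∈

module _ {V : Space ℓ} where

  ∑-mapMaybe-cong : ∀ (h : A → Maybe B) (is : List A) (f : B → Lin (Gen V)) (g : A → Lin (Gen V)) →
                    (∀ {i j} → h i ≡ just j → i ∈ is → f j ≈[ V ] g i) → (∀ {i} → h i ≡ nothing → i ∈ is → g i ≈[ V ] []) →
                    ∑ (mapMaybe h is) f ≈[ V ] ∑ is g
  ∑-mapMaybe-cong h []       f g e n = ≈-refl
  ∑-mapMaybe-cong h (i ∷ is) f g e n with h i in eq
  ... | just j  = ⊕-cong (e eq (here refl)) (∑-mapMaybe-cong h is f g (λ e′ k → e e′ (there k)) (λ e′ k → n e′ (there k)))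
  ... | nothing = ⊕-cong (≈-sym (n eq (here refl))) (∑-mapMaybe-cong h is f g (λ e′ k → e e′ (there k)) (λ e′ k → n e′ (there k)))

  -- A summand that vanishes on the lists with intersecting arrows can be summed over all lists of
  -- arrows, which removes the proofs stored in dissections.
  ∑-dissections : ∀ {N} (f : Dissection N → Lin (Gen V)) (g : List (Arrow N) → Lin (Gen V)) →
                  (∀ as → Unique as → (p : AllPairs NonIntersecting as) → f (dissection as p) ≈[ V ] g as) →
                  (∀ as → Unique as → ¬ AllPairs NonIntersecting as → g as ≈[ V ] []) →
                  ∑ (dissections N) f ≈[ V ] ∑ (sublists (allArrows N)) g
  ∑-dissections {N} f g e n = ∑-mapMaybe-cong _ (sublists (allArrows N)) f g somewhere nowhere
    where
    unique : ∀ {as} → as ∈ sublists (allArrows N) → Unique as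
    unique = All.lookup (sublists-unique (allArrows-unique N))
    somewhere : ∀ {as} {D : Dissection N} → _ ≡ just D → as ∈ sublists (allArrows N) → f D ≈[ V ] g as
    somewhere {as} eq k with allPairs? nonIntersecting? as
    somewhere {as} refl k | yes p = e as (unique k) p
    nowhere : ∀ {as} → _ ≡ nothing → as ∈ sublists (allArrows N) → g as ≈[ V ] []
    nowhere {as} eq k with allPairs? nonIntersecting? as
    nowhere {as} refl k | no ¬p = n as (unique k) ¬p

  -- Applied to linear orders of regions: only those beginning with the root region survive, so that
  -- the root region can be left out of the permutation.
  ∑-permutations-first : ∀ (x : A) xs (f : List A → Lin (Gen V)) →
                         (∀ y zs → y ∈ xs → x ∈ zs → f (y ∷ zs) ≈[ V ] []) →
                         ∑ (permutations (x ∷ xs)) f ≈[ V ] (∑[ m ∈ permutations xs ] f (x ∷ m))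
  ∑-permutations-first x xs f z = ≈-trans (≡⇒≈ (∑-permutations-∷ x xs f)) (∑-cong-∈ (permutations xs) (λ m m∈ →
    inserted m (λ y∈ → ↭.∈-resp-↭ (↭-sym (All.lookup (permutations-↭ xs) m∈)) y∈)))
    where
    inserted : ∀ m → (∀ {y} → y ∈ m → y ∈ xs) → ∑ (insertions x m) f ≈[ V ] f (x ∷ m)
    inserted []      _ = ≡⇒≈ (⊕-identityʳ (f [ x ]))
    inserted (y ∷ m) k = ≈-trans (≡⇒≈ (∑-insertions-∷ x y m f)) (≈-trans
      (⊕-congˡ {x = f (x ∷ y ∷ m)} (≈-trans (∑-cong-∈ (insertions x m) (λ zs zs∈ →
        z y zs (k (here refl)) (↭.∈-resp-↭ (All.lookup (insertions-↭ x m) zs∈) (here refl)))) (∑-0 (insertions x m) (λ _ → ≈-refl))))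
      (≡⇒≈ (⊕-identityʳ (f (x ∷ y ∷ m)))))

nonIntersecting-sym : ∀ {N} {α β : Arrow N} → NonIntersecting α β → NonIntersecting β α
nonIntersecting-sym (p , q) = q , p

module _ {R : Set ℓ} (π : Polygon R) where

  private
    xs : List R
    xs = sides π

    N : ℕ
    N = size π

  -- A word lists the regions in a linear order `m`, while `sgn` runs through `arrows D`; neither
  -- labels nor products depend on the order. Forward arrows contribute the factor 1 to `signIn`.
  sgn≡ : ∀ (D : Dissection N) {m} → arrows D ↭ m →
         sgn π D ≡ product (map (signIn (map arcOf m) xs) (map arcOf m))
  sgn≡ D {m} p = trans (product-filter backward? f (arrows D)) (trans
    (product-↭ (↭.map⁺ (λ α → if does (backward? α) then f α else 1ℚ) p))
    (cong product (trans (map-cong (λ α → cong₂ (λ o n → if o then [-1]^ pred n else 1ℚ) (sym (odd-arcOf α (backward? α)))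
      (cong length (trans (regionLabels≡ π D (just α)) (labels-↭ (↭.map⁺ arcOf p) (just (arcOf α)) xs)))) m) (map-∘ m))))
    where
    f : Arrow N → ℚ
    f α = [-1]^ χ (regionPolygon π D (just α))

  dissectionWord≡ : ∀ (D : Dissection N) {m} → arrows D ↭ m →
                    dissectionWord (map arcOf m) xs ≡ map sides (map (regionPolygon π D) (nothing ∷ map just m))
  dissectionWord≡ D {m} p = cong₂ _∷_ (sym (label nothing)) (trans (sym (map-∘ m)) (trans
    (map-cong (λ α → sym (label (just α))) m) (trans (map-∘ m) (map-∘ (map just m)))))
    where
    label : ∀ r → regionLabels π D r ≡ labels (map arcOf m) (Data.Maybe.map arcOf r) xs
    label r = trans (regionLabels≡ π D r) (labels-↭ (↭.map⁺ arcOf p) (Data.Maybe.map arcOf r) xs)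

  Linear : List (Region N) → Set
  Linear = AllPairs (λ r s → ¬ (s ≺ r))

  linear? : ∀ ℓ → Dec (Linear ℓ)
  linear? = allPairs? (λ r s → ¬? (s ≺? r))

  Linear⇔ : ∀ {m : List (Arrow N)} → Unique m → AllPairs NonIntersecting m →
            Linear (nothing ∷ map just m) ⇔ AllPairs Before (map arcOf m)
  Linear⇔ {m} u ni = mk⇔
    (λ { (_ ∷ ps) → AllPairs.map⁺ (AllPairs-zip (λ {α} {β} α≢β (h , h′) → Equivalence.to (Before⇔ α β α≢β) (h , h′)) u
                      (AllPairs-zip _,_ ni (AllPairs.map⁻ ps))) })
    (λ ps → All.tabulate (λ {r} _ → ⊀root r) ∷ AllPairs.map⁺ (AllPairs-zip
      (λ {α} {β} α≢β h → proj₂ (Equivalence.from (Before⇔ α β α≢β) h)) u (AllPairs.map⁻ ps)))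

  𝓑 : Lin (List (Polygon R))
  𝓑 = realize (𝔹 xs)

  private
    term : List Arc → Lin (Word {X = Polygon R})
    term ms = toBar (realize (orderedTerm xs ms))

    term≡ : ∀ (D : Dissection N) {m} → arrows D ↭ m →
            term (map arcOf m) ≡ guard (allPairs? before? (map arcOf m))
              (sgn π D • ⟦ map (λ r → letter (regionPolygon π D r)) (nothing ∷ map just m) ⟧)
    term≡ D {m} p = trans (cong toBar (linear-guard realizeWord d u)) (trans (linear-guard (⟦_⟧ ∘ embedWord) d (realize u))
      (cong (guard d) (begin
        toBar (realize (q • ⟦ w ⟧))
          ≡⟨ cong toBar (trans (linear-• realizeWord q ⟦ w ⟧) (cong (q •_) (trans (linear-⟦⟧ realizeWord w)
               (trans (cong realizeWord (dissectionWord≡ D p)) (realizeWord-sides polygons))))) ⟩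
        toBar (q • ⟦ polygons ⟧)
          ≡⟨ trans (linear-• (⟦_⟧ ∘ embedWord) q ⟦ polygons ⟧) (cong (q •_) (linear-⟦⟧ (⟦_⟧ ∘ embedWord) polygons)) ⟩
        q • ⟦ embedWord polygons ⟧
          ≡⟨ cong₂ (λ c v → c • ⟦ v ⟧) (sym (sgn≡ D p)) (sym (map-∘ (nothing ∷ map just m))) ⟩
        sgn π D • ⟦ map (λ r → letter (regionPolygon π D r)) (nothing ∷ map just m) ⟧ ∎)))
      where
      open ≡-Reasoning
      d = allPairs? before? (map arcOf m)
      q = product (map (signIn (map arcOf m) xs) (map arcOf m))
      w = dissectionWord (map arcOf m) xs
      u = q • ⟦ w ⟧
      polygons = map (regionPolygon π D) (nothing ∷ map just m)

    orders : ∀ as → Unique as → (p : AllPairs NonIntersecting as) → let D = dissection as p in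
             sgn π D • (∑[ m ∈ linearOrders D ] ⟦ map (λ r → letter (regionPolygon π D r)) m ⟧) ∼
             (∑[ m ∈ permutations as ] term (map arcOf m))
    orders as u p = begin
      s • ∑ (linearOrders D) (⟦_⟧ ∘ w)
        ≡⟨ cong (s •_) (∑-filter linear? (permutations (nothing ∷ map just as)) (⟦_⟧ ∘ w)) ⟩
      s • (∑[ m ∈ permutations (nothing ∷ map just as) ] guard (linear? m) ⟦ w m ⟧)
        ≈⟨ •-cong s (∑-permutations-first nothing (map just as) (λ m → guard (linear? m) ⟦ w m ⟧) (λ y zs y∈ n∈ →
             ≡⇒≈ (guard-no (linear? (y ∷ zs)) (λ { (q ∷ _) → before-root y y∈ (All.lookup q n∈) })))) ⟩
      s • (∑[ m ∈ permutations (map just as) ] guard (linear? (nothing ∷ m)) ⟦ w (nothing ∷ m) ⟧)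
        ≡⟨ cong (s •_) (∑-permutations-map just as (λ m → guard (linear? (nothing ∷ m)) ⟦ w (nothing ∷ m) ⟧)) ⟩
      s • (∑[ m ∈ permutations as ] guard (linear? (nothing ∷ map just m)) ⟦ w (nothing ∷ map just m) ⟧)
        ≡⟨ trans (∑-• s (permutations as) _) (∑-≗ (λ m → •-guard s (linear? (nothing ∷ map just m)) ⟦ w (nothing ∷ map just m) ⟧) (permutations as)) ⟩
      (∑[ m ∈ permutations as ] guard (linear? (nothing ∷ map just m)) (s • ⟦ w (nothing ∷ map just m) ⟧))
        ≈⟨ ∑-cong-∈ (permutations as) (λ m m∈ → let q = All.lookup (permutations-↭ as) m∈
                                                    e = Linear⇔ (AllPairs-↭ (λ x≢y y≡x → x≢y (sym y≡x)) q u)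
                                                                (AllPairs-↭ (λ {α} {β} → nonIntersecting-sym {N} {α} {β}) q p) in
             guard-cong (linear? (nothing ∷ map just m)) (allPairs? before? (map arcOf m)) (Equivalence.to e) (Equivalence.from e) (λ _ → ≈-refl)) ⟩
      (∑[ m ∈ permutations as ] guard (allPairs? before? (map arcOf m)) (s • ⟦ w (nothing ∷ map just m) ⟧))
        ≈⟨ ∑-cong-∈ (permutations as) (λ m m∈ → ≡⇒≈ (sym (term≡ D (All.lookup (permutations-↭ as) m∈)))) ⟩
      (∑[ m ∈ permutations as ] term (map arcOf m)) ∎
      where
      open ∼-Reasoning (Word {X = Polygon R})
      D : Dissection N
      D = dissection as p
      s : ℚ
      s = sgn π D
      w : List (Region N) → Word {X = Polygon R}
      w = map (λ r → letter (regionPolygon π D r))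
      before-root : ∀ y → y ∈ map just as → ¬ ¬ (nothing ≺ y)
      before-root y y∈ ¬h with ∈-map⁻ just y∈
      ... | α , _ , refl = ¬h (root≺ α)

    noOrders : ∀ as → Unique as → ¬ AllPairs NonIntersecting as → (∑[ m ∈ permutations as ] term (map arcOf m)) ∼ []
    noOrders as u ¬p = ≈-trans (∑-cong-∈ (permutations as) (λ m m∈ → let q = All.lookup (permutations-↭ as) m∈ in
      ≡⇒≈ (cong (toBar ∘ realize) (guard-no (allPairs? before? (map arcOf m)) (λ ps → ¬p (AllPairs-↭
        (λ {α} {β} → nonIntersecting-sym {N} {α} {β}) (↭-sym q)
        (AllPairs-zip (λ {α} {β} α≢β h → proj₁ (Equivalence.from (Before⇔ α β α≢β) h))
          (AllPairs-↭ (λ x≢y y≡x → x≢y (sym y≡x)) q u) (AllPairs.map⁻ ps))))))))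
      (∑-0 (permutations as) (λ _ → ≈-refl))

  𝐁-toBar : 𝐁 π ∼ toBar 𝓑
  𝐁-toBar = begin
    𝐁 π
      ≈⟨ ∑-dissections _ (λ as → ∑[ m ∈ permutations as ] term (map arcOf m)) orders noOrders ⟩
    (∑[ as ∈ sublists (allArrows N) ] ∑[ m ∈ permutations as ] term (map arcOf m))
      ≡⟨ ∑-arrangements-map arcOf (allArrows N) term ⟨
    ∑-arrangements (map arcOf (allArrows N)) term
      ≈⟨ ∑-arrangements-↭ term (arcs-↭ N) ⟩
    ∑-arrangements (arcs N) term
      ≡⟨ trans (cong toBar (linear-∑ realizeWord (sublists (arcs N)) _)) (trans (linear-∑ (⟦_⟧ ∘ embedWord) (sublists (arcs N)) _)
           (∑-≗ (λ as → trans (cong toBar (linear-∑ realizeWord (permutations as) (orderedTerm xs)))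
             (linear-∑ (⟦_⟧ ∘ embedWord) (permutations as) (realize ∘ orderedTerm xs))) (sublists (arcs N)))) ⟨
    toBar 𝓑 ∎
    where open ∼-Reasoning (Word {X = Polygon R})

-- The coproduct formula

ш-cong : {Y : Set ℓ} {p p′ q q′ : Lin (Word {X = Y})} → p ∼ p′ → q ∼ q′ → p ш q ∼ p′ ш q′
ш-cong = bilinear-cong shuffle

∏ш-cong : {Y : Set ℓ} (f g : A → Lin (Word {X = Y})) (is : List A) → (∀ {i} → i ∈ is → f i ∼ g i) →
          ∏ш (map f is) ∼ ∏ш (map g is)
∏ш-cong f g []       e = ≈-refl
∏ш-cong f g (i ∷ is) e = ш-cong (e (here refl)) (∏ш-cong f g is (e ∘ there))

shuffle-[]ʳ : {Y : Set ℓ} (u : Word {X = Y}) → shuffle u [] ≡ ⟦ u ⟧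
shuffle-[]ʳ []      = refl
shuffle-[]ʳ (x ∷ u) = refl

ш-identityʳ : {Y : Set ℓ} (p : Lin (Word {X = Y})) → p ш 𝟏 ≡ p
ш-identityʳ p = trans (linear-≗ (λ u → trans (linear-⟦⟧ (shuffle u) []) (shuffle-[]ʳ u)) p) (linear-id p)

⊗ʷ-cong : {Y : Set ℓ} {p p′ q q′ : Lin (Word {X = Y})} → p ∼ p′ → q ∼ q′ → p ⊗ q ∼ p′ ⊗ q′
⊗ʷ-cong = bilinear-cong (λ v w → ⟦ v , w ⟧)

admissibleTerm-↭ : (xs : List X) → ∀ {as bs} → as ↭ bs → admissibleTerm xs as ∼ admissibleTerm xs bs
admissibleTerm-↭ xs {as} {bs} p = guard-cong (allPairs? disjoint? as) (allPairs? disjoint? bs)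
  (AllPairs-↭ (λ {α} {β} → disjoint-sym {α} {β}) p) (AllPairs-↭ (λ {α} {β} → disjoint-sym {α} {β}) (↭-sym p))
  (λ _ → ≈-trans (≡⇒≈ (cong₂ (λ s u → s • (𝔹 u ⊗ partsFactor xs as)) (product-↭ (↭.map⁺ sign p)) (labels-↭ p nothing xs)))
    (•-cong (signs bs) (⊗-cong (≈-refl {x = rootFactor xs bs}) (∏⧢-↭ (↭.map⁺ (λ α → 𝔹 (co α xs)) p)))))

-- 𝐁 of the polygon with decorations ys, if there are at least two of them.
𝐁ᴸ : {R : Set ℓ} → List R → Lin (Word {X = Polygon R})
𝐁ᴸ ys = toBar (realize (𝔹 ys))

𝐁-𝐁ᴸ : {R : Set ℓ} (π : Polygon R) → 𝐁 π ∼ 𝐁ᴸ (sides π)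
𝐁-𝐁ᴸ = 𝐁-toBar

arcTerm : {R : Set ℓ} → List R → List Arc → Lin (Word {X = Polygon R} × Word {X = Polygon R})
arcTerm xs as = guard (allPairs? disjoint? as)
  (signs as • (𝐁ᴸ (labels as nothing xs) ⊗ ∏ш (map (λ α → 𝐁ᴸ (co α xs)) as)))

toBar-⊗-realize : {R : Set ℓ} (p q : Lin (List (List R))) → toBar² (realize² (p ⊗ q)) ∼ toBar (realize p) ⊗ toBar (realize q)
toBar-⊗-realize p q = ≈-trans (mapGen-cong _ (realize-⊗ p q)) (≡⇒≈ (sym (toBar-⊗ (realize p) (realize q))))

toBar-∏⧢-realize : {R : Set ℓ} (f : A → Lin (List (List R))) (is : List A) →
                   toBar (realize (∏⧢ (map f is))) ∼ ∏ш (map (toBar ∘ realize ∘ f) is)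
toBar-∏⧢-realize f is = ≈-trans (mapGen-cong embedWord (realize-∏⧢ (map f is)))
  (≡⇒≈ (trans (sym (toBar-∏⧢ (map realize (map f is)))) (cong ∏ш (trans (sym (map-∘ (map f is))) (sym (map-∘ is))))))

arcTerm-admissible : {R : Set ℓ} (xs : List R) (as : List Arc) → toBar² (realize² (admissibleTerm xs as)) ∼ arcTerm xs as
arcTerm-admissible xs as = ≈-trans
  (≡⇒≈ (trans (cong toBar² (linear-guard realizePair d (signs as • u)))
    (trans (linear-guard (λ (u , w) → ⟦ embedWord u , embedWord w ⟧) d (realize² (signs as • u)))
      (cong (guard d) (trans (cong toBar² (linear-• realizePair (signs as) u))
        (linear-• (λ (u , w) → ⟦ embedWord u , embedWord w ⟧) (signs as) (realize² u)))))))
  (guard-cong d d id id (λ _ → •-cong (signs as) (≈-trans (toBar-⊗-realize (rootFactor xs as) (partsFactor xs as))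
    (⊗ʷ-cong (≈-refl {x = 𝐁ᴸ (labels as nothing xs)}) (toBar-∏⧢-realize (λ α → 𝔹 (co α xs)) as)))))
  where
  d = allPairs? disjoint? as
  u = rootFactor xs as ⊗ partsFactor xs as

Δ-𝐁ᴸ : {R : Set ℓ} (xs : List R) → Δ (𝐁ᴸ xs) ∼ (𝟏 ⊗ 𝐁ᴸ xs) ⊕ (∑[ as ∈ sublists (arcs (length xs)) ] arcTerm xs as)
Δ-𝐁ᴸ {R = R} xs = begin
  Δ (𝐁ᴸ xs)
    ≡⟨ Δ-toBar (realize (𝔹 xs)) ⟩
  toBar² (deconcatenate (realize (𝔹 xs)))
    ≈⟨ mapGen-cong _ (≈-trans (deconcatenate-realize (𝔹 xs)) (linear-resp-∼ realizePair (deconcatenate-𝔹 (suc (length xs)) xs ≤-refl))) ⟩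
  toBar² (realize² ((⟦ [] ⟧ ⊗ 𝔹 xs) ⊕ 𝕋 xs))
    ≡⟨ trans (cong toBar² (linear-⊕ realizePair (⟦ [] ⟧ ⊗ 𝔹 xs) (𝕋 xs))) (linear-⊕ e (realize² (⟦ [] ⟧ ⊗ 𝔹 xs)) (realize² (𝕋 xs))) ⟩
  toBar² (realize² (⟦ [] ⟧ ⊗ 𝔹 xs)) ⊕ toBar² (realize² (𝕋 xs))
    ≈⟨ ⊕-cong (toBar-⊗-realize ⟦ [] ⟧ (𝔹 xs)) (≈-trans
         (≡⇒≈ (trans (cong toBar² (linear-∑ realizePair (sublists L) (admissibleTerm xs))) (linear-∑ e (sublists L) (realize² ∘ admissibleTerm xs))))
         (∑-cong (sublists L) (arcTerm-admissible xs))) ⟩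
  (𝟏 ⊗ 𝐁ᴸ xs) ⊕ (∑[ as ∈ sublists L ] arcTerm xs as) ∎
  where
  open ∼-Reasoning (Word {X = Polygon R} × Word {X = Polygon R})
  L = arcs (length xs)
  e : List (Polygon R) × List (Polygon R) → Lin (Word {X = Polygon R} × Word {X = Polygon R})
  e (u , w) = ⟦ embedWord u , embedWord w ⟧

module _ {R : Set ℓ} (π : Polygon R) where

  private
    xs : List R
    xs = sides π

    N : ℕ
    N = size π

    W : Set ℓ
    W = Word {X = Polygon R}

  -- All arrows lie beyond the root region, so the regions are its children iff no arrow lies beyond
  -- another. For distinct arrows that do not intersect, this leaves only disjointness.
  admissible⇔ : ∀ as → Unique as → (p : AllPairs NonIntersecting as) →
                Admissible (dissection {N} as p) ⇔ AllPairs Disjoint (map arcOf as)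
  admissible⇔ as u p = mk⇔
    (λ adm → AllPairs.map⁺ (AllPairs-zip (λ {α} {β} α≢β (ni , h) → Equivalence.to (Disjoint⇔ α β α≢β) (ni , h)) u
      (AllPairs-zip _,_ p (AllPairs-∈ (λ {α} {β} α∈ β∈ → minimal adm α∈ β∈ , minimal adm β∈ α∈)))))
    (λ ds → All.tabulate (λ {α} α∈ → root≺ α , λ
      { (here (h , _)) → ⊀root {N} nothing h
      ; (there q) → let (β , β∈ , _ , h) = find (Any.map⁻ q) in
          [ (λ e → proj₂ h (cong (lo ∘ just) e , cong (hi ∘ just) (sym e))) ,
            (λ d → Disjoint⇒⊅ {arcOf β} {arcOf α} d (Equivalence.to (≺⇔⊃ β α) h)) ]′
            (AllPairs-lookup {S = λ α β → Disjoint (arcOf α) (arcOf β)} (λ {α} {β} → disjoint-sym {arcOf α} {arcOf β}) (AllPairs.map⁻ ds) β∈ α∈) }))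
    where
    minimal : Admissible (dissection {N} as p) → ∀ {α β} → α ∈ as → β ∈ as → ¬ (just α ≺ just β)
    minimal adm {α} {β} α∈ β∈ h = proj₂ (All.lookup adm β∈) (there (Any.map⁺ (lose α∈ (root≺ α , h))))

  -- For an arbitrary function b, so that the type checker does not unfold 𝐁.
  module _ (b : Polygon R → Lin W) (bᴸ : List R → Lin W) (b∼bᴸ : ∀ π → b π ∼ bᴸ (sides π)) where

    termOf : Dissection N → Lin (W × W)
    termOf D = sgn π D • (b (regionPolygon π D nothing) ⊗ ∏ш (map b (remainingPolygons π (just D))))

    arcTermOf : List Arc → Lin (W × W)
    arcTermOf as = signs as • (bᴸ (labels as nothing (sides π)) ⊗ ∏ш (map (λ α → bᴸ (co α (sides π))) as))

    module _ (D : Dissection N) (ds : AllPairs Disjoint (map arcOf (arrows D))) where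

      private
        outermost : ∀ α → α ∈ arrows D → labels (map arcOf (arrows D)) (just (arcOf α)) (sides π) ≡ co (arcOf α) (sides π)
        outermost α α∈ = labels-outermost (map arcOf (arrows D)) (arcOf α) (sides π) (All.tabulate (λ {γ} γ∈ →
          [ (λ e → subst (λ δ → ¬ (arcOf α ⊃ δ)) e (⊃-irrefl (arcOf α))) , (λ d → Disjoint⇒⊅ {arcOf α} {γ} d) ]′
            (AllPairs-lookup {S = Disjoint} (λ {α} {β} → disjoint-sym {α} {β}) ds (∈-map⁺ arcOf α∈) γ∈)))

        pieceLabels : ∀ α → α ∈ arrows D → regionLabels π D (just α) ≡ co (arcOf α) (sides π)
        pieceLabels α α∈ = trans (regionLabels-arrow π D α) (outermost α α∈)

        signIn≡ : ∀ α → α ∈ arrows D → signIn (map arcOf (arrows D)) (sides π) (arcOf α) ≡ sign (arcOf α)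
        signIn≡ α α∈ = cong (λ n → if odd (proj₁ (arcOf α)) then [-1]^ pred n else 1ℚ)
          (trans (cong length (outermost α α∈)) (length-co (arcOf α) (sides π) (arcOf-valid α)))

        coefficient : sgn π D ≡ signs (map arcOf (arrows D))
        coefficient = trans (sgn≡ π D ↭refl) (cong product (trans (sym (map-∘ (arrows D))) (trans
          (map-cong-All {P = _∈ arrows D} {f = signIn (map arcOf (arrows D)) (sides π) ∘ arcOf} {g = sign ∘ arcOf}
            (λ {α} → signIn≡ α) (All.tabulate id)) (map-∘ (arrows D)))))

        region∼ : ∀ r {ys} → regionLabels π D r ≡ ys → b (regionPolygon π D r) ∼ bᴸ ys
        region∼ r refl = b∼bᴸ (regionPolygon π D r)

        pieces∼ : ∏ш (map b (remainingPolygons π (just D))) ∼ ∏ш (map (λ α → bᴸ (co α (sides π))) (map arcOf (arrows D)))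
        pieces∼ = subst₂ (λ u v → ∏ш u ∼ ∏ш v)
          (map-∘ {g = b} {f = λ α → regionPolygon π D (just α)} (arrows D))
          (map-∘ {g = λ α → bᴸ (co α (sides π))} {f = arcOf} (arrows D))
          (∏ш-cong (λ α → b (regionPolygon π D (just α))) (λ α → bᴸ (co (arcOf α) (sides π))) (arrows D)
            (λ {α} α∈ → region∼ (just α) (pieceLabels α α∈)))

      termOf∼ : termOf D ∼ arcTermOf (map arcOf (arrows D))
      termOf∼ = ≈-trans (≡⇒≈ (cong (_• (b (regionPolygon π D nothing) ⊗ ∏ш (map b (remainingPolygons π (just D))))) coefficient))
        (•-cong (signs (map arcOf (arrows D))) (⊗ʷ-cong (region∼ nothing (regionLabels-root π D)) pieces∼))

    dissections-sum : (∑[ D ∈ dissections N ] guard (admissible? D) (termOf D)) ∼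
                      (∑[ as ∈ sublists (allArrows N) ] guard (allPairs? disjoint? (map arcOf as)) (arcTermOf (map arcOf as)))
    dissections-sum = ∑-dissections (λ D → guard (admissible? D) (termOf D))
      (λ as → guard (allPairs? disjoint? (map arcOf as)) (arcTermOf (map arcOf as)))
      (λ as u p → let e = admissible⇔ as u p in guard-cong (admissible? (dissection as p)) (allPairs? disjoint? (map arcOf as))
        (Equivalence.to e) (Equivalence.from e) (λ adm → termOf∼ (dissection as p) (Equivalence.to e adm)))
      (λ as u ¬p → ≡⇒≈ (guard-no (allPairs? disjoint? (map arcOf as)) (λ ds → ¬p (AllPairs-zip
        (λ {α} {β} α≢β d → proj₁ (Equivalence.from (Disjoint⇔ α β α≢β) d)) u (AllPairs.map⁻ ds)))))

  admissibleTerms-sum : (∑[ D ∈ admissibleTerms π ] sgnᵃ π D • (𝐁∅ (rootPolygon π D) ⊗ ∏ш (map 𝐁 (remainingPolygons π D)))) ∼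
                        (𝟏 ⊗ 𝐁ᴸ xs) ⊕ (∑[ as ∈ sublists (arcs N) ] arcTerm xs as)
  admissibleTerms-sum = ⊕-cong
    (≈-trans (≡⇒≈ (trans (1• (𝟏 ⊗ ∏ш [ 𝐁 π ])) (cong (𝟏 ⊗_) (ш-identityʳ (𝐁 π))))) (⊗ʷ-cong (≈-refl {x = 𝟏}) (𝐁-𝐁ᴸ π)))
    (begin
      ∑ (map just (filter admissible? (dissections N))) summand
        ≡⟨ trans (∑-map just (filter admissible? (dissections N)) summand) (∑-filter admissible? (dissections N) (summand ∘ just)) ⟩
      (∑[ D ∈ dissections N ] guard (admissible? D) (summand (just D)))
        ≈⟨ dissections-sum 𝐁 𝐁ᴸ 𝐁-𝐁ᴸ ⟩
      (∑[ as ∈ sublists (allArrows N) ] arcTerm xs (map arcOf as))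
        ≡⟨ ∑-sublists-map arcOf (allArrows N) (arcTerm xs) ⟨
      (∑[ as ∈ sublists (map arcOf (allArrows N)) ] arcTerm xs as)
        ≈⟨ ∑-sublists-↭ (arcTerm xs) invariant (arcs-↭ N) ⟩
      (∑[ as ∈ sublists (arcs N) ] arcTerm xs as) ∎)
    where
    open ∼-Reasoning (W × W)
    summand : AdmissibleTerm π → Lin (W × W)
    summand D = sgnᵃ π D • (𝐁∅ (rootPolygon π D) ⊗ ∏ш (map 𝐁 (remainingPolygons π D)))
    invariant : ∀ {as bs} → as ↭ bs → arcTerm xs as ∼ arcTerm xs bs
    invariant {as} {bs} p = ≈-trans (≈-sym (arcTerm-admissible xs as)) (≈-trans
      (mapGen-cong _ (linear-resp-∼ realizePair (admissibleTerm-↭ xs p))) (arcTerm-admissible xs bs))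

  Δ-𝐁 : Δ (𝐁 π) ∼ (∑[ D ∈ admissibleTerms π ] sgnᵃ π D • (𝐁∅ (rootPolygon π D) ⊗ ∏ш (map 𝐁 (remainingPolygons π D))))
  Δ-𝐁 = ≈-trans (linear-resp-∼ (λ w → ∑[ j ∈ upTo (suc (length w)) ] ⟦ splitAt j w ⟧) (𝐁-𝐁ᴸ π)) (≈-trans (Δ-𝐁ᴸ xs) (≈-sym admissibleTerms-sum))

-- The Hopf algebra of words in letters of degree zero

cancel : (p : Lin G) → p ⊕ ((-ℚ 1ℚ) • p) ∼ []
cancel p = ≈-trans (⊕-congʳ {y = (-ℚ 1ℚ) • p} (≡⇒≈ (sym (1• p)))) (≈-trans (≈-sym (+-• 1ℚ (-ℚ 1ℚ) p)) (0• p))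

module _ {X : Set ℓ} where

  private
    W : Set ℓ
    W = List X

    fst : X → Lin (W × W) → Lin (W × W)
    fst x = mapGen (map₁ (x ∷_))

  -- `antipodeWord` for letters of degree zero: the reversal of a word times (-1) to its length.
  antipodeList : W → Lin W
  antipodeList []      = ⟦ [] ⟧
  antipodeList (x ∷ u) = (-ℚ 1ℚ) • (antipodeList u ▷ x)

  antipodeᴸ : Lin W → Lin W
  antipodeᴸ = linear antipodeList

  private
    antipode-cons : ∀ x p → antipodeᴸ (cons x p) ≡ (-ℚ 1ℚ) • (antipodeᴸ p ▷ x)
    antipode-cons x p = trans (linear-mapGen antipodeList (x ∷_) p)
      (trans (linear-•ʳ (-ℚ 1ℚ) (λ u → antipodeList u ▷ x) p)
        (cong ((-ℚ 1ℚ) •_) (sym (mapGen-linear (_∷ʳ x) antipodeList p))))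

  -- Reversal turns the recursion of `shuf` on first letters into that of `⧢-last` on last letters,
  -- and the signs agree because lengths add up.
  antipode-shuf : ∀ u w → antipodeᴸ (shuf u w) ∼ antipodeList u ⧢ antipodeList w
  antipode-shuf []      w       = ≡⇒≈ (trans (linear-⟦⟧ antipodeList w) (sym (⧢-identityˡ (antipodeList w))))
  antipode-shuf (x ∷ u) []      = ≡⇒≈ (trans (linear-⟦⟧ antipodeList (x ∷ u)) (sym (⧢-identityʳ (antipodeList (x ∷ u)))))
  antipode-shuf (x ∷ u) (y ∷ w) = begin
    antipodeᴸ (cons x (shuf u (y ∷ w)) ⊕ cons y (shuf (x ∷ u) w))
      ≡⟨ trans (linear-⊕ antipodeList (cons x (shuf u (y ∷ w))) (cons y (shuf (x ∷ u) w)))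
           (cong₂ _⊕_ (antipode-cons x (shuf u (y ∷ w))) (antipode-cons y (shuf (x ∷ u) w))) ⟩
    (m • (antipodeᴸ (shuf u (y ∷ w)) ▷ x)) ⊕ (m • (antipodeᴸ (shuf (x ∷ u) w) ▷ y))
      ≈⟨ ⊕-cong (•-cong m (mapGen-cong (_∷ʳ x) (antipode-shuf u (y ∷ w)))) (•-cong m (mapGen-cong (_∷ʳ y) (antipode-shuf (x ∷ u) w))) ⟩
    (m • ((p ⧢ (m • (q ▷ y))) ▷ x)) ⊕ (m • (((m • (p ▷ x)) ⧢ q) ▷ y))
      ≡⟨ cong₂ _⊕_ (pull (p ⧢ (m • (q ▷ y))) (p ⧢ (q ▷ y)) x (bilinear-•ʳ shuf m p (q ▷ y)))
           (pull ((m • (p ▷ x)) ⧢ q) ((p ▷ x) ⧢ q) y (bilinear-•ˡ shuf m (p ▷ x) q)) ⟩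
    ((p ⧢ (q ▷ y)) ▷ x) ⊕ (((p ▷ x) ⧢ q) ▷ y)
      ≈⟨ ⧢-last p x q y ⟨
    (p ▷ x) ⧢ (q ▷ y)
      ≡⟨ trans (bilinear-•ˡ shuf m (p ▷ x) (m • (q ▷ y))) (trans (cong (m •_) (bilinear-•ʳ shuf m (p ▷ x) (q ▷ y)))
           (trans (•-• m m ((p ▷ x) ⧢ (q ▷ y))) (1• ((p ▷ x) ⧢ (q ▷ y))))) ⟨
    antipodeList (x ∷ u) ⧢ antipodeList (y ∷ w) ∎
    where
    open ∼-Reasoning W
    m = -ℚ 1ℚ
    p = antipodeList u
    q = antipodeList w
    pull : ∀ r s z → r ≡ m • s → m • (r ▷ z) ≡ s ▷ z
    pull r s z e = trans (cong (λ v → m • (v ▷ z)) e) (trans (cong (m •_) (linear-• (λ w → ⟦ w ∷ʳ z ⟧) m s))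
      (trans (•-• m m (s ▷ z)) (1• (s ▷ z))))

  antipode-⧢ : ∀ p q → antipodeᴸ (p ⧢ q) ∼ antipodeᴸ p ⧢ antipodeᴸ q
  antipode-⧢ p q = ≈-trans (≡⇒≈ (linear-bilinear antipodeList shuf p q)) (≈-trans (bilinear-cong-≗ antipode-shuf p q)
    (≈-sym (bilinear-linear shuf antipodeList antipodeList p q)))

  private
    -- reversed r u is (-1)^|u| times the reversal of u followed by r, and convolution [] is S ⋆ id.
    reversed : W → W → Lin W
    reversed r []      = ⟦ r ⟧
    reversed r (x ∷ u) = (-ℚ 1ℚ) • reversed (x ∷ r) u

    reversed≡ : ∀ r u → reversed r u ≡ mapGen (_++ r) (antipodeList u)
    reversed≡ r []      = refl
    reversed≡ r (x ∷ u) = trans (cong ((-ℚ 1ℚ) •_) (trans (reversed≡ (x ∷ r) u) (trans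
        (linear-≗ (λ w → cong ⟦_⟧ (sym (++-assoc w [ x ] r))) (antipodeList u))
        (sym (mapGen-mapGen (_++ r) (_∷ʳ x) (antipodeList u))))))
      (sym (linear-• (λ w → ⟦ w ++ r ⟧) (-ℚ 1ℚ) (antipodeList u ▷ x)))

    convolution : W → W → Lin W
    convolution r s = linear (λ (u , v) → reversed r u ⧢ ⟦ v ⟧) (δ s)

    convolution-∷ : ∀ r y s → convolution r (y ∷ s) ≡ shuf r (y ∷ s) ⊕ ((-ℚ 1ℚ) • convolution (y ∷ r) s)
    convolution-∷ r y s = trans (cong (linear f) (δ-∷ y s)) (trans (linear-⊕ f ⟦ [] , y ∷ s ⟧ (fst y (δ s))) (cong₂ _⊕_
      (trans (linear-⟦⟧ f ([] , y ∷ s)) (trans (linear-⟦⟧ (λ u → linear (shuf u) ⟦ y ∷ s ⟧) r) (linear-⟦⟧ (shuf r) (y ∷ s))))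
      (trans (linear-mapGen f (map₁ (y ∷_)) (δ s)) (trans
        (linear-≗ (λ (u , v) → bilinear-•ˡ shuf (-ℚ 1ℚ) (reversed (y ∷ r) u) ⟦ v ⟧) (δ s))
        (linear-•ʳ (-ℚ 1ℚ) (λ (u , v) → reversed (y ∷ r) u ⧢ ⟦ v ⟧) (δ s))))))
      where
      f : W × W → Lin W
      f (u , v) = reversed r u ⧢ ⟦ v ⟧

  private
    -- Of the two halves of `shuf (z ∷ r) (y ∷ s)`, the one beginning with `y` cancels against the
    -- next summand, known by induction; the half beginning with `z` remains.
    convolution-telescopes : ∀ z r s → convolution (z ∷ r) s ∼ cons z (shuf r s)
    convolution-telescopes z r []      = ≡⇒≈ (trans (linear-⟦⟧ (λ (u , v) → reversed (z ∷ r) u ⧢ ⟦ v ⟧) ([] , []))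
      (trans (⧢-identityʳ ⟦ z ∷ r ⟧) (cong (cons z) (sym (shuf-[]ʳ r)))))
    convolution-telescopes z r (y ∷ s) = begin
      convolution (z ∷ r) (y ∷ s)
        ≡⟨ convolution-∷ (z ∷ r) y s ⟩
      (cons z (shuf r (y ∷ s)) ⊕ cons y (shuf (z ∷ r) s)) ⊕ ((-ℚ 1ℚ) • convolution (y ∷ z ∷ r) s)
        ≈⟨ ⊕-congˡ {x = cons z (shuf r (y ∷ s)) ⊕ cons y (shuf (z ∷ r) s)} (•-cong (-ℚ 1ℚ) (convolution-telescopes y (z ∷ r) s)) ⟩
      (cons z (shuf r (y ∷ s)) ⊕ cons y (shuf (z ∷ r) s)) ⊕ ((-ℚ 1ℚ) • cons y (shuf (z ∷ r) s))
        ≡⟨ ++-assoc (cons z (shuf r (y ∷ s))) (cons y (shuf (z ∷ r) s)) _ ⟩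
      cons z (shuf r (y ∷ s)) ⊕ (cons y (shuf (z ∷ r) s) ⊕ ((-ℚ 1ℚ) • cons y (shuf (z ∷ r) s)))
        ≈⟨ ⊕-congˡ {x = cons z (shuf r (y ∷ s))} (cancel (cons y (shuf (z ∷ r) s))) ⟩
      cons z (shuf r (y ∷ s)) ⊕ []
        ≡⟨ ⊕-identityʳ _ ⟩
      cons z (shuf r (y ∷ s)) ∎
      where open ∼-Reasoning W

  convolve : Lin (W × W) → Lin W
  convolve = linear (λ (u , v) → antipodeList u ⧢ ⟦ v ⟧)

  convolve-⊗ : ∀ p q → convolve (p ⊗ q) ∼ antipodeᴸ p ⧢ q
  convolve-⊗ p q = ≈-trans (≡⇒≈ (trans (linear-bilinear (λ (u , v) → antipodeList u ⧢ ⟦ v ⟧) (λ v w → ⟦ v , w ⟧) p q)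
      (linear-≗ (λ u → linear-≗ (λ w → linear-⟦⟧ (λ (u , v) → antipodeList u ⧢ ⟦ v ⟧) (u , w)) q) p)))
    (≈-trans (linear-cong (λ u → ≈-trans (≈-sym (bilinear-linearʳ shuf ⟦_⟧ (antipodeList u) q))
        (≡⇒≈ (cong (antipodeList u ⧢_) (linear-id q)))) p)
      (≡⇒≈ (sym (linear-linear (λ u → linear (shuf u) q) antipodeList p))))

  counit : Lin W → Lin W
  counit = linear (λ w → atNil w ⟦ [] ⟧)

  convolve-deconcatenate : ∀ p → convolve (deconcatenate p) ∼ counit p
  convolve-deconcatenate p = ≈-trans (≡⇒≈ (linear-linear (λ (u , v) → antipodeList u ⧢ ⟦ v ⟧) δ p)) (linear-cong word p)
    where
    unreversed : ∀ s → convolve (δ s) ≡ convolution [] s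
    unreversed s = linear-≗ (λ (u , v) → cong (_⧢ ⟦ v ⟧) (sym (trans (reversed≡ [] u)
      (trans (linear-≗ (λ w → cong ⟦_⟧ (++-identityʳ w)) (antipodeList u)) (linear-id (antipodeList u)))))) (δ s)
    word : ∀ s → convolve (δ s) ∼ atNil s ⟦ [] ⟧
    word []      = ≈-refl
    word (y ∷ s) = ≈-trans (≡⇒≈ (trans (unreversed (y ∷ s)) (convolution-∷ [] y s)))
      (≈-trans (⊕-congˡ {x = ⟦ y ∷ s ⟧} (•-cong (-ℚ 1ℚ) (convolution-telescopes y [] s))) (cancel ⟦ y ∷ s ⟧))

  -- Compatibility of deconcatenation with the shuffle product

  mul : W × W → W × W → Lin (W × W)
  mul (a , b) (c , d) = shuf a c ⊗ shuf b d

  infixl 7 _⊙_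
  _⊙_ : Lin (W × W) → Lin (W × W) → Lin (W × W)
  _⊙_ = bilinear mul

  private
    fst-⊗ : ∀ x (p q : Lin W) → cons x p ⊗ q ≡ fst x (p ⊗ q)
    fst-⊗ x p q = trans (linear-mapGen (λ u → linear (λ w → ⟦ u , w ⟧) q) (x ∷_) p)
      (trans (linear-≗ (λ u → sym (mapGen-mapGen (map₁ (x ∷_)) (u ,_) q)) p)
        (sym (mapGen-linear (map₁ (x ∷_)) (λ u → linear (λ w → ⟦ u , w ⟧) q) p)))

    fst-⊙ : ∀ x P y Q → fst x P ⊙ fst y Q ∼ fst x (P ⊙ fst y Q) ⊕ fst y (fst x P ⊙ Q)
    fst-⊙ x P y Q = begin
      fst x P ⊙ fst y Q
        ≡⟨ trans (bilinear-mapGen mul (map₁ (x ∷_)) (map₁ (y ∷_)) P Q) (linear-≗ (λ (a , b) → linear-≗ (λ (c , d) →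
             trans (bilinear-⊕ˡ (λ v w → ⟦ v , w ⟧) (cons x (shuf a (y ∷ c))) (cons y (shuf (x ∷ a) c)) (shuf b d))
               (cong₂ _⊕_ (fst-⊗ x (shuf a (y ∷ c)) (shuf b d)) (fst-⊗ y (shuf (x ∷ a) c) (shuf b d)))) Q) P) ⟩
      bilinear (λ s t → fst x (mul s (map₁ (y ∷_) t)) ⊕ fst y (mul (map₁ (x ∷_) s) t)) P Q
        ≈⟨ ≈-trans (linear-cong (λ s → linear-⊕ʳ (λ t → fst x (mul s (map₁ (y ∷_) t))) (λ t → fst y (mul (map₁ (x ∷_) s) t)) Q) P)
             (linear-⊕ʳ (λ s → linear (λ t → fst x (mul s (map₁ (y ∷_) t))) Q) (λ s → linear (λ t → fst y (mul (map₁ (x ∷_) s) t)) Q) P) ⟩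
      bilinear (λ s t → fst x (mul s (map₁ (y ∷_) t))) P Q ⊕ bilinear (λ s t → fst y (mul (map₁ (x ∷_) s) t)) P Q
        ≡⟨ cong₂ _⊕_
             (trans (sym (linear-bilinear (⟦_⟧ ∘ map₁ (x ∷_)) (λ s t → mul s (map₁ (y ∷_) t)) P Q))
               (cong (fst x) (linear-≗ (λ s → sym (linear-mapGen (mul s) (map₁ (y ∷_)) Q)) P)))
             (trans (sym (linear-bilinear (⟦_⟧ ∘ map₁ (y ∷_)) (λ s t → mul (map₁ (x ∷_) s) t) P Q))
               (cong (fst y) (sym (linear-mapGen (λ s → linear (mul s) Q) (map₁ (x ∷_)) P)))) ⟩
      fst x (P ⊙ fst y Q) ⊕ fst y (fst x P ⊙ Q) ∎
      where open ∼-Reasoning (W × W)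

    unitˡ-⊙ : ∀ a y Q → ⟦ [] , a ⟧ ⊙ fst y Q ≡ fst y (⟦ [] , a ⟧ ⊙ Q)
    unitˡ-⊙ a y Q = trans (linear-⟦⟧ (λ s → linear (mul s) (fst y Q)) ([] , a)) (trans (linear-mapGen (mul ([] , a)) (map₁ (y ∷_)) Q)
      (trans (linear-≗ (λ (c , d) → fst-⊗ y ⟦ c ⟧ (shuf a d)) Q) (trans (sym (mapGen-linear (map₁ (y ∷_)) (mul ([] , a)) Q))
        (cong (fst y) (sym (linear-⟦⟧ (λ s → linear (mul s) Q) ([] , a)))))))

    unitʳ-⊙ : ∀ x P b → fst x P ⊙ ⟦ [] , b ⟧ ≡ fst x (P ⊙ ⟦ [] , b ⟧)
    unitʳ-⊙ x P b = trans (linear-mapGen (λ s → linear (mul s) ⟦ [] , b ⟧) (map₁ (x ∷_)) P)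
      (trans (linear-≗ (λ (a , d) → trans (linear-⟦⟧ (mul (x ∷ a , d)) ([] , b)) (trans (fst-⊗ x ⟦ a ⟧ (shuf d b))
          (cong (fst x) (sym (trans (linear-⟦⟧ (mul (a , d)) ([] , b)) (cong (_⊗ shuf d b) (shuf-[]ʳ a))))))) P)
        (sym (mapGen-linear (map₁ (x ∷_)) (λ s → linear (mul s) ⟦ [] , b ⟧) P)))

  -- A cut of a shuffle either leaves nothing on the left or has a first letter there, taken from
  -- `u` or from `w`. Expanding both factors on the right by `δ-∷` gives four products; `fst-⊙` and
  -- the two unit laws sort them by this first letter.
  δ-shuf : ∀ u w → deconcatenate (shuf u w) ∼ δ u ⊙ δ w
  δ-shuf [] w = ≡⇒≈ (trans (linear-⟦⟧ δ w) (sym (trans (linear-⟦⟧ (λ s → linear (mul s) (δ w)) ([] , [])) (linear-id (δ w)))))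
  δ-shuf (x ∷ u) [] = ≡⇒≈ (trans (linear-⟦⟧ δ (x ∷ u)) (sym (trans (linear-≗ (λ (a , b) →
    trans (linear-⟦⟧ (mul (a , b)) ([] , [])) (cong₂ _⊗_ (shuf-[]ʳ a) (shuf-[]ʳ b))) (δ (x ∷ u))) (linear-id (δ (x ∷ u))))))
  δ-shuf (x ∷ u) (y ∷ w) = begin
    deconcatenate (cons x p ⊕ cons y q)
      ≡⟨ linear-⊕ δ (cons x p) (cons y q) ⟩
    deconcatenate (cons x p) ⊕ deconcatenate (cons y q)
      ≈⟨ ⊕-cong (≈-trans (deconcatenate-cons x p) (⊕-congˡ {x = ⟦ [] ⟧ ⊗ cons x p} (mapGen-cong (map₁ (x ∷_)) (δ-shuf u (y ∷ w)))))
                (≈-trans (deconcatenate-cons y q) (⊕-congˡ {x = ⟦ [] ⟧ ⊗ cons y q} (mapGen-cong (map₁ (y ∷_)) (δ-shuf (x ∷ u) w)))) ⟩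
    ((⟦ [] ⟧ ⊗ cons x p) ⊕ fst x (U ⊙ δ (y ∷ w))) ⊕ ((⟦ [] ⟧ ⊗ cons y q) ⊕ fst y (δ (x ∷ u) ⊙ V))
      ≈⟨ ⊕-interchange (⟦ [] ⟧ ⊗ cons x p) (fst x (U ⊙ δ (y ∷ w))) (⟦ [] ⟧ ⊗ cons y q) _ ⟩
    ((⟦ [] ⟧ ⊗ cons x p) ⊕ (⟦ [] ⟧ ⊗ cons y q)) ⊕ (fst x (U ⊙ δ (y ∷ w)) ⊕ fst y (δ (x ∷ u) ⊙ V))
      ≈⟨ ⊕-cong (≈-trans (≈-sym (bilinear-⊕ʳ (λ v w → ⟦ v , w ⟧) ⟦ [] ⟧ (cons x p) (cons y q)))
             (≡⇒≈ (sym (trans (linear-⟦⟧ (λ s → linear (mul s) EB) ([] , x ∷ u)) (linear-⟦⟧ (mul ([] , x ∷ u)) ([] , y ∷ w))))))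
           (⊕-cong (≈-trans (≡⇒≈ (cong (λ v → fst x (U ⊙ v)) (δ-∷ y w))) (≈-trans (mapGen-cong (map₁ (x ∷_)) (bilinear-⊕ʳ mul U EB (fst y V)))
                      (≡⇒≈ (linear-⊕ (⟦_⟧ ∘ map₁ (x ∷_)) (U ⊙ EB) (U ⊙ fst y V)))))
                   (≡⇒≈ (trans (cong (λ v → fst y (v ⊙ V)) (δ-∷ x u)) (trans (cong (fst y) (bilinear-⊕ˡ mul EA (fst x U) V))
                      (linear-⊕ (⟦_⟧ ∘ map₁ (y ∷_)) (EA ⊙ V) (fst x U ⊙ V)))))) ⟩
    (EA ⊙ EB) ⊕ ((fst x (U ⊙ EB) ⊕ fst x (U ⊙ fst y V)) ⊕ (fst y (EA ⊙ V) ⊕ fst y (fst x U ⊙ V)))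
      ≈⟨ ⊕-congˡ {x = EA ⊙ EB} (≈-trans (⊕-comm (fst x (U ⊙ EB) ⊕ fst x (U ⊙ fst y V)) _)
           (⊕-interchange′ (fst y (EA ⊙ V)) (fst y (fst x U ⊙ V)) (fst x (U ⊙ EB)) (fst x (U ⊙ fst y V)))) ⟩
    (EA ⊙ EB) ⊕ (fst y (EA ⊙ V) ⊕ (fst x (U ⊙ EB) ⊕ (fst x (U ⊙ fst y V) ⊕ fst y (fst x U ⊙ V))))
      ≈⟨ ⊕-congˡ {x = EA ⊙ EB} (⊕-cong (≡⇒≈ (sym (unitˡ-⊙ (x ∷ u) y V))) (⊕-cong (≡⇒≈ (sym (unitʳ-⊙ x U (y ∷ w)))) (≈-sym (fst-⊙ x U y V)))) ⟩
    (EA ⊙ EB) ⊕ ((EA ⊙ fst y V) ⊕ ((fst x U ⊙ EB) ⊕ (fst x U ⊙ fst y V)))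
      ≡⟨ ++-assoc (EA ⊙ EB) (EA ⊙ fst y V) _ ⟨
    ((EA ⊙ EB) ⊕ (EA ⊙ fst y V)) ⊕ ((fst x U ⊙ EB) ⊕ (fst x U ⊙ fst y V))
      ≈⟨ ⊕-cong (bilinear-⊕ʳ mul EA EB (fst y V)) (bilinear-⊕ʳ mul (fst x U) EB (fst y V)) ⟨
    (EA ⊙ (EB ⊕ fst y V)) ⊕ (fst x U ⊙ (EB ⊕ fst y V))
      ≡⟨ trans (cong₂ _⊙_ (δ-∷ x u) (δ-∷ y w)) (bilinear-⊕ˡ mul EA (fst x U) (EB ⊕ fst y V)) ⟨
    δ (x ∷ u) ⊙ δ (y ∷ w) ∎
    where
    open ∼-Reasoning (W × W)
    p = shuf u (y ∷ w)
    q = shuf (x ∷ u) w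
    U V EA EB : Lin (W × W)
    U = δ u
    V = δ w
    EA = ⟦ [] , x ∷ u ⟧
    EB = ⟦ [] , y ∷ w ⟧
    ⊕-interchange′ : ∀ (a b c d : Lin (W × W)) → (a ⊕ b) ⊕ (c ⊕ d) ∼ a ⊕ (c ⊕ (d ⊕ b))
    ⊕-interchange′ a b c d = ≈-trans (≡⇒≈ (++-assoc a b (c ⊕ d))) (⊕-congˡ {x = a}
      (≈-trans (⊕-swapˡ b c d) (⊕-congˡ {x = c} (⊕-comm b d))))

  deconcatenate-⧢ : ∀ p q → deconcatenate (p ⧢ q) ∼ deconcatenate p ⊙ deconcatenate q
  deconcatenate-⧢ p q = ≈-trans (≡⇒≈ (linear-bilinear δ shuf p q)) (≈-trans (bilinear-cong-≗ δ-shuf p q)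
    (≈-sym (bilinear-linear mul δ δ p q)))

  ⊗-⊙-⊗ : ∀ p q p′ q′ → (p ⊗ q) ⊙ (p′ ⊗ q′) ∼ (p ⧢ p′) ⊗ (q ⧢ q′)
  ⊗-⊙-⊗ p q p′ q′ = begin
    (p ⊗ q) ⊙ (p′ ⊗ q′)
      ≈⟨ bilinear-linear mul (λ a → mapGen (a ,_) q) (λ c → mapGen (c ,_) q′) p p′ ⟩
    bilinear (λ a c → mapGen (a ,_) q ⊙ mapGen (c ,_) q′) p p′
      ≈⟨ bilinear-cong-≗ (λ a c → ≈-trans (≡⇒≈ (bilinear-mapGen mul (a ,_) (c ,_) q q′))
           (≈-sym (≈-trans (bilinear-linearʳ tensor (λ b → linear (shuf b) q′) (shuf a c) q)
             (linear-cong (λ b → bilinear-linearʳ tensor (shuf b) (shuf a c) q′) q)))) p p′ ⟩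
    bilinear (λ a c → shuf a c ⊗ (q ⧢ q′)) p p′
      ≡⟨ trans (linear-linear (λ v → linear (tensor v) (q ⧢ q′)) (λ a → linear (shuf a) p′) p)
           (linear-≗ (λ a → linear-linear (λ v → linear (tensor v) (q ⧢ q′)) (shuf a) p′) p) ⟨
    (p ⧢ p′) ⊗ (q ⧢ q′) ∎
    where
    open ∼-Reasoning (W × W)
    tensor : W → W → Lin (W × W)
    tensor v w = ⟦ v , w ⟧

antipode-toBar : {Y : Set ℓ} (p : Lin (List Y)) → antipode (toBar p) ≡ toBar (antipodeᴸ p)
antipode-toBar p = trans (linear-mapGen antipodeWord embedWord p) (trans (linear-≗ word p) (sym (mapGen-linear embedWord antipodeList p)))
  where
  word : ∀ u → antipodeWord (embedWord u) ≡ toBar (antipodeList u)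
  word []      = refl
  word (x ∷ u) = trans (cong (λ q → (-ℚ 1ℚ) • mapGen (_∷ʳ (x List⁺.∷ [])) q) (word u)) (trans
    (cong ((-ℚ 1ℚ) •_) (trans (mapGen-mapGen (_∷ʳ (x List⁺.∷ [])) embedWord (antipodeList u))
      (trans (linear-≗ (λ w → cong ⟦_⟧ (sym (map-++ (List⁺._∷ []) w [ x ]))) (antipodeList u))
        (sym (mapGen-mapGen embedWord (_∷ʳ x) (antipodeList u))))))
    (sym (linear-• (⟦_⟧ ∘ embedWord) (-ℚ 1ℚ) (antipodeList u ▷ x))))

-- Operations of the bar construction respect its relations

linear-cong-All : {P : G → Set} {f f′ : G → Lin H} → (∀ {g} → P g → f g ≡ f′ g) →
                  ∀ {x : Lin G} → All (P ∘ proj₂) x → linear f x ≡ linear f′ x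
linear-cong-All e []                     = refl
linear-cong-All e {(q , g) ∷ x} (p ∷ ps) = cong₂ (λ u v → q • u ⊕ v) (e p) (linear-cong-All e ps)

module _ {Y : Set ℓ} where

  degree-++⁺ : ∀ (u : List Y) {g h : List⁺ Y} → degree g ≡ degree h → degree (u ++⁺ g) ≡ degree (u ++⁺ h)
  degree-++⁺ []      e = e
  degree-++⁺ (x ∷ u) e = cong suc (degree-++⁺ u e)

  -- Koszul signs depend on a letter only through its degree. As all terms of a relator have the
  -- same degree, the signs are constant along it.
  relator-homogeneous : ∀ {r} → WedgeRelator Y r → ∃ λ n → All (λ t → degree (proj₂ t) ≡ n) r
  relator-homogeneous (square u x v) = _ , refl ∷ []
  relator-homogeneous (swap u x y v) =
    _ , refl ∷ degree-++⁺ u {y List⁺.∷ x ∷ v} {x List⁺.∷ y ∷ v} refl ∷ []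

  wordDegree-insert : ∀ (u w : Word {X = Y}) {g n} → degree g ≡ n →
                      wordDegree (u ++ g ∷ w) ≡ wordDegree u + (n + wordDegree w)
  wordDegree-insert []      w e = cong (_+ wordDegree w) e
  wordDegree-insert (x ∷ u) w e = trans (cong (degree x +_) (wordDegree-insert u w e)) (sym (+-assoc (degree x) _ _))

-- Linear combinations of generators into which a letter g is plugged, with
-- coefficients that depend on the degree of g only.
module Plugging {Y : Set ℓ} (V : Space ℓ) {S : Set ℓ} (plug : S → Letter {X = Y} → Gen V)
                (good : ∀ s {r} → WedgeRelator Y r → mapGen (plug s) r ≈[ V ] []) where

  plugs : Lin S → Letter {X = Y} → Lin (Gen V)
  plugs K g = mapGen (λ s → plug s g) K

  Plugs : ℕ → (Letter {X = Y} → Lin (Gen V)) → Set ℓ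
  Plugs n F = ∃ λ K → ∀ {g} → degree g ≡ n → F g ≡ plugs K g

  plugs-0 : ∀ K {r} → WedgeRelator Y r → linear (plugs K) r ≈[ V ] []
  plugs-0 K {r} ρ = ≈-trans (linear-swap (λ g s → ⟦ plug s g ⟧) r K) (linear-0ʳ (λ s → good s ρ) K)

  Plugs-0 : ∀ {F} → (∀ n → Plugs n F) → ∀ {r} → WedgeRelator Y r → linear F r ≈[ V ] []
  Plugs-0 h {r} ρ with relator-homogeneous ρ
  ... | n , homogeneous = ≈-trans (≡⇒≈ (linear-cong-All (proj₂ (h n)) homogeneous)) (plugs-0 (proj₁ (h n)) ρ)

  Plugs-⊕ : ∀ {n F F′} → Plugs n F → Plugs n F′ → Plugs n (λ g → F g ⊕ F′ g)
  Plugs-⊕ (K , e) (K′ , e′) = K ⊕ K′ , λ {g} d → trans (cong₂ _⊕_ (e d) (e′ d)) (sym (linear-⊕ (λ s → ⟦ plug s g ⟧) K K′))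

  Plugs-• : ∀ {n F} (c : Letter {X = Y} → ℚ) c₀ → (∀ {g} → degree g ≡ n → c g ≡ c₀) → Plugs n F → Plugs n (λ g → c g • F g)
  Plugs-• c c₀ h (K , e) = c₀ • K , λ {g} d → trans (cong₂ _•_ (h d) (e d)) (sym (linear-• (λ s → ⟦ plug s g ⟧) c₀ K))

  Plugs-map : ∀ {n F} (f : Gen V → Gen V) (f′ : S → S) → (∀ s g → f (plug s g) ≡ plug (f′ s) g) →
              Plugs n F → Plugs n (λ g → mapGen f (F g))
  Plugs-map f f′ h (K , e) = mapGen f′ K , λ {g} d → trans (cong (mapGen f) (e d)) (trans
    (mapGen-mapGen f (λ s → plug s g) K) (trans (linear-≗ (λ s → cong ⟦_⟧ (h s g)) K) (sym (mapGen-mapGen (λ s → plug s g) f′ K))))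

  Plugs-gen : ∀ {n} (f : Gen V → S) (x : Lin (Gen V)) {h : Letter {X = Y} → Gen V → Gen V} → (∀ g w → h g w ≡ plug (f w) g) →
              Plugs n (λ g → mapGen (h g) x)
  Plugs-gen f x e = mapGen f x , λ {g} _ → trans (linear-≗ (λ w → cong ⟦_⟧ (e g w)) x) (sym (mapGen-mapGen (λ s → plug s g) f x))

  Plugs-⟦⟧ : ∀ {n} s → Plugs n (λ g → ⟦ plug s g ⟧)
  Plugs-⟦⟧ s = ⟦ s ⟧ , λ _ → refl

module _ {Y : Set ℓ} where

  private
    V : Space ℓ
    V = Bar Y

    W : Set ℓ
    W = Word {X = Y}

    plugWord : W × W → Letter {X = Y} → W
    plugWord (u , w) g = u ++ g ∷ w

    plugWord-0 : ∀ s {r} → WedgeRelator Y r → mapGen (plugWord s) r ≈[ V ] []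
    plugWord-0 (u , w) {r} ρ = ≈-trans (≡⇒≈ (sym (1• _))) (relator 1ℚ (in-letter u ρ w))

    open Plugging V plugWord plugWord-0

    Plugs-prefix : ∀ {n F} x → Plugs n F → Plugs n (λ g → prefix x (F g))
    Plugs-prefix x = Plugs-map (x ∷_) (map₁ (x ∷_)) (λ _ _ → refl)

    Plugs-suffix : ∀ {n F} x → Plugs n F → Plugs n (λ g → mapGen (_∷ʳ x) (F g))
    Plugs-suffix x = Plugs-map (_∷ʳ x) (map₂ (_∷ʳ x)) (λ (u , w) g → ++-assoc u (g ∷ w) [ x ])

    plugs-shuffleˡ : ∀ n u w z → Plugs n (λ g → shuffle (u ++ g ∷ w) z)
    plugs-shuffleˡ n []      w []      = Plugs-⟦⟧ ([] , w)
    plugs-shuffleˡ n []      w (y ∷ z) = Plugs-⊕ (Plugs-gen ([] ,_) (shuffle w (y ∷ z)) (λ _ _ → refl))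
      (Plugs-• (λ g → [-1]^ (degree y * wordDegree (g ∷ w))) ([-1]^ (degree y * (n + wordDegree w)))
        (cong (λ k → [-1]^ (degree y * (k + wordDegree w)))) (Plugs-prefix y (plugs-shuffleˡ n [] w z)))
    plugs-shuffleˡ n (x ∷ u) w []      = Plugs-⟦⟧ (x ∷ u , w)
    plugs-shuffleˡ n (x ∷ u) w (y ∷ z) = Plugs-⊕ (Plugs-prefix x (plugs-shuffleˡ n u w (y ∷ z)))
      (Plugs-• (λ g → [-1]^ (degree y * wordDegree (x ∷ u ++ g ∷ w))) ([-1]^ (degree y * (wordDegree (x ∷ u) + (n + wordDegree w))))
        (λ d → cong (λ k → [-1]^ (degree y * k)) (wordDegree-insert (x ∷ u) w d)) (Plugs-prefix y (plugs-shuffleˡ n (x ∷ u) w z)))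

    plugs-shuffleʳ : ∀ n z u w → Plugs n (λ g → shuffle z (u ++ g ∷ w))
    plugs-shuffleʳ n []      u       w = Plugs-⟦⟧ (u , w)
    plugs-shuffleʳ n (x ∷ z) []      w = Plugs-⊕ (Plugs-prefix x (plugs-shuffleʳ n z [] w))
      (Plugs-• (λ g → [-1]^ (degree g * wordDegree (x ∷ z))) ([-1]^ (n * wordDegree (x ∷ z)))
        (cong (λ k → [-1]^ (k * wordDegree (x ∷ z)))) (Plugs-gen ([] ,_) (shuffle (x ∷ z) w) (λ _ _ → refl)))
    plugs-shuffleʳ n (x ∷ z) (y ∷ u) w = Plugs-⊕ (Plugs-prefix x (plugs-shuffleʳ n z (y ∷ u) w))
      (Plugs-• (λ _ → [-1]^ (degree y * wordDegree (x ∷ z))) _ (λ _ → refl) (Plugs-prefix y (plugs-shuffleʳ n (x ∷ z) u w)))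

    plugs-antipode : ∀ n u w → Plugs n (λ g → antipodeWord (u ++ g ∷ w))
    plugs-antipode n []      w = Plugs-• (λ g → -ℚ ([-1]^ (degree g * wordDegree w))) (-ℚ ([-1]^ (n * wordDegree w)))
      (cong (λ k → -ℚ ([-1]^ (k * wordDegree w)))) (Plugs-gen (_, []) (antipodeWord w) (λ _ _ → refl))
    plugs-antipode n (x ∷ u) w = Plugs-• (λ g → -ℚ ([-1]^ (degree x * wordDegree (u ++ g ∷ w))))
      (-ℚ ([-1]^ (degree x * (wordDegree u + (n + wordDegree w)))))
      (λ d → cong (λ k → -ℚ ([-1]^ (degree x * k))) (wordDegree-insert u w d)) (Plugs-suffix x (plugs-antipode n u w))

    letter-resp : ∀ (f : W → Lin W) → (∀ n u w → Plugs n (λ g → f (u ++ g ∷ w))) → ∀ {r} → WordRelator (Λ⁺ Y) r → linear f r ≈[ V ] []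
    letter-resp f h (in-letter {r} u ρ w) = ≈-trans (≡⇒≈ (linear-mapGen f (λ g → u ++ g ∷ w) r)) (Plugs-0 (λ n → h n u w) ρ)

  -- A relator of words is a wedge relator plugged into a fixed word. By `plugs-shuffleˡ` and
  -- `plugs-shuffleʳ` every word of the shuffle again arises by plugging the letter in, so each
  -- contribution is a multiple of a relator.
  ш-resp : ∀ {x x′ y y′ : Lin W} → x ≈[ V ] x′ → y ≈[ V ] y′ → x ш y ≈[ V ] x′ ш y′
  ш-resp {x} {x′} {y} {y′} e e′ = ≈-trans (linear-resp (λ u → linear (shuffle u) y) left e)
    (linear-cong (λ u → linear-resp (shuffle u) (letter-resp (shuffle u) (λ n → plugs-shuffleʳ n u)) e′) x′)
    where
    left : ∀ {r} → WordRelator (Λ⁺ Y) r → linear (λ u → linear (shuffle u) y) r ≈[ V ] []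
    left {r} ρ = ≈-trans (linear-swap shuffle r y)
      (linear-0ʳ (λ z → letter-resp (λ u → shuffle u z) (λ n u w → plugs-shuffleˡ n u w z) ρ) y)

  antipode-resp : ∀ {x x′ : Lin W} → x ≈[ V ] x′ → antipode x ≈[ V ] antipode x′
  antipode-resp = linear-resp antipodeWord (letter-resp antipodeWord plugs-antipode)

  private
    -- After a cut the letter `g` lies in the first or in the second part, which produces a relator
    -- of the corresponding tensor factor.
    plugPair : (W × W) × W ⊎ W × (W × W) → Letter {X = Y} → W × W
    plugPair (inj₁ (s , v)) g = plugWord s g , v
    plugPair (inj₂ (v , s)) g = v , plugWord s g

    plugPair-0 : ∀ s {r} → WedgeRelator Y r → mapGen (plugPair s) r ≈[ V ⊗ˢ V ] []
    plugPair-0 (inj₁ ((u , w) , v)) {r} ρ = ≈-trans (≡⇒≈ (trans (sym (mapGen-mapGen (_, v) (plugWord (u , w)) r)) (sym (1• _))))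
      (relator 1ℚ (relatorˡ (in-letter u ρ w) v))
    plugPair-0 (inj₂ (v , (u , w))) {r} ρ = ≈-trans (≡⇒≈ (trans (sym (mapGen-mapGen (v ,_) (plugWord (u , w)) r)) (sym (1• _))))
      (relator 1ℚ (relatorʳ v (in-letter u ρ w)))

    module Pair = Plugging (V ⊗ˢ V) plugPair plugPair-0

    plugs-δ : ∀ n u w → Pair.Plugs n (λ g → δ (u ++ g ∷ w))
    plugs-δ n [] w = map₂ (λ e {g} d → trans (δ-∷ g w) (e d))
      (Pair.Plugs-⊕ (Pair.Plugs-⟦⟧ (inj₂ ([] , ([] , w)))) (Pair.Plugs-gen (λ (a , b) → inj₁ (([] , a) , b)) (δ w) (λ _ _ → refl)))
    plugs-δ n (x ∷ u) w = map₂ (λ e {g} d → trans (δ-∷ x (u ++ g ∷ w)) (e d))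
      (Pair.Plugs-⊕ (Pair.Plugs-⟦⟧ (inj₂ ([] , (x ∷ u , w)))) (Pair.Plugs-map (map₁ (x ∷_)) grow commutes (plugs-δ n u w)))
      where
      grow : (W × W) × W ⊎ W × (W × W) → (W × W) × W ⊎ W × (W × W)
      grow (inj₁ ((a , b) , v)) = inj₁ ((x ∷ a , b) , v)
      grow (inj₂ (v , s))       = inj₂ (x ∷ v , s)
      commutes : ∀ s g → map₁ (x ∷_) (plugPair s g) ≡ plugPair (grow s) g
      commutes (inj₁ _) g = refl
      commutes (inj₂ _) g = refl

  Δ-resp : ∀ {x x′ : Lin W} → x ≈[ V ] x′ → Δ x ≈[ V ⊗ˢ V ] Δ x′
  Δ-resp {x} {x′} e = ≈-trans (≡⇒≈ (Δ-deconcatenate x)) (≈-trans (linear-resp δ respects e) (≡⇒≈ (sym (Δ-deconcatenate x′))))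
    where
    respects : ∀ {r} → WordRelator (Λ⁺ Y) r → linear δ r ≈[ V ⊗ˢ V ] []
    respects (in-letter {r} u ρ w) = ≈-trans (≡⇒≈ (linear-mapGen δ (λ g → u ++ g ∷ w) r)) (Pair.Plugs-0 (λ n → plugs-δ n u w) ρ)

-- The subalgebra generated by the elements B(π)

select-length : {P Q : ℕ → Set} (P? : ∀ j → Dec (P j)) (Q? : ∀ j → Dec (Q j)) → (∀ j → P j → Q j) →
                ∀ k (xs : List X) → length (select P? k xs) ≤ length (select Q? k xs)
select-length P? Q? h k []       = z≤n
select-length P? Q? h k (x ∷ xs) with P? k | Q? k
... | yes p | yes q = s≤s (select-length P? Q? h (suc k) xs)
... | yes p | no ¬q = ⊥-elim (¬q (h k p))
... | no ¬p | yes q = ≤-trans (select-length P? Q? h (suc k) xs) (n≤1+n _)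
... | no ¬p | no ¬q = select-length P? Q? h (suc k) xs

-- Further arcs can only hide more sides from the root region, so the length is at most that of
-- `rt α xs`, where `proj₂ α ≥ 1` sides are missing.
rootPart-shorter : ∀ α as (xs : List X) → Valid (length xs) α → length (labels (α ∷ as) nothing xs) < length xs
rootPart-shorter α as xs v = ≤-<-trans
  (select-length (visible? (α ∷ as) nothing) (visible? [ α ] nothing) (λ j (_ , ¬v) → tt , λ { (here c) → ¬v (here c) }) 0 xs)
  (subst (length (rt α xs) <_) (length-rt α xs v) (m<m+n (length (rt α xs)) (proj₁ v)))

sublists-[] : (xs : List A) → ∃ λ rest → sublists xs ≡ [] ∷ rest × All (_≢ []) rest
sublists-[] []       = [] , refl , []
sublists-[] (x ∷ xs) with sublists-[] xs
... | rest , e , ne = rest ++ map (x ∷_) (sublists xs) , cong (_++ map (x ∷_) (sublists xs)) e ,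
  All.++⁺ ne (All.map⁺ (All.tabulate (λ _ ())))

-- Every word of `𝔹 xs` begins with the letter of the root region; its realization is therefore 0 or
-- consists of non-empty words.
counit-realize : {R : Set ℓ} (xs : List R) → counit (realize (𝔹 xs)) ∼ []
counit-realize xs = ≈-trans (≡⇒≈ (trans (cong counit (linear-∑ realizeWord (sublists L) _))
    (linear-∑ ε (sublists L) _))) (∑-0 (sublists L) (λ as →
  ≈-trans (≡⇒≈ (trans (cong counit (linear-∑ realizeWord (permutations as) (orderedTerm xs)))
    (linear-∑ ε (permutations as) (realize ∘ orderedTerm xs)))) (∑-0 (permutations as) term)))
  where
  L = arcs (length xs)
  ε : List (Polygon _) → Lin (List (Polygon _))
  ε w = atNil w ⟦ [] ⟧
  word : ∀ x w → counit (realizeWord (x ∷ w)) ∼ []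
  word x w with toPolygon x
  ... | nothing = ≈-refl
  ... | just π  = ≈-trans (≡⇒≈ (linear-mapGen ε (π ∷_) (realizeWord w))) (linear-0ʳ (λ _ → ≈-refl) (realizeWord w))
  term : ∀ ms → counit (realize (orderedTerm xs ms)) ∼ []
  term ms = ≈-trans (≡⇒≈ (trans (cong counit (linear-guard realizeWord d (q • ⟦ w ⟧))) (linear-guard ε d (realize (q • ⟦ w ⟧)))))
    (guard-0 d (λ _ → ≈-trans (≡⇒≈ (trans (cong counit (trans (linear-• realizeWord q ⟦ w ⟧) (cong (q •_) (linear-⟦⟧ realizeWord w))))
      (linear-• ε q (realizeWord w)))) (•-cong q (word (labels ms nothing xs) (map (λ α → labels ms (just α) xs) ms)))))
    where
    d = allPairs? before? ms
    q = product (map (signIn ms xs) ms)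
    w = dissectionWord ms xs

module _ {R : Set ℓ} where

  private
    W : Set ℓ
    W = List (Polygon R)

    𝓗 : Lin (Word {X = Polygon R}) → Set ℓ
    𝓗 = Generated (PolygonElement R)

  -- A record, so that `p` can be read off from the type; from `toBar p` unification would not
  -- recover it.
  record Hᴸ (p : Lin W) : Set ℓ where
    constructor inH
    field
      outH : 𝓗 (toBar p)

  Hᴸ-∼ : ∀ {p q} → p ∼ q → Hᴸ p → Hᴸ q
  Hᴸ-∼ e (inH h) = inH (resp (∼⇒≈ (mapGen-cong embedWord e)) h)

  Hᴸ-0 : Hᴸ []
  Hᴸ-0 = inH (resp (0• 𝟏) (scale 0ℚ one))

  Hᴸ-⊕ : ∀ {p q} → Hᴸ p → Hᴸ q → Hᴸ (p ⊕ q)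
  Hᴸ-⊕ {p} {q} (inH hp) (inH hq) = inH (subst 𝓗 (sym (linear-⊕ (⟦_⟧ ∘ embedWord) p q)) (plus hp hq))

  Hᴸ-• : ∀ c {p} → Hᴸ p → Hᴸ (c • p)
  Hᴸ-• c {p} (inH hp) = inH (subst 𝓗 (sym (linear-• (⟦_⟧ ∘ embedWord) c p)) (scale c hp))

  Hᴸ-⧢ : ∀ {p q} → Hᴸ p → Hᴸ q → Hᴸ (p ⧢ q)
  Hᴸ-⧢ {p} {q} (inH hp) (inH hq) = inH (subst 𝓗 (toBar-⧢ p q) (times hp hq))

  Hᴸ-guard : (d : Dec P) {p : Lin W} → Hᴸ p → Hᴸ (guard d p)
  Hᴸ-guard (yes _) hp = hp
  Hᴸ-guard (no _)  hp = Hᴸ-0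

  Hᴸ-∑ : ∀ (is : List A) (f : A → Lin W) → (∀ {i} → i ∈ is → Hᴸ (f i)) → Hᴸ (∑ is f)
  Hᴸ-∑ []       f h = Hᴸ-0
  Hᴸ-∑ (i ∷ is) f h = Hᴸ-⊕ (h (here refl)) (Hᴸ-∑ is f (h ∘ there))

  Hᴸ-𝔹 : ∀ ys → Hᴸ (realize (𝔹 ys))
  -- Fewer than two decorations form no polygon and admit no arc. By `𝔹-last` only a word with a
  -- single letter is left, and `realize` sends it to 0.
  Hᴸ-𝔹 []               = Hᴸ-∼ (≈-sym (linear-resp-∼ realizeWord (𝔹-last []))) Hᴸ-0
  Hᴸ-𝔹 (y ∷ [])         = Hᴸ-∼ (≈-sym (linear-resp-∼ realizeWord (𝔹-last (y ∷ [])))) Hᴸ-0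
  Hᴸ-𝔹 ys@(_ ∷ _ ∷ _)  = inH (resp (∼⇒≈ (𝐁-toBar π)) (generator (π , refl)))
    where
    π : Polygon R
    π = polygon ys (s≤s (s≤s z≤n))

  Hᴸ-parts : ∀ xs as → Hᴸ (realize (partsFactor xs as))
  Hᴸ-parts xs as = Hᴸ-∼ (≈-sym (realize-∏⧢ (map (λ α → 𝔹 (co α xs)) as))) (shuffles as)
    where
    shuffles : ∀ as → Hᴸ (∏⧢ (map realize (map (λ α → 𝔹 (co α xs)) as)))
    shuffles []       = inH one
    shuffles (α ∷ as) = Hᴸ-⧢ (Hᴸ-𝔹 (co α xs)) (shuffles as)

  -- The image of H ⊗ H among pairs of words of polygons, prior to the relations of the bar
  -- construction; here tensors are multiplied by `_⊙_` without signs.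
  data Tensors : Lin (W × W) → Set ℓ where
    pure : ∀ {p q} → Hᴸ p → Hᴸ q → Tensors (p ⊗ q)
    none : Tensors []
    both : ∀ {P Q} → Tensors P → Tensors Q → Tensors (P ⊕ Q)
    same : ∀ {P Q} → P ∼ Q → Tensors P → Tensors Q

  Tensors⇒TensorSquare : ∀ {P} → Tensors P → TensorSquare 𝓗 (toBar² P)
  Tensors⇒TensorSquare (pure {p} {q} (inH hp) (inH hq)) = subst (TensorSquare 𝓗) (toBar-⊗ p q) (pure hp hq)
  Tensors⇒TensorSquare none                   = zero
  Tensors⇒TensorSquare (both {P} {Q} hP hQ)   =
    subst (TensorSquare 𝓗) (sym (linear-⊕ (λ (u , w) → ⟦ embedWord u , embedWord w ⟧) P Q))
      (plus (Tensors⇒TensorSquare hP) (Tensors⇒TensorSquare hQ))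
  Tensors⇒TensorSquare (same e hP)            =
    resp (∼⇒≈ (mapGen-cong (λ (u , w) → embedWord u , embedWord w) e)) (Tensors⇒TensorSquare hP)

  Tensors-• : ∀ c {P} → Tensors P → Tensors (c • P)
  Tensors-• c (pure {p} {q} hp hq) = subst Tensors (bilinear-•ˡ (λ v w → ⟦ v , w ⟧) c p q) (pure (Hᴸ-• c hp) hq)
  Tensors-• c none                 = none
  Tensors-• c (both {P} {Q} hP hQ) = subst Tensors (sym (•-⊕ c P Q)) (both (Tensors-• c hP) (Tensors-• c hQ))
  Tensors-• c (same e hP)          = same (•-cong c e) (Tensors-• c hP)

  Tensors-guard : (d : Dec P) {U : Lin (W × W)} → Tensors U → Tensors (guard d U)
  Tensors-guard (yes _) h = h
  Tensors-guard (no _)  h = none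

  Tensors-∑ : ∀ (is : List A) (f : A → Lin (W × W)) → (∀ i → Tensors (f i)) → Tensors (∑ is f)
  Tensors-∑ []       f h = none
  Tensors-∑ (i ∷ is) f h = both (h i) (Tensors-∑ is f h)

  Tensors-⊙ : ∀ {P Q} → Tensors P → Tensors Q → Tensors (P ⊙ Q)
  Tensors-⊙ {Q = Q} none                 hQ = none
  Tensors-⊙ {Q = Q} (both {P} {P′} h h′) hQ = subst Tensors (sym (bilinear-⊕ˡ mul P P′ Q)) (both (Tensors-⊙ h hQ) (Tensors-⊙ h′ hQ))
  Tensors-⊙ {Q = Q} (same e h)           hQ = same (bilinear-cong mul e (≈-refl {x = Q})) (Tensors-⊙ h hQ)
  Tensors-⊙ (pure {p} {q} hp hq) (pure {p′} {q′} hp′ hq′) =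
    same (≈-sym (⊗-⊙-⊗ p q p′ q′)) (pure (Hᴸ-⧢ hp hp′) (Hᴸ-⧢ hq hq′))
  Tensors-⊙ (pure {p} {q} hp hq) none =
    same (≈-sym (linear-0ʳ {f = λ s → linear (mul s) []} (λ _ → ≈-refl) (p ⊗ q))) none
  Tensors-⊙ (pure {p} {q} hp hq) (both {Q} {Q′} h h′) =
    same (≈-sym (bilinear-⊕ʳ mul (p ⊗ q) Q Q′)) (both (Tensors-⊙ (pure hp hq) h) (Tensors-⊙ (pure hp hq) h′))
  Tensors-⊙ (pure {p} {q} hp hq) (same e h) =
    same (bilinear-cong mul (≈-refl {x = p ⊗ q}) e) (Tensors-⊙ (pure hp hq) h)

  private
    termAt : List R → List Arc → Lin (W × W)
    termAt xs as = realize² (admissibleTerm xs as)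

    termAt∼ : ∀ xs as → termAt xs as ∼
              guard (allPairs? disjoint? as) (signs as • (realize (rootFactor xs as) ⊗ realize (partsFactor xs as)))
    termAt∼ xs as = ≈-trans (≡⇒≈ (trans (linear-guard realizePair d (signs as • (rootFactor xs as ⊗ partsFactor xs as)))
        (cong (guard d) (linear-• realizePair (signs as) (rootFactor xs as ⊗ partsFactor xs as)))))
      (guard-cong d d id id (λ _ → •-cong (signs as) (realize-⊗ (rootFactor xs as) (partsFactor xs as))))
      where d = allPairs? disjoint? as

    deconcatenate-realize-𝔹 : ∀ xs → deconcatenate (realize (𝔹 xs)) ∼
                              (⟦ [] ⟧ ⊗ realize (𝔹 xs)) ⊕ (∑[ as ∈ sublists (arcs (length xs)) ] termAt xs as)
    deconcatenate-realize-𝔹 xs = ≈-trans (deconcatenate-realize (𝔹 xs)) (≈-trans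
      (linear-resp-∼ realizePair (deconcatenate-𝔹 (suc (length xs)) xs ≤-refl))
      (≈-trans (≡⇒≈ (linear-⊕ realizePair (⟦ [] ⟧ ⊗ 𝔹 xs) (𝕋 xs)))
        (⊕-cong (realize-⊗ ⟦ [] ⟧ (𝔹 xs)) (≡⇒≈ (linear-∑ realizePair (sublists (arcs (length xs))) (admissibleTerm xs))))))

  Tensors-𝔹 : ∀ xs → Tensors (deconcatenate (realize (𝔹 xs)))
  Tensors-𝔹 xs = same (≈-sym (deconcatenate-realize-𝔹 xs)) (both (pure {⟦ [] ⟧} (inH one) (Hᴸ-𝔹 xs))
    (Tensors-∑ (sublists (arcs (length xs))) (termAt xs) (λ as → same (≈-sym (termAt∼ xs as))
      (Tensors-guard (allPairs? disjoint? as) (Tensors-• (signs as)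
        (pure (Hᴸ-𝔹 (labels as nothing xs)) (Hᴸ-parts xs as)))))))

  -- In S ⋆ id = ε, evaluated at B(π), all antipodes but one are those of smaller root polygons.
  Hᴸ-antipode-𝔹 : ∀ n xs → length xs < n → Hᴸ (antipodeᴸ (realize (𝔹 xs)))
  Hᴸ-antipode-𝔹 (suc n) xs h = Hᴸ-∼ (≈-sym solved) (Hᴸ-• (-ℚ 1ℚ) (Hᴸ-⊕ (Hᴸ-𝔹 xs) others∈𝓗))
    where
    open ∼-Reasoning W
    L = arcs (length xs)
    -- The non-empty lists of arcs. The empty one is the dissection without arrows, whose term
    -- contains the antipode to be determined.
    rest : List (List Arc)
    rest = proj₁ (sublists-[] L)
    elem anti others : Lin W
    elem = realize (𝔹 xs)
    anti = antipodeᴸ elem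
    others = ∑[ as ∈ rest ] convolve (termAt xs as)
    convolve-term : ∀ as → convolve (termAt xs as) ∼
                    guard (allPairs? disjoint? as) (signs as • (antipodeᴸ (realize (rootFactor xs as)) ⧢ realize (partsFactor xs as)))
    convolve-term as = ≈-trans (linear-resp-∼ f (termAt∼ xs as)) (≈-trans
      (≡⇒≈ (trans (linear-guard f d (signs as • u)) (cong (guard d) (linear-• f (signs as) u))))
      (guard-cong d d id id (λ _ → •-cong (signs as) (convolve-⊗ (realize (rootFactor xs as)) (realize (partsFactor xs as))))))
      where
      f : W × W → Lin W
      f (v , w) = antipodeList v ⧢ ⟦ w ⟧
      d = allPairs? disjoint? as
      u = realize (rootFactor xs as) ⊗ realize (partsFactor xs as)
    first : convolve (termAt xs []) ∼ anti
    first = ≈-trans (convolve-term []) (≡⇒≈ (trans (1• _) (trans (⧢-identityʳ (antipodeᴸ (realize (rootFactor xs []))))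
      (cong (λ ys → antipodeᴸ (realize (𝔹 ys))) (labels-[] xs)))))
    -- The counit vanishes on B(π); the term 1 ⊗ B(π) contributes B(π) itself, and B(π) ⊗ 1
    -- contributes its antipode.
    total : [] ∼ elem ⊕ (anti ⊕ others)
    total = begin
      []
        ≈⟨ counit-realize xs ⟨
      counit elem
        ≈⟨ convolve-deconcatenate elem ⟨
      convolve (deconcatenate elem)
        ≈⟨ linear-resp-∼ f (deconcatenate-realize-𝔹 xs) ⟩
      convolve ((⟦ [] ⟧ ⊗ elem) ⊕ ∑ (sublists L) (termAt xs))
        ≡⟨ trans (linear-⊕ f (⟦ [] ⟧ ⊗ elem) (∑ (sublists L) (termAt xs))) (cong (convolve (⟦ [] ⟧ ⊗ elem) ⊕_)
             (trans (linear-∑ f (sublists L) (termAt xs)) (cong (λ is → ∑ is (convolve ∘ termAt xs)) (proj₁ (proj₂ (sublists-[] L)))))) ⟩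
      convolve (⟦ [] ⟧ ⊗ elem) ⊕ (convolve (termAt xs []) ⊕ others)
        ≈⟨ ⊕-cong (≈-trans (convolve-⊗ ⟦ [] ⟧ elem) (≡⇒≈ (⧢-identityˡ elem))) (⊕-congʳ {y = others} first) ⟩
      elem ⊕ (anti ⊕ others) ∎
      where
      f : W × W → Lin W
      f (v , w) = antipodeList v ⧢ ⟦ w ⟧
    solved : anti ∼ (-ℚ 1ℚ) • (elem ⊕ others)
    solved = begin
      anti
        ≡⟨ ⊕-identityʳ anti ⟨
      anti ⊕ []
        ≈⟨ ⊕-congˡ {x = anti} (cancel (elem ⊕ others)) ⟨
      anti ⊕ ((elem ⊕ others) ⊕ ((-ℚ 1ℚ) • (elem ⊕ others)))
        ≡⟨ ++-assoc anti (elem ⊕ others) ((-ℚ 1ℚ) • (elem ⊕ others)) ⟨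
      (anti ⊕ (elem ⊕ others)) ⊕ ((-ℚ 1ℚ) • (elem ⊕ others))
        ≈⟨ ⊕-congʳ {y = (-ℚ 1ℚ) • (elem ⊕ others)} (≈-trans (⊕-swapˡ anti elem others) (≈-sym total)) ⟩
      (-ℚ 1ℚ) • (elem ⊕ others) ∎
    valid-rest : ∀ {as} → as ∈ rest → All (Valid (length xs)) as
    valid-rest {as} as∈ = All.lookup (sublists-All (All.tabulate (arcs-valid (length xs))))
      (subst (as ∈_) (sym (proj₁ (proj₂ (sublists-[] L)))) (there as∈))
    shorter : ∀ as → as ≢ [] → All (Valid (length xs)) as → length (labels as nothing xs) < n
    shorter []       ne vs       = ⊥-elim (ne refl)
    shorter (α ∷ as) ne (v ∷ vs) = <-≤-trans (rootPart-shorter α as xs v) (s≤s⁻¹ h)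
    others∈𝓗 : Hᴸ others
    others∈𝓗 = Hᴸ-∑ rest (convolve ∘ termAt xs) (λ {as} as∈ → Hᴸ-∼ (≈-sym (convolve-term as)) (Hᴸ-guard (allPairs? disjoint? as)
      (Hᴸ-• (signs as)
        (Hᴸ-⧢
          (Hᴸ-antipode-𝔹 n (labels as nothing xs) (shorter as (All.lookup (proj₂ (proj₂ (sublists-[] L))) as∈) (valid-rest as∈)))
          (Hᴸ-parts xs as)))))

  -- Every element of the subalgebra is represented by words of polygons, which have
  -- degree zero, so that no Koszul signs occur in its coproduct and antipode.
  Represented : Lin (Word {X = Polygon R}) → Set ℓ
  Represented x = ∃ λ p → x ≈[ Bar (Polygon R) ] toBar p × Tensors (deconcatenate p) × Hᴸ (antipodeᴸ p)

  -- Induction on the generation of `x`. In the case `resp` the representative `p` is kept, so the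
  -- properties of `p` have to be stable under `∼` only.
  represented : ∀ {x} → 𝓗 x → Represented x
  represented (generator (π , refl)) =
    realize (𝔹 (sides π)) , ∼⇒≈ (𝐁-toBar π) , Tensors-𝔹 (sides π) , Hᴸ-antipode-𝔹 (suc (size π)) (sides π) ≤-refl
  represented one = ⟦ [] ⟧ , ≈-refl {x = 𝟏} , pure {⟦ [] ⟧} {⟦ [] ⟧} (inH one) (inH one) , inH {⟦ [] ⟧} one
  represented (plus hx hy) with represented hx | represented hy
  ... | p , ep , tp , ap | q , eq , tq , aq = p ⊕ q ,
    ≈-trans (⊕-cong ep eq) (≡⇒≈ (sym (linear-⊕ (⟦_⟧ ∘ embedWord) p q))) ,
    subst Tensors (sym (linear-⊕ δ p q)) (both tp tq) ,
    subst Hᴸ (sym (linear-⊕ antipodeList p q)) (Hᴸ-⊕ ap aq)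
  represented (scale c hx) with represented hx
  ... | p , ep , tp , ap = c • p ,
    ≈-trans (•-cong c ep) (≡⇒≈ (sym (linear-• (⟦_⟧ ∘ embedWord) c p))) ,
    subst Tensors (sym (linear-• δ c p)) (Tensors-• c tp) ,
    subst Hᴸ (sym (linear-• antipodeList c p)) (Hᴸ-• c ap)
  represented (times hx hy) with represented hx | represented hy
  ... | p , ep , tp , ap | q , eq , tq , aq = p ⧢ q ,
    ≈-trans (ш-resp ep eq) (≡⇒≈ (toBar-⧢ p q)) ,
    same (≈-sym (deconcatenate-⧢ p q)) (Tensors-⊙ tp tq) ,
    Hᴸ-∼ (≈-sym (antipode-⧢ p q)) (Hᴸ-⧢ ap aq)
  represented (resp e hx) with represented hx
  ... | p , ep , tp , ap = p , ≈-trans (≈-sym e) ep , tp , ap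

  isHopfSubalgebra : IsHopfSubalgebra 𝓗
  isHopfSubalgebra = record
    { ≈-closed        = resp
    ; ⊕-closed        = plus
    ; •-closed        = scale
    ; 𝟏-closed        = one
    ; ш-closed        = times
    ; Δ-closed        = λ hx → let (p , e , t , _) = represented hx in
        resp (≈-sym (≈-trans (Δ-resp e) (≡⇒≈ (Δ-toBar p)))) (Tensors⇒TensorSquare t)
    ; antipode-closed = λ hx → let (p , e , _ , a) = represented hx in
        resp (≈-sym (≈-trans (antipode-resp e) (≡⇒≈ (antipode-toBar p)))) (Hᴸ.outH a)
    }

theorem7p1 : ∀ {a : Level} (R : Set a) →
    ((π : Polygon R) →
    Δ (𝐁 π)
    ≈[ Bar (Polygon R) ⊗ˢ Bar (Polygon R) ]
    (∑[ D ∈ admissibleTerms π ]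
    sgnᵃ π D • (𝐁∅ (rootPolygon π D) ⊗ ∏ш (map 𝐁 (remainingPolygons π D)))))
    × IsHopfSubalgebra (Generated (PolygonElement R))
theorem7p1 R = (λ π → ∼⇒≈ (Δ-𝐁 π)) , isHopfSubalgebra
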